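{- Let $n$ and $h$ be positive integers and put $m=\operatorname{lcm}(n,h)$. Suppose that a $\mathrm{BH}(\mathbb{Z}_n,h)$ matrix exists. Assume moreover that for every prime divisor $p$ of $n$: (i) $p$ divides $h$, and (ii) for every prime divisor $q\neq p$ of $n$, $q^{\operatorname{ord}_{\widetilde{m}_q}(q)}\not\equiv 1 \pmod{p^{\nu_p(h)+1}}$. Then $n\leq \gcd(h,n)^2$.
   Context: For a finite abelian group $(G,+)$ and a positive integer $h$, a $\mathrm{BH}(G,h)$ matrix is a $|G|\times|G|$ matrix $H=(a_{g,k})_{g,k\in G}$ whose entries are complex $h$th roots of unity, which is $G$-invariant (i.e. $a_{g+l,k+l}=a_{g,k}$ for all $g,k,l\in G$), and satisfies $HH^*=|G|I$, where $H^*$ is the conjugate transpose. $\mathbb{Z}_n$ is the cyclic group of order $n$. $\nu_p(x)$ is the $p$-adic valuation of $x$; for coprime integers $a,N$, $\operatorname{ord}_N(a)$ is the least positive $j$ with $a^j\equiv 1\pmod N$. Writing the prime factorization $m=\prod_{i=1}^t p_i^{c_i}$, for a prime divisor $q$ of $n$ define $\widetilde{m}_q=\prod_{p_i\neq q}p_i$ if $m$ is odd or $q=2$, and $\widetilde{m}_q=4\prod_{p_i\neq 2,q}p_i$ otherwise. -}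

module Defs where

open import Level using (0ℓ)
open import Data.Nat using (ℕ; zero; suc; _+_; _*_; _∸_; _^_; _≤_; _<_; NonZero)
open import Data.Nat.DivMod using (_mod_)
open import Data.Nat.Divisibility using (_∣?_) renaming (_∣_ to _∣ℕ_)
open import Data.Nat.Primality using (Prime; prime?)
open import Data.Nat.LCM using (lcm)
open import Data.Fin using (Fin; toℕ)
import Data.Fin as F
open import Data.Integer using (ℤ; +_; _-_)
open import Data.Integer.Divisibility using (_∣_)
open import Data.List using (List; filter; upTo)
open import Data.Nat.ListAction using (product)
open import Data.Product using (_×_; ∃)
open import Data.Sum using (_⊎_)
open import Relation.Nullary using (¬_; Dec; yes; no)
open import Relation.Nullary.Decidable using (_×-dec_; ¬?)
open import Relation.Binary.PropositionalEquality using (_≡_)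
open import Algebra.Bundles using (CommutativeRing)

infix 4 _≋_[mod_]
_≋_[mod_] : ℕ → ℕ → ℕ → Set
a ≋ b [mod N ] = (+ N) ∣ ((+ a) - (+ b))

IsValuation : ℕ → ℕ → ℕ → Set
IsValuation p x e = (p ^ e ∣ℕ x) × ¬ (p ^ suc e ∣ℕ x)

IsOrder : ℕ → ℕ → ℕ → Set
IsOrder N a j = (0 < j) × (a ^ j ≋ 1 [mod N ]) ×
                (∀ i → 0 < i → i < j → ¬ (a ^ i ≋ 1 [mod N ]))

radExcept : ℕ → ℕ → ℕ → ℕ
radExcept m r s =
  product (filter (λ p → (prime? p ×-dec (p ∣? m)) ×-dec
                           (¬? (p Data.Nat.≟ r) ×-dec ¬? (p Data.Nat.≟ s)))
                  (upTo (suc m)))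

mTilde : ℕ → ℕ → ℕ
mTilde m q with 2 ∣? m | q Data.Nat.≟ 2
... | no _  | _     = radExcept m q q
... | yes _ | yes _ = radExcept m q q
... | yes _ | no _  = 4 * radExcept m 2 q

addZ : (n : ℕ) .{{_ : NonZero n}} → Fin n → Fin n → Fin n
addZ n g k = (toℕ g + toℕ k) mod n

-- Ring-side notions.  The complex numbers are not available, so the
-- h-th roots of unity are taken in an arbitrary integral domain R of
-- characteristic 0 containing a primitive h-th root of unity ζ
-- (e.g. R = ℂ, ζ = exp(2πi/h)); every h-th root of unity is ζ^a with
-- a ∈ {0,…,h-1}, and its complex conjugate is ζ^(h-a).

module _ (R : CommutativeRing 0ℓ 0ℓ) where
  open CommutativeRing R using (Carrier; _≈_; 0#; 1#) renaming (_+_ to _+R_; _*_ to _*R_)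

  pow : Carrier → ℕ → Carrier
  pow x zero    = 1#
  pow x (suc k) = x *R pow x k

  natCast : ℕ → Carrier
  natCast zero    = 0#
  natCast (suc k) = 1# +R natCast k

  sumFin : ∀ {n} → (Fin n → Carrier) → Carrier
  sumFin {zero}  f = 0#
  sumFin {suc n} f = f F.zero +R sumFin (λ i → f (F.suc i))

  IsIntegralDomain : Set
  IsIntegralDomain = ¬ (1# ≈ 0#) × (∀ x y → x *R y ≈ 0# → x ≈ 0# ⊎ y ≈ 0#)

  HasCharZero : Set
  HasCharZero = ∀ k → natCast k ≈ 0# → k ≡ 0

  IsPrimitiveRoot : ℕ → Carrier → Set
  IsPrimitiveRoot h ζ = (pow ζ h ≈ 1#) × (∀ d → 0 < d → d < h → ¬ (pow ζ d ≈ 1#))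

  -- A BH(ℤ_n, h) matrix with entries H_{g,k} = ζ^(a g k):
  --   G-invariance and H H* = n I.
  IsBH : (n : ℕ) .{{_ : NonZero n}} (h : ℕ) (ζ : Carrier) →
         (Fin n → Fin n → Fin h) → Set
  IsBH n h ζ a =
    (∀ g k l → a (addZ n g l) (addZ n k l) ≡ a g k) ×
    (∀ g g' → sumFin (λ k → pow ζ (toℕ (a g k)) *R pow ζ (h ∸ toℕ (a g' k)))
                ≈ δ g g')
    where
    δ : Fin n → Fin n → Carrier
    δ g g' with g F.≟ g'
    ... | yes _ = natCast n
    ... | no _  = 0#

{-# OPTIONS --safe #-}

-- Field descent without algebraic number theory. The ring ℤ[x , x⁻¹] modulo the radical of the trace form is the
-- cyclotomic ring ℤ[ζ_D]; its Galois automorphisms are the substitutions x ↦ xˢ.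
--
-- The relations of a BH(ℤ_n , h) matrix hold at one primitive h-th root ζ of R. Landau's argument (a relation at ζ holds
-- modulo p at ζᵖ, hence holds at ζᵖ for large p) carries them to ℤ[ζ_h]. Put m = lcm(n , h) = wh. The primitive
-- character of ℤ_n, applied to a column, gives X ∈ ℤ[ζ_m] with X X̄ = n.
--
-- Let p be a prime dividing w and σ : x ↦ x^(1+D) on ℤ[ζ_{pD}], where h ∣ D. The order condition makes 1 + D a power of q
-- modulo the q-free part of pD for every prime q ∣ n, so σ fixes every ideal above q; therefore n ∣ σ(X) X̄ and
-- σ(X) = Y X with Y Ȳ = 1. By Cassels' induction on the trace form, Y is a root of unity, and then σᵖ = 1 forces X to be
-- supported on a single class of exponents modulo p. Iterating down to D = h leaves a sum of at most gcd(h , n) roots of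
-- unity of norm n, whence n ≤ gcd(h , n)².
--
-- If 4 ∤ h and w is even, the step p = 2 stops at D = 2h. The order condition then makes n a power of 2, the bound becomes
-- n ≤ 8, and n = 8 is excluded directly.
module Submission where

open import Defs
open import Level using (0ℓ)
open import Algebra.Bundles using (CommutativeRing)
import Algebra.Properties.CommutativeSemiring.Binomial as Binomial
import Algebra.Properties.Ring as RingProperties
import Algebra.Properties.Semiring.Exp as Exp
import Algebra.Properties.Semiring.Mult as Mult
import Algebra.Properties.Semiring.Sum as SemiringSum
import Algebra.Solver.Ring as RingSolver
open import Algebra.Solver.Ring.AlmostCommutativeRing using (AlmostCommutativeRing; fromCommutativeRing; _-Raw-AlmostCommutative⟶_)
open import Data.Empty using (⊥; ⊥-elim)
open import Data.Fin using (Fin; toℕ; fromℕ<) renaming (zero to fzero; suc to fsuc)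
import Data.Fin.Properties as Finₚ
open import Data.Integer as ℤ using (ℤ; +_; -[1+_]; 0ℤ; 1ℤ)
import Data.Integer.Properties as ℤₚ
open import Data.Integer.DivMod using (_%ℕ_; _/ℕ_; n%ℕd<d; a≡a%ℕn+[a/ℕn]*n)
import Data.Integer.Divisibility.Signed as ℤsgn
import Data.Integer.Tactic.RingSolver as ℤ-Solver
open import Data.List using (List; []; _∷_; length; filter; upTo)
open import Data.List.Membership.Propositional using (_∈_)
import Data.List.Membership.Propositional.Properties as Memₚ
import Data.List.Relation.Unary.All.Properties as Allₚ
open import Data.List.Relation.Unary.All using (All; []; _∷_)
open import Data.List.Relation.Unary.Any using (Any; here; there)
import Data.List.Relation.Unary.Any.Properties as Anyₚ
import Data.Vec.Functional
import Data.Vec.Functional.Properties as VecFₚ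
import Data.List.Properties as Listₚ
open import Data.List.Relation.Unary.AllPairs using ([]; _∷_)
open import Data.List.Relation.Unary.Unique.Propositional using (Unique)
import Data.List.Relation.Unary.Unique.Propositional.Properties as Uniqueₚ
open import Data.Maybe using (just; nothing)
open import Data.Nat using (ℕ; _!; zero; suc; _+_; _*_; _∸_; _^_; _≤_; _<_; z≤n; s≤s; _≟_; _<?_; NonZero; ≢-nonZero; ≢-nonZero⁻¹; >-nonZero; nonTrivial⇒n>1)
open import Data.Nat.Combinatorics using (_C_; nCn≡1; nCk≡nC[n∸k])
import Data.Nat.Combinatorics as Comb
import Data.Nat.Combinatorics.Specification as CombSpec
open import Data.Nat.Coprimality as Coprimality using (Coprime)
open import Data.Nat.Divisibility using (_∣_; divides; _∣?_; ∣-trans; ∣-refl; ∣-reflexive; m∣m*n; n∣m*n; ∣m⇒∣m*n; ∣n⇒∣m*n; ∣⇒≤; _∣0; 1∣_; ∣1⇒≡1; ∣m∣n⇒∣m+n; ∣m+n∣m⇒∣n; *-monoʳ-∣; *-monoˡ-∣; *-cancelˡ-∣; *-cancelʳ-∣)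
open import Data.Nat.DivMod using (_/_; _%_; _mod_; m≡m%n+[m/n]*n; m%n<n; m<n⇒m%n≡m; n%n≡0; %-distribˡ-+; m/n*n≡m)
open import Data.Nat.GCD using (module Bézout; gcd; gcd[m,n]∣m; gcd[m,n]∣n; gcd-greatest; gcd[m,n]≢0; gcd[m,n]≡0⇒n≡0; gcd-comm; gcd-GCD)
open import Data.Nat.Induction using (<-rec)
open import Data.Nat.LCM using (lcm; m∣lcm[m,n]; gcd*lcm)
open import Data.Nat.Primality using (Prime; prime?; prime[2]; prime⇒nonZero; prime⇒nonTrivial; prime⇒irreducible; euclidsLemma)
open import Data.Nat.Primality.Factorisation using (factorise; PrimeFactorisation)
open import Data.Nat.ListAction using (product)
import Data.Nat.ListAction.Properties as ListActionₚ
import Data.Nat.Properties as ℕₚ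
import Data.Nat.Tactic.RingSolver as ℕ-Solver
open import Data.Product using (Σ; ∃; ∃₂; _×_; _,_; proj₁; proj₂)
open import Data.Sum using (_⊎_; inj₁; inj₂; [_,_]′)
open import Function using (it; _⟨_⟩_; _∘_; _$_; id)
open import Relation.Nullary using (¬_; Dec; yes; no; contradiction)
open import Relation.Nullary.Decidable using (_×-dec_; ¬?; decidable-stable)
open import Relation.Binary.PropositionalEquality using (_≡_; _≢_; refl; sym; trans; cong; cong₂; subst; subst₂; module ≡-Reasoning)
import Relation.Binary.Reasoning.Setoid as SetoidReasoning

-- Commutative rings

-- The arithmetic cannot be done at `ζ` itself, since `R` need not have automorphisms, a decidable
-- equality or a notion of size. In the quotient by a trace radical, equality is a family of integer
-- equations: freeness from torsion is immediate, and a substitution is well defined as soon as the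
-- trace is invariant under it.
--
-- No prime ideal is ever constructed. The one property needed of them, stability under σ, holds for
-- every ideal that contains a power of π = 1 - x^E, where E is the q-free part of the level.
--
-- The descended element must remain a sum of monomials indexed by distinct elements of ℤ_n, because
-- the last step counts terms. This is why elements are formal expressions and components are
-- obtained by filtering an index list.
--
-- The prime 2 is exceptional because 1 + s + ... + s^(p-1), with s = 1 + D, is p + D p(p-1)/2
-- modulo pD. For p = 2 and D/2 odd the number 2 + D has a further factor 2, and the exponent j of
-- the multiplier x^j is only forced to be divisible by D/2 instead of D.

module CRing (R : CommutativeRing 0ℓ 0ℓ) where
  open CommutativeRing R public
    using (Carrier; _≈_; 0#; 1#; setoid; +-cong; +-congˡ; +-congʳ; *-cong; *-congˡ; *-congʳ;
           -‿cong; +-assoc; +-comm; *-assoc; *-comm; +-identityˡ; +-identityʳ; *-identityˡ; *-identityʳ;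
           distribˡ; distribʳ; zeroˡ; zeroʳ; -‿inverseˡ; -‿inverseʳ; semiring; commutativeSemiring)
    renaming (refl to ≈-refl; sym to ≈-sym; trans to ≈-trans; reflexive to ≈-reflexive;
              _+_ to _⊕_; _*_ to _⊙_; -_ to ⊝_; _-_ to _⊖_)
  open RingProperties (CommutativeRing.ring R) using (-0#≈0#; -‿+-comm; -‿involutive; -‿distribˡ-*; -‿distribʳ-*)

  infixr 8 _↑_
  _↑_ : Carrier → ℕ → Carrier
  x ↑ n = pow R x n

  nat : ℕ → Carrier
  nat = natCast R

  int : ℤ → Carrier
  int (+ n) = nat n
  int -[1+ n ] = ⊝ nat (suc n)

  open SetoidReasoning setoid

  nat-+ : ∀ m n → nat (m + n) ≈ nat m ⊕ nat n
  nat-+ zero    n = ≈-sym (+-identityˡ _)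
  nat-+ (suc m) n = ≈-trans (+-congˡ (nat-+ m n)) (≈-sym (+-assoc _ _ _))

  nat-* : ∀ m n → nat (m * n) ≈ nat m ⊙ nat n
  nat-* zero    n = ≈-sym (zeroˡ _)
  nat-* (suc m) n = begin
    nat (n + m * n)             ≈⟨ nat-+ n (m * n) ⟩
    nat n ⊕ nat (m * n)         ≈⟨ +-cong (≈-sym (*-identityˡ _)) (nat-* m n) ⟩
    1# ⊙ nat n ⊕ nat m ⊙ nat n  ≈⟨ distribʳ _ _ _ ⟨
    nat (suc m) ⊙ nat n         ∎

  nat-1 : nat 1 ≈ 1#
  nat-1 = +-identityʳ _

  int-⊖ : ∀ m n → int (m ℤ.⊖ n) ≈ nat m ⊖ nat n
  int-⊖ m zero = begin
    int (m ℤ.⊖ 0)  ≈⟨ ≈-reflexive (cong int (ℤₚ.⊖-≥ {m} z≤n)) ⟩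
    nat m          ≈⟨ +-identityʳ _ ⟨
    nat m ⊕ 0#     ≈⟨ +-congˡ -0#≈0# ⟨
    nat m ⊖ 0#     ∎
  int-⊖ zero (suc n) = begin
    int (0 ℤ.⊖ suc n)  ≡⟨⟩
    ⊝ nat (suc n)      ≈⟨ +-identityˡ _ ⟨
    0# ⊖ nat (suc n)   ∎
  int-⊖ (suc m) (suc n) = begin
    int (suc m ℤ.⊖ suc n)                ≈⟨ ≈-reflexive (cong int (ℤₚ.[1+m]⊖[1+n]≡m⊖n m n)) ⟩
    int (m ℤ.⊖ n)                        ≈⟨ int-⊖ m n ⟩
    nat m ⊖ nat n                        ≈⟨ +-identityˡ _ ⟨
    0# ⊕ (nat m ⊖ nat n)                 ≈⟨ +-congʳ (-‿inverseʳ 1#) ⟨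
    (1# ⊖ 1#) ⊕ (nat m ⊖ nat n)          ≈⟨ +-assoc _ _ _ ⟩
    1# ⊕ (⊝ 1# ⊕ (nat m ⊖ nat n))        ≈⟨ +-congˡ (≈-sym (+-assoc _ _ _)) ⟩
    1# ⊕ ((⊝ 1# ⊕ nat m) ⊖ nat n)        ≈⟨ +-congˡ (+-congʳ (+-comm _ _)) ⟩
    1# ⊕ ((nat m ⊖ 1#) ⊖ nat n)          ≈⟨ +-congˡ (+-assoc _ _ _) ⟩
    1# ⊕ (nat m ⊕ (⊝ 1# ⊖ nat n))        ≈⟨ +-assoc _ _ _ ⟨
    nat (suc m) ⊕ (⊝ 1# ⊖ nat n)         ≈⟨ +-congˡ (-‿+-comm _ _) ⟩
    nat (suc m) ⊖ nat (suc n)            ∎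

  int-+ : ∀ a b → int (a ℤ.+ b) ≈ int a ⊕ int b
  int-+ (+ m)    (+ n)    = nat-+ m n
  int-+ (+ m)    -[1+ n ] = int-⊖ m (suc n)
  int-+ -[1+ m ] (+ n)    = ≈-trans (int-⊖ n (suc m)) (+-comm _ _)
  int-+ -[1+ m ] -[1+ n ] = begin
    ⊝ nat (suc (suc (m + n)))        ≈⟨ -‿cong (≈-reflexive (cong (nat ∘ suc) (sym (ℕₚ.+-suc m n)))) ⟩
    ⊝ nat (suc m + suc n)            ≈⟨ -‿cong (nat-+ (suc m) (suc n)) ⟩
    ⊝ (nat (suc m) ⊕ nat (suc n))    ≈⟨ -‿+-comm _ _ ⟨
    ⊝ nat (suc m) ⊖ nat (suc n)      ∎

  int-neg : ∀ a → int (ℤ.- a) ≈ ⊝ int a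
  int-neg (+ zero)  = ≈-sym -0#≈0#
  int-neg (+ suc n) = ≈-refl
  int-neg -[1+ n ]  = ≈-sym (-‿involutive _)

  private
    int-nat* : ∀ m b → int (+ m ℤ.* b) ≈ nat m ⊙ int b
    int-nat* zero b = ≈-sym (zeroˡ _)
    int-nat* (suc m) b = begin
      int (+ suc m ℤ.* b)             ≈⟨ ≈-reflexive (cong int (ℤₚ.suc-* (+ m) b)) ⟩
      int (b ℤ.+ + m ℤ.* b)           ≈⟨ int-+ b (+ m ℤ.* b) ⟩
      int b ⊕ int (+ m ℤ.* b)         ≈⟨ +-cong (≈-sym (*-identityˡ _)) (int-nat* m b) ⟩
      1# ⊙ int b ⊕ nat m ⊙ int b      ≈⟨ distribʳ _ _ _ ⟨
      nat (suc m) ⊙ int b             ∎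

  int-* : ∀ a b → int (a ℤ.* b) ≈ int a ⊙ int b
  int-* (+ m) b = int-nat* m b
  int-* -[1+ m ] b = begin
    int (-[1+ m ] ℤ.* b)          ≈⟨ ≈-reflexive (cong int (sym (ℤₚ.neg-distribˡ-* (+ suc m) b))) ⟩
    int (ℤ.- (+ suc m ℤ.* b))     ≈⟨ int-neg (+ suc m ℤ.* b) ⟩
    ⊝ int (+ suc m ℤ.* b)         ≈⟨ -‿cong (int-nat* (suc m) b) ⟩
    ⊝ (nat (suc m) ⊙ int b)       ≈⟨ -‿distribˡ-* _ _ ⟩
    int -[1+ m ] ⊙ int b          ∎

  private
    acr : AlmostCommutativeRing 0ℓ 0ℓ
    acr = fromCommutativeRing R

    -- int with the value at 1 normalised to 1#, so that the solver's constant 1 is literally 1#.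
    coeff : ℤ → Carrier
    coeff (+ 1) = 1#
    coeff a     = int a

    coeff≈int : ∀ a → coeff a ≈ int a
    coeff≈int (+ 0)           = ≈-refl
    coeff≈int (+ 1)           = ≈-sym nat-1
    coeff≈int (+ suc (suc _)) = ≈-refl
    coeff≈int -[1+ _ ]        = ≈-refl

    ℤ⟶R : CommutativeRing.rawRing ℤₚ.+-*-commutativeRing -Raw-AlmostCommutative⟶ acr
    ℤ⟶R = record
      { ⟦_⟧    = coeff
      ; +-homo = λ a b → ≈-trans (coeff≈int (a ℤ.+ b)) (≈-trans (int-+ a b) (+-cong (≈-sym (coeff≈int a)) (≈-sym (coeff≈int b))))
      ; *-homo = λ a b → ≈-trans (coeff≈int (a ℤ.* b)) (≈-trans (int-* a b) (*-cong (≈-sym (coeff≈int a)) (≈-sym (coeff≈int b))))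
      ; -‿homo = λ a → ≈-trans (coeff≈int (ℤ.- a)) (≈-trans (int-neg a) (-‿cong (≈-sym (coeff≈int a))))
      ; 0-homo = ≈-refl
      ; 1-homo = ≈-refl
      }

    coeff-≟ : ∀ a b → _
    coeff-≟ a b with a ℤ.≟ b
    ... | yes a≡b = just (≈-reflexive (cong coeff a≡b))
    ... | no _    = nothing

  open RingSolver (CommutativeRing.rawRing ℤₚ.+-*-commutativeRing) acr ℤ⟶R coeff-≟ public
    using (solve; _:=_; _:+_; _:*_; _:-_; :-_; con)

  x⊖x≈0 : ∀ x → x ⊖ x ≈ 0#
  x⊖x≈0 = -‿inverseʳ

  ⊖≈0⇒≈ : ∀ {x y} → x ⊖ y ≈ 0# → x ≈ y
  ⊖≈0⇒≈ {x} {y} e = begin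
    x              ≈⟨ solve 2 (λ x y → x := (x :- y) :+ y) ≈-refl x y ⟩
    (x ⊖ y) ⊕ y    ≈⟨ +-congʳ e ⟩
    0# ⊕ y         ≈⟨ +-identityˡ y ⟩
    y              ∎

  ≈⇒⊖≈0 : ∀ {x y} → x ≈ y → x ⊖ y ≈ 0#
  ≈⇒⊖≈0 {x} {y} e = ≈-trans (+-congʳ e) (x⊖x≈0 y)

  ↑-cong : ∀ {x y} n → x ≈ y → x ↑ n ≈ y ↑ n
  ↑-cong zero    e = ≈-refl
  ↑-cong (suc n) e = *-cong e (↑-cong n e)

  ↑-+ : ∀ x m n → x ↑ (m + n) ≈ x ↑ m ⊙ x ↑ n
  ↑-+ x zero    n = ≈-sym (*-identityˡ _)
  ↑-+ x (suc m) n = ≈-trans (*-congˡ (↑-+ x m n)) (≈-sym (*-assoc _ _ _))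

  1↑ : ∀ n → 1# ↑ n ≈ 1#
  1↑ zero    = ≈-refl
  1↑ (suc n) = ≈-trans (*-identityˡ _) (1↑ n)

  ↑-⊙ : ∀ x y n → (x ⊙ y) ↑ n ≈ x ↑ n ⊙ y ↑ n
  ↑-⊙ x y zero    = ≈-sym (*-identityˡ _)
  ↑-⊙ x y (suc n) = ≈-trans (*-congˡ (↑-⊙ x y n))
    (solve 4 (λ a b c d → (a :* b) :* (c :* d) := (a :* c) :* (b :* d)) ≈-refl x y _ _)

  ↑-* : ∀ x m n → x ↑ (m * n) ≈ (x ↑ n) ↑ m
  ↑-* x zero    n = ≈-refl
  ↑-* x (suc m) n = ≈-trans (↑-+ x n (m * n)) (*-congˡ (↑-* x m n))

  0↑ : ∀ n → 0 < n → 0# ↑ n ≈ 0#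
  0↑ (suc n) _ = zeroˡ _

  infix 4 _∣ᴿ_
  record _∣ᴿ_ (d z : Carrier) : Set where
    constructor mk∣
    field
      quotient : Carrier
      equality : z ≈ d ⊙ quotient

  ∣-resp : ∀ {d x y} → x ≈ y → d ∣ᴿ x → d ∣ᴿ y
  ∣-resp e (mk∣ w f) = mk∣ w $ ≈-trans (≈-sym e) f

  ∣-respˡ : ∀ {d e x} → d ≈ e → d ∣ᴿ x → e ∣ᴿ x
  ∣-respˡ e (mk∣ w f) = mk∣ w $ ≈-trans f (*-congʳ e)

  ∣-⊕ : ∀ {d x y} → d ∣ᴿ x → d ∣ᴿ y → d ∣ᴿ x ⊕ y
  ∣-⊕ (mk∣ v e) (mk∣ w f) = mk∣ (v ⊕ w) $ ≈-trans (+-cong e f) (≈-sym (distribˡ _ _ _))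

  ∣-⊝ : ∀ {d x} → d ∣ᴿ x → d ∣ᴿ ⊝ x
  ∣-⊝ (mk∣ v e) = mk∣ (⊝ v) $ ≈-trans (-‿cong e) (-‿distribʳ-* _ _)

  ∣-⊖ : ∀ {d x y} → d ∣ᴿ x → d ∣ᴿ y → d ∣ᴿ x ⊖ y
  ∣-⊖ p q = ∣-⊕ p (∣-⊝ q)

  ∣-⊙ʳ : ∀ {d x} y → d ∣ᴿ x → d ∣ᴿ x ⊙ y
  ∣-⊙ʳ y (mk∣ v e) = mk∣ (v ⊙ y) $ ≈-trans (*-congʳ e) (*-assoc _ _ _)

  ∣-⊙ˡ : ∀ {d x} y → d ∣ᴿ x → d ∣ᴿ y ⊙ x
  ∣-⊙ˡ y p = ∣-resp (*-comm _ _) (∣-⊙ʳ y p)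

  ∣-0 : ∀ {d} → d ∣ᴿ 0#
  ∣-0 = mk∣ 0# $ ≈-sym (zeroʳ _)

  ∣-self : ∀ {d} → d ∣ᴿ d
  ∣-self = mk∣ 1# $ ≈-sym (*-identityʳ _)

  ∣-trans′ : ∀ {a b c} → a ∣ᴿ b → b ∣ᴿ c → a ∣ᴿ c
  ∣-trans′ p (mk∣ w e) = ∣-resp (≈-sym e) (∣-⊙ʳ w p)

  ∣-⊙⊙ : ∀ {a b x y} → a ∣ᴿ x → b ∣ᴿ y → a ⊙ b ∣ᴿ x ⊙ y
  ∣-⊙⊙ (mk∣ v e) (mk∣ w f) = mk∣ (v ⊙ w) $ ≈-trans (*-cong e f)
    (solve 4 (λ a v b w → (a :* v) :* (b :* w) := (a :* b) :* (v :* w)) ≈-refl _ _ _ _)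

  ∣-nat : ∀ {m n} → m ∣ n → nat m ∣ᴿ nat n
  ∣-nat {m} (divides q refl) = mk∣ (nat q) $ ≈-trans (nat-* q m) (*-comm _ _)

  ∣-≡ : ∀ {d x y z} → d ∣ᴿ x ⊖ y → d ∣ᴿ y ⊖ z → d ∣ᴿ x ⊖ z
  ∣-≡ p q = ∣-resp (solve 3 (λ x y z → (x :- y) :+ (y :- z) := x :- z) ≈-refl _ _ _) (∣-⊕ p q)

  ∣-≡-sym : ∀ {d x y} → d ∣ᴿ x ⊖ y → d ∣ᴿ y ⊖ x
  ∣-≡-sym p = ∣-resp (solve 2 (λ x y → :- (x :- y) := y :- x) ≈-refl _ _) (∣-⊝ p)

  -- The sum of a^i b^(n-1-i) over i < n, the cofactor of a - b in a^n - b^n; the recursion avoids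
  -- truncated subtraction.
  geometric : Carrier → Carrier → ℕ → Carrier
  geometric a b zero    = 0#
  geometric a b (suc n) = a ⊙ geometric a b n ⊕ b ↑ n

  geometric-eq : ∀ a b n → a ↑ n ⊖ b ↑ n ≈ (a ⊖ b) ⊙ geometric a b n
  geometric-eq a b zero = ≈-trans (x⊖x≈0 _) (≈-sym (zeroʳ _))
  geometric-eq a b (suc n) = begin
    a ⊙ a ↑ n ⊖ b ⊙ b ↑ n                             ≈⟨ solve 4 (λ a b x y → a :* x :- b :* y := a :* (x :- y) :+ (a :- b) :* y) ≈-refl a b _ _ ⟩
    a ⊙ (a ↑ n ⊖ b ↑ n) ⊕ (a ⊖ b) ⊙ b ↑ n             ≈⟨ +-congʳ (*-congˡ (geometric-eq a b n)) ⟩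
    a ⊙ ((a ⊖ b) ⊙ geometric a b n) ⊕ (a ⊖ b) ⊙ b ↑ n ≈⟨ solve 4 (λ a b x y → a :* ((a :- b) :* x) :+ (a :- b) :* y := (a :- b) :* (a :* x :+ y)) ≈-refl a b _ _ ⟩
    (a ⊖ b) ⊙ geometric a b (suc n)                   ∎

  ∣-↑ : ∀ {d a b} n → d ∣ᴿ a ⊖ b → d ∣ᴿ a ↑ n ⊖ b ↑ n
  ∣-↑ {d} {a} {b} n p = ∣-resp (≈-sym (geometric-eq a b n)) (∣-⊙ʳ _ p)

  -- Modulo d each of the n terms equals b^(n-1); the extra factor b spares the exponent n - 1.
  geometric-mod : ∀ {d a b} n → d ∣ᴿ a ⊖ b → d ∣ᴿ b ⊙ geometric a b n ⊖ nat n ⊙ b ↑ n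
  geometric-mod {d} {a} {b} zero p = ∣-resp
    (solve 2 (λ b x → con 0ℤ := b :* con 0ℤ :- con 0ℤ :* x) ≈-refl b (b ↑ 0)) ∣-0
  geometric-mod {d} {a} {b} (suc n) p = ∣-resp
    (solve 5 (λ a b g k y → b :* (b :* g :- k :* y) :+ (a :- b) :* (b :* g) := b :* (a :* g :+ y) :- (con 1ℤ :+ k) :* (b :* y))
       ≈-refl a b (geometric a b n) (nat n) (b ↑ n))
    (∣-⊕ (∣-⊙ˡ b (geometric-mod n p)) (∣-⊙ʳ _ p))

  ∣-geometric : ∀ {d a b} n → d ∣ᴿ a ⊖ b → d ∣ᴿ nat n → d ∣ᴿ geometric a b n
  ∣-geometric zero p q = ∣-0
  ∣-geometric {d} {a} {b} (suc n) p q = ∣-resp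
    (solve 5 (λ a b g k y → ((a :- b) :* g :+ (b :* g :- k :* y)) :+ (con 1ℤ :+ k) :* y := a :* g :+ y)
       ≈-refl a b (geometric a b n) (nat n) (b ↑ n))
    (∣-⊕ (∣-⊕ (∣-⊙ʳ _ p) (geometric-mod n p)) (∣-⊙ʳ _ q))

  -- a^q - b^q is a - b times a sum of q terms that are congruent modulo d, and this sum is
  -- divisible by d because q is. One power of d is gained.
  lift-congruence : ∀ {d a b} i q → d ∣ᴿ nat q → d ↑ suc i ∣ᴿ a ⊖ b → d ↑ suc (suc i) ∣ᴿ a ↑ q ⊖ b ↑ q
  lift-congruence {d} {a} {b} i q d∣q p = ∣-resp (≈-sym (geometric-eq a b q))
    (∣-respˡ (*-comm _ _) (∣-⊙⊙ p (∣-geometric q (∣-trans′ (mk∣ (d ↑ i) ≈-refl) p) d∣q)))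

  lift-congruence-↑ : ∀ {d a b} q → d ∣ᴿ nat q → d ∣ᴿ a ⊖ b → ∀ k → d ↑ suc k ∣ᴿ a ↑ (q ^ k) ⊖ b ↑ (q ^ k)
  lift-congruence-↑ {d} {a} {b} q d∣q p zero =
    ∣-respˡ (≈-sym (*-identityʳ d)) (∣-resp (+-cong (≈-sym (*-identityʳ a)) (-‿cong (≈-sym (*-identityʳ b)))) p)
  lift-congruence-↑ {d} {a} {b} q d∣q p (suc k) =
    ∣-resp (+-cong (≈-sym (↑-* a q (q ^ k))) (-‿cong (≈-sym (↑-* b q (q ^ k)))))
           (lift-congruence k q d∣q (lift-congruence-↑ q d∣q p k))

  ∣-coprime : ∀ {m n z} → Coprime m n → nat m ∣ᴿ z → nat n ∣ᴿ z → nat (m * n) ∣ᴿ z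
  ∣-coprime {m} {n} {z} c (mk∣ v e) (mk∣ w f) with Coprimality.coprime-Bézout c
  ... | Bézout.+- x y eq = mk∣ (nat x ⊙ w ⊖ nat y ⊙ v) (begin
    z                                               ≈⟨ solve 2 (λ z b → z := (con 1ℤ :+ b) :* z :- b :* z) ≈-refl z (nat y ⊙ nat n) ⟩
    (1# ⊕ nat y ⊙ nat n) ⊙ z ⊖ (nat y ⊙ nat n) ⊙ z
      ≈⟨ +-congʳ (*-congʳ bez) ⟩
    (nat x ⊙ nat m) ⊙ z ⊖ (nat y ⊙ nat n) ⊙ z       ≈⟨ +-cong (*-congˡ f) (-‿cong (*-congˡ e)) ⟩
    (nat x ⊙ nat m) ⊙ (nat n ⊙ w) ⊖ (nat y ⊙ nat n) ⊙ (nat m ⊙ v)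
      ≈⟨ solve 6 (λ x y m n v w → (x :* m) :* (n :* w) :- (y :* n) :* (m :* v) := (m :* n) :* (x :* w :- y :* v)) ≈-refl _ _ _ _ _ _ ⟩
    (nat m ⊙ nat n) ⊙ (nat x ⊙ w ⊖ nat y ⊙ v)       ≈⟨ *-congʳ (nat-* m n) ⟨
    nat (m * n) ⊙ (nat x ⊙ w ⊖ nat y ⊙ v)           ∎)
    where
    bez : 1# ⊕ nat y ⊙ nat n ≈ nat x ⊙ nat m
    bez = begin
      1# ⊕ nat y ⊙ nat n   ≈⟨ +-congˡ (nat-* y n) ⟨
      nat (1 + y * n)         ≈⟨ ≈-reflexive (cong nat eq) ⟩
      nat (x * m)             ≈⟨ nat-* x m ⟩
      nat x ⊙ nat m           ∎
  ... | Bézout.-+ x y eq = mk∣ (nat y ⊙ v ⊖ nat x ⊙ w) (begin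
    z                                               ≈⟨ solve 2 (λ z b → z := (con 1ℤ :+ b) :* z :- b :* z) ≈-refl z (nat x ⊙ nat m) ⟩
    (1# ⊕ nat x ⊙ nat m) ⊙ z ⊖ (nat x ⊙ nat m) ⊙ z
      ≈⟨ +-congʳ (*-congʳ bez) ⟩
    (nat y ⊙ nat n) ⊙ z ⊖ (nat x ⊙ nat m) ⊙ z       ≈⟨ +-cong (*-congˡ e) (-‿cong (*-congˡ f)) ⟩
    (nat y ⊙ nat n) ⊙ (nat m ⊙ v) ⊖ (nat x ⊙ nat m) ⊙ (nat n ⊙ w)
      ≈⟨ solve 6 (λ x y m n v w → (y :* n) :* (m :* v) :- (x :* m) :* (n :* w) := (m :* n) :* (y :* v :- x :* w)) ≈-refl _ _ _ _ _ _ ⟩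
    (nat m ⊙ nat n) ⊙ (nat y ⊙ v ⊖ nat x ⊙ w)       ≈⟨ *-congʳ (nat-* m n) ⟨
    nat (m * n) ⊙ (nat y ⊙ v ⊖ nat x ⊙ w)           ∎)
    where
    bez : 1# ⊕ nat x ⊙ nat m ≈ nat y ⊙ nat n
    bez = begin
      1# ⊕ nat x ⊙ nat m   ≈⟨ +-congˡ (nat-* x m) ⟨
      nat (1 + x * m)         ≈⟨ ≈-reflexive (cong nat eq) ⟩
      nat (y * n)             ≈⟨ nat-* y n ⟩
      nat y ⊙ nat n           ∎

-- Frobenius and finite sums

nCk*k![n-k]! : ∀ {n k} → k ≤ n → (n C k) * (k ! * (n ∸ k) !) ≡ n !
nCk*k![n-k]! {n} {k} k≤n = begin
  (n C k) * (k ! * (n ∸ k) !)                            ≡⟨ cong (_* (k ! * (n ∸ k) !)) (CombSpec.nCk≡n!/k![n-k]! k≤n) ⟩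
  (n ! / (k ! * (n ∸ k) !)) * (k ! * (n ∸ k) !)        ≡⟨ m/n*n≡m (Comb.k![n∸k]!∣n! k≤n) ⟩
  n !                                                  ∎
  where
  open ≡-Reasoning
  instance _ = ℕₚ._!*_!≢0 k (n ∸ k)

prime∤! : ∀ {p} → Prime p → ∀ k → k < p → ¬ p ∣ k !
prime∤! pr zero    k<p p∣ = ℕₚ.<⇒≢ (nonTrivial⇒n>1 _ {{prime⇒nonTrivial pr}}) (sym (∣1⇒≡1 p∣))
prime∤! pr (suc k) k<p p∣ with euclidsLemma (suc k) (k !) pr p∣
... | inj₁ p∣k  = ℕₚ.<⇒≱ k<p (∣⇒≤ p∣k)
... | inj₂ p∣k! = prime∤! pr k (ℕₚ.<-trans (ℕₚ.n<1+n k) k<p) p∣k!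

p∣p! : ∀ {p} → Prime p → p ∣ p !
p∣p! {suc p} _ = m∣m*n (p !)

p∣pCk : ∀ {p k} → Prime p → 0 < k → k < p → p ∣ p C k
p∣pCk {p} {k} pr 0<k k<p with euclidsLemma (p C k) (k ! * (p ∸ k) !) pr (subst (p ∣_) (sym (nCk*k![n-k]! (ℕₚ.<⇒≤ k<p))) (p∣p! pr))
... | inj₁ p∣C = p∣C
... | inj₂ p∣d with euclidsLemma (k !) ((p ∸ k) !) pr p∣d
...   | inj₁ x = contradiction x (prime∤! pr k k<p)
...   | inj₂ x = contradiction x (prime∤! pr (p ∸ k) (ℕₚ.∸-monoʳ-< 0<k (ℕₚ.<⇒≤ k<p)))

module Frobenius (R : CommutativeRing 0ℓ 0ℓ) where
  open CRing R
  open SetoidReasoning setoid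

  private
    module E = Exp semiring
    module M = Mult semiring
    module S = SemiringSum semiring

  ↑≡^ : ∀ x n → x ↑ n ≡ x E.^ n
  ↑≡^ x zero    = refl
  ↑≡^ x (suc n) = cong (x ⊙_) (↑≡^ x n)

  ×≈nat : ∀ n x → n M.× x ≈ nat n ⊙ x
  ×≈nat zero    x = ≈-sym (zeroˡ x)
  ×≈nat (suc n) x = ≈-trans (+-cong (≈-sym (*-identityˡ x)) (×≈nat n x)) (≈-sym (distribʳ _ _ _))

  ∣-sum : ∀ {d n} (t : Fin n → Carrier) → (∀ k → d ∣ᴿ t k) → d ∣ᴿ S.sum t
  ∣-sum {n = zero}  t p = ∣-0
  ∣-sum {n = suc n} t p = ∣-⊕ (p fzero) (∣-sum (t ∘ fsuc) (p ∘ fsuc))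

  frobenius : ∀ {p} → Prime p → ∀ x y → nat p ∣ᴿ (x ⊕ y) ↑ p ⊖ (x ↑ p ⊕ y ↑ p)
  frobenius {zero}  pr x y = ⊥-elim (ℕₚ.n≮0 (nonTrivial⇒n>1 0 {{prime⇒nonTrivial pr}}))
  frobenius {p@(suc p′)} pr x y = ∣-resp eq (∣-sum middle middle-∣)
    where
    open Binomial commutativeSemiring using (theorem; binomialTerm; binomial)
    term : Fin (suc p) → Carrier
    term = binomialTerm x y p

    middle : Fin p′ → Carrier
    middle k = term (fsuc (Data.Fin.inject₁ k))

    middle-∣ : ∀ k → nat p ∣ᴿ middle k
    middle-∣ k = ∣-resp (≈-sym (×≈nat (p C suc (toℕ (Data.Fin.inject₁ k))) _)) (∣-⊙ʳ _ (∣-nat (p∣pCk pr (s≤s z≤n) (s≤s (subst (_< p′) (sym (Finₚ.toℕ-inject₁ k)) (Finₚ.toℕ<n k))))))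

    first : term fzero ≈ y ↑ p
    first = begin
      term fzero                ≈⟨ ×≈nat (p C 0) _ ⟩
      nat (p C 0) ⊙ binomial x y p fzero ≈⟨ *-cong (≈-trans (≈-reflexive (cong nat pC0)) nat-1) (*-identityˡ _) ⟩
      1# ⊙ y E.^ p              ≈⟨ *-identityˡ _ ⟩
      y E.^ p                   ≡⟨ ↑≡^ y p ⟨
      y ↑ p                     ∎
      where
      pC0 : p C 0 ≡ 1
      pC0 = trans (nCk≡nC[n∸k] {0} {p} z≤n) (nCn≡1 p)

    final : term (fsuc (Data.Fin.fromℕ p′)) ≈ x ↑ p
    final = begin
      term (fsuc (Data.Fin.fromℕ p′))     ≈⟨ ×≈nat (p C k) _ ⟩
      nat (p C k) ⊙ (x E.^ k ⊙ y E.^ (p ∸ k)) ≈⟨ *-cong (≈-trans (≈-reflexive (cong nat (trans (cong (p C_) k≡p) (nCn≡1 p)))) nat-1)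
                                                   (*-cong (≈-reflexive (cong (x E.^_) k≡p)) (≈-reflexive (cong (y E.^_) (trans (cong (p ∸_) k≡p) (ℕₚ.n∸n≡0 p))))) ⟩
      1# ⊙ (x E.^ p ⊙ 1#)                 ≈⟨ ≈-trans (*-identityˡ _) (*-identityʳ _) ⟩
      x E.^ p                             ≡⟨ ↑≡^ x p ⟨
      x ↑ p                               ∎
      where
      k = suc (toℕ (Data.Fin.fromℕ p′))
      k≡p : k ≡ p
      k≡p = cong suc (Finₚ.toℕ-fromℕ p′)

    eq : S.sum middle ≈ (x ⊕ y) ↑ p ⊖ (x ↑ p ⊕ y ↑ p)
    eq = ≈-sym (begin
      (x ⊕ y) ↑ p ⊖ (x ↑ p ⊕ y ↑ p)                       ≈⟨ +-congʳ (≈-trans (≈-reflexive (↑≡^ (x ⊕ y) p)) (theorem p x y)) ⟩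
      (term fzero ⊕ S.sum (term ∘ fsuc)) ⊖ (x ↑ p ⊕ y ↑ p) ≈⟨ +-congʳ (+-congˡ (S.sum-init-last (term ∘ fsuc))) ⟩
      (term fzero ⊕ (S.sum middle ⊕ term (fsuc (Data.Fin.fromℕ p′)))) ⊖ (x ↑ p ⊕ y ↑ p) ≈⟨ +-congʳ (+-cong first (+-congˡ final)) ⟩
      (y ↑ p ⊕ (S.sum middle ⊕ x ↑ p)) ⊖ (x ↑ p ⊕ y ↑ p)  ≈⟨ solve 3 (λ a b c → (a :+ (b :+ c)) :- (c :+ a) := b) ≈-refl (y ↑ p) (S.sum middle) (x ↑ p) ⟩
      S.sum middle                                        ∎)

module Sums (R : CommutativeRing 0ℓ 0ℓ) where
  open CRing R
  open SetoidReasoning setoid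

  ∑ : ℕ → (ℕ → Carrier) → Carrier
  ∑ zero    f = 0#
  ∑ (suc n) f = f 0 ⊕ ∑ n (f ∘ suc)

  ∑-cong : ∀ n {f g} → (∀ i → i < n → f i ≈ g i) → ∑ n f ≈ ∑ n g
  ∑-cong zero    e = ≈-refl
  ∑-cong (suc n) e = +-cong (e 0 (s≤s z≤n)) (∑-cong n (λ i i<n → e (suc i) (s≤s i<n)))

  ∑-zero : ∀ n {f} → (∀ i → i < n → f i ≈ 0#) → ∑ n f ≈ 0#
  ∑-zero zero    e = ≈-refl
  ∑-zero (suc n) e = ≈-trans (+-cong (e 0 (s≤s z≤n)) (∑-zero n (λ i i<n → e (suc i) (s≤s i<n)))) (+-identityˡ _)

  ∑-⊕ : ∀ n f g → ∑ n (λ i → f i ⊕ g i) ≈ ∑ n f ⊕ ∑ n g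
  ∑-⊕ zero    f g = ≈-sym (+-identityˡ _)
  ∑-⊕ (suc n) f g = ≈-trans (+-congˡ (∑-⊕ n (f ∘ suc) (g ∘ suc)))
    (solve 4 (λ a b c d → (a :+ b) :+ (c :+ d) := (a :+ c) :+ (b :+ d)) ≈-refl _ _ _ _)

  ∑-⊝ : ∀ n f → ∑ n (λ i → ⊝ f i) ≈ ⊝ ∑ n f
  ∑-⊝ zero    f = solve 0 (con 0ℤ := :- con 0ℤ) ≈-refl
  ∑-⊝ (suc n) f = ≈-trans (+-congˡ (∑-⊝ n (f ∘ suc)))
    (solve 2 (λ a b → (:- a) :+ (:- b) := :- (a :+ b)) ≈-refl _ _)

  ∑-⊙ˡ : ∀ n c f → ∑ n (λ i → c ⊙ f i) ≈ c ⊙ ∑ n f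
  ∑-⊙ˡ zero    c f = ≈-sym (zeroʳ _)
  ∑-⊙ˡ (suc n) c f = ≈-trans (+-congˡ (∑-⊙ˡ n c (f ∘ suc))) (≈-sym (distribˡ _ _ _))

  ∑-const : ∀ n c → ∑ n (λ _ → c) ≈ nat n ⊙ c
  ∑-const zero    c = ≈-sym (zeroˡ _)
  ∑-const (suc n) c = ≈-trans (+-cong (≈-sym (*-identityˡ c)) (∑-const n c)) (≈-sym (distribʳ _ _ _))

  ∑-last : ∀ n f → ∑ (suc n) f ≈ ∑ n f ⊕ f n
  ∑-last zero    f = +-comm _ _
  ∑-last (suc n) f = ≈-trans (+-congˡ (∑-last n (f ∘ suc))) (≈-sym (+-assoc _ _ _))

  ∑-swap : ∀ m n (f : ℕ → ℕ → Carrier) → ∑ m (λ i → ∑ n (f i)) ≈ ∑ n (λ j → ∑ m (λ i → f i j))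
  ∑-swap zero    n f = ≈-sym (∑-zero n (λ _ _ → ≈-refl))
  ∑-swap (suc m) n f = ≈-trans (+-congˡ (∑-swap m n (f ∘ suc))) (≈-sym (∑-⊕ n (f 0) _))

  ∑-single : ∀ n f k → k < n → (∀ i → i < n → i ≢ k → f i ≈ 0#) → ∑ n f ≈ f k
  ∑-single (suc n) f zero    k<n z = ≈-trans (+-congˡ (∑-zero n (λ i i<n → z (suc i) (s≤s i<n) λ ()))) (+-identityʳ _)
  ∑-single (suc n) f (suc k) (s≤s k<n) z = ≈-trans
    (+-cong (z 0 (s≤s z≤n) λ ()) (∑-single n (f ∘ suc) k k<n (λ i i<n i≢k → z (suc i) (s≤s i<n) (i≢k ∘ ℕₚ.suc-injective))))
    (+-identityˡ _)

  ∑-shift₁ : ∀ n f → f n ≈ f 0 → ∑ n (f ∘ suc) ≈ ∑ n f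
  ∑-shift₁ zero    f e = ≈-refl
  ∑-shift₁ (suc n) f e = begin
    ∑ (suc n) (f ∘ suc)        ≈⟨ ∑-last n (f ∘ suc) ⟩
    ∑ n (f ∘ suc) ⊕ f (suc n)  ≈⟨ +-congˡ e ⟩
    ∑ n (f ∘ suc) ⊕ f 0        ≈⟨ +-comm _ _ ⟩
    ∑ (suc n) f                ∎

  ∑-shift : ∀ n f → (∀ i → f (i + n) ≈ f i) → ∀ k → ∑ n (λ i → f (i + k)) ≈ ∑ n f
  ∑-shift n f per zero    = ∑-cong n (λ i _ → ≈-reflexive (cong f (ℕₚ.+-identityʳ i)))
  ∑-shift n f per (suc k) = begin
    ∑ n (λ i → f (i + suc k))    ≈⟨ ∑-cong n (λ i _ → ≈-reflexive (cong f (ℕₚ.+-suc i k))) ⟩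
    ∑ n (λ i → f (suc i + k))    ≈⟨ ∑-shift₁ n (λ i → f (i + k)) (≈-trans (≈-reflexive (cong f (ℕₚ.+-comm n k))) (per k)) ⟩
    ∑ n (λ i → f (i + k))        ≈⟨ ∑-shift n f per k ⟩
    ∑ n f                        ∎

  ∑-sumFin : ∀ n f → sumFin R {n} (λ i → f (toℕ i)) ≈ ∑ n f
  ∑-sumFin zero    f = ≈-refl
  ∑-sumFin (suc n) f = +-congˡ (∑-sumFin n (f ∘ suc))

-- Laurent polynomials and their quotients

-- Integral combinations of the monomials xⁱ (i ∈ ℤ), i.e. ℤ[x , x⁻¹].
infix 9 X^_
infixl 6 _⊞_
infixl 7 _⊠_
infix 8 ⊟_
data Poly : Set where
  𝟘   : Poly
  X^_ : ℤ → Poly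
  _⊞_ : Poly → Poly → Poly
  ⊟_  : Poly → Poly

bind : Poly → (ℤ → Poly) → Poly
bind 𝟘       f = 𝟘
bind (X^ i)  f = f i
bind (a ⊞ b) f = bind a f ⊞ bind b f
bind (⊟ a)   f = ⊟ bind a f

opaque
  _⊠_ : Poly → Poly → Poly
  a ⊠ b = bind a (λ i → bind b (λ j → X^ (i ℤ.+ j)))

  σ : ℤ → Poly → Poly
  σ s a = bind a (λ i → X^ (s ℤ.* i))

  X^⊠X^ : ∀ i j → X^ i ⊠ X^ j ≡ X^ (i ℤ.+ j)
  X^⊠X^ i j = refl

  ⊞-⊠ : ∀ a b c → (a ⊞ b) ⊠ c ≡ a ⊠ c ⊞ b ⊠ c
  ⊞-⊠ a b c = refl

  σ-𝟘 : ∀ s → σ s 𝟘 ≡ 𝟘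
  σ-𝟘 s = refl

  σ-X^ : ∀ s i → σ s (X^ i) ≡ X^ (s ℤ.* i)
  σ-X^ s i = refl

  σ-⊞ : ∀ s a b → σ s (a ⊞ b) ≡ σ s a ⊞ σ s b
  σ-⊞ s a b = refl

  σ-⊟ : ∀ s a → σ s (⊟ a) ≡ ⊟ σ s a
  σ-⊟ s a = refl

conj : Poly → Poly
conj = σ ℤ.-1ℤ

module Lin (R : CommutativeRing 0ℓ 0ℓ) where
  open CRing R
  open Sums R
  open SetoidReasoning setoid

  lin : (ℤ → Carrier) → Poly → Carrier
  lin f 𝟘       = 0#
  lin f (X^ i)  = f i
  lin f (a ⊞ b) = lin f a ⊕ lin f b
  lin f (⊟ a)   = ⊝ lin f a

  lin-cong : ∀ a {f g} → (∀ i → f i ≈ g i) → lin f a ≈ lin g a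
  lin-cong 𝟘       e = ≈-refl
  lin-cong (X^ i)  e = e i
  lin-cong (a ⊞ b) e = +-cong (lin-cong a e) (lin-cong b e)
  lin-cong (⊟ a)   e = -‿cong (lin-cong a e)

  lin-bind : ∀ f a g → lin f (bind a g) ≡ lin (λ i → lin f (g i)) a
  lin-bind f 𝟘       g = refl
  lin-bind f (X^ i)  g = refl
  lin-bind f (a ⊞ b) g = cong₂ _⊕_ (lin-bind f a g) (lin-bind f b g)
  lin-bind f (⊟ a)   g = cong ⊝_ (lin-bind f a g)

  lin-0 : ∀ a {f} → (∀ i → f i ≈ 0#) → lin f a ≈ 0#
  lin-0 𝟘       e = ≈-refl
  lin-0 (X^ i)  e = e i
  lin-0 (a ⊞ b) e = ≈-trans (+-cong (lin-0 a e) (lin-0 b e)) (+-identityˡ _)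
  lin-0 (⊟ a)   e = ≈-trans (-‿cong (lin-0 a e)) (solve 0 (:- con 0ℤ := con 0ℤ) ≈-refl)

  lin-⊕ : ∀ a f g → lin (λ i → f i ⊕ g i) a ≈ lin f a ⊕ lin g a
  lin-⊕ 𝟘       f g = ≈-sym (+-identityˡ _)
  lin-⊕ (X^ i)  f g = ≈-refl
  lin-⊕ (a ⊞ b) f g = ≈-trans (+-cong (lin-⊕ a f g) (lin-⊕ b f g))
    (solve 4 (λ a b c d → (a :+ b) :+ (c :+ d) := (a :+ c) :+ (b :+ d)) ≈-refl _ _ _ _)
  lin-⊕ (⊟ a)   f g = ≈-trans (-‿cong (lin-⊕ a f g))
    (solve 2 (λ a b → :- (a :+ b) := (:- a) :+ (:- b)) ≈-refl _ _)

  lin-⊝ : ∀ a f → lin (λ i → ⊝ f i) a ≈ ⊝ lin f a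
  lin-⊝ 𝟘       f = solve 0 (con 0ℤ := :- con 0ℤ) ≈-refl
  lin-⊝ (X^ i)  f = ≈-refl
  lin-⊝ (a ⊞ b) f = ≈-trans (+-cong (lin-⊝ a f) (lin-⊝ b f))
    (solve 2 (λ a b → (:- a) :+ (:- b) := :- (a :+ b)) ≈-refl _ _)
  lin-⊝ (⊟ a)   f = -‿cong (lin-⊝ a f)

  lin-⊙ˡ : ∀ a c f → lin (λ i → c ⊙ f i) a ≈ c ⊙ lin f a
  lin-⊙ˡ 𝟘       c f = ≈-sym (zeroʳ c)
  lin-⊙ˡ (X^ i)  c f = ≈-refl
  lin-⊙ˡ (a ⊞ b) c f = ≈-trans (+-cong (lin-⊙ˡ a c f) (lin-⊙ˡ b c f)) (≈-sym (distribˡ _ _ _))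
  lin-⊙ˡ (⊟ a)   c f = ≈-trans (-‿cong (lin-⊙ˡ a c f)) (solve 2 (λ c x → :- (c :* x) := c :* (:- x)) ≈-refl _ _)

  lin-swap : ∀ a b (g : ℤ → ℤ → Carrier) → lin (λ i → lin (g i) b) a ≈ lin (λ j → lin (λ i → g i j) a) b
  lin-swap 𝟘       b g = ≈-sym (lin-0 b (λ _ → ≈-refl))
  lin-swap (X^ i)  b g = ≈-refl
  lin-swap (a ⊞ a′) b g = ≈-trans (+-cong (lin-swap a b g) (lin-swap a′ b g)) (≈-sym (lin-⊕ b _ _))
  lin-swap (⊟ a)   b g = ≈-trans (-‿cong (lin-swap a b g)) (≈-sym (lin-⊝ b _))

  lin-∑ : ∀ a n (f : ℕ → ℤ → Carrier) → lin (λ i → ∑ n (λ k → f k i)) a ≈ ∑ n (λ k → lin (f k) a)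
  lin-∑ a zero    f = lin-0 a (λ _ → ≈-refl)
  lin-∑ a (suc n) f = ≈-trans (lin-⊕ a _ _) (+-congˡ (lin-∑ a n (f ∘ suc)))

  opaque
   unfolding _⊠_

   lin-⊠ : ∀ f a b → lin f (a ⊠ b) ≈ lin (λ i → lin (λ j → f (i ℤ.+ j)) b) a
   lin-⊠ f a b = ≈-trans (≈-reflexive (lin-bind f a _)) (lin-cong a (λ i → ≈-reflexive (lin-bind f b _)))

   lin-σ : ∀ f s a → lin f (σ s a) ≡ lin (λ i → f (s ℤ.* i)) a
   lin-σ f s a = lin-bind f a _

-- The quotient of ℤ[x , x⁻¹] by the largest ideal on which the functional xⁱ ↦ t i vanishes.
module Quot (R : CommutativeRing 0ℓ 0ℓ) (t : ℤ → CommutativeRing.Carrier R) where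
  open CRing R
  open Lin R
  open SetoidReasoning setoid

  at : ℤ → ℤ → Carrier
  at j i = t (j ℤ.+ i)

  infix 4 _∼_
  -- Testing on multiples by monomials suffices: they span, and multiplying by a monomial only
  -- shifts j, so the null space is an ideal.
  record _∼_ (a b : Poly) : Set where
    constructor mk∼
    field eq : ∀ j → lin (at j) a ≈ lin (at j) b
  open _∼_ public

  ∼-refl : ∀ {a} → a ∼ a
  ∼-refl .eq j = ≈-refl

  ∼-reflexive : ∀ {a b} → a ≡ b → a ∼ b
  ∼-reflexive refl = ∼-refl

  ∼-sym : ∀ {a b} → a ∼ b → b ∼ a
  ∼-sym p .eq j = ≈-sym (eq p j)

  ∼-trans : ∀ {a b c} → a ∼ b → b ∼ c → a ∼ c
  ∼-trans p q .eq j = ≈-trans (eq p j) (eq q j)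

  at-⊠ : ∀ j a b → lin (at j) (a ⊠ b) ≈ lin (λ i → lin (at (j ℤ.+ i)) b) a
  at-⊠ j a b = ≈-trans (lin-⊠ (at j) a b)
    (lin-cong a (λ i → lin-cong b (λ k → ≈-reflexive (cong t (sym (ℤₚ.+-assoc j i k))))))

  ⊠-comm : ∀ a b → a ⊠ b ∼ b ⊠ a
  ⊠-comm a b .eq j = begin
    lin (at j) (a ⊠ b)                              ≈⟨ lin-⊠ (at j) a b ⟩
    lin (λ i → lin (λ k → at j (i ℤ.+ k)) b) a      ≈⟨ lin-swap a b _ ⟩
    lin (λ k → lin (λ i → at j (i ℤ.+ k)) a) b      ≈⟨ lin-cong b (λ k → lin-cong a (λ i → ≈-reflexive (cong (at j) (ℤₚ.+-comm i k)))) ⟩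
    lin (λ k → lin (λ i → at j (k ℤ.+ i)) a) b      ≈⟨ lin-⊠ (at j) b a ⟨
    lin (at j) (b ⊠ a)                              ∎

  ⊠-congˡ : ∀ {a b b′} → b ∼ b′ → a ⊠ b ∼ a ⊠ b′
  ⊠-congˡ {a} {b} {b′} p .eq j = ≈-trans (at-⊠ j a b) (≈-trans (lin-cong a (λ i → eq p (j ℤ.+ i))) (≈-sym (at-⊠ j a b′)))

  ⊠-cong : ∀ {a a′ b b′} → a ∼ a′ → b ∼ b′ → a ⊠ b ∼ a′ ⊠ b′
  ⊠-cong {a} {a′} {b} {b′} p q = ∼-trans (⊠-congˡ {a} q) (∼-trans (⊠-comm a b′) (∼-trans (⊠-congˡ {b′} p) (⊠-comm b′ a′)))

  ⊠-assoc : ∀ a b c → (a ⊠ b) ⊠ c ∼ a ⊠ (b ⊠ c)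
  ⊠-assoc a b c .eq j = begin
    lin (at j) ((a ⊠ b) ⊠ c)                                  ≈⟨ lin-⊠ (at j) (a ⊠ b) c ⟩
    lin (λ i → lin (λ k → at j (i ℤ.+ k)) c) (a ⊠ b)          ≈⟨ lin-⊠ _ a b ⟩
    lin (λ i → lin (λ l → lin (λ k → at j ((i ℤ.+ l) ℤ.+ k)) c) b) a
      ≈⟨ lin-cong a (λ i → lin-cong b (λ l → lin-cong c (λ k → ≈-reflexive (cong (at j) (ℤₚ.+-assoc i l k))))) ⟩
    lin (λ i → lin (λ l → lin (λ k → at j (i ℤ.+ (l ℤ.+ k))) c) b) a
      ≈⟨ lin-cong a (λ i → lin-⊠ _ b c) ⟨
    lin (λ i → lin (λ m → at j (i ℤ.+ m)) (b ⊠ c)) a          ≈⟨ lin-⊠ (at j) a (b ⊠ c) ⟨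
    lin (at j) (a ⊠ (b ⊠ c))                                  ∎

  ⊠-identityˡ : ∀ a → X^ 0ℤ ⊠ a ∼ a
  ⊠-identityˡ a .eq j = ≈-trans (lin-⊠ (at j) (X^ 0ℤ) a) (lin-cong a (λ i → ≈-reflexive (cong (at j) (ℤₚ.+-identityˡ i))))

  ⊠-distribʳ : ∀ c a b → (a ⊞ b) ⊠ c ∼ a ⊠ c ⊞ b ⊠ c
  ⊠-distribʳ c a b = ∼-reflexive (⊞-⊠ a b c)

  A : CommutativeRing 0ℓ 0ℓ
  A = record
    { Carrier = Poly ; _≈_ = _∼_ ; _+_ = _⊞_ ; _*_ = _⊠_ ; -_ = ⊟_ ; 0# = 𝟘 ; 1# = X^ 0ℤ
    ; isCommutativeRing = record
      { isRing = record
        { +-isAbelianGroup = record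
          { isGroup = record
            { isMonoid = record
              { isSemigroup = record
                { isMagma = record
                  { isEquivalence = record { refl = ∼-refl ; sym = ∼-sym ; trans = ∼-trans }
                  ; ∙-cong = λ p q → mk∼ (λ j → +-cong (eq p j) (eq q j)) }
                ; assoc = λ a b c → mk∼ (λ j → +-assoc _ _ _) }
              ; identity = (λ a → mk∼ (λ j → +-identityˡ _)) , (λ a → mk∼ (λ j → +-identityʳ _)) }
            ; inverse = (λ a → mk∼ (λ j → -‿inverseˡ _)) , (λ a → mk∼ (λ j → -‿inverseʳ _))
            ; ⁻¹-cong = λ p → mk∼ (λ j → -‿cong (eq p j)) }
          ; comm = λ a b → mk∼ (λ j → +-comm _ _) }
        ; *-cong = ⊠-cong
        ; *-assoc = ⊠-assoc
        ; *-identity = ⊠-identityˡ , (λ a → ∼-trans (⊠-comm a (X^ 0ℤ)) (⊠-identityˡ a))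
        ; distrib = (λ a b c → ∼-trans (⊠-comm a (b ⊞ c)) (∼-trans (⊠-distribʳ a b c) (mk∼ (λ j → +-cong (eq (⊠-comm b a) j) (eq (⊠-comm c a) j)))))
                  , ⊠-distribʳ
        }
      ; *-comm = ⊠-comm
      }
    }

  module 𝔸 = CRing A
  module ∑𝔸 = Sums A

  X^-cong : ∀ {i j} → i ≡ j → X^ i ∼ X^ j
  X^-cong refl = ∼-refl

  X^-↑ : ∀ i n → X^ i 𝔸.↑ n ∼ X^ (+ n ℤ.* i)
  X^-↑ i zero    = ∼-refl
  X^-↑ i (suc n) = ∼-trans (⊠-congˡ {X^ i} (X^-↑ i n)) (∼-reflexive (trans (X^⊠X^ _ _) (cong X^_ (sym (ℤₚ.suc-* (+ n) i)))))

  lin-nat : ∀ f n → lin f (𝔸.nat n) ≈ nat n ⊙ f 0ℤ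
  lin-nat f zero    = ≈-sym (zeroˡ _)
  lin-nat f (suc n) = ≈-trans (+-cong (≈-sym (*-identityˡ _)) (lin-nat f n)) (≈-sym (distribʳ _ _ _))

  lin-∑𝔸 : ∀ f n g → lin f (∑𝔸.∑ n g) ≈ Sums.∑ R n (lin f ∘ g)
  lin-∑𝔸 f zero    g = ≈-refl
  lin-∑𝔸 f (suc n) g = +-congˡ (lin-∑𝔸 f n (g ∘ suc))

  lin-nat⊠ : ∀ j n a → lin (at j) (𝔸.nat n ⊠ a) ≈ nat n ⊙ lin (at j) a
  lin-nat⊠ j n a = begin
    lin (at j) (𝔸.nat n ⊠ a)                  ≈⟨ at-⊠ j (𝔸.nat n) a ⟩
    lin (λ i → lin (at (j ℤ.+ i)) a) (𝔸.nat n) ≈⟨ lin-nat _ n ⟩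
    nat n ⊙ lin (at (j ℤ.+ 0ℤ)) a             ≈⟨ *-congˡ (≈-reflexive (cong (λ j → lin (at j) a) (ℤₚ.+-identityʳ j))) ⟩
    nat n ⊙ lin (at j) a                      ∎

  σ-⊠ : ∀ s a b → σ s (a ⊠ b) ∼ σ s a ⊠ σ s b
  σ-⊠ s a b .eq j = begin
    lin (at j) (σ s (a ⊠ b))                                   ≡⟨ lin-σ (at j) s (a ⊠ b) ⟩
    lin (λ i → at j (s ℤ.* i)) (a ⊠ b)                         ≈⟨ lin-⊠ _ a b ⟩
    lin (λ i → lin (λ k → at j (s ℤ.* (i ℤ.+ k))) b) a         ≈⟨ lin-cong a (λ i → lin-cong b (λ k → ≈-reflexive (cong (at j) (ℤₚ.*-distribˡ-+ s i k)))) ⟩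
    lin (λ i → lin (λ k → at j (s ℤ.* i ℤ.+ s ℤ.* k)) b) a     ≈⟨ lin-cong a (λ i → ≈-reflexive (lin-σ _ s b)) ⟨
    lin (λ i → lin (λ k → at j (s ℤ.* i ℤ.+ k)) (σ s b)) a     ≡⟨ lin-σ _ s a ⟨
    lin (λ i → lin (λ k → at j (i ℤ.+ k)) (σ s b)) (σ s a)     ≈⟨ lin-⊠ (at j) (σ s a) (σ s b) ⟨
    lin (at j) (σ s a ⊠ σ s b)                                 ∎

  σ-1 : ∀ s → σ s (X^ 0ℤ) ∼ X^ 0ℤ
  σ-1 s = ∼-reflexive (trans (σ-X^ s 0ℤ) (cong X^_ (ℤₚ.*-zeroʳ s)))

  σ-↑ : ∀ s a n → σ s (a 𝔸.↑ n) ∼ σ s a 𝔸.↑ n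
  σ-↑ s a zero    = σ-1 s
  σ-↑ s a (suc n) = ∼-trans (σ-⊠ s a (a 𝔸.↑ n)) (⊠-congˡ {σ s a} (σ-↑ s a n))

  σ-nat : ∀ s n → σ s (𝔸.nat n) ∼ 𝔸.nat n
  σ-nat s zero    = ∼-reflexive (σ-𝟘 s)
  σ-nat s (suc n) = ∼-trans (∼-reflexive (σ-⊞ s _ _)) $ 𝔸.+-cong (σ-1 s) (σ-nat s n)

  σ-σ : ∀ r s a → σ r (σ s a) ∼ σ (r ℤ.* s) a
  σ-σ r s a .eq j = begin
    lin (at j) (σ r (σ s a))                   ≡⟨ lin-σ _ r (σ s a) ⟩
    lin (λ i → at j (r ℤ.* i)) (σ s a)         ≡⟨ lin-σ _ s a ⟩
    lin (λ i → at j (r ℤ.* (s ℤ.* i))) a       ≈⟨ lin-cong a (λ i → ≈-reflexive (cong (at j) (sym (ℤₚ.*-assoc r s i)))) ⟩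
    lin (λ i → at j ((r ℤ.* s) ℤ.* i)) a       ≡⟨ lin-σ _ (r ℤ.* s) a ⟨
    lin (at j) (σ (r ℤ.* s) a)                 ∎

module QuotFrobenius (R : CommutativeRing 0ℓ 0ℓ) (t : ℤ → CommutativeRing.Carrier R) where
  open Quot R t
  open CRing A

  σ-frobenius : ∀ {p} → Prime p → ∀ a → nat p ∣ᴿ a ↑ p ⊖ σ (+ p) a
  σ-frobenius {p} pr = go
    where
    0<p : 0 < p
    0<p = ℕₚ.n≢0⇒n>0 (≢-nonZero⁻¹ p {{prime⇒nonZero pr}})

    go : ∀ a → nat p ∣ᴿ a ↑ p ⊖ σ (+ p) a
    go 𝟘 = ∣-resp (∼-sym (≈⇒⊖≈0 (∼-trans (0↑ p 0<p) (∼-reflexive (sym (σ-𝟘 _)))))) ∣-0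
    go (X^ i) = ∣-resp (∼-sym (≈⇒⊖≈0 (∼-trans (X^-↑ i p) (∼-reflexive (sym (σ-X^ _ i)))))) ∣-0
    go (a ⊞ b) rewrite σ-⊞ (+ p) a b = ∣-resp
      (solve 5 (λ u a b c d → (u :- (a :+ b)) :+ ((a :- c) :+ (b :- d)) := u :- (c :+ d)) ∼-refl _ _ _ _ _)
      (∣-⊕ (Frobenius.frobenius A pr a b) (∣-⊕ (go a) (go b)))
    -- No sign (-1)^p is evaluated: 0 = (a + (-a))^p is congruent to a^p + (-a)^p.
    go (⊟ a) rewrite σ-⊟ (+ p) a = ∣-resp
      (solve 4 (λ u a b c → (:- ((u :- (a :+ b)) :+ (a :- c))) :+ u := b :- (:- c)) ∼-refl ((a ⊞ ⊟ a) ↑ p) (a ↑ p) ((⊟ a) ↑ p) (σ (+ p) a))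
      (∣-⊕ (∣-⊝ (∣-⊕ (Frobenius.frobenius A pr a (⊟ a)) (go a)))
         (∣-resp (∼-sym (∼-trans (↑-cong p (x⊖x≈0 a)) (0↑ p 0<p))) ∣-0))

-- Traces of roots of unity

record Cong (D : ℕ) (i j : ℤ) : Set where
  constructor mkC
  field
    factor   : ℤ
    equation : i ≡ j ℤ.+ factor ℤ.* + D

cong-refl : ∀ {D i} → Cong D i i
cong-refl {D} {i} = mkC 0ℤ $ lem i (+ D)
  where
  lem : ∀ i d → i ≡ i ℤ.+ 0ℤ ℤ.* d
  lem = ℤ-Solver.solve-∀

cong-sym : ∀ {D i j} → Cong D i j → Cong D j i
cong-sym {D} {i} {j} (mkC k refl) = mkC (ℤ.- k) $ lem j k (+ D)
  where
  lem : ∀ j k d → j ≡ j ℤ.+ k ℤ.* d ℤ.+ (ℤ.- k) ℤ.* d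
  lem = ℤ-Solver.solve-∀

cong-trans : ∀ {D i j l} → Cong D i j → Cong D j l → Cong D i l
cong-trans {D} {l = l} (mkC k refl) (mkC k′ refl) = mkC (k′ ℤ.+ k) $ lem l k k′ (+ D)
  where
  lem : ∀ l k k′ d → l ℤ.+ k′ ℤ.* d ℤ.+ k ℤ.* d ≡ l ℤ.+ (k′ ℤ.+ k) ℤ.* d
  lem = ℤ-Solver.solve-∀

cong-+ : ∀ {D i j i′ j′} → Cong D i j → Cong D i′ j′ → Cong D (i ℤ.+ i′) (j ℤ.+ j′)
cong-+ {D} {j = j} {j′ = j′} (mkC k refl) (mkC k′ refl) = mkC (k ℤ.+ k′) $ lem j j′ k k′ (+ D)
  where
  lem : ∀ j j′ k k′ d → (j ℤ.+ k ℤ.* d) ℤ.+ (j′ ℤ.+ k′ ℤ.* d) ≡ j ℤ.+ j′ ℤ.+ (k ℤ.+ k′) ℤ.* d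
  lem = ℤ-Solver.solve-∀

cong-*ˡ : ∀ {D i j} c → Cong D i j → Cong D (c ℤ.* i) (c ℤ.* j)
cong-*ˡ {D} {j = j} c (mkC k refl) = mkC (c ℤ.* k) $ lem c j k (+ D)
  where
  lem : ∀ c j k d → c ℤ.* (j ℤ.+ k ℤ.* d) ≡ c ℤ.* j ℤ.+ (c ℤ.* k) ℤ.* d
  lem = ℤ-Solver.solve-∀

cong-* : ∀ {D i j i′ j′} → Cong D i j → Cong D i′ j′ → Cong D (i ℤ.* i′) (j ℤ.* j′)
cong-* {D} {j = j} {j′ = j′} (mkC k refl) (mkC k′ refl) = mkC (j ℤ.* k′ ℤ.+ k ℤ.* j′ ℤ.+ k ℤ.* k′ ℤ.* + D) $ lem j j′ k k′ (+ D)
  where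
  lem : ∀ j j′ k k′ d → (j ℤ.+ k ℤ.* d) ℤ.* (j′ ℤ.+ k′ ℤ.* d) ≡ j ℤ.* j′ ℤ.+ (j ℤ.* k′ ℤ.+ k ℤ.* j′ ℤ.+ k ℤ.* k′ ℤ.* d) ℤ.* d
  lem = ℤ-Solver.solve-∀

cong-∣ : ∀ {D E i j} → E ∣ D → Cong D i j → Cong E i j
cong-∣ {E = E} {j = j} (divides q refl) (mkC k refl) = mkC (k ℤ.* + q) $ cong (λ x → j ℤ.+ x) (trans (cong (k ℤ.*_) (ℤₚ.pos-* q E)) (sym (ℤₚ.*-assoc k (+ q) (+ E))))

cong-≡ : ∀ {D i j} → i ≡ j → Cong D i j
cong-≡ refl = cong-refl

∣i-j∣<p : ∀ {p} a b → a < p → b < p → ℤ.∣ + a ℤ.- + b ∣ < p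
∣i-j∣<p {p} a b a<p b<p = begin-strict
  ℤ.∣ + a ℤ.- + b ∣     ≡⟨ cong ℤ.∣_∣ (ℤₚ.[+m]-[+n]≡m⊖n a b) ⟩
  ℤ.∣ a ℤ.⊖ b ∣         ≤⟨ ℤₚ.∣m⊝n∣≤m⊔n a b ⟩
  a Data.Nat.⊔ b        <⟨ ℕₚ.⊔-lub a<p b<p ⟩
  p                     ∎
  where open ℕₚ.≤-Reasoning

ℤ-+-cancelʳ : ∀ c {i j} → i ℤ.+ c ≡ j ℤ.+ c → i ≡ j
ℤ-+-cancelʳ c {i} {j} eq = trans (lem i c) (trans (cong (ℤ._- c) eq) (sym (lem j c)))
  where
  lem : ∀ i c → i ≡ i ℤ.+ c ℤ.- c
  lem = ℤ-Solver.solve-∀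

division-unique : ∀ {p} r q r′ q′ → r < p → r′ < p → + r ℤ.+ q ℤ.* + p ≡ + r′ ℤ.+ q′ ℤ.* + p → r ≡ r′ × q ≡ q′
division-unique {p} r q r′ q′ r<p r′<p eq = ℤₚ.+-injective (ℤ-+-cancelʳ (q ℤ.* + p) (trans eq (cong (λ q → + r′ ℤ.+ q ℤ.* + p) (sym q≡q′)))) , q≡q′
  where
  lem : ∀ r r′ q q′ p → r ℤ.+ q ℤ.* p ≡ r′ ℤ.+ q′ ℤ.* p → (q ℤ.- q′) ℤ.* p ≡ r′ ℤ.- r
  lem r r′ q q′ p eq = trans (l₁ r q q′ p) (trans (cong (λ x → x ℤ.- r ℤ.- q′ ℤ.* p) eq) (l₂ r r′ q′ p))
    where
    l₁ : ∀ r q q′ p → (q ℤ.- q′) ℤ.* p ≡ (r ℤ.+ q ℤ.* p) ℤ.- r ℤ.- q′ ℤ.* p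
    l₁ = ℤ-Solver.solve-∀
    l₂ : ∀ r r′ q′ p → (r′ ℤ.+ q′ ℤ.* p) ℤ.- r ℤ.- q′ ℤ.* p ≡ r′ ℤ.- r
    l₂ = ℤ-Solver.solve-∀

  abs : ℤ.∣ q ℤ.- q′ ∣ * p < 1 * p
  abs = begin-strict
    ℤ.∣ q ℤ.- q′ ∣ * p             ≡⟨ ℤₚ.abs-* (q ℤ.- q′) (+ p) ⟨
    ℤ.∣ (q ℤ.- q′) ℤ.* + p ∣       ≡⟨ cong ℤ.∣_∣ (lem (+ r) (+ r′) q q′ (+ p) eq) ⟩
    ℤ.∣ + r′ ℤ.- + r ∣             <⟨ ∣i-j∣<p r′ r r′<p r<p ⟩
    p                              ≡⟨ ℕₚ.*-identityˡ p ⟨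
    1 * p                          ∎
    where open ℕₚ.≤-Reasoning

  q≡q′ : q ≡ q′
  q≡q′ = ℤₚ.i-j≡0⇒i≡j q q′ (ℤₚ.∣i∣≡0⇒i≡0 (ℕₚ.n<1⇒n≡0 (ℕₚ.*-cancelʳ-< p _ 1 abs)))

module _ (p : ℕ) .{{_ : NonZero p}} where
  %ℕ-unique : ∀ i r q → r < p → i ≡ + r ℤ.+ q ℤ.* + p → i %ℕ p ≡ r × i /ℕ p ≡ q
  %ℕ-unique i r q r<p eq = division-unique _ _ r q (n%ℕd<d i p) r<p (trans (sym (a≡a%ℕn+[a/ℕn]*n i p)) eq)

  cong-%ℕ : ∀ i → Cong p i (+ (i %ℕ p))
  cong-%ℕ i = mkC (i /ℕ p) $ a≡a%ℕn+[a/ℕn]*n i p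

  %ℕ-cong : ∀ {i j} → Cong p i j → i %ℕ p ≡ j %ℕ p
  %ℕ-cong {i} {j} ij with cong-trans ij (cong-%ℕ j)
  ... | mkC k eq = proj₁ (%ℕ-unique i _ k (n%ℕd<d j p) eq)

  %ℕ-small : ∀ r → r < p → (+ r) %ℕ p ≡ r
  %ℕ-small r r<p = proj₁ (%ℕ-unique (+ r) r 0ℤ r<p (sym (ℤₚ.+-identityʳ (+ r))))

  %ℕ-cong⁻¹ : ∀ {i j} → i %ℕ p ≡ j %ℕ p → Cong p i j
  %ℕ-cong⁻¹ {i} {j} eq = cong-trans (cong-%ℕ i) (cong-trans (cong-≡ (cong +_ eq)) (cong-sym (cong-%ℕ j)))

  *p%ℕp : ∀ q → (q ℤ.* + p) %ℕ p ≡ 0 × (q ℤ.* + p) /ℕ p ≡ q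
  *p%ℕp q = %ℕ-unique (q ℤ.* + p) 0 q (ℕₚ.n≢0⇒n>0 (≢-nonZero⁻¹ p)) (sym (ℤₚ.+-identityˡ _))

  %ℕ≡0⇒ : ∀ i → i %ℕ p ≡ 0 → i ≡ (i /ℕ p) ℤ.* + p
  %ℕ≡0⇒ i eq = trans (a≡a%ℕn+[a/ℕn]*n i p) (trans (cong (λ r → + r ℤ.+ (i /ℕ p) ℤ.* + p) eq) (ℤₚ.+-identityˡ _))

  cong⇒≡ : ∀ {r r′} → r < p → r′ < p → Cong p (+ r) (+ r′) → r ≡ r′
  cong⇒≡ {r} {r′} r<p r′<p c = trans (sym (%ℕ-small r r<p)) (trans (%ℕ-cong c) (%ℕ-small r′ r′<p))

-- Primes and units modulo D

prime>1 : ∀ {p} → Prime p → 1 < p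
prime>1 pr = nonTrivial⇒n>1 _ {{prime⇒nonTrivial pr}}

prime>0 : ∀ {p} → Prime p → 0 < p
prime>0 pr = ℕₚ.<-trans (s≤s z≤n) (prime>1 pr)

prime∣prime : ∀ {p q} → Prime p → Prime q → p ∣ q → p ≡ q
prime∣prime pp pq p∣q with prime⇒irreducible pq p∣q
... | inj₁ refl = contradiction (prime>1 pp) (ℕₚ.<-irrefl refl)
... | inj₂ p≡q = p≡q

prime∤⇒coprime : ∀ {p a} → Prime p → ¬ p ∣ a → Coprime p a
prime∤⇒coprime pr p∤a {d} (d∣p , d∣a) with prime⇒irreducible pr d∣p
... | inj₁ d≡1  = d≡1
... | inj₂ refl = contradiction d∣a p∤a

record Unit (D : ℕ) (s : ℤ) : Set where
  constructor mkU
  field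
    inverse : ℤ
    unit    : Cong D (s ℤ.* inverse) 1ℤ

coprime⇒unit : ∀ {D s} → Coprime s D → Unit D (+ s)
coprime⇒unit {D} {s} c with Coprimality.coprime-Bézout c
... | Bézout.+- x y eq = mkU (+ x) (mkC (+ y) (begin
  + s ℤ.* + x                 ≡⟨ ℤₚ.*-comm (+ s) (+ x) ⟩
  + x ℤ.* + s                 ≡⟨ ℤₚ.pos-* x s ⟨
  + (x * s)                   ≡⟨ cong +_ eq ⟨
  1ℤ ℤ.+ + (y * D)            ≡⟨ cong (λ z → 1ℤ ℤ.+ z) (ℤₚ.pos-* y D) ⟩
  1ℤ ℤ.+ + y ℤ.* + D          ∎))
  where open ≡-Reasoning
... | Bézout.-+ x y eq = mkU (ℤ.- + x) (mkC (ℤ.- + y) (begin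
  + s ℤ.* (ℤ.- + x)                       ≡⟨ l₁ (+ s) (+ x) ⟩
  1ℤ ℤ.- (1ℤ ℤ.+ + x ℤ.* + s)             ≡⟨ cong (λ z → 1ℤ ℤ.- (1ℤ ℤ.+ z)) (ℤₚ.pos-* x s) ⟨
  1ℤ ℤ.- + (1 + x * s)                    ≡⟨ cong (λ z → 1ℤ ℤ.- + z) eq ⟩
  1ℤ ℤ.- + (y * D)                        ≡⟨ cong (λ z → 1ℤ ℤ.- z) (ℤₚ.pos-* y D) ⟩
  1ℤ ℤ.- + y ℤ.* + D                      ≡⟨ l₂ (+ y) (+ D) ⟩
  1ℤ ℤ.+ (ℤ.- + y) ℤ.* + D                ∎))
  where
  open ≡-Reasoning
  l₁ : ∀ s x → s ℤ.* (ℤ.- x) ≡ 1ℤ ℤ.- (1ℤ ℤ.+ x ℤ.* s)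
  l₁ = ℤ-Solver.solve-∀
  l₂ : ∀ y d → 1ℤ ℤ.- y ℤ.* d ≡ 1ℤ ℤ.+ (ℤ.- y) ℤ.* d
  l₂ = ℤ-Solver.solve-∀

unit-∣ : ∀ {D E s} → E ∣ D → Unit D s → Unit E s
unit-∣ E∣D (mkU s′ c) = mkU s′ (cong-∣ E∣D c)

unit-cancel : ∀ {D s i j} → Unit D s → Cong D (s ℤ.* i) (s ℤ.* j) → Cong D i j
unit-cancel {D} {s} {i} {j} (mkU s′ u) c = cong-trans (cong-sym (lem i)) (cong-trans (cong-*ˡ s′ c) (lem j))
  where
  l₁ : ∀ s s′ i → s′ ℤ.* (s ℤ.* i) ≡ (s ℤ.* s′) ℤ.* i
  l₁ = ℤ-Solver.solve-∀
  lem : ∀ i → Cong D (s′ ℤ.* (s ℤ.* i)) i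
  lem i = cong-trans (cong-≡ (l₁ s s′ i)) (cong-trans (cong-* u (cong-refl {i = i})) (cong-≡ (ℤₚ.*-identityˡ i)))

when : {P : Set} → Dec P → ℤ → ℤ
when (yes _) z = z
when (no _)  z = 0ℤ

when-yes : ∀ {P : Set} (d : Dec P) {z} → P → when d z ≡ z
when-yes (yes _) _ = refl
when-yes (no ¬p) p = contradiction p ¬p

when-no : ∀ {P : Set} (d : Dec P) {z} → ¬ P → when d z ≡ 0ℤ
when-no (yes p) ¬p = contradiction p ¬p
when-no (no _)  _  = refl

opaque
  sel : (p : ℕ) .{{_ : NonZero p}} → ℕ → ℤ → ℤ → ℤ
  sel p k i z = when (i %ℕ p ≟ k) z

  sel-yes : ∀ p .{{_ : NonZero p}} {k i z} → i %ℕ p ≡ k → sel p k i z ≡ z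
  sel-yes p {k} {i} e = when-yes (i %ℕ p ≟ k) e

  sel-no : ∀ p .{{_ : NonZero p}} {k i z} → i %ℕ p ≢ k → sel p k i z ≡ 0ℤ
  sel-no p {k} {i} e = when-no (i %ℕ p ≟ k) e

sel-⇔ : ∀ p .{{_ : NonZero p}} {k l i j z w} → (i %ℕ p ≡ k → j %ℕ p ≡ l) → (j %ℕ p ≡ l → i %ℕ p ≡ k) →
        (i %ℕ p ≡ k → z ≡ w) → sel p k i z ≡ sel p l j w
sel-⇔ p {k} {l} {i} {j} to from eq with i %ℕ p ≟ k
... | yes e = trans (sel-yes p e) (trans (eq e) (sym (sel-yes p (to e))))
... | no ne = trans (sel-no p ne) (sym (sel-no p (ne ∘ from)))

-- A Tower D builds the D-th cyclotomic ring one prime at a time; tr is the trace of a root of unity xʲ,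
-- divided by D / rad D.
data Tower : ℕ → Set where
  one   : Tower 1
  ram   : ∀ {D} p .{{_ : NonZero p}} → Prime p → p ∣ D → Tower D → Tower (p * D)
  unram : ∀ {D} p .{{_ : NonZero p}} → Prime p → ¬ p ∣ D → Tower D → Tower (p * D)

-- The Ramanujan sum of a prime: p - 1 if p divides j and -1 otherwise, the trace of the j-th power
-- of a primitive p-th root of unity.
c : (p : ℕ) .{{_ : NonZero p}} → ℤ → ℤ
c p j = + p ℤ.* sel p 0 j 1ℤ ℤ.- 1ℤ

tr : ∀ {D} → Tower D → ℤ → ℤ
tr one             j = 1ℤ
-- From level pD to level D the trace of x^j is 0 unless p divides j, and then it is p times x^j;
-- this factor p is the one divided out.
tr (ram p _ _ T)   j = sel p 0 j (tr T (j /ℕ p))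
-- Writing x as a p-th root of unity times a D-th one makes the trace a product. The units that
-- multiply j in the two factors are dropped, as neither factor changes under units.
tr (unram p _ _ T) j = c p j ℤ.* tr T j

c-cong : ∀ p .{{_ : NonZero p}} i j → (i %ℕ p ≡ 0 → j %ℕ p ≡ 0) → (j %ℕ p ≡ 0 → i %ℕ p ≡ 0) → c p i ≡ c p j
c-cong p i j to from = cong (λ z → + p ℤ.* z ℤ.- 1ℤ) (sel-⇔ p to from (λ _ → refl))

module _ {D p : ℕ} .{{_ : NonZero p}} {pr : Prime p} {p∣D : p ∣ D} (T : Tower D) where
  tr-ram-* : ∀ q → tr (ram p pr p∣D T) (q ℤ.* + p) ≡ tr T q
  tr-ram-* q = trans (sel-yes p (proj₁ (*p%ℕp p q))) (cong (tr T) (proj₂ (*p%ℕp p q)))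

  tr-ram-≢0 : ∀ j → ¬ j %ℕ p ≡ 0 → tr (ram p pr p∣D T) j ≡ 0ℤ
  tr-ram-≢0 j ne = sel-no p ne

tr-cong : ∀ {D} (T : Tower D) {i j} → Cong D i j → tr T i ≡ tr T j
tr-cong one cg = refl
tr-cong {D′} (ram {D} p pr p∣D T) {i} {j} cg@(mkC k eq) = sel-⇔ p (trans (sym (%ℕ-cong p cgp))) (trans (%ℕ-cong p cgp)) λ i%p≡0 →
  tr-cong T (div i%p≡0)
  where
  cgp = cong-∣ (m∣m*n D) cg
  div : i %ℕ p ≡ 0 → Cong D (i /ℕ p) (j /ℕ p)
  div i%p≡0 = mkC k (ℤₚ.*-cancelʳ-≡ _ _ (+ p) (begin
    (i /ℕ p) ℤ.* + p                               ≡⟨ %ℕ≡0⇒ p i i%p≡0 ⟨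
    i                                                  ≡⟨ eq ⟩
    j ℤ.+ k ℤ.* + (p * D)                              ≡⟨ cong₂ (λ x y → x ℤ.+ k ℤ.* y) (%ℕ≡0⇒ p j (trans (sym (%ℕ-cong p cgp)) i%p≡0)) (ℤₚ.pos-* p D) ⟩
    (j /ℕ p) ℤ.* + p ℤ.+ k ℤ.* (+ p ℤ.* + D)       ≡⟨ lem (j /ℕ p) k (+ p) (+ D) ⟩
    ((j /ℕ p) ℤ.+ k ℤ.* + D) ℤ.* + p               ∎))
    where
    open ≡-Reasoning
    lem : ∀ x k p d → x ℤ.* p ℤ.+ k ℤ.* (p ℤ.* d) ≡ (x ℤ.+ k ℤ.* d) ℤ.* p
    lem = ℤ-Solver.solve-∀
    instance _ = ℤ.≢-nonZero {+ p} (≢-nonZero⁻¹ p ∘ ℤₚ.+-injective)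
tr-cong (unram {D} p pr p∤D T) {i} {j} cg = cong₂ ℤ._*_
  (c-cong p i j (trans (sym (%ℕ-cong p cgp))) (trans (%ℕ-cong p cgp)))
  (tr-cong T (cong-∣ (n∣m*n p) cg))
  where cgp = cong-∣ (m∣m*n D) cg

%ℕ-unit : ∀ p .{{_ : NonZero p}} {s i} → Unit p s → (i %ℕ p ≡ 0 → (s ℤ.* i) %ℕ p ≡ 0) × ((s ℤ.* i) %ℕ p ≡ 0 → i %ℕ p ≡ 0)
%ℕ-unit p {s} {i} u =
  (λ e → trans (%ℕ-cong p (cong-*ˡ s (%ℕ-cong⁻¹ p {i} {0ℤ} (trans e (sym 0%p))))) (trans (cong (_%ℕ p) (ℤₚ.*-zeroʳ s)) 0%p)) ,
  (λ e → trans (%ℕ-cong p (unit-cancel u (%ℕ-cong⁻¹ p {s ℤ.* i} {s ℤ.* 0ℤ} (trans e (sym (trans (cong (_%ℕ p) (ℤₚ.*-zeroʳ s)) 0%p)))))) 0%p)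
  where
  0%p : 0ℤ %ℕ p ≡ 0
  0%p = %ℕ-small p 0 (ℕₚ.n≢0⇒n>0 (≢-nonZero⁻¹ p))

-- Galois invariance. It makes `σ s` well defined on the quotient and, at -1, the trace form
-- symmetric.
tr-unit : ∀ {D} (T : Tower D) {s} → Unit D s → ∀ i → tr T (s ℤ.* i) ≡ tr T i
tr-unit one u i = refl
tr-unit (ram {D} p pr p∣D T) {s} u i = by-cases (i %ℕ p ≟ 0)
  where
  up = %ℕ-unit p {s} {i} (unit-∣ (m∣m*n D) u)
  by-cases : Dec (i %ℕ p ≡ 0) → tr (ram p pr p∣D T) (s ℤ.* i) ≡ tr (ram p pr p∣D T) i
  by-cases (no ne) = trans (tr-ram-≢0 {pr = pr} {p∣D} T (s ℤ.* i) (ne ∘ proj₂ up)) (sym (tr-ram-≢0 {pr = pr} {p∣D} T i ne))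
  by-cases (yes e) = begin
    tr T′ (s ℤ.* i)                          ≡⟨ cong (λ z → tr T′ (s ℤ.* z)) (%ℕ≡0⇒ p i e) ⟩
    tr T′ (s ℤ.* ((i /ℕ p) ℤ.* + p))     ≡⟨ cong (tr T′) (ℤₚ.*-assoc s (i /ℕ p) (+ p)) ⟨
    tr T′ (s ℤ.* (i /ℕ p) ℤ.* + p)       ≡⟨ tr-ram-* {pr = pr} {p∣D} T (s ℤ.* (i /ℕ p)) ⟩
    tr T (s ℤ.* (i /ℕ p))                ≡⟨ tr-unit T (unit-∣ (n∣m*n p) u) _ ⟩
    tr T (i /ℕ p)                        ≡⟨ sel-yes p e ⟨
    tr T′ i                                  ∎
    where
    open ≡-Reasoning
    T′ = ram p pr p∣D T
tr-unit (unram {D} p pr p∤D T) {s} u i = cong₂ ℤ._*_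
  (c-cong p (s ℤ.* i) i (proj₂ up) (proj₁ up))
  (tr-unit T (unit-∣ (n∣m*n p) u) i)
  where up = %ℕ-unit p {s} {i} (unit-∣ (m∣m*n D) u)

ℤR : CommutativeRing 0ℓ 0ℓ
ℤR = ℤₚ.+-*-commutativeRing

module ℤ∑ = Sums ℤR
open ℤ∑ using (∑) public

nat≡+ : ∀ n → CRing.nat ℤR n ≡ + n
nat≡+ zero    = refl
nat≡+ (suc n) = cong (λ z → 1ℤ ℤ.+ z) (nat≡+ n)

∑-sel-unit : ∀ p .{{_ : NonZero p}} j e → Unit p e → ∑ p (λ i → sel p 0 (j ℤ.+ + i ℤ.* e) 1ℤ) ≡ 1ℤ
∑-sel-unit p j e u@(mkU e′ ee′) = trans (ℤ∑.∑-single p _ k k<p others) (sel-yes p at-k)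
  where
  -- The only index below p at which j + k e is divisible by p.
  k = ((ℤ.- j) ℤ.* e′) %ℕ p
  k<p = n%ℕd<d ((ℤ.- j) ℤ.* e′) p
  l₁ : ∀ j e′ e → ((ℤ.- j) ℤ.* e′) ℤ.* e ≡ (ℤ.- j) ℤ.* (e ℤ.* e′)
  l₁ = ℤ-Solver.solve-∀
  l₂ : ∀ j → j ℤ.+ (ℤ.- j) ℤ.* 1ℤ ≡ 0ℤ
  l₂ = ℤ-Solver.solve-∀
  root : Cong p (j ℤ.+ + k ℤ.* e) 0ℤ
  root = cong-trans (cong-+ (cong-refl {i = j}) (cong-trans (cong-* (cong-sym (cong-%ℕ p ((ℤ.- j) ℤ.* e′))) (cong-refl {i = e}))
    (cong-trans (cong-≡ (l₁ j e′ e)) (cong-*ˡ (ℤ.- j) ee′)))) (cong-≡ (l₂ j))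
  0%p : 0ℤ %ℕ p ≡ 0
  0%p = %ℕ-small p 0 (ℕₚ.n≢0⇒n>0 (≢-nonZero⁻¹ p))
  at-k : (j ℤ.+ + k ℤ.* e) %ℕ p ≡ 0
  at-k = trans (%ℕ-cong p root) 0%p
  l₃ : ∀ j x → (ℤ.- j) ℤ.+ (j ℤ.+ x) ≡ x
  l₃ = ℤ-Solver.solve-∀
  others : ∀ i → i < p → i ≢ k → sel p 0 (j ℤ.+ + i ℤ.* e) 1ℤ ≡ 0ℤ
  others i i<p i≢k = sel-no p λ at-i → i≢k (cong⇒≡ p i<p k<p (unit-cancel {s = e} u
    (cong-trans (cong-≡ (trans (ℤₚ.*-comm e (+ i)) (sym (l₃ j (+ i ℤ.* e)))))
    (cong-trans (cong-+ (cong-refl {i = ℤ.- j}) (%ℕ-cong⁻¹ p (trans at-i (sym at-k))))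
                (cong-≡ (trans (l₃ j (+ k ℤ.* e)) (ℤₚ.*-comm (+ k) e)))))))

∑-c : ∀ p .{{_ : NonZero p}} j e → Unit p e → ∑ p (λ i → c p (j ℤ.+ + i ℤ.* e)) ≡ 0ℤ
∑-c p j e u = begin
  ∑ p (λ i → + p ℤ.* w i ℤ.- 1ℤ)                   ≡⟨ ℤ∑.∑-⊕ p (λ i → + p ℤ.* w i) (λ _ → ℤ.- 1ℤ) ⟩
  ∑ p (λ i → + p ℤ.* w i) ℤ.+ ∑ p (λ _ → ℤ.- 1ℤ)   ≡⟨ cong₂ ℤ._+_ (ℤ∑.∑-⊙ˡ p (+ p) w) (ℤ∑.∑-const p (ℤ.- 1ℤ)) ⟩
  + p ℤ.* ∑ p w ℤ.+ CRing.nat ℤR p ℤ.* (ℤ.- 1ℤ)    ≡⟨ cong₂ (λ x y → + p ℤ.* x ℤ.+ y ℤ.* (ℤ.- 1ℤ)) (∑-sel-unit p j e u) (nat≡+ p) ⟩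
  + p ℤ.* 1ℤ ℤ.+ + p ℤ.* (ℤ.- 1ℤ)                  ≡⟨ lem (+ p) ⟩
  0ℤ                                               ∎
  where
  open ≡-Reasoning
  w : ℕ → ℤ
  w i = sel p 0 (j ℤ.+ + i ℤ.* e) 1ℤ
  lem : ∀ p → p ℤ.* 1ℤ ℤ.+ p ℤ.* (ℤ.- 1ℤ) ≡ 0ℤ
  lem = ℤ-Solver.solve-∀

-- This is the trace of x^j times the sum of all ℓ-th roots of unity. At a ramified p the exponents
-- j + iE agree modulo p, so either all terms vanish or all are divided by p, and ℓ still divides D.
-- At an unramified p one of the two factors is constant: `tr T` if ℓ = p, the factor `c` otherwise.
tr-vanish : ∀ {D} (T : Tower D) {ℓ E} → Prime ℓ → D ≡ ℓ * E → ∀ j → ∑ ℓ (λ i → tr T (j ℤ.+ + i ℤ.* + E)) ≡ 0ℤ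
tr-vanish one {ℓ} {E} prℓ eq j = contradiction (∣1⇒≡1 (divides E (trans eq (ℕₚ.*-comm ℓ E)))) (ℕₚ.<⇒≢ (prime>1 prℓ) ∘ sym)
tr-vanish (ram {D} p pr p∣D T) {ℓ} {E} prℓ eq j with ℓ∣D
  where
  ℓ∣D : ℓ ∣ D
  ℓ∣D with euclidsLemma p D prℓ (divides E (trans eq (ℕₚ.*-comm ℓ E)))
  ... | inj₂ x = x
  ... | inj₁ x with prime∣prime prℓ pr x
  ...   | refl = p∣D
... | divides E₀ D≡E₀ℓ = by-cases (j %ℕ p ≟ 0)
  where
  T′ = ram p pr p∣D T
  E≡ : E ≡ p * E₀
  E≡ = ℕₚ.*-cancelˡ-≡ E (p * E₀) ℓ {{prime⇒nonZero prℓ}} (trans (sym eq) (trans (cong (p *_) D≡E₀ℓ) (lem p E₀ ℓ)))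
    where
    lem : ∀ p e ℓ → p * (e * ℓ) ≡ ℓ * (p * e)
    lem = ℕ-Solver.solve-∀
  same : ∀ i → Cong p (j ℤ.+ + i ℤ.* + E) j
  same i = mkC (+ i ℤ.* + E₀) (cong (λ z → j ℤ.+ z) (trans (cong (+ i ℤ.*_) (trans (cong +_ (trans E≡ (ℕₚ.*-comm p E₀))) (ℤₚ.pos-* E₀ p))) (sym (ℤₚ.*-assoc (+ i) (+ E₀) (+ p)))))
  by-cases : Dec (j %ℕ p ≡ 0) → ∑ ℓ (λ i → tr T′ (j ℤ.+ + i ℤ.* + E)) ≡ 0ℤ
  by-cases (no ne) = ℤ∑.∑-zero ℓ (λ i _ → tr-ram-≢0 {pr = pr} {p∣D} T _ (ne ∘ trans (sym (%ℕ-cong p (same i)))))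
  by-cases (yes e) = trans (ℤ∑.∑-cong ℓ (λ i _ → trans (cong (tr T′) (rearrange i)) (tr-ram-* {pr = pr} {p∣D} T _))) (tr-vanish T prℓ (trans D≡E₀ℓ (ℕₚ.*-comm E₀ ℓ)) (j /ℕ p))
    where
    open ≡-Reasoning
    lem : ∀ q i e p → q ℤ.* p ℤ.+ i ℤ.* (p ℤ.* e) ≡ (q ℤ.+ i ℤ.* e) ℤ.* p
    lem = ℤ-Solver.solve-∀
    rearrange : ∀ i → j ℤ.+ + i ℤ.* + E ≡ ((j /ℕ p) ℤ.+ + i ℤ.* + E₀) ℤ.* + p
    rearrange i = begin
      j ℤ.+ + i ℤ.* + E                                   ≡⟨ cong₂ (λ x y → x ℤ.+ + i ℤ.* y) (%ℕ≡0⇒ p j e) (trans (cong +_ E≡) (ℤₚ.pos-* p E₀)) ⟩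
      (j /ℕ p) ℤ.* + p ℤ.+ + i ℤ.* (+ p ℤ.* + E₀)     ≡⟨ lem (j /ℕ p) (+ i) (+ E₀) (+ p) ⟩
      ((j /ℕ p) ℤ.+ + i ℤ.* + E₀) ℤ.* + p             ∎
tr-vanish (unram {D} p pr p∤D T) {ℓ} {E} prℓ eq j with ℓ ≟ p
... | yes refl = begin
  ∑ p (λ i → c p (j ℤ.+ + i ℤ.* + E) ℤ.* tr T (j ℤ.+ + i ℤ.* + E))   ≡⟨ ℤ∑.∑-cong p (λ i _ → trans (cong (c p (j ℤ.+ + i ℤ.* + E) ℤ.*_) (same i)) (ℤₚ.*-comm _ (tr T j))) ⟩
  ∑ p (λ i → tr T j ℤ.* c p (j ℤ.+ + i ℤ.* + E))                      ≡⟨ ℤ∑.∑-⊙ˡ p (tr T j) (λ i → c p (j ℤ.+ + i ℤ.* + E)) ⟩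
  tr T j ℤ.* ∑ p (λ i → c p (j ℤ.+ + i ℤ.* + E))                      ≡⟨ cong (tr T j ℤ.*_) (∑-c p j (+ E) (coprime⇒unit (Coprimality.sym (prime∤⇒coprime pr (subst (λ x → ¬ p ∣ x) D≡E p∤D))))) ⟩
  tr T j ℤ.* 0ℤ                                                       ≡⟨ ℤₚ.*-zeroʳ (tr T j) ⟩
  0ℤ                                                                  ∎
  where
  open ≡-Reasoning
  D≡E : D ≡ E
  D≡E = ℕₚ.*-cancelˡ-≡ D E p eq
  same : ∀ i → tr T (j ℤ.+ + i ℤ.* + E) ≡ tr T j
  same i = tr-cong T (mkC (+ i) (cong (λ z → j ℤ.+ + i ℤ.* + z) (sym D≡E)))
... | no ℓ≢p with euclidsLemma p D prℓ (divides E (trans eq (ℕₚ.*-comm ℓ E)))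
...   | inj₁ x = contradiction (prime∣prime prℓ pr x) ℓ≢p
...   | inj₂ (divides E₀ D≡E₀ℓ) = begin
  ∑ ℓ (λ i → c p (j ℤ.+ + i ℤ.* + E) ℤ.* tr T (j ℤ.+ + i ℤ.* + E))   ≡⟨ ℤ∑.∑-cong ℓ (λ i _ → cong (ℤ._* tr T (j ℤ.+ + i ℤ.* + E)) (c-cong p (j ℤ.+ + i ℤ.* + E) j (trans (sym (%ℕ-cong p (same i)))) (trans (%ℕ-cong p (same i))))) ⟩
  ∑ ℓ (λ i → c p j ℤ.* tr T (j ℤ.+ + i ℤ.* + E))                      ≡⟨ ℤ∑.∑-⊙ˡ ℓ (c p j) (λ i → tr T (j ℤ.+ + i ℤ.* + E)) ⟩
  c p j ℤ.* ∑ ℓ (λ i → tr T (j ℤ.+ + i ℤ.* + E))                      ≡⟨ cong (c p j ℤ.*_) (ℤ∑.∑-cong ℓ (λ i _ → cong (λ z → tr T (j ℤ.+ z)) (regroup i))) ⟩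
  c p j ℤ.* ∑ ℓ (λ i → tr T (j ℤ.+ + i ℤ.* + p ℤ.* + E₀))             ≡⟨ cong (c p j ℤ.*_) vanish ⟩
  c p j ℤ.* 0ℤ                                                        ≡⟨ ℤₚ.*-zeroʳ (c p j) ⟩
  0ℤ                                                                  ∎
  where
  open ≡-Reasoning
  E≡ : E ≡ p * E₀
  E≡ = ℕₚ.*-cancelˡ-≡ E (p * E₀) ℓ {{prime⇒nonZero prℓ}} (trans (sym eq) (trans (cong (p *_) D≡E₀ℓ) (lem p E₀ ℓ)))
    where
    lem : ∀ p e ℓ → p * (e * ℓ) ≡ ℓ * (p * e)
    lem = ℕ-Solver.solve-∀
  regroup : ∀ i → + i ℤ.* + E ≡ + i ℤ.* + p ℤ.* + E₀
  regroup i = trans (cong (+ i ℤ.*_) (trans (cong +_ E≡) (ℤₚ.pos-* p E₀))) (sym (ℤₚ.*-assoc (+ i) (+ p) (+ E₀)))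
  same : ∀ i → Cong p (j ℤ.+ + i ℤ.* + E) j
  same i = mkC (+ i ℤ.* + E₀) (cong (λ z → j ℤ.+ z) (trans (regroup i) (lem (+ i) (+ p) (+ E₀))))
    where
    lem : ∀ i p e → i ℤ.* p ℤ.* e ≡ i ℤ.* e ℤ.* p
    lem = ℤ-Solver.solve-∀
  -- In `T` the increment is p E₀ instead of E₀. As p is a unit modulo D, j is p (p′ j), and Galois
  -- invariance removes the common factor p.
  vanish : ∑ ℓ (λ i → tr T (j ℤ.+ + i ℤ.* + p ℤ.* + E₀)) ≡ 0ℤ
  vanish with coprime⇒unit {D} {p} (prime∤⇒coprime pr p∤D)
  ... | u@(mkU p′ pp′) = trans
    (ℤ∑.∑-cong ℓ (λ i _ → trans
      (tr-cong T (cong-trans (cong-+ (cong-trans (cong-≡ (sym (ℤₚ.*-identityˡ j))) (cong-* (cong-sym pp′) (cong-refl {i = j}))) (cong-refl {i = + i ℤ.* + p ℤ.* + E₀})) (cong-≡ (lem (+ p) p′ j (+ i) (+ E₀)))))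
      (tr-unit T u (p′ ℤ.* j ℤ.+ + i ℤ.* + E₀))))
    (tr-vanish T prℓ (trans D≡E₀ℓ (ℕₚ.*-comm E₀ ℓ)) (p′ ℤ.* j))
    where
    lem : ∀ p p′ j i e → (p ℤ.* p′) ℤ.* j ℤ.+ i ℤ.* p ℤ.* e ≡ p ℤ.* (p′ ℤ.* j ℤ.+ i ℤ.* e)
    lem = ℤ-Solver.solve-∀

c-0 : ∀ p .{{_ : NonZero p}} {j} → j %ℕ p ≡ 0 → c p j ≡ + p ℤ.- 1ℤ
c-0 p e = cong (ℤ._- 1ℤ) (trans (cong (+ p ℤ.*_) (sel-yes p e)) (ℤₚ.*-identityʳ (+ p)))

c-≢0 : ∀ p .{{_ : NonZero p}} {j} → j %ℕ p ≢ 0 → c p j ≡ ℤ.- 1ℤ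
c-≢0 p e = cong (ℤ._- 1ℤ) (trans (cong (+ p ℤ.*_) (sel-no p e)) (ℤₚ.*-zeroʳ (+ p)))

0%ℕ : ∀ p .{{_ : NonZero p}} → 0ℤ %ℕ p ≡ 0
0%ℕ p = %ℕ-small p 0 (ℕₚ.n≢0⇒n>0 (≢-nonZero⁻¹ p))

-- The normalised trace of 1, that is Euler's function at the radical of D.
t₀ : ∀ {D} → Tower D → ℕ
t₀ one             = 1
t₀ (ram p _ _ T)   = t₀ T
t₀ (unram p _ _ T) = (p ∸ 1) * t₀ T

t₀>0 : ∀ {D} (T : Tower D) → 0 < t₀ T
t₀>0 one              = s≤s z≤n
t₀>0 (ram p _ _ T)    = t₀>0 T
t₀>0 (unram p pr _ T) = ℕₚ.*-mono-≤ (ℕₚ.m<n⇒0<n∸m (prime>1 pr)) (t₀>0 T)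

+p-1 : ∀ p .{{_ : NonZero p}} → + p ℤ.- 1ℤ ≡ + (p ∸ 1)
+p-1 (suc p) = ℤₚ.⊖-≥ {suc p} {1} (s≤s z≤n)

tr-0 : ∀ {D} (T : Tower D) → tr T 0ℤ ≡ + t₀ T
tr-0 one              = refl
tr-0 (ram p pr d T)   = trans (tr-ram-* {pr = pr} {d} T 0ℤ) (tr-0 T)
tr-0 (unram p pr _ T) = trans (cong₂ ℤ._*_ (trans (c-0 p (0%ℕ p)) (+p-1 p)) (tr-0 T)) (sym (ℤₚ.pos-* (p ∸ 1) (t₀ T)))

∣c∣≤ : ∀ p .{{_ : NonZero p}} → Prime p → ∀ j → ℤ.∣ c p j ∣ ≤ p ∸ 1
∣c∣≤ p pr j with j %ℕ p ≟ 0
... | yes e = ℕₚ.≤-reflexive (cong ℤ.∣_∣ (trans (c-0 p e) (+p-1 p)))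
... | no ne = subst (λ z → ℤ.∣ z ∣ ≤ p ∸ 1) (sym (c-≢0 p ne)) (ℕₚ.m<n⇒0<n∸m (prime>1 pr))

∣tr∣≤ : ∀ {D} (T : Tower D) j → ℤ.∣ tr T j ∣ ≤ t₀ T
∣tr∣≤ one j = s≤s z≤n
∣tr∣≤ (ram p pr d T) j with j %ℕ p ≟ 0
... | yes e = subst (λ z → ℤ.∣ z ∣ ≤ t₀ T) (sym (sel-yes p e)) (∣tr∣≤ T _)
... | no ne = subst (λ z → ℤ.∣ z ∣ ≤ t₀ T) (sym (sel-no p ne)) z≤n
∣tr∣≤ (unram p pr _ T) j = subst (_≤ (p ∸ 1) * t₀ T) (sym (ℤₚ.abs-* (c p j) (tr T j))) (ℕₚ.*-mono-≤ (∣c∣≤ p pr j) (∣tr∣≤ T j))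

i≤∣i∣ : ∀ i → i ℤ.≤ + ℤ.∣ i ∣
i≤∣i∣ (+ n)    = ℤₚ.≤-refl
i≤∣i∣ -[1+ n ] = ℤ.-≤+

tr≤ : ∀ {D} (T : Tower D) j → tr T j ℤ.≤ + t₀ T
tr≤ T j = ℤₚ.≤-trans (i≤∣i∣ (tr T j)) (ℤ.+≤+ (∣tr∣≤ T j))

tower-nonZero : ∀ {D} → Tower D → NonZero D
tower-nonZero one             = _
tower-nonZero (ram p _ _ T)   = ℕₚ.m*n≢0 p _ {{it}} {{tower-nonZero T}}
tower-nonZero (unram p _ _ T) = ℕₚ.m*n≢0 p _ {{it}} {{tower-nonZero T}}

extend : ∀ {D} p → Prime p → Tower D → Tower (p * D)
extend {D} p pr T with p ∣? D
... | yes p∣D = ram p {{prime⇒nonZero pr}} pr p∣D T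
... | no p∤D  = unram p {{prime⇒nonZero pr}} pr p∤D T

tower : ∀ D → .{{NonZero D}} → Tower D
tower D = subst Tower (sym (PrimeFactorisation.isFactorisation (factorise D))) (go (PrimeFactorisation.factors (factorise D)) (PrimeFactorisation.factorsPrime (factorise D)))
  where
  go : ∀ ps → All Prime ps → Tower (product ps)
  go []       []          = one
  go (p ∷ ps) (pr ∷ prs) = extend p pr (go ps prs)

primeDivisor : ∀ k → 1 < k → ∃ λ ℓ → Prime ℓ × ℓ ∣ k
primeDivisor k@(suc _) 1<k with factorise k
... | record { factors = [] ; isFactorisation = e } = contradiction (sym e) (ℕₚ.<⇒≢ 1<k)
... | record { factors = ℓ ∷ ps ; isFactorisation = e ; factorsPrime = pr ∷ _ } = ℓ , pr , divides (product ps) (trans e (ℕₚ.*-comm ℓ _))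

-1-unit : ∀ {D} → Unit D ℤ.-1ℤ
-1-unit = mkU ℤ.-1ℤ cong-refl

-- The cyclotomic ring of level D

module Cyc {D : ℕ} (T : Tower D) where
  open Quot ℤR (tr T)
  open CRing A
  open Sums A renaming (∑ to ∑ᴬ; ∑-cong to ∑ᴬ-cong)
  open Lin ℤR using (lin; lin-σ; lin-cong; lin-⊠)

  X^-mod : ∀ {i j} → Cong D i j → X^ i ∼ X^ j
  X^-mod cg .eq u = tr-cong T (cong-+ (cong-refl {i = u}) cg)

  -- By Galois invariance the test of a(x^s) against x^j is the test of a against x^(s′j), where s′
  -- is the inverse of s.
  σ-cong : ∀ {s a b} → Unit D s → a ∼ b → σ s a ∼ σ s b
  σ-cong {s} {a} {b} u@(mkU s′ ss′) p .eq j = trans (expand a) (trans (eq p (s′ ℤ.* j)) (sym (expand b)))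
    where
    l₁ : ∀ s s′ j i → (s ℤ.* s′) ℤ.* j ℤ.+ s ℤ.* i ≡ s ℤ.* (s′ ℤ.* j ℤ.+ i)
    l₁ = ℤ-Solver.solve-∀
    expand : ∀ a → lin (at j) (σ s a) ≡ lin (at (s′ ℤ.* j)) a
    expand a = trans (lin-σ (at j) s a) (lin-cong a (λ i → trans
      (tr-cong T (cong-trans (cong-+ (cong-trans (cong-≡ (sym (ℤₚ.*-identityˡ j))) (cong-* (cong-sym ss′) (cong-refl {i = j}))) (cong-refl {i = s ℤ.* i}))
                             (cong-≡ (l₁ s s′ j i))))
      (tr-unit T u (s′ ℤ.* j ℤ.+ i))))

  σ-mod : ∀ {r s} → Cong D r s → ∀ a → σ r a ∼ σ s a
  σ-mod {r} {s} cg a .eq j = trans (lin-σ (at j) r a) (trans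
    (lin-cong a (λ i → tr-cong T (cong-+ (cong-refl {i = j}) (cong-* cg (cong-refl {i = i})))))
    (sym (lin-σ (at j) s a)))

  σ-id : ∀ a → σ 1ℤ a ∼ a
  σ-id a .eq j = trans (lin-σ (at j) 1ℤ a) (lin-cong a (λ i → cong (at j) (ℤₚ.*-identityˡ i)))

  conj-cong : ∀ {a b} → a ∼ b → conj a ∼ conj b
  conj-cong = σ-cong -1-unit

  conj-conj : ∀ a → conj (conj a) ∼ a
  conj-conj a = ∼-trans (σ-σ ℤ.-1ℤ ℤ.-1ℤ a) (σ-id a)

  conj-σ : ∀ s a → conj (σ s a) ∼ σ s (conj a)
  conj-σ s a = ∼-trans (σ-σ ℤ.-1ℤ s a) (∼-trans (∼-reflexive (cong (λ s → σ s a) (ℤₚ.*-comm ℤ.-1ℤ s))) (∼-sym (σ-σ s ℤ.-1ℤ a)))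

  -- The traces that define equality are integers, where n cancels.
  torsion-free : ∀ n {a b} → 0 < n → nat n ⊠ a ∼ nat n ⊠ b → a ∼ b
  torsion-free n@(suc _) {a} {b} _ p .eq j = ℤₚ.*-cancelˡ-≡ (+ n) _ _ (trans (expand a) (trans (eq p j) (sym (expand b))))
    where
    expand : ∀ a → + n ℤ.* lin (at j) a ≡ lin (at j) (nat n ⊠ a)
    expand a = sym (trans (lin-nat⊠ j n a) (cong (ℤ._* lin (at j) a) (nat≡+ n)))

  nat∼𝟘⇒ : ∀ n → nat n ∼ 𝟘 → n ≡ 0
  nat∼𝟘⇒ n p with ℤₚ.i*j≡0⇒i≡0∨j≡0 (+ n) {+ t₀ T} (trans (sym lhs) (eq p 0ℤ))
    where
    lhs : lin (at 0ℤ) (nat n) ≡ + n ℤ.* + t₀ T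
    lhs = trans (lin-nat (at 0ℤ) n) (cong₂ ℤ._*_ (nat≡+ n) (tr-0 T))
  ... | inj₁ e = ℤₚ.+-injective e
  ... | inj₂ e = contradiction (ℤₚ.+-injective e) (ℕₚ.<⇒≢ (t₀>0 T) ∘ sym)

  X^⊠ : ∀ i j → X^ i ⊠ X^ j ∼ X^ (i ℤ.+ j)
  X^⊠ i j = ∼-reflexive (X^⊠X^ i j)

  conj-X^ : ∀ i → conj (X^ i) ≡ X^ (ℤ.- i)
  conj-X^ i = trans (σ-X^ ℤ.-1ℤ i) (cong X^_ (ℤₚ.-1*i≡-i i))

  X^-inverse : ∀ i → X^ (ℤ.- i) ⊠ X^ i ∼ X^ 0ℤ
  X^-inverse i = ∼-trans (X^⊠ (ℤ.- i) i) (X^-cong (ℤₚ.+-inverseˡ i))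

  X^-cancel : ∀ i {a b} → X^ i ⊠ a ∼ X^ i ⊠ b → a ∼ b
  X^-cancel i {a} {b} p = ∼-trans (∼-sym (expand a)) (∼-trans (⊠-congˡ {X^ (ℤ.- i)} p) (expand b))
    where
    expand : ∀ a → X^ (ℤ.- i) ⊠ (X^ i ⊠ a) ∼ a
    expand a = ∼-trans (∼-sym (⊠-assoc _ _ a)) (∼-trans (⊠-cong (X^-inverse i) (∼-refl {a})) (⊠-identityˡ a))

  vanish : ∀ {ℓ E} → Prime ℓ → D ≡ ℓ * E → ∑ᴬ ℓ (λ i → X^ (+ i ℤ.* + E)) ∼ 𝟘
  vanish {ℓ} {E} pr e .eq j = trans (lin-∑𝔸 (at j) ℓ _) (tr-vanish T pr e j)

  -- If x^(D/ℓ) = 1 then ℓ = Σ x^(iD/ℓ) = 0.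
  X^E≁1 : ∀ {ℓ E} → Prime ℓ → D ≡ ℓ * E → ¬ X^ (+ E) ∼ X^ 0ℤ
  X^E≁1 {ℓ} {E} pr e p = ℕₚ.<⇒≢ (prime>0 pr) (sym (nat∼𝟘⇒ ℓ (begin
    nat ℓ                                  ≈⟨ *-identityʳ (nat ℓ) ⟨
    nat ℓ ⊠ X^ 0ℤ                          ≈⟨ ∑-const ℓ (X^ 0ℤ) ⟨
    ∑ᴬ ℓ (λ _ → X^ 0ℤ)                     ≈⟨ ∑ᴬ-cong ℓ (λ i _ → power i) ⟨
    ∑ᴬ ℓ (λ i → X^ (+ i ℤ.* + E))          ≈⟨ vanish pr e ⟩
    𝟘                                      ∎)))
    where
    open SetoidReasoning setoid
    power : ∀ i → X^ (+ i ℤ.* + E) ∼ X^ 0ℤ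
    power i = ∼-trans (∼-sym (X^-↑ (+ E) i)) (∼-trans (↑-cong i p) (1↑ i))

  X^-* : ∀ k {i} → X^ i ∼ X^ 0ℤ → X^ (k ℤ.* i) ∼ X^ 0ℤ
  X^-* (+ n) {i} p = ∼-trans (∼-sym (X^-↑ i n)) (∼-trans (↑-cong n p) (1↑ n))
  X^-* -[1+ n ] {i} p = X^-cancel (+ suc n ℤ.* i) (begin
    X^ (+ suc n ℤ.* i) ⊠ X^ (-[1+ n ] ℤ.* i)    ≈⟨ X^⊠ _ _ ⟩
    X^ (+ suc n ℤ.* i ℤ.+ -[1+ n ] ℤ.* i)       ≈⟨ X^-cong (lem (+ suc n) i) ⟩
    X^ 0ℤ                                       ≈⟨ X^-* (+ suc n) p ⟨
    X^ (+ suc n ℤ.* i)                          ≈⟨ *-identityʳ _ ⟨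
    X^ (+ suc n ℤ.* i) ⊠ X^ 0ℤ                  ∎)
    where
    open SetoidReasoning setoid
    lem : ∀ k i → k ℤ.* i ℤ.+ (ℤ.- k) ℤ.* i ≡ 0ℤ
    lem = ℤ-Solver.solve-∀

  -- With g = gcd(a , D), Bézout gives x^g = 1. If D/g had a prime factor ℓ, then x^(D/ℓ) would be a
  -- power of x^g and hence 1, against `X^E≁1`.
  X^∼1⇒∣ : ∀ a → X^ (+ a) ∼ X^ 0ℤ → D ∣ a
  X^∼1⇒∣ a p with gcd[m,n]∣n a D
  ... | divides k D≡kg = by-cases k D≡kg
    where
    g = gcd a D
    instance _ = tower-nonZero T

    bez : X^ (+ g) ∼ X^ 0ℤ
    bez with Bézout.identity (gcd-GCD a D)
    ... | Bézout.+- x y e = begin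
      X^ (+ g)                       ≈⟨ X^-mod (mkC (+ y) (trans (cong +_ (sym e)) (cong (λ z → + g ℤ.+ z) (ℤₚ.pos-* y D)))) ⟨
      X^ (+ (x * a))                 ≈⟨ X^-cong (ℤₚ.pos-* x a) ⟩
      X^ (+ x ℤ.* + a)               ≈⟨ X^-* (+ x) p ⟩
      X^ 0ℤ                          ∎
      where open SetoidReasoning setoid
    ... | Bézout.-+ x y e = begin
      X^ (+ g)                       ≈⟨ X^-mod (mkC (+ y) (trans (l₁ (+ g) (+ x) (+ a)) (cong (λ u → ℤ.- (+ x ℤ.* + a) ℤ.+ u) eq′))) ⟩
      X^ (ℤ.- (+ x ℤ.* + a))         ≈⟨ X^-cong (ℤₚ.neg-distribˡ-* (+ x) (+ a)) ⟩
      X^ ((ℤ.- + x) ℤ.* + a)         ≈⟨ X^-* (ℤ.- + x) p ⟩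
      X^ 0ℤ                          ∎
      where
      open SetoidReasoning setoid
      l₁ : ∀ g x a → g ≡ ℤ.- (x ℤ.* a) ℤ.+ (g ℤ.+ x ℤ.* a)
      l₁ = ℤ-Solver.solve-∀
      eq′ : + g ℤ.+ + x ℤ.* + a ≡ + y ℤ.* + D
      eq′ = trans (cong (λ z → + g ℤ.+ z) (sym (ℤₚ.pos-* x a))) (trans (cong +_ e) (ℤₚ.pos-* y D))

    by-cases : ∀ k → D ≡ k * g → D ∣ a
    by-cases 0 e = contradiction e (≢-nonZero⁻¹ D)
    by-cases 1 e = subst (_∣ a) (trans (sym (ℕₚ.*-identityˡ g)) (sym e)) (gcd[m,n]∣m a D)
    by-cases k@(suc (suc _)) e with primeDivisor k (s≤s (s≤s z≤n))
    ... | ℓ , pr , divides k′ k≡k′ℓ = contradiction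
      (∼-trans (X^-cong (ℤₚ.pos-* k′ g)) (X^-* (+ k′) bez))
      (X^E≁1 pr (trans e (trans (cong (_* g) (trans k≡k′ℓ (ℕₚ.*-comm k′ ℓ))) (ℕₚ.*-assoc ℓ k′ g))))

  -1∼X^ : ∀ {E} → D ≡ 2 * E → ⊟ X^ 0ℤ ∼ X^ (+ E)
  -1∼X^ {E} e = begin
    ⊟ X^ 0ℤ                                       ≈⟨ solve 2 (λ a b → :- a := b :- (a :+ (b :+ con 0ℤ))) ∼-refl (X^ 0ℤ) (X^ (+ E)) ⟩
    X^ (+ E) ⊖ (X^ 0ℤ ⊞ (X^ (+ E) ⊞ 𝟘))           ≈⟨ +-congˡ {X^ (+ E)} (-‿cong (+-congˡ {X^ 0ℤ} (+-congʳ {𝟘} (X^-cong (sym (ℤₚ.*-identityˡ (+ E))))))) ⟩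
    X^ (+ E) ⊖ ∑ᴬ 2 (λ i → X^ (+ i ℤ.* + E))      ≈⟨ +-congˡ {X^ (+ E)} (-‿cong (vanish prime[2] e)) ⟩
    X^ (+ E) ⊖ 𝟘                                  ≈⟨ solve 1 (λ b → b :- con 0ℤ := b) ∼-refl (X^ (+ E)) ⟩
    X^ (+ E)                                      ∎
    where open SetoidReasoning setoid

-- The trace form

open Lin ℤR using (lin; lin-cong; lin-bind; lin-0; lin-⊕; lin-⊝; lin-⊙ˡ; lin-swap; lin-∑; lin-⊠; lin-σ) public

module _ (t : ℤ) (0≤t : 0ℤ ℤ.≤ t) where
  -- P k records why the k-th term vanishes, so that the same lemma serves components of one element
  -- and differences of several.
  sum-dichotomy : ∀ n {P : ℕ → Set} {f : ℕ → ℤ} → (∀ k → k < n → (P k × f k ≡ 0ℤ) ⊎ t ℤ.≤ f k) →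
                  ((∀ k → k < n → P k) × ∑ n f ≡ 0ℤ) ⊎ t ℤ.≤ ∑ n f
  sum-dichotomy zero h = inj₁ ((λ k ()) , refl)
  sum-dichotomy (suc n) {P} {f} h with h 0 (s≤s z≤n) | sum-dichotomy n {P ∘ suc} {f ∘ suc} (λ k k<n → h (suc k) (s≤s k<n))
  ... | inj₁ (p , e) | inj₁ (ps , es) = inj₁ ((λ { zero _ → p ; (suc k) (s≤s k<n) → ps k k<n }) , cong₂ ℤ._+_ e es)
  ... | inj₁ (p , e) | inj₂ le = inj₂ (subst (t ℤ.≤_) (sym (trans (cong (ℤ._+ ∑ n (f ∘ suc)) e) (ℤₚ.+-identityˡ _))) le)
  ... | inj₂ le | inj₁ (ps , es) = inj₂ (subst (t ℤ.≤_) (sym (trans (cong (λ z → f 0 ℤ.+ z) es) (ℤₚ.+-identityʳ _))) le)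
  ... | inj₂ le | inj₂ le′ = inj₂ (subst (ℤ._≤ ∑ (suc n) f) (ℤₚ.+-identityʳ t) (ℤₚ.+-mono-≤ le (ℤₚ.≤-trans 0≤t le′)))

  -- Two terms of size at least t would already exceed the total t.
  sum-equality : 0ℤ ℤ.< t → ∀ n {P : ℕ → Set} {f : ℕ → ℤ} → (∀ k → k < n → (P k × f k ≡ 0ℤ) ⊎ t ℤ.≤ f k) → ∑ n f ≡ t →
                 ∃ λ k → k < n × f k ≡ t × (∀ l → l < n → l ≢ k → P l)
  sum-equality 0<t zero h e = contradiction e (ℤₚ.<⇒≢ 0<t)
  sum-equality 0<t (suc n) {P} {f} h e with h 0 (s≤s z≤n)
  ... | inj₁ (p , e₀) with sum-equality 0<t n {P ∘ suc} {f ∘ suc} (λ k k<n → h (suc k) (s≤s k<n)) (trans (sym (trans (cong (ℤ._+ ∑ n (f ∘ suc)) e₀) (ℤₚ.+-identityˡ _))) e)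
  ...   | k , k<n , fk , others = suc k , s≤s k<n , fk , λ { zero _ _ → p ; (suc l) (s≤s l<n) ne → others l l<n (ne ∘ cong suc) }
  sum-equality 0<t (suc n) {P} {f} h e | inj₂ le with sum-dichotomy n {P ∘ suc} {f ∘ suc} (λ k k<n → h (suc k) (s≤s k<n))
  ...   | inj₁ (ps , es) = 0 , s≤s z≤n , trans (sym (trans (cong (λ z → f 0 ℤ.+ z) es) (ℤₚ.+-identityʳ _))) e ,
                           λ { zero _ ne → contradiction refl ne ; (suc l) (s≤s l<n) _ → ps l l<n }
  ...   | inj₂ le′ = contradiction (sym e) (ℤₚ.<⇒≢ (ℤₚ.<-≤-trans (subst (ℤ._< t ℤ.+ t) (ℤₚ.+-identityʳ t) (ℤₚ.+-monoʳ-< t 0<t)) (ℤₚ.+-mono-≤ le le′)))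

whenᴾ : {P : Set} → Dec P → Poly → Poly
whenᴾ (yes _) a = a
whenᴾ (no _)  a = 𝟘

lin-whenᴾ : ∀ {P : Set} (d : Dec P) f a → lin f (whenᴾ d a) ≡ when d (lin f a)
lin-whenᴾ (yes _) f a = refl
lin-whenᴾ (no _)  f a = refl

opaque
  unfolding sel

  -- For an unramified p: the exponents stay as they are, since at level D they keep their meaning.
  -- Its counterpart `sub` is for a ramified p, where passing to level D divides them by p.
  comp : (p : ℕ) .{{_ : NonZero p}} → ℕ → Poly → Poly
  comp p k a = bind a (λ i → whenᴾ (i %ℕ p ≟ k) (X^ i))

  -- a = Σ_k x^k (sub p k a)(x^p).
  sub : (p : ℕ) .{{_ : NonZero p}} → ℕ → Poly → Poly
  sub p k a = bind a (λ i → whenᴾ (i %ℕ p ≟ k) (X^ (i /ℕ p)))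

  lin-comp : ∀ p .{{_ : NonZero p}} k f a → lin f (comp p k a) ≡ lin (λ i → sel p k i (f i)) a
  lin-comp p k f a = trans (lin-bind f a _) (lin-cong a (λ i → lin-whenᴾ (i %ℕ p ≟ k) f (X^ i)))

  lin-sub : ∀ p .{{_ : NonZero p}} k f a → lin f (sub p k a) ≡ lin (λ i → sel p k i (f (i /ℕ p))) a
  lin-sub p k f a = trans (lin-bind f a _) (lin-cong a (λ i → lin-whenᴾ (i %ℕ p ≟ k) f (X^ (i /ℕ p))))

opaque
  -- The form Tr(a b̄) expanded on monomials; `F≡` gives the intrinsic version.
  F : ∀ {D} → Tower D → Poly → Poly → ℤ
  F T a b = lin (λ i → lin (λ j → tr T (i ℤ.- j)) b) a

  F-def : ∀ {D} (T : Tower D) a b → F T a b ≡ lin (λ i → lin (λ j → tr T (i ℤ.- j)) b) a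
  F-def T a b = refl

  F-⊞ : ∀ {D} (T : Tower D) a a′ b → F T (a ⊞ a′) b ≡ F T a b ℤ.+ F T a′ b
  F-⊞ T a a′ b = refl

  F-⊟ : ∀ {D} (T : Tower D) a b → F T (⊟ a) b ≡ ℤ.- F T a b
  F-⊟ T a b = refl

Q : ∀ {D} → Tower D → Poly → ℤ
Q T a = F T a a

module Form {D} (T : Tower D) where
  open Quot ℤR (tr T)
  open CRing A
  open Sums A renaming (∑ to ∑ᴬ)
  open Cyc T

  F≡ : ∀ a b → F T a b ≡ lin (at 0ℤ) (a ⊠ conj b)
  F≡ a b = trans (F-def T a b) $ sym (trans (lin-⊠ (at 0ℤ) a (conj b)) (lin-cong a (λ i → trans (lin-σ _ ℤ.-1ℤ b) (lin-cong b (λ j → cong (tr T) (lem i j))))))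
    where
    lem : ∀ i j → 0ℤ ℤ.+ (i ℤ.+ ℤ.-1ℤ ℤ.* j) ≡ i ℤ.- j
    lem = ℤ-Solver.solve-∀

  F-cong : ∀ {a a′ b b′} → a ∼ a′ → b ∼ b′ → F T a b ≡ F T a′ b′
  F-cong {a} {a′} {b} {b′} p q = trans (F≡ a b) (trans (eq (⊠-cong p (conj-cong q)) 0ℤ) (sym (F≡ a′ b′)))

  F-sym : ∀ a b → F T a b ≡ F T b a
  F-sym a b = trans (F-def T a b) $ trans (lin-swap a b _) $ trans (lin-cong b (λ j → lin-cong a (λ i → trans (cong (tr T) (lem i j)) (tr-unit T -1-unit (j ℤ.- i))))) (sym (F-def T b a))
    where
    lem : ∀ i j → i ℤ.- j ≡ ℤ.-1ℤ ℤ.* (j ℤ.- i)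
    lem = ℤ-Solver.solve-∀

  F-⊖ : ∀ u v b → F T (u ⊖ v) b ≡ F T u b ℤ.- F T v b
  F-⊖ u v b = trans (F-⊞ T u (⊟ v) b) (cong (λ z → F T u b ℤ.+ z) (F-⊟ T v b))

  Q-⊖ : ∀ u v → Q T (u ⊖ v) ≡ Q T u ℤ.+ Q T v ℤ.- + 2 ℤ.* F T u v
  Q-⊖ u v = begin
    F T (u ⊖ v) (u ⊖ v)                                  ≡⟨ F-⊖ u v (u ⊖ v) ⟩
    F T u (u ⊖ v) ℤ.- F T v (u ⊖ v)                      ≡⟨ cong₂ ℤ._-_ (trans (F-sym u (u ⊖ v)) (F-⊖ u v u)) (trans (F-sym v (u ⊖ v)) (F-⊖ u v v)) ⟩
    (F T u u ℤ.- F T v u) ℤ.- (F T u v ℤ.- F T v v)      ≡⟨ cong (λ z → (F T u u ℤ.- z) ℤ.- (F T u v ℤ.- F T v v)) (F-sym v u) ⟩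
    (F T u u ℤ.- F T u v) ℤ.- (F T u v ℤ.- F T v v)      ≡⟨ lem (F T u u) (F T v v) (F T u v) ⟩
    Q T u ℤ.+ Q T v ℤ.- + 2 ℤ.* F T u v                  ∎
    where
    open ≡-Reasoning
    lem : ∀ x y z → (x ℤ.- z) ℤ.- (z ℤ.- y) ≡ x ℤ.+ y ℤ.- + 2 ℤ.* z
    lem = ℤ-Solver.solve-∀

  Q-𝟘 : ∀ {a} → a ∼ 𝟘 → Q T a ≡ 0ℤ
  Q-𝟘 {a} p = trans (F-cong p p) (F-def T 𝟘 𝟘)

  F-∑ : ∀ n v b → F T (∑ᴬ n v) b ≡ ∑ n (λ k → F T (v k) b)
  F-∑ n v b = trans (F-def T (∑ᴬ n v) b) (trans (lin-∑𝔸 _ n v) (ℤ∑.∑-cong n (λ k _ → sym (F-def T (v k) b))))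

  S : (ℕ → Poly) → ℕ → ℤ
  S v zero    = 0ℤ
  S v (suc n) = S v n ℤ.+ ∑ n (λ j → Q T (v n ⊖ v j))

  -- Lagrange's identity for the form, `S v n` being the sum of Q (v i - v j) over the pairs j < i <
  -- n. It turns the expression met at an unramified prime into a sum over pairs, where a lower
  -- bound is visible.
  S-formula : ∀ v n → S v n ≡ + n ℤ.* ∑ n (Q T ∘ v) ℤ.- Q T (∑ᴬ n v)
  S-formula v zero = cong (λ z → 0ℤ ℤ.- z) (sym (F-def T 𝟘 𝟘))
  S-formula v (suc n) = begin
    S v n ℤ.+ ∑ n (λ j → Q T (v n ⊖ v j))                  ≡⟨ cong₂ ℤ._+_ (S-formula v n) rest ⟩
    (+ n ℤ.* s ℤ.- Q T w) ℤ.+ (+ n ℤ.* q ℤ.+ s ℤ.- + 2 ℤ.* F T (v n) w)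
      ≡⟨ lem (+ n) s (Q T w) q (F T (v n) w) ⟩
    (1ℤ ℤ.+ + n) ℤ.* (s ℤ.+ q) ℤ.- ((Q T w ℤ.+ F T (v n) w) ℤ.+ (F T (v n) w ℤ.+ q))
      ≡⟨ cong₂ (λ x y → (1ℤ ℤ.+ + n) ℤ.* x ℤ.- y) (sym (ℤ∑.∑-last n (Q T ∘ v))) (sym last) ⟩
    + suc n ℤ.* ∑ (suc n) (Q T ∘ v) ℤ.- Q T (∑ᴬ (suc n) v)  ∎
    where
    open ≡-Reasoning
    s = ∑ n (Q T ∘ v)
    w = ∑ᴬ n v
    q = Q T (v n)
    lem : ∀ n s x q f → (n ℤ.* s ℤ.- x) ℤ.+ (n ℤ.* q ℤ.+ s ℤ.- + 2 ℤ.* f) ≡ (1ℤ ℤ.+ n) ℤ.* (s ℤ.+ q) ℤ.- ((x ℤ.+ f) ℤ.+ (f ℤ.+ q))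
    lem = ℤ-Solver.solve-∀
    last : Q T (∑ᴬ (suc n) v) ≡ (Q T w ℤ.+ F T (v n) w) ℤ.+ (F T (v n) w ℤ.+ q)
    last = begin
      Q T (∑ᴬ (suc n) v)                                 ≡⟨ F-cong (∑-last n v) (∑-last n v) ⟩
      F T (w ⊞ v n) (w ⊞ v n)                            ≡⟨ F-⊞ T w (v n) (w ⊞ v n) ⟩
      F T w (w ⊞ v n) ℤ.+ F T (v n) (w ⊞ v n)            ≡⟨ cong₂ ℤ._+_ (trans (F-sym w (w ⊞ v n)) (F-⊞ T w (v n) w)) (trans (F-sym (v n) (w ⊞ v n)) (F-⊞ T w (v n) (v n))) ⟩
      (Q T w ℤ.+ F T (v n) w) ℤ.+ (F T w (v n) ℤ.+ q)    ≡⟨ cong (λ z → (Q T w ℤ.+ F T (v n) w) ℤ.+ (z ℤ.+ q)) (F-sym w (v n)) ⟩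
      (Q T w ℤ.+ F T (v n) w) ℤ.+ (F T (v n) w ℤ.+ q)    ∎
    rest : ∑ n (λ j → Q T (v n ⊖ v j)) ≡ + n ℤ.* q ℤ.+ s ℤ.- + 2 ℤ.* F T (v n) w
    rest = begin
      ∑ n (λ j → Q T (v n ⊖ v j))                                           ≡⟨ ℤ∑.∑-cong n (λ j _ → trans (Q-⊖ (v n) (v j)) (lem′ q (Q T (v j)) (F T (v n) (v j)))) ⟩
      ∑ n (λ j → (q ℤ.+ Q T (v j)) ℤ.+ (ℤ.- + 2) ℤ.* F T (v n) (v j))       ≡⟨ ℤ∑.∑-⊕ n _ _ ⟩
      ∑ n (λ j → q ℤ.+ Q T (v j)) ℤ.+ ∑ n (λ j → (ℤ.- + 2) ℤ.* F T (v n) (v j))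
        ≡⟨ cong₂ ℤ._+_ (trans (ℤ∑.∑-⊕ n (λ _ → q) (Q T ∘ v)) (cong (ℤ._+ s) (trans (ℤ∑.∑-const n q) (cong (ℤ._* q) (nat≡+ n)))))
             (trans (ℤ∑.∑-⊙ˡ n (ℤ.- + 2) _) (cong ((ℤ.- + 2) ℤ.*_) (trans (ℤ∑.∑-cong n (λ j _ → F-sym (v n) (v j))) (trans (sym (F-∑ n v (v n))) (F-sym w (v n)))))) ⟩
      (+ n ℤ.* q ℤ.+ s) ℤ.+ (ℤ.- + 2) ℤ.* F T (v n) w                       ≡⟨ lem″ (+ n ℤ.* q ℤ.+ s) (F T (v n) w) ⟩
      + n ℤ.* q ℤ.+ s ℤ.- + 2 ℤ.* F T (v n) w                               ∎
      where
      lem′ : ∀ a b c → a ℤ.+ b ℤ.- + 2 ℤ.* c ≡ (a ℤ.+ b) ℤ.+ (ℤ.- + 2) ℤ.* c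
      lem′ = ℤ-Solver.solve-∀
      lem″ : ∀ a c → a ℤ.+ (ℤ.- + 2) ℤ.* c ≡ a ℤ.- + 2 ℤ.* c
      lem″ = ℤ-Solver.solve-∀

∑-sel : ∀ p .{{_ : NonZero p}} i (h : ℕ → ℤ) → ∑ p (λ k → sel p k i (h k)) ≡ h (i %ℕ p)
∑-sel p i h = trans (ℤ∑.∑-single p _ (i %ℕ p) (n%ℕd<d i p) (λ k _ k≢ → sel-no p (k≢ ∘ sym))) (sel-yes p refl)

i-j%p : ∀ p .{{_ : NonZero p}} i j → (j %ℕ p ≡ i %ℕ p → (i ℤ.- j) %ℕ p ≡ 0) × ((i ℤ.- j) %ℕ p ≡ 0 → j %ℕ p ≡ i %ℕ p)
i-j%p p i j =
  (λ e → trans (%ℕ-cong p (cong-trans (cong-+ (%ℕ-cong⁻¹ p {i} {j} (sym e)) (cong-refl {i = ℤ.- j})) (cong-≡ (ℤₚ.+-inverseʳ j)))) (0%ℕ p)) ,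
  (λ e → sym (%ℕ-cong p (cong-trans (cong-≡ (l₁ i j)) (cong-trans (cong-+ (%ℕ-cong⁻¹ p {i ℤ.- j} {0ℤ} (trans e (sym (0%ℕ p)))) (cong-refl {i = j})) (cong-≡ (ℤₚ.+-identityˡ j))))))
  where
  l₁ : ∀ i j → i ≡ (i ℤ.- j) ℤ.+ j
  l₁ = ℤ-Solver.solve-∀

-- Two exponents lie in a common class modulo p exactly when p divides their difference.
∑-diagonal : ∀ p .{{_ : NonZero p}} (g : ℤ → ℤ → ℤ) a →
  ∑ p (λ k → lin (λ i → sel p k i (lin (λ j → sel p k j (g i j)) a)) a) ≡ lin (λ i → lin (λ j → sel p 0 (i ℤ.- j) (g i j)) a) a
∑-diagonal p g a = trans (sym (lin-∑ a p (λ k i → sel p k i (lin (λ j → sel p k j (g i j)) a))))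
  (lin-cong a (λ i → trans (∑-sel p i (λ k → lin (λ j → sel p k j (g i j)) a))
    (lin-cong a (λ j → sel-⇔ p (proj₁ (i-j%p p i j)) (proj₂ (i-j%p p i j)) (λ _ → refl)))))

-- Cassels' bound: the minimum of the trace form

module _ {D} (T : Tower D) where
  open Quot ℤR (tr T)

  IsRootOfUnity : Poly → Set
  IsRootOfUnity a = ∃ λ j → a ∼ X^ j ⊎ a ∼ ⊟ X^ j

  -- A nonzero cyclotomic integer has normalised trace form at least 1 (Cassels), with equality only at roots of unity.
  record Kronecker : Set where
    field
      dichotomy : ∀ a → a ∼ 𝟘 ⊎ + t₀ T ℤ.≤ Q T a
      equality  : ∀ a → Q T a ≡ + t₀ T → IsRootOfUnity a
open Kronecker public

1≤i*i : ∀ i → i ≢ 0ℤ → 1ℤ ℤ.≤ i ℤ.* i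
1≤i*i (+ zero)    i≢0 = contradiction refl i≢0
1≤i*i (+ suc n)   _   = ℤ.+≤+ (s≤s z≤n)
1≤i*i -[1+ n ]    _   = ℤ.+≤+ (s≤s z≤n)

i*i≡1 : ∀ i → i ℤ.* i ≡ 1ℤ → i ≡ 1ℤ ⊎ i ≡ ℤ.- 1ℤ
i*i≡1 i e with ℕₚ.m*n≡1⇒m≡1 ℤ.∣ i ∣ ℤ.∣ i ∣ (trans (sym (ℤₚ.abs-* i i)) (cong ℤ.∣_∣ e))
i*i≡1 (+ 1) e      | refl = inj₁ refl
i*i≡1 -[1+ 0 ] e   | refl = inj₂ refl

-- At level 1 an element is determined by its coefficient sum, and the claim is about squares of
-- integers.
kronecker-one : Kronecker one
kronecker-one = record { dichotomy = dich ; equality = equal }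
  where
  open Quot ℤR (tr one)
  size : Poly → ℤ
  size = lin (λ _ → 1ℤ)
  Q≡ : ∀ a → Q one a ≡ size a ℤ.* size a
  Q≡ a = trans (F-def one a a) $ trans (lin-cong a (λ _ → sym (ℤₚ.*-identityʳ (size a)))) (lin-⊙ˡ a (size a) (λ _ → 1ℤ))
  dich : ∀ a → a ∼ 𝟘 ⊎ 1ℤ ℤ.≤ Q one a
  dich a with size a ℤ.≟ 0ℤ
  ... | yes e = inj₁ (mk∼ (λ _ → e))
  ... | no ne = inj₂ (subst (1ℤ ℤ.≤_) (sym (Q≡ a)) (1≤i*i _ ne))
  equal : ∀ a → Q one a ≡ 1ℤ → IsRootOfUnity one a
  equal a e with i*i≡1 (size a) (trans (sym (Q≡ a)) e)
  ... | inj₁ s = 0ℤ , inj₁ (mk∼ (λ _ → s))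
  ... | inj₂ s = 0ℤ , inj₂ (mk∼ (λ _ → s))

0≤t₀ : ∀ {D} (T : Tower D) → 0ℤ ℤ.≤ + t₀ T
0≤t₀ T = ℤ.+≤+ z≤n

0<t₀ : ∀ {D} (T : Tower D) → 0ℤ ℤ.< + t₀ T
0<t₀ T = ℤ.+<+ (t₀>0 T)

module Ramified {D} p .{{_ : NonZero p}} (pr : Prime p) (p∣D : p ∣ D) (T : Tower D) where
  private T′ = ram p pr p∣D T
  open Quot ℤR (tr T) using (∼-refl; mk∼) renaming (_∼_ to _∼ᵀ_; eq to eqᵀ; at to atᵀ)
  open Quot ℤR (tr T′) using (_∼_; eq; at)

  /ℕ-+ : ∀ u i → u %ℕ p ≡ 0 → (u ℤ.+ i) /ℕ p ≡ (u /ℕ p) ℤ.+ (i /ℕ p)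
  /ℕ-+ u i u0 = proj₂ (%ℕ-unique p (u ℤ.+ i) (i %ℕ p) _ (n%ℕd<d i p) (trans
    (cong₂ ℤ._+_ (%ℕ≡0⇒ p u u0) (a≡a%ℕn+[a/ℕn]*n i p)) (lem (u /ℕ p) (+ (i %ℕ p)) (i /ℕ p) (+ p))))
    where
    lem : ∀ u r q p → u ℤ.* p ℤ.+ (r ℤ.+ q ℤ.* p) ≡ r ℤ.+ (u ℤ.+ q) ℤ.* p
    lem = ℤ-Solver.solve-∀

  -- Multiplying by x^(vp-k) moves exactly the class k to exponents divisible by p, the only ones
  -- with non-zero trace.
  lin-at-sub : ∀ k v → k < p → ∀ a → lin (atᵀ v) (sub p k a) ≡ lin (at (v ℤ.* + p ℤ.- + k)) a
  lin-at-sub k v k<p a = trans (lin-sub p k (atᵀ v) a) (lin-cong a (λ i → sel-⇔ p (to i) (from i) (λ e → cong (tr T) (same i e))))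
    where
    u = v ℤ.* + p ℤ.- + k
    l₂ : ∀ v p k i → i ≡ k ℤ.+ (v ℤ.* p ℤ.- k ℤ.+ i) ℤ.+ (ℤ.- v) ℤ.* p
    l₂ = ℤ-Solver.solve-∀
    l₃ : ∀ v p k q → v ℤ.* p ℤ.- k ℤ.+ (k ℤ.+ q ℤ.* p) ≡ 0ℤ ℤ.+ (v ℤ.+ q) ℤ.* p
    l₃ = ℤ-Solver.solve-∀
    split : ∀ i → i %ℕ p ≡ k → i ≡ + k ℤ.+ (i /ℕ p) ℤ.* + p
    split i e = trans (a≡a%ℕn+[a/ℕn]*n i p) (cong (λ r → + r ℤ.+ (i /ℕ p) ℤ.* + p) e)
    decomposed : ∀ i → i %ℕ p ≡ k → (u ℤ.+ i) %ℕ p ≡ 0 × (u ℤ.+ i) /ℕ p ≡ v ℤ.+ (i /ℕ p)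
    decomposed i e = %ℕ-unique p (u ℤ.+ i) 0 (v ℤ.+ (i /ℕ p)) (prime>0 pr)
      (trans (cong (λ z → u ℤ.+ z) (split i e)) (l₃ v (+ p) (+ k) (i /ℕ p)))
    to : ∀ i → i %ℕ p ≡ k → (u ℤ.+ i) %ℕ p ≡ 0
    to i e = proj₁ (decomposed i e)
    same : ∀ i → i %ℕ p ≡ k → v ℤ.+ (i /ℕ p) ≡ (u ℤ.+ i) /ℕ p
    same i e = sym (proj₂ (decomposed i e))
    from : ∀ i → (u ℤ.+ i) %ℕ p ≡ 0 → i %ℕ p ≡ k
    from i e = trans (%ℕ-cong p (cong-trans (mkC (ℤ.- v) (l₂ v (+ p) (+ k) i))
      (cong-trans (cong-+ (cong-refl {i = + k}) (%ℕ-cong⁻¹ p {u ℤ.+ i} {0ℤ} (trans e (sym (0%ℕ p))))) (cong-≡ (ℤₚ.+-identityʳ (+ k)))))) (%ℕ-small p k k<p)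

  sub-cong : ∀ {a b} k → k < p → a ∼ b → sub p k a ∼ᵀ sub p k b
  sub-cong {a} {b} k k<p e = mk∼ (λ v → trans (lin-at-sub k v k<p a) (trans (eq e (v ℤ.* + p ℤ.- + k)) (sym (lin-at-sub k v k<p b))))

  -- Division of -u by p writes every exponent u as vp - k with 0 <= k < p, so each test at level pD
  -- is a test of one component at level D.
  sub-reflects : ∀ {a b} → (∀ k → k < p → sub p k a ∼ᵀ sub p k b) → a ∼ b
  sub-reflects {a} {b} h = Quot.mk∼ (λ u → trans (expand u a) (trans (eqᵀ (h (k u) (k<p u)) (v u)) (sym (expand u b))))
    where
    k : ℤ → ℕ
    k u = (ℤ.- u) %ℕ p
    k<p : ∀ u → k u < p
    k<p u = n%ℕd<d (ℤ.- u) p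
    v : ℤ → ℤ
    v u = ℤ.- ((ℤ.- u) /ℕ p)
    l₁ : ∀ u → u ≡ ℤ.- (ℤ.- u)
    l₁ = ℤ-Solver.solve-∀
    l₂ : ∀ r q p → ℤ.- (r ℤ.+ q ℤ.* p) ≡ (ℤ.- q) ℤ.* p ℤ.- r
    l₂ = ℤ-Solver.solve-∀
    u≡ : ∀ u → u ≡ v u ℤ.* + p ℤ.- + k u
    u≡ u = trans (l₁ u) (trans (cong ℤ.-_ (a≡a%ℕn+[a/ℕn]*n (ℤ.- u) p)) (l₂ (+ k u) ((ℤ.- u) /ℕ p) (+ p)))
    expand : ∀ u a → lin (at u) a ≡ lin (atᵀ (v u)) (sub p (k u) a)
    expand u a = trans (cong (λ z → lin (at z) a) (u≡ u)) (sym (lin-at-sub (k u) (v u) (k<p u) a))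

  -- The powers x^k with k < p are orthogonal over level D, because the trace vanishes on exponents
  -- prime to p.
  Q-sub : ∀ a → Q T′ a ≡ ∑ p (λ k → Q T (sub p k a))
  Q-sub a = trans (F-def T′ a a) $ sym (trans (ℤ∑.∑-cong p (λ k _ → expand k)) (trans (∑-diagonal p _ a) (lin-cong a (λ i → lin-cong a (λ j →
    sel-⇔ p id id (λ e → cong (tr T) (trans (cong (ℤ._- (j /ℕ p)) (trans (cong (_/ℕ p) (l₁ i j)) (/ℕ-+ (i ℤ.- j) j e))) (l₂ ((i ℤ.- j) /ℕ p) (j /ℕ p)))))))))
    where
    l₁ : ∀ i j → i ≡ (i ℤ.- j) ℤ.+ j
    l₁ = ℤ-Solver.solve-∀
    l₂ : ∀ x j → x ℤ.+ j ℤ.- j ≡ x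
    l₂ = ℤ-Solver.solve-∀
    expand : ∀ k → Q T (sub p k a) ≡ lin (λ i → sel p k i (lin (λ j → sel p k j (tr T ((i /ℕ p) ℤ.- (j /ℕ p)))) a)) a
    expand k = trans (F-def T (sub p k a) (sub p k a)) $ trans (lin-sub p k _ a) (lin-cong a (λ i → cong (sel p k i) (lin-sub p k _ a)))

  sub-X^-yes : ∀ k j → k < p → sub p k (X^ (+ k ℤ.+ j ℤ.* + p)) ∼ᵀ X^ j
  sub-X^-yes k j k<p = mk∼ (λ v → trans (lin-sub p k (atᵀ v) (X^ _)) (trans (sel-yes p (proj₁ u)) (cong (atᵀ v) (proj₂ u))))
    where u = %ℕ-unique p (+ k ℤ.+ j ℤ.* + p) k j k<p refl

  sub-X^-no : ∀ k l j → k < p → l ≢ k → sub p l (X^ (+ k ℤ.+ j ℤ.* + p)) ∼ᵀ 𝟘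
  sub-X^-no k l j k<p l≢k = mk∼ (λ v → trans (lin-sub p l (atᵀ v) (X^ _)) (sel-no p (λ e → l≢k (trans (sym e) (proj₁ u)))))
    where u = %ℕ-unique p (+ k ℤ.+ j ℤ.* + p) k j k<p refl

  open CRing (Quot.A ℤR (tr T)) using (-‿cong; ≈-trans; ≈-sym) renaming (solve to solveᵀ; _:=_ to _:=ᵀ_; :-_ to :-ᵀ_; con to conᵀ)

  sub-⊟ : ∀ k a → sub p k (⊟ a) ∼ᵀ ⊟ sub p k a
  sub-⊟ k a = mk∼ (λ v → trans (lin-sub p k (atᵀ v) (⊟ a)) (cong ℤ.-_ (sym (lin-sub p k (atᵀ v) a))))

  sub-𝟘 : ∀ k → sub p k 𝟘 ∼ᵀ 𝟘
  sub-𝟘 k = mk∼ (λ v → lin-sub p k (atᵀ v) 𝟘)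

  ⊟𝟘 : ⊟ 𝟘 ∼ᵀ 𝟘
  ⊟𝟘 = solveᵀ 0 (:-ᵀ conᵀ 0ℤ :=ᵀ conᵀ 0ℤ) ∼-refl

  module _ (K : Kronecker T) where
    Part : Poly → ℕ → Set
    Part a k = (sub p k a ∼ᵀ 𝟘 × Q T (sub p k a) ≡ 0ℤ) ⊎ + t₀ T ℤ.≤ Q T (sub p k a)

    parts : ∀ a k → k < p → Part a k
    parts a k _ = go (dichotomy K (sub p k a))
      where
      go : sub p k a ∼ᵀ 𝟘 ⊎ + t₀ T ℤ.≤ Q T (sub p k a) → Part a k
      go (inj₁ e)  = inj₁ (e , Form.Q-𝟘 T e)
      go (inj₂ le) = inj₂ le

    dichotomy-ram : ∀ a → a ∼ 𝟘 ⊎ + t₀ T ℤ.≤ Q T′ a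
    dichotomy-ram a = go (sum-dichotomy (+ t₀ T) (0≤t₀ T) p {λ k → sub p k a ∼ᵀ 𝟘} {λ k → Q T (sub p k a)} (parts a))
      where
      go : ((∀ k → k < p → sub p k a ∼ᵀ 𝟘) × ∑ p (λ k → Q T (sub p k a)) ≡ 0ℤ) ⊎ + t₀ T ℤ.≤ ∑ p (λ k → Q T (sub p k a)) → a ∼ 𝟘 ⊎ + t₀ T ℤ.≤ Q T′ a
      go (inj₁ (zs , _)) = inj₁ (sub-reflects (λ k k<p → ≈-trans (zs k k<p) (≈-sym (sub-𝟘 k))))
      go (inj₂ le)       = inj₂ (subst (+ t₀ T ℤ.≤_) (sym (Q-sub a)) le)

    module _ (a : Poly) (k : ℕ) (k<p : k < p) (others : ∀ l → l < p → l ≢ k → sub p l a ∼ᵀ 𝟘) where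
      X : ℤ → Poly
      X j = X^ (+ k ℤ.+ j ℤ.* + p)

      plus : ∀ j → sub p k a ∼ᵀ X^ j → ∀ l → l < p → Dec (l ≡ k) → sub p l a ∼ᵀ sub p l (X j)
      plus j s l l<p (yes refl) = ≈-trans s (≈-sym (sub-X^-yes k j k<p))
      plus j s l l<p (no l≢k)   = ≈-trans (others l l<p l≢k) (≈-sym (sub-X^-no k l j k<p l≢k))

      minus : ∀ j → sub p k a ∼ᵀ ⊟ X^ j → ∀ l → l < p → Dec (l ≡ k) → sub p l a ∼ᵀ sub p l (⊟ X j)
      minus j s l l<p (yes refl) = ≈-trans s (≈-sym (≈-trans (sub-⊟ k (X j)) (-‿cong (sub-X^-yes k j k<p))))
      minus j s l l<p (no l≢k)   = ≈-trans (others l l<p l≢k) (≈-sym (≈-trans (sub-⊟ l (X j)) (≈-trans (-‿cong (sub-X^-no k l j k<p l≢k)) ⊟𝟘)))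

      root : IsRootOfUnity T (sub p k a) → IsRootOfUnity T′ a
      root (j , inj₁ s) = + k ℤ.+ j ℤ.* + p , inj₁ (sub-reflects λ l l<p → plus j s l l<p (l ≟ k))
      root (j , inj₂ s) = + k ℤ.+ j ℤ.* + p , inj₂ (sub-reflects λ l l<p → minus j s l l<p (l ≟ k))

    equality-ram : ∀ a → Q T′ a ≡ + t₀ T → IsRootOfUnity T′ a
    equality-ram a e = go (sum-equality (+ t₀ T) (0≤t₀ T) (0<t₀ T) p {λ k → sub p k a ∼ᵀ 𝟘} {λ k → Q T (sub p k a)} (parts a) (trans (sym (Q-sub a)) e))
      where
      go : (∃ λ k → k < p × Q T (sub p k a) ≡ + t₀ T × (∀ l → l < p → l ≢ k → sub p l a ∼ᵀ 𝟘)) → IsRootOfUnity T′ a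
      go (k , k<p , qk , others) = root a k k<p others (equality K (sub p k a) qk)

    kronecker-ram : Kronecker T′
    kronecker-ram = record { dichotomy = dichotomy-ram ; equality = equality-ram }

module Unramified {D} p .{{_ : NonZero p}} (pr : Prime p) (p∤D : ¬ p ∣ D) (T : Tower D) where
  private T′ = unram p pr p∤D T
  open Quot ℤR (tr T) using (∼-refl; mk∼) renaming (_∼_ to _∼ᵀ_; eq to eqᵀ; at to atᵀ; lin-∑𝔸 to lin-∑ᵀ)
  open Quot ℤR (tr T′) using (_∼_; at)
  open CRing (Quot.A ℤR (tr T)) using (≈-trans; ≈-sym; _⊖_; ⊖≈0⇒≈; ≈⇒⊖≈0; +-congˡ; -‿cong)
  open Form T
  open ≡-Reasoning

  -- On the exponents of class k modulo p the factor `c` takes the constant value c p (u + k) and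
  -- can be pulled out.
  lin-at : ∀ u a → lin (at u) a ≡ ∑ p (λ k → c p (u ℤ.+ + k) ℤ.* lin (atᵀ u) (comp p k a))
  lin-at u a = sym (begin
    ∑ p (λ k → c p (u ℤ.+ + k) ℤ.* lin (atᵀ u) (comp p k a))          ≡⟨ ℤ∑.∑-cong p (λ k _ → trans (cong (c p (u ℤ.+ + k) ℤ.*_) (lin-comp p k (atᵀ u) a)) (sym (lin-⊙ˡ a (c p (u ℤ.+ + k)) (λ i → sel p k i (atᵀ u i))))) ⟩
    ∑ p (λ k → lin (λ i → c p (u ℤ.+ + k) ℤ.* sel p k i (atᵀ u i)) a)  ≡⟨ lin-∑ a p (λ k i → c p (u ℤ.+ + k) ℤ.* sel p k i (atᵀ u i)) ⟨
    lin (λ i → ∑ p (λ k → c p (u ℤ.+ + k) ℤ.* sel p k i (atᵀ u i))) a  ≡⟨ lin-cong a pointwise ⟩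
    lin (at u) a                                                       ∎)
    where
    pointwise : ∀ i → ∑ p (λ k → c p (u ℤ.+ + k) ℤ.* sel p k i (atᵀ u i)) ≡ at u i
    pointwise i = trans
      (ℤ∑.∑-single p (λ k → c p (u ℤ.+ + k) ℤ.* sel p k i (atᵀ u i)) (i %ℕ p) (n%ℕd<d i p)
        (λ k _ k≢ → trans (cong (c p (u ℤ.+ + k) ℤ.*_) (sel-no p (k≢ ∘ sym))) (ℤₚ.*-zeroʳ (c p (u ℤ.+ + k)))))
      (cong₂ ℤ._*_ (c-cong p (u ℤ.+ + (i %ℕ p)) (u ℤ.+ i) (trans (sym (%ℕ-cong p cg))) (trans (%ℕ-cong p cg))) (sel-yes p refl))
      where
      cg : Cong p (u ℤ.+ + (i %ℕ p)) (u ℤ.+ i)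
      cg = cong-+ (cong-refl {i = u}) (cong-sym (cong-%ℕ p i))

  ∑-c′ : ∀ u → ∑ p (λ k → c p (u ℤ.+ + k)) ≡ 0ℤ
  ∑-c′ u = trans (ℤ∑.∑-cong p (λ k _ → cong (λ z → c p (u ℤ.+ z)) (sym (ℤₚ.*-identityʳ (+ k))))) (∑-c p u 1ℤ (mkU 1ℤ cong-refl))

  ∑-c-const : ∀ u z → ∑ p (λ k → c p (u ℤ.+ + k) ℤ.* z) ≡ 0ℤ
  ∑-c-const u z = begin
    ∑ p (λ k → c p (u ℤ.+ + k) ℤ.* z)   ≡⟨ ℤ∑.∑-cong p (λ k _ → ℤₚ.*-comm (c p (u ℤ.+ + k)) z) ⟩
    ∑ p (λ k → z ℤ.* c p (u ℤ.+ + k))   ≡⟨ ℤ∑.∑-⊙ˡ p z (λ k → c p (u ℤ.+ + k)) ⟩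
    z ℤ.* ∑ p (λ k → c p (u ℤ.+ + k))   ≡⟨ cong (z ℤ.*_) (∑-c′ u) ⟩
    z ℤ.* 0ℤ                            ≡⟨ ℤₚ.*-zeroʳ z ⟩
    0ℤ                                  ∎

  -- Equal components mean a multiple of the sum of all p-th roots of unity, which is zero.
  all-equal⇒∼𝟘 : ∀ a w → (∀ k → k < p → comp p k a ∼ᵀ w) → a ∼ 𝟘
  all-equal⇒∼𝟘 a w h = Quot.mk∼ λ u → trans (lin-at u a)
    (trans (ℤ∑.∑-cong p (λ k k<p → cong (c p (u ℤ.+ + k) ℤ.*_) (eqᵀ (h k k<p) u))) (∑-c-const u (lin (atᵀ u) w)))

  -- The weights c p (u + k) sum to zero over k, so the common part w is invisible to the trace.
  odd-one-out : ∀ a w e k → k < p → (∀ l → l < p → l ≢ k → comp p l a ∼ᵀ w) → comp p k a ⊖ w ∼ᵀ e →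
                ∀ u → lin (at u) a ≡ c p (u ℤ.+ + k) ℤ.* lin (atᵀ u) e
  odd-one-out a w e k k<p others ke u = begin
    lin (at u) a                                                       ≡⟨ lin-at u a ⟩
    ∑ p (λ l → c p (u ℤ.+ + l) ℤ.* L l)                                ≡⟨ ℤ∑.∑-cong p (λ l _ → l₁ (c p (u ℤ.+ + l)) (L l) W) ⟩
    ∑ p (λ l → c p (u ℤ.+ + l) ℤ.* W ℤ.+ c p (u ℤ.+ + l) ℤ.* (L l ℤ.- W)) ≡⟨ ℤ∑.∑-⊕ p _ _ ⟩
    ∑ p (λ l → c p (u ℤ.+ + l) ℤ.* W) ℤ.+ ∑ p (λ l → c p (u ℤ.+ + l) ℤ.* (L l ℤ.- W))
      ≡⟨ cong₂ ℤ._+_ (∑-c-const u W) (ℤ∑.∑-single p _ k k<p (λ l l<p l≢k → trans (cong (λ z → c p (u ℤ.+ + l) ℤ.* (z ℤ.- W)) (eqᵀ (others l l<p l≢k) u)) (l₂ (c p (u ℤ.+ + l)) W))) ⟩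
    0ℤ ℤ.+ c p (u ℤ.+ + k) ℤ.* (L k ℤ.- W)                             ≡⟨ ℤₚ.+-identityˡ _ ⟩
    c p (u ℤ.+ + k) ℤ.* (L k ℤ.- W)                                    ≡⟨ cong (c p (u ℤ.+ + k) ℤ.*_) (eqᵀ ke u) ⟩
    c p (u ℤ.+ + k) ℤ.* lin (atᵀ u) e                                  ∎
    where
    L : ℕ → ℤ
    L l = lin (atᵀ u) (comp p l a)
    W = lin (atᵀ u) w
    l₁ : ∀ c x w → c ℤ.* x ≡ c ℤ.* w ℤ.+ c ℤ.* (x ℤ.- w)
    l₁ = ℤ-Solver.solve-∀
    l₂ : ∀ c w → c ℤ.* (w ℤ.- w) ≡ 0ℤ
    l₂ = ℤ-Solver.solve-∀

  crt : ∀ k j → ∃ λ J → Cong p J (+ k) × Cong D J j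
  crt k j = go (coprime⇒unit {p} {D} (Coprimality.sym (prime∤⇒coprime pr p∤D)))
    where
    l₁ : ∀ j k d d′ → j ℤ.+ (k ℤ.- j) ℤ.* d′ ℤ.* d ≡ j ℤ.+ (k ℤ.- j) ℤ.* (d ℤ.* d′)
    l₁ = ℤ-Solver.solve-∀
    l₂ : ∀ j k → j ℤ.+ (k ℤ.- j) ℤ.* 1ℤ ≡ k
    l₂ = ℤ-Solver.solve-∀
    go : Unit p (+ D) → ∃ λ J → Cong p J (+ k) × Cong D J j
    go (mkU d′ dd′) = j ℤ.+ (+ k ℤ.- j) ℤ.* d′ ℤ.* + D ,
      cong-trans (cong-≡ (l₁ j (+ k) (+ D) d′)) (cong-trans (cong-+ (cong-refl {i = j}) (cong-*ˡ (+ k ℤ.- j) dd′)) (cong-≡ (l₂ j (+ k)))) ,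
      mkC ((+ k ℤ.- j) ℤ.* d′) refl

  at-crt : ∀ {k j J} → Cong p J (+ k) → Cong D J j → ∀ u → at u J ≡ c p (u ℤ.+ + k) ℤ.* atᵀ u j
  at-crt {k} {j} {J} cp cD u = cong₂ ℤ._*_
    (c-cong p (u ℤ.+ J) (u ℤ.+ + k) (trans (sym (%ℕ-cong p cg))) (trans (%ℕ-cong p cg)))
    (tr-cong T (cong-+ (cong-refl {i = u}) cD))
    where
    cg : Cong p (u ℤ.+ J) (u ℤ.+ + k)
    cg = cong-+ (cong-refl {i = u}) cp

  -- Subtracting w from every component leaves a single one, a root of unity with exponent j up to
  -- sign. The Chinese remainder theorem combines the class k modulo p and the class j modulo D into
  -- one exponent.
  root-of-unity : ∀ a w k → k < p → (∀ l → l < p → l ≢ k → comp p l a ∼ᵀ w) → IsRootOfUnity T (comp p k a ⊖ w) → IsRootOfUnity T′ a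
  root-of-unity a w k k<p others (j , inj₁ s) = go (crt k j)
    where
    go : (∃ λ J → Cong p J (+ k) × Cong D J j) → IsRootOfUnity T′ a
    go (J , cp , cD) = J , inj₁ (Quot.mk∼ λ u → trans (odd-one-out a w (X^ j) k k<p others s u) (sym (at-crt cp cD u)))
  root-of-unity a w k k<p others (j , inj₂ s) = go (crt k j)
    where
    go : (∃ λ J → Cong p J (+ k) × Cong D J j) → IsRootOfUnity T′ a
    go (J , cp , cD) = J , inj₂ (Quot.mk∼ λ u → trans (odd-one-out a w (⊟ X^ j) k k<p others s u)
      (trans (sym (ℤₚ.neg-distribʳ-* (c p (u ℤ.+ + k)) (atᵀ u j))) (cong ℤ.-_ (sym (at-crt cp cD u)))))

  ∑-comp : ∀ a → a ∼ᵀ Sums.∑ (Quot.A ℤR (tr T)) p (λ k → comp p k a)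
  ∑-comp a = mk∼ λ u → sym (begin
    lin (atᵀ u) (Sums.∑ (Quot.A ℤR (tr T)) p (λ k → comp p k a))   ≡⟨ lin-∑ᵀ (atᵀ u) p (λ k → comp p k a) ⟩
    ∑ p (λ k → lin (atᵀ u) (comp p k a))                           ≡⟨ ℤ∑.∑-cong p (λ k _ → lin-comp p k (atᵀ u) a) ⟩
    ∑ p (λ k → lin (λ i → sel p k i (atᵀ u i)) a)                  ≡⟨ lin-∑ a p (λ k i → sel p k i (atᵀ u i)) ⟨
    lin (λ i → ∑ p (λ k → sel p k i (atᵀ u i))) a                  ≡⟨ lin-cong a (λ i → ∑-sel p i (λ _ → atᵀ u i)) ⟩
    lin (atᵀ u) a                                                  ∎)

  -- As `c p` is p times the indicator of divisibility by p, minus 1, the form is p times the sum of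
  -- the Q of the components minus Q of their sum. Lagrange's identity applies to this difference.
  Q-comp : ∀ a → Q T′ a ≡ S (λ k → comp p k a) p
  Q-comp a = begin
    Q T′ a                                                                                    ≡⟨ trans (F-def T′ a a) $ lin-cong a (λ i → trans (lin-cong a (λ j → pointwise i j)) (trans (lin-⊕ a _ _) (cong₂ ℤ._+_ (lin-⊙ˡ a (+ p) _) (lin-⊝ a _)))) ⟩
    lin (λ i → + p ℤ.* diag i ℤ.+ ℤ.- lin (λ j → tr T (i ℤ.- j)) a) a                         ≡⟨ trans (lin-⊕ a _ _) (cong₂ ℤ._+_ (lin-⊙ˡ a (+ p) diag) (lin-⊝ a _)) ⟩
    + p ℤ.* lin diag a ℤ.- lin (λ i → lin (λ j → tr T (i ℤ.- j)) a) a                         ≡⟨ cong (λ z → + p ℤ.* lin diag a ℤ.- z) (F-def T a a) ⟨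
    + p ℤ.* lin diag a ℤ.- Q T a                                                              ≡⟨ cong₂ (λ x y → + p ℤ.* x ℤ.- y) (sym (trans (ℤ∑.∑-cong p (λ k _ → expand k)) (∑-diagonal p _ a))) (F-cong (∑-comp a) (∑-comp a)) ⟩
    + p ℤ.* ∑ p (λ k → Q T (comp p k a)) ℤ.- Q T (Sums.∑ (Quot.A ℤR (tr T)) p (λ k → comp p k a)) ≡⟨ S-formula (λ k → comp p k a) p ⟨
    S (λ k → comp p k a) p                                                                    ∎
    where
    diag : ℤ → ℤ
    diag i = lin (λ j → sel p 0 (i ℤ.- j) (tr T (i ℤ.- j))) a
    sel-* : ∀ i z → sel p 0 i 1ℤ ℤ.* z ≡ sel p 0 i z
    sel-* i z = go (i %ℕ p ≟ 0)
      where
      go : Dec (i %ℕ p ≡ 0) → sel p 0 i 1ℤ ℤ.* z ≡ sel p 0 i z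
      go (yes e) = trans (cong (ℤ._* z) (sel-yes p e)) (trans (ℤₚ.*-identityˡ z) (sym (sel-yes p e)))
      go (no ne) = trans (cong (ℤ._* z) (sel-no p ne)) (trans (ℤₚ.*-zeroˡ z) (sym (sel-no p ne)))
    l₁ : ∀ p s z → (p ℤ.* s ℤ.- 1ℤ) ℤ.* z ≡ p ℤ.* (s ℤ.* z) ℤ.+ ℤ.- z
    l₁ = ℤ-Solver.solve-∀
    pointwise : ∀ i j → tr T′ (i ℤ.- j) ≡ + p ℤ.* sel p 0 (i ℤ.- j) (tr T (i ℤ.- j)) ℤ.+ ℤ.- tr T (i ℤ.- j)
    pointwise i j = trans (l₁ (+ p) (sel p 0 (i ℤ.- j) 1ℤ) (tr T (i ℤ.- j))) (cong (λ z → + p ℤ.* z ℤ.+ ℤ.- tr T (i ℤ.- j)) (sel-* (i ℤ.- j) (tr T (i ℤ.- j))))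
    expand : ∀ k → Q T (comp p k a) ≡ lin (λ i → sel p k i (lin (λ j → sel p k j (tr T (i ℤ.- j))) a)) a
    expand k = trans (F-def T (comp p k a) (comp p k a)) $ trans (lin-comp p k _ a) (lin-cong a (λ i → cong (sel p k i) (lin-comp p k _ a)))

  module _ (K : Kronecker T) where
    Difference : (ℕ → Poly) → ℕ → ℕ → Set
    Difference v m j = (v j ∼ᵀ v m × Q T (v m ⊖ v j) ≡ 0ℤ) ⊎ + t₀ T ℤ.≤ Q T (v m ⊖ v j)

    difference : ∀ (v : ℕ → Poly) m j → Difference v m j
    difference v m j = go (dichotomy K (v m ⊖ v j))
      where
      go : v m ⊖ v j ∼ᵀ 𝟘 ⊎ + t₀ T ℤ.≤ Q T (v m ⊖ v j) → Difference v m j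
      go (inj₁ e)  = inj₁ (≈-sym (⊖≈0⇒≈ e) , Q-𝟘 e)
      go (inj₂ le) = inj₂ le

    AllEqual : (ℕ → Poly) → ℕ → Set
    AllEqual v n = (∀ k → k < n → v k ∼ᵀ v 0) × S v n ≡ 0ℤ

    Row : (ℕ → Poly) → ℕ → Set
    Row v m = ((∀ j → j < m → v j ∼ᵀ v m) × ∑ m (λ j → Q T (v m ⊖ v j)) ≡ 0ℤ) ⊎ + t₀ T ℤ.≤ ∑ m (λ j → Q T (v m ⊖ v j))

    row : ∀ (v : ℕ → Poly) m → Row v m
    row v m = sum-dichotomy (+ t₀ T) (0≤t₀ T) m {λ j → v j ∼ᵀ v m} {λ j → Q T (v m ⊖ v j)} (λ j _ → difference v m j)

    row-const : ∀ (v : ℕ → Poly) m → (∀ k → k < m → v k ∼ᵀ v 0) → ∑ m (λ j → Q T (v m ⊖ v j)) ≡ + m ℤ.* Q T (v m ⊖ v 0)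
    row-const v m h = trans (ℤ∑.∑-cong m (λ j j<m → F-cong (+-congˡ {v m} (-‿cong (h j j<m))) (+-congˡ {v m} (-‿cong (h j j<m)))))
      (trans (ℤ∑.∑-const m _) (cong (ℤ._* Q T (v m ⊖ v 0)) (nat≡+ m)))

    zero-S : ∀ (v : ℕ → Poly) n → (∀ k → k < n → v k ∼ᵀ v 0) → S v n ≡ 0ℤ
    zero-S v zero    _ = refl
    zero-S v (suc n) g = cong₂ ℤ._+_ (zero-S v n (λ k k<n → g k (ℕₚ.m<n⇒m<1+n k<n)))
      (trans (row-const v n (λ k k<n → g k (ℕₚ.m<n⇒m<1+n k<n))) (trans (cong (+ n ℤ.*_) (Q-𝟘 (≈⇒⊖≈0 (g n (ℕₚ.n<1+n n))))) (ℤₚ.*-zeroʳ (+ n))))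

    all-equal-suc : ∀ (v : ℕ → Poly) m → AllEqual v (suc m) → v (suc m) ∼ᵀ v 0 → AllEqual v (suc (suc m))
    all-equal-suc v m (h , s) e = all , trans (cong₂ ℤ._+_ s (trans (row-const v (suc m) h) (trans (cong (+ suc m ℤ.*_) (Q-𝟘 (≈⇒⊖≈0 e))) (ℤₚ.*-zeroʳ (+ suc m))))) refl
      where
      all : ∀ k → k < suc (suc m) → v k ∼ᵀ v 0
      all k k<n = go (ℕₚ.m≤n⇒m<n∨m≡n (ℕₚ.≤-pred k<n))
        where
        go : k < suc m ⊎ k ≡ suc m → v k ∼ᵀ v 0
        go (inj₁ lt)   = h k lt
        go (inj₂ refl) = e

    suc-* : ∀ m t → + suc m ℤ.* t ≡ + m ℤ.* t ℤ.+ t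
    suc-* m t = trans (ℤₚ.suc-* (+ m) t) (ℤₚ.+-comm t (+ m ℤ.* t))

    -- If m + 1 elements are not all equal, at least m of the differences are non-zero: the first
    -- element to break equality differs from all those before it, and each later one from at least
    -- one. For m + 1 = p this is the factor p - 1 by which `t₀` grows.
    S-dichotomy : ∀ (v : ℕ → Poly) m → AllEqual v (suc m) ⊎ + m ℤ.* + t₀ T ℤ.≤ S v (suc m)
    S-dichotomy v zero = inj₁ ((λ { zero _ → ∼-refl ; (suc _) (s≤s ()) }) , refl)
    S-dichotomy v (suc m) = go (S-dichotomy v m)
      where
      Goal = AllEqual v (suc (suc m)) ⊎ + suc m ℤ.* + t₀ T ℤ.≤ S v (suc (suc m))
      unequal : AllEqual v (suc m) → Difference v (suc m) 0 → Goal
      unequal ae (inj₁ (e , _)) = inj₁ (all-equal-suc v m ae (≈-sym e))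
      unequal (h , s) (inj₂ le) = inj₂ (subst (+ suc m ℤ.* + t₀ T ℤ.≤_) (sym (trans (cong₂ ℤ._+_ s (row-const v (suc m) h)) (ℤₚ.+-identityˡ _))) (ℤₚ.*-monoˡ-≤-nonNeg (+ suc m) le))
      rows : + m ℤ.* + t₀ T ℤ.≤ S v (suc m) → Row v (suc m) → Goal
      rows le (inj₂ le′) = inj₂ (subst (ℤ._≤ S v (suc (suc m))) (sym (suc-* m (+ t₀ T))) (ℤₚ.+-mono-≤ le le′))
      rows le (inj₁ (h , s)) = inj₁ (all-equal-suc v m (h′ , zero-S v (suc m) h′) (≈-sym (h 0 (s≤s z≤n))))
        where
        h′ : ∀ k → k < suc m → v k ∼ᵀ v 0
        h′ k k<n = ≈-trans (h k k<n) (≈-sym (h 0 (s≤s z≤n)))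
      go : AllEqual v (suc m) ⊎ + m ℤ.* + t₀ T ℤ.≤ S v (suc m) → Goal
      go (inj₁ ae) = unequal ae (difference v (suc m) 0)
      go (inj₂ le) = rows le (row v (suc m))

    OddOneOut : (ℕ → Poly) → ℕ → Set
    OddOneOut v n = ∃₂ λ k l → k < n × l < n × Q T (v k ⊖ v l) ≡ + t₀ T × (∀ i → i < n → i ≢ k → v i ∼ᵀ v l)

    Q-flip : ∀ u w → Q T (u ⊖ w) ≡ Q T (w ⊖ u)
    Q-flip u w = trans (Q-⊖ u w) (trans (cong₂ (λ x y → x ℤ.- + 2 ℤ.* y) (ℤₚ.+-comm (Q T u) (Q T w)) (F-sym u w)) (sym (Q-⊖ w u)))

    squeeze : ∀ {a b x y} → a ℤ.≤ x → b ℤ.≤ y → x ℤ.+ y ≡ a ℤ.+ b → y ≡ b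
    squeeze {a} {b} {x} {y} a≤x b≤y e = ℤₚ.≤-antisym (ℤₚ.≮⇒≥ λ b<y → ℤₚ.<-irrefl (sym e) (ℤₚ.+-mono-≤-< a≤x b<y)) b≤y

    -- Equality leaves no slack in the count: one element stands apart from the others, which agree,
    -- and its distance is the least possible one.
    S-equality : ∀ (v : ℕ → Poly) m → S v (suc (suc m)) ≡ + suc m ℤ.* + t₀ T → OddOneOut v (suc (suc m))
    S-equality v m e = go (S-dichotomy v m)
      where
      n = suc (suc m)
      case-equal : AllEqual v (suc m) → OddOneOut v n
      case-equal (h , s) = suc m , 0 , ℕₚ.n<1+n _ , s≤s z≤n , ℤₚ.*-cancelˡ-≡ (+ suc m) _ _ (trans (sym (trans (cong₂ ℤ._+_ s (row-const v (suc m) h)) (ℤₚ.+-identityˡ _))) e) ,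
        λ i i<n i≢ → h i (ℕₚ.≤∧≢⇒< (ℕₚ.≤-pred i<n) i≢)
      case-row : + m ℤ.* + t₀ T ℤ.≤ S v (suc m) → Row v (suc m) → OddOneOut v n
      -- Here all elements are equal and S is zero, whereas its prescribed value is positive; the
      -- argument still missing for `case-equal` comes from this contradiction.
      case-row le (inj₁ (h , s)) = case-equal ((λ k k<n → ≈-trans (h k k<n) (≈-sym (h 0 (s≤s z≤n)))) , contra)
        where
        contra : S v (suc m) ≡ 0ℤ
        contra = ⊥-elim (ℤₚ.<-irrefl refl (ℤₚ.<-≤-trans
          (subst (0ℤ ℤ.<_) (ℤₚ.pos-* (suc m) (t₀ T)) (ℤ.+<+ (ℕₚ.*-mono-≤ (s≤s (z≤n {m})) (t₀>0 T))))
          (ℤₚ.≤-reflexive (trans (sym e) (Sv≡0)))))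
          where
          h′ : ∀ k → k < suc m → v k ∼ᵀ v 0
          h′ k k<n = ≈-trans (h k k<n) (≈-sym (h 0 (s≤s z≤n)))
          Sv≡0 : S v n ≡ 0ℤ
          Sv≡0 = cong₂ ℤ._+_ (zero-S v (suc m) h′) s
      case-row le (inj₂ le′) = found (sum-equality (+ t₀ T) (0≤t₀ T) (0<t₀ T) (suc m) {λ j → v j ∼ᵀ v (suc m)} {λ j → Q T (v (suc m) ⊖ v j)} (λ j _ → difference v (suc m) j)
          (squeeze le le′ (trans e (suc-* m (+ t₀ T)))))
        where
        found : (∃ λ k → k < suc m × Q T (v (suc m) ⊖ v k) ≡ + t₀ T × (∀ l → l < suc m → l ≢ k → v l ∼ᵀ v (suc m))) → OddOneOut v n
        found (k , k<n , qk , others) = k , suc m , ℕₚ.m<n⇒m<1+n k<n , ℕₚ.n<1+n _ , trans (Q-flip (v k) (v (suc m))) qk , rest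
          where
          rest : ∀ i → i < n → i ≢ k → v i ∼ᵀ v (suc m)
          rest i i<n i≢k = last-or (ℕₚ.m≤n⇒m<n∨m≡n (ℕₚ.≤-pred i<n))
            where
            last-or : i < suc m ⊎ i ≡ suc m → v i ∼ᵀ v (suc m)
            last-or (inj₁ lt)   = others i lt i≢k
            last-or (inj₂ refl) = ∼-refl
      go : AllEqual v (suc m) ⊎ + m ℤ.* + t₀ T ℤ.≤ S v (suc m) → OddOneOut v n
      go (inj₁ ae) = case-equal ae
      go (inj₂ le) = case-row le (row v (suc m))

    p≡2+ : p ≡ suc (suc (p ∸ 2))
    p≡2+ = sym (ℕₚ.m+[n∸m]≡n (prime>1 pr))

    p-1≡ : p ∸ 1 ≡ suc (p ∸ 2)
    p-1≡ = cong (_∸ 1) p≡2+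

    t₀′ : + t₀ T′ ≡ + suc (p ∸ 2) ℤ.* + t₀ T
    t₀′ = trans (cong (λ x → + (x * t₀ T)) p-1≡) (ℤₚ.pos-* (suc (p ∸ 2)) (t₀ T))

    components : Poly → ℕ → Poly
    components a k = comp p k a

    dichotomy-unram : ∀ a → a ∼ 𝟘 ⊎ + t₀ T′ ℤ.≤ Q T′ a
    dichotomy-unram a = go (S-dichotomy (components a) (suc (p ∸ 2)))
      where
      go : AllEqual (components a) (suc (suc (p ∸ 2))) ⊎ + suc (p ∸ 2) ℤ.* + t₀ T ℤ.≤ S (components a) (suc (suc (p ∸ 2))) → a ∼ 𝟘 ⊎ + t₀ T′ ℤ.≤ Q T′ a
      go (inj₁ (h , _)) = inj₁ (all-equal⇒∼𝟘 a (components a 0) (λ k k<p → h k (subst (k <_) p≡2+ k<p)))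
      go (inj₂ le)      = inj₂ (subst₂ ℤ._≤_ (sym t₀′) (sym (trans (Q-comp a) (cong (S (components a)) p≡2+))) le)

    equality-unram : ∀ a → Q T′ a ≡ + t₀ T′ → IsRootOfUnity T′ a
    equality-unram a e = go (S-equality (components a) (p ∸ 2) (trans (sym (trans (Q-comp a) (cong (S (components a)) p≡2+))) (trans e t₀′)))
      where
      go : OddOneOut (components a) (suc (suc (p ∸ 2))) → IsRootOfUnity T′ a
      go (k , l , k<n , l<n , qk , others) = root-of-unity a (components a l) k (subst (k <_) (sym p≡2+) k<n)
        (λ i i<p → others i (subst (i <_) p≡2+ i<p)) (equality K (components a k ⊖ components a l) qk)

    kronecker-unram : Kronecker T′
    kronecker-unram = record { dichotomy = dichotomy-unram ; equality = equality-unram }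

kronecker : ∀ {D} (T : Tower D) → Kronecker T
kronecker one                = kronecker-one
kronecker (ram p pr p∣D T)   = Ramified.kronecker-ram p pr p∣D T (kronecker T)
kronecker (unram p pr p∤D T) = Unramified.kronecker-unram p pr p∤D T (kronecker T)

-- Ideals fixed by Galois conjugation

prime∣^⇒∣ : ∀ {ℓ q} → Prime ℓ → ∀ a → ℓ ∣ q ^ a → ℓ ∣ q
prime∣^⇒∣ prℓ zero    d = contradiction (∣1⇒≡1 d) (ℕₚ.<⇒≢ (prime>1 prℓ) ∘ sym)
prime∣^⇒∣ {ℓ} {q} prℓ (suc a) d = [ id , prime∣^⇒∣ prℓ a ]′ (euclidsLemma q (q ^ a) prℓ d)

no-common-prime⇒coprime : ∀ {a b} → .{{NonZero a}} → (∀ {ℓ} → Prime ℓ → ℓ ∣ a → ℓ ∣ b → ⊥) → Coprime a b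
no-common-prime⇒coprime {a} h {zero}        (d∣a , _) = contradiction (Data.Nat.Divisibility.0∣⇒≡0 d∣a) (≢-nonZero⁻¹ a)
no-common-prime⇒coprime h {suc zero}        _         = refl
no-common-prime⇒coprime h {d@(suc (suc _))} (d∣a , d∣b) = go (primeDivisor d (s≤s (s≤s z≤n)))
  where
  go : (∃ λ ℓ → Prime ℓ × ℓ ∣ d) → d ≡ 1
  go (ℓ , pr , ℓ∣d) = ⊥-elim (h pr (∣-trans ℓ∣d d∣a) (∣-trans ℓ∣d d∣b))

coprime-^ : ∀ {q b} a → Prime q → ¬ q ∣ b → Coprime (q ^ a) b
coprime-^ {q} a pr q∤b = no-common-prime⇒coprime {{ℕₚ.m^n≢0 q a {{prime⇒nonZero pr}}}}
  λ prℓ ℓ∣q^a ℓ∣b → q∤b (subst (_∣ _) (prime∣prime prℓ pr (prime∣^⇒∣ prℓ a ℓ∣q^a)) ℓ∣b)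

record Split (q d : ℕ) : Set where
  constructor mkSplit
  field
    exponent : ℕ
    rest     : ℕ
    d≡       : d ≡ q ^ exponent * rest
    q∤rest   : ¬ q ∣ rest

split : ∀ {q} → Prime q → ∀ d → .{{NonZero d}} → Split q d
split {q} pr d = <-rec (λ d → NonZero d → Split q d) step d (≢-nonZero (≢-nonZero⁻¹ d))
  where
  step : ∀ d → (∀ {e} → e < d → NonZero e → Split q e) → NonZero d → Split q d
  step d rec nz = go (q ∣? d)
    where
    go : Dec (q ∣ d) → Split q d
    go (no q∤d) = mkSplit 0 d (sym (ℕₚ.*-identityˡ d)) q∤d
    go (yes (divides e d≡)) = up (rec e<d nze)
      where
      nze : NonZero e
      nze = ≢-nonZero λ e≡0 → ≢-nonZero⁻¹ d {{nz}} (trans d≡ (cong (_* q) e≡0))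
      e<d : e < d
      e<d = subst (e <_) (sym d≡) (ℕₚ.m<m*n e q {{nze}} (prime>1 pr))
      up : Split q e → Split q d
      up (mkSplit a r e≡ q∤r) = mkSplit (suc a) r (trans d≡ (trans (cong (_* q) e≡) (lem (q ^ a) r q))) q∤r
        where
        lem : ∀ x r q → x * r * q ≡ q * x * r
        lem = ℕ-Solver.solve-∀

module Ideals {D : ℕ} (T : Tower D) where
  open Quot ℤR (tr T)
  open CRing A
  open Sums A renaming (∑ to ∑ᴬ)
  open Cyc T
  open QuotFrobenius ℤR (tr T)

  record IsIdeal (J : Poly → Set) : Set where
    field
      resp : ∀ {a b} → a ∼ b → J a → J b
      add  : ∀ {a b} → J a → J b → J (a ⊞ b)
      mul  : ∀ b {a} → J a → J (b ⊠ a)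

    sub-closed : ∀ {a b} → J a → J b → J (a ⊖ b)
    sub-closed {a} {b} ja jb = resp (solve 2 (λ a b → a :+ (:- con 1ℤ) :* b := a :- b) ∼-refl a b) (add ja (mul (⊟ X^ 0ℤ) jb))

    power-closed : ∀ {a} n → 0 < n → J a → J (a ↑ n)
    power-closed {a} (suc n) _ ja = resp (*-comm (a ↑ n) a) (mul (a ↑ n) ja)

    ∣-closed : ∀ {a b} → J a → a ∣ᴿ b → J b
    ∣-closed {a} {b} ja (mk∣ w e) = resp (∼-trans (*-comm w a) (∼-sym e)) (mul w ja)

  frobenius-iterate : ∀ {q} → Prime q → ∀ k a → nat q ∣ᴿ a ↑ (q ^ k) ⊖ σ (+ (q ^ k)) a
  frobenius-iterate {q} pr zero a = ∣-resp (∼-sym (≈⇒⊖≈0 (∼-trans (*-identityʳ a) (∼-sym (σ-id a))))) ∣-0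
  frobenius-iterate {q} pr (suc k) a = ∣-≡ (∣-resp (+-congʳ (∼-sym (↑-* a q (q ^ k)))) (∣-↑ q (frobenius-iterate pr k a)))
    (∣-resp (+-congˡ {σ (+ (q ^ k)) a ↑ q} (-‿cong (∼-trans (σ-σ (+ q) (+ (q ^ k)) a) (∼-reflexive (cong (λ s → σ s a) (sym (ℤₚ.pos-* q (q ^ k)))))))) (σ-frobenius pr (σ (+ (q ^ k)) a)))

  module _ (E : ℕ) where
    -- For D = q^(c+1) E the power x^E is a primitive root of unity of order q^(c+1). So π lies in
    -- every prime ideal above q, and modulo π exponents matter only modulo E.
    π : Poly
    π = X^ 0ℤ ⊖ X^ (+ E)

    π∣X^kE : ∀ k → π ∣ᴿ X^ 0ℤ ⊖ X^ (k ℤ.* + E)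
    π∣X^kE (+ n) = ∣-resp (+-cong (1↑ n) (-‿cong (X^-↑ (+ E) n))) (∣-↑ n ∣-self)
    π∣X^kE k@(-[1+ n ]) = ∣-resp (∼-trans (distribˡ _ _ _) (+-cong
        (∼-trans (*-congˡ {X^ (k ℤ.* + E)} (∼-refl {⊟ X^ 0ℤ})) (solve 1 (λ a → a :* (:- con 1ℤ) := :- a) ∼-refl (X^ (k ℤ.* + E))))
        (∼-trans (X^⊠ (k ℤ.* + E) (+ suc n ℤ.* + E)) (X^-cong (lem (+ suc n) (+ E)))))
      ⟨ ∼-trans ⟩ +-comm (⊟ X^ (k ℤ.* + E)) (X^ 0ℤ))
      (∣-⊙ˡ (X^ (k ℤ.* + E)) (∣-resp (solve 2 (λ a b → :- (a :- b) := (:- a) :+ b) ∼-refl (X^ 0ℤ) (X^ (+ suc n ℤ.* + E))) (∣-⊝ (π∣X^kE (+ suc n)))))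
      where
      lem : ∀ k e → (ℤ.- k) ℤ.* e ℤ.+ k ℤ.* e ≡ 0ℤ
      lem = ℤ-Solver.solve-∀

    π∣X^-X^ : ∀ {i j} → Cong E i j → π ∣ᴿ X^ j ⊖ X^ i
    π∣X^-X^ {i} {j} (mkC k refl) = ∣-resp
      (∼-trans (solve 2 (λ a b → a :* (con 1ℤ :- b) := a :- a :* b) ∼-refl (X^ j) (X^ (k ℤ.* + E))) (+-congˡ {X^ j} (-‿cong (X^⊠ j (k ℤ.* + E)))))
      (∣-⊙ˡ (X^ j) (π∣X^kE k))

    π∣σ-σ : ∀ {r s} → Cong E r s → ∀ a → π ∣ᴿ σ s a ⊖ σ r a
    π∣σ-σ {r} {s} cg 𝟘 rewrite σ-𝟘 r | σ-𝟘 s = ∣-resp (∼-sym (x⊖x≈0 𝟘)) ∣-0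
    π∣σ-σ {r} {s} cg (X^ i) rewrite σ-X^ r i | σ-X^ s i = π∣X^-X^ (cong-* cg (cong-refl {i = i}))
    π∣σ-σ {r} {s} cg (a ⊞ b) rewrite σ-⊞ r a b | σ-⊞ s a b =
      ∣-resp (solve 4 (λ a b c d → (a :- b) :+ (c :- d) := (a :+ c) :- (b :+ d)) ∼-refl _ _ _ _) (∣-⊕ (π∣σ-σ cg a) (π∣σ-σ cg b))
    π∣σ-σ {r} {s} cg (⊟ a) rewrite σ-⊟ r a | σ-⊟ s a =
      ∣-resp (solve 2 (λ a b → :- (a :- b) := (:- a) :- (:- b)) ∼-refl _ _) (∣-⊝ (π∣σ-σ cg a))

    module _ {q c : ℕ} (prq : Prime q) (D≡ : D ≡ q ^ suc c * E) where
      -- Subtracting the vanishing sum of the q-th roots of unity from q leaves a sum of terms 1 - z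
      -- with z a power of x^E.
      π∣q : π ∣ᴿ nat q
      π∣q = ∣-resp total (∣-∑ q (λ i → X^ 0ℤ ⊖ X^ (+ i ℤ.* + (q ^ c * E))) λ i →
          ∣-resp (+-congˡ {X^ 0ℤ} (-‿cong (X^-cong (trans (ℤₚ.*-assoc (+ i) (+ (q ^ c)) (+ E)) (cong (+ i ℤ.*_) (sym (ℤₚ.pos-* (q ^ c) E))))))) (π∣X^kE (+ i ℤ.* + (q ^ c))))
        where
        ∣-∑ : ∀ {d} n f → (∀ i → d ∣ᴿ f i) → d ∣ᴿ ∑ᴬ n f
        ∣-∑ zero    f h = ∣-0
        ∣-∑ (suc n) f h = ∣-⊕ (h 0) (∣-∑ n (f ∘ suc) (h ∘ suc))
        open SetoidReasoning setoid
        total : ∑ᴬ q (λ i → X^ 0ℤ ⊖ X^ (+ i ℤ.* + (q ^ c * E))) ∼ nat q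
        total = begin
          ∑ᴬ q (λ i → X^ 0ℤ ⊖ X^ (+ i ℤ.* + (q ^ c * E)))                   ≈⟨ ∑-⊕ q (λ _ → X^ 0ℤ) (λ i → ⊟ X^ (+ i ℤ.* + (q ^ c * E))) ⟩
          ∑ᴬ q (λ _ → X^ 0ℤ) ⊞ ∑ᴬ q (λ i → ⊟ X^ (+ i ℤ.* + (q ^ c * E)))    ≈⟨ +-cong (∑-const q (X^ 0ℤ)) (∑-⊝ q (λ i → X^ (+ i ℤ.* + (q ^ c * E)))) ⟩
          nat q ⊠ X^ 0ℤ ⊖ ∑ᴬ q (λ i → X^ (+ i ℤ.* + (q ^ c * E)))           ≈⟨ +-cong (*-identityʳ (nat q)) (-‿cong (vanish prq (trans D≡ (ℕₚ.*-assoc q (q ^ c) E)))) ⟩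
          nat q ⊖ 𝟘                                                         ≈⟨ solve 1 (λ a → a :- con 0ℤ := a) ∼-refl (nat q) ⟩
          nat q                                                             ∎

      -- Modulo q this power is π with x replaced by x^(q^(c+1)), that is 1 - x^D = 0.
      q∣π^ : nat q ∣ᴿ π ↑ (q ^ suc c)
      q∣π^ = ∣-resp (∼-trans (+-congˡ {π ↑ (q ^ suc c)} (-‿cong σπ)) (solve 1 (λ a → a :- con 0ℤ := a) ∼-refl (π ↑ (q ^ suc c)))) (frobenius-iterate prq (suc c) π)
        where
        σπ : σ (+ (q ^ suc c)) π ∼ 𝟘
        σπ rewrite σ-⊞ (+ (q ^ suc c)) (X^ 0ℤ) (⊟ X^ (+ E)) | σ-⊟ (+ (q ^ suc c)) (X^ (+ E)) | σ-X^ (+ (q ^ suc c)) 0ℤ | σ-X^ (+ (q ^ suc c)) (+ E) =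
          ≈⇒⊖≈0 (X^-mod (mkC ℤ.-1ℤ (trans (ℤₚ.*-zeroʳ (+ (q ^ suc c))) (trans (lem (+ D)) (cong (λ z → z ℤ.+ ℤ.-1ℤ ℤ.* + D) (trans (cong +_ D≡) (ℤₚ.pos-* (q ^ suc c) E)))))))
          where
          lem : ∀ d → 0ℤ ≡ d ℤ.+ ℤ.-1ℤ ℤ.* d
          lem = ℤ-Solver.solve-∀

      q^∣π^ : ∀ a → nat (q ^ a) ∣ᴿ π ↑ (a * q ^ suc c)
      q^∣π^ zero    = ∣-resp nat-1 ∣-self
      q^∣π^ (suc a) = ∣-respˡ (∼-sym (nat-* q (q ^ a))) (∣-resp (∼-sym (↑-+ π (q ^ suc c) (a * q ^ suc c))) (∣-⊙⊙ q∣π^ (q^∣π^ a)))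

      -- Modulo π the substitution `σ r` is a power of Frobenius. This expresses σ through powers,
      -- under which ideals are closed.
      π∣frobenius : ∀ K {r} → Cong E (+ (q ^ K)) r → ∀ a → π ∣ᴿ a ↑ (q ^ K) ⊖ σ r a
      π∣frobenius K cg a = ∣-≡ (∣-trans′ π∣q (frobenius-iterate prq K a)) (∣-≡-sym (π∣σ-σ cg a))

      module _ {s : ℤ} (u : Unit D s) (τ : ℕ) (sτ : Cong E (+ (q ^ τ)) s) (f : ℕ) (0<f : 0 < f) (qf : Cong E (+ (q ^ f)) 1ℤ) where
        q^>0 : ∀ k → 0 < q ^ k
        q^>0 k = ℕₚ.n≢0⇒n>0 (≢-nonZero⁻¹ (q ^ k) {{ℕₚ.m^n≢0 q k {{prime⇒nonZero prq}}}})

        q^fk : ∀ k → Cong E (+ (q ^ (k * f))) 1ℤ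
        q^fk zero    = cong-refl
        q^fk (suc k) = cong-trans (cong-≡ (trans (cong +_ (ℕₚ.^-distribˡ-+-* q f (k * f))) (ℤₚ.pos-* (q ^ f) (q ^ (k * f))))) (cong-* qf (q^fk k))

        -- Induction on the power of π contained in J. With N = q^K write σx = (σx)^N - σ(x^N - x).
        -- The first term is congruent to a power of x modulo a power of π that lies in J. In the
        -- second, x^N - x = πz with z in the ideal quotient J : π, which contains π^k and so is
        -- stable by induction; and σπ is a multiple of π.
        ideal-σ : ∀ k (J : Poly → Set) → IsIdeal J → J (π ↑ k) → ∀ {x} → J x → J (σ s x)
        ideal-σ zero    J I one∈J {x} jx = IsIdeal.resp I (*-identityʳ (σ s x)) (IsIdeal.mul I (σ s x) one∈J)
        ideal-σ (suc k) J I πk∈J {x} jx = resp final (sub-closed step₁ step₂)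
          where
          open IsIdeal I
          -- A multiple of f, so that q^K is 1 modulo E, and at least k, so that π^(K+1) lies in J.
          K = suc k * f

          J:π : Poly → Set
          J:π z = J (π ⊠ z)

          J:π-ideal : IsIdeal J:π
          J:π-ideal = record
            { resp = λ {a} {b} e j → resp (*-congˡ {π} e) j
            ; add  = λ {a} {b} ja jb → resp (∼-sym (distribˡ π a b)) (add ja jb)
            ; mul  = λ b {a} ja → resp (solve 3 (λ p a b → b :* (p :* a) := p :* (b :* a)) ∼-refl π a b) (mul b ja)
            }

          k≤K : k ≤ K
          k≤K = ℕₚ.≤-trans (ℕₚ.n≤1+n k) (ℕₚ.m≤m*n (suc k) f {{>-nonZero 0<f}})

          -- (σx)^(q^K) ≡ x^(q^τ q^K) modulo π^(K+1), which lies in J.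
          step₁ : J (σ s x ↑ (q ^ K))
          step₁ = resp (solve 2 (λ a b → a :- (a :- b) := b) ∼-refl ((x ↑ (q ^ τ)) ↑ (q ^ K)) (σ s x ↑ (q ^ K)))
            (sub-closed (power-closed (q ^ K) (q^>0 K) (power-closed (q ^ τ) (q^>0 τ) jx))
              (∣-closed πk∈J (∣-trans′ π^k∣π^K (lift-congruence-↑ q π∣q (π∣frobenius τ sτ x) K))))
            where
            π^k∣π^K : π ↑ suc k ∣ᴿ π ↑ suc K
            π^k∣π^K = mk∣ (π ↑ (K ∸ k)) (∼-trans (∼-reflexive (cong (λ z → π ↑ suc z) (sym (ℕₚ.m+[n∸m]≡n k≤K)))) (↑-+ π (suc k) (K ∸ k)))

          step₂ : J (σ s (x ↑ (q ^ K) ⊖ x))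
          step₂ = go (π∣frobenius K (q^fk (suc k)) x)
            where
            go : π ∣ᴿ x ↑ (q ^ K) ⊖ σ 1ℤ x → J (σ s (x ↑ (q ^ K) ⊖ x))
            go (mk∣ z e) = resp (∼-sym eq′) (∣-closed (ideal-σ k J:π J:π-ideal πk∈J jπz) (∣-resp (*-comm (σ s z) (σ s π)) (∣-⊙ˡ′ σπ)))
              where
              e′ : x ↑ (q ^ K) ⊖ x ∼ π ⊠ z
              e′ = ∼-trans (+-congˡ {x ↑ (q ^ K)} (-‿cong (∼-sym (σ-id x)))) e
              jπz : J (π ⊠ z)
              jπz = resp e′ (sub-closed (power-closed (q ^ K) (q^>0 K) jx) jx)
              eq′ : σ s (x ↑ (q ^ K) ⊖ x) ∼ σ s π ⊠ σ s z
              eq′ = ∼-trans (σ-cong u e′) (σ-⊠ s π z)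
              σπ : π ∣ᴿ σ s π
              σπ rewrite σ-⊞ s (X^ 0ℤ) (⊟ X^ (+ E)) | σ-⊟ s (X^ (+ E)) | σ-X^ s 0ℤ | σ-X^ s (+ E) | ℤₚ.*-zeroʳ s = π∣X^kE s
              ∣-⊙ˡ′ : π ∣ᴿ σ s π → π ⊠ σ s z ∣ᴿ σ s z ⊠ σ s π
              ∣-⊙ˡ′ (mk∣ w ew) = mk∣ w (∼-trans (*-congˡ {σ s z} ew) (solve 3 (λ a p w → a :* (p :* w) := (p :* a) :* w) ∼-refl (σ s z) π w))

          final : σ s x ↑ (q ^ K) ⊖ σ s (x ↑ (q ^ K) ⊖ x) ∼ σ s x
          final rewrite σ-⊞ s (x ↑ (q ^ K)) (⊟ x) | σ-⊟ s x = ∼-trans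
            (+-congˡ {σ s x ↑ (q ^ K)} (-‿cong (+-congʳ {⊟ σ s x} (σ-↑ s x (q ^ K)))))
            (solve 2 (λ a b → a :- (a :- b) := b) ∼-refl (σ s x ↑ (q ^ K)) (σ s x))

  -- σ s fixes every prime ideal above q once s is a power of q modulo the q-free part E of D.
  record FixesPrime (s : ℤ) (q : ℕ) : Set where
    field
      prime     : Prime q
      κ E       : ℕ
      D≡        : D ≡ q ^ suc κ * E
      τ         : ℕ
      sτ        : Cong E (+ (q ^ τ)) s
      f         : ℕ
      0<f       : 0 < f
      qf        : Cong E (+ (q ^ f)) 1ℤ

  module _ {s : ℤ} (u : Unit D s) {x : Poly} {n : ℕ} (norm : x ⊠ conj x ∼ nat n) where
    -- The z for which q^a divides z x̄ form an ideal. It contains x, because x x̄ = n, and a power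
    -- of π, because q^a divides one; so it contains σx.
    prime-power-∣ : ∀ {q} → FixesPrime s q → ∀ a → q ^ a ∣ n → nat (q ^ a) ∣ᴿ σ s x ⊠ conj x
    prime-power-∣ {q} fp a q^a∣n = ideal-σ E {q} {κ} prime D≡ u τ sτ f 0<f qf (a * q ^ suc κ) J I
        (∣-⊙ʳ (conj x) (q^∣π^ E {q} {κ} prime D≡ a)) (∣-resp (∼-sym norm) (∣-nat q^a∣n))
      where
      open FixesPrime fp
      J : Poly → Set
      J z = nat (q ^ a) ∣ᴿ z ⊠ conj x
      I : IsIdeal J
      I = record
        { resp = λ {a} {b} e j → ∣-resp (*-congʳ {conj x} e) j
        ; add  = λ {a} {b} ja jb → ∣-resp (∼-sym (distribʳ (conj x) a b)) (∣-⊕ ja jb)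
        ; mul  = λ b {a} ja → ∣-resp (∼-sym (*-assoc b a (conj x))) (∣-⊙ˡ b ja)
        }

    n∣σx*x̄ : .{{NonZero n}} → (∀ q → Prime q → q ∣ n → FixesPrime s q) → nat n ∣ᴿ σ s x ⊠ conj x
    n∣σx*x̄ fixes = <-rec (λ d → NonZero d → d ∣ n → nat d ∣ᴿ σ s x ⊠ conj x) step n (≢-nonZero (≢-nonZero⁻¹ n)) ∣-refl
      where
      step : ∀ d → (∀ {e} → e < d → NonZero e → e ∣ n → nat e ∣ᴿ σ s x ⊠ conj x) → NonZero d → d ∣ n → nat d ∣ᴿ σ s x ⊠ conj x
      step 1 rec nz d∣n = mk∣ (σ s x ⊠ conj x) (∼-trans (∼-sym (*-identityˡ _)) (*-congʳ (∼-sym nat-1)))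
      step d@(suc (suc _)) rec nz d∣n = go (primeDivisor d (s≤s (s≤s z≤n)))
        where
        go : (∃ λ q → Prime q × q ∣ d) → nat d ∣ᴿ σ s x ⊠ conj x
        go (q , pr , q∣d) = go′ (split pr d {{nz}})
          where
          go′ : Split q d → nat d ∣ᴿ σ s x ⊠ conj x
          go′ (mkSplit a r d≡ q∤r) = ∣-respˡ (∼-reflexive (cong nat (sym d≡))) (∣-coprime (coprime-^ a pr q∤r)
              (prime-power-∣ (fixes q pr (∣-trans q∣d d∣n)) a (∣-trans (subst (q ^ a ∣_) (sym d≡) (m∣m*n r)) d∣n))
              (rec r<d nzr (∣-trans (subst (r ∣_) (sym d≡) (n∣m*n (q ^ a))) d∣n)))
            where
            nzr : NonZero r
            nzr = ≢-nonZero λ r≡0 → ≢-nonZero⁻¹ d {{nz}} (trans d≡ (trans (cong (q ^ a *_) r≡0) (ℕₚ.*-zeroʳ (q ^ a))))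
            r≢d : r ≢ d
            r≢d r≡d = q∤r (subst (q ∣_) (sym r≡d) q∣d)
            r<d : r < d
            r<d = ℕₚ.≤∧≢⇒< (∣⇒≤ (subst (r ∣_) (sym d≡) (n∣m*n (q ^ a)))) r≢d

-- Field descent

-- The sum 0 + 1 + ... + (a-1), the coefficient of D when 1 + s + ... + s^(a-1) is expanded at s = 1
-- + D to first order.
tri : ℕ → ℕ
tri zero    = 0
tri (suc a) = tri a + a

2*tri : ∀ a → 2 * tri (suc a) ≡ suc a * a
2*tri zero    = refl
2*tri (suc a) = trans (ℕₚ.*-distribˡ-+ 2 (tri (suc a)) (suc a)) (trans (cong (_+ 2 * suc a) (2*tri a)) (lem a))
  where
  lem : ∀ a → suc a * a + 2 * suc a ≡ suc (suc a) * suc a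
  lem = ℕ-Solver.solve-∀

-- The number is p(p-1)/2. For p = 2 it is 1, and this is where the side conditions at 2 come from.
p∣tri : ∀ {p} → Prime p → p ≢ 2 → p ∣ tri p
p∣tri {zero}  pr p≢2 = ⊥-elim (ℕₚ.n≮0 (prime>1 pr))
p∣tri {suc a} pr p≢2 = [ (λ p∣2 → contradiction (prime∣prime pr prime[2] p∣2) p≢2) , id ]′
  (euclidsLemma 2 (tri (suc a)) pr (subst (suc a ∣_) (sym (2*tri a)) (m∣m*n a)))

module Step {D : ℕ} (p : ℕ) .{{nzp : NonZero p}} (pr : Prime p) (p∣D : p ∣ D) (T : Tower D) where
  T′ : Tower (p * D)
  T′ = ram p pr p∣D T

  D′ : ℕ
  D′ = p * D

  -- Congruent to 1 modulo D and of order p modulo pD: `σ s` generates the Galois group of level pD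
  -- over level D.
  s : ℤ
  s = 1ℤ ℤ.+ + D

  e : ℕ
  e = _∣_.quotient p∣D

  D≡ep : D ≡ e * p
  D≡ep = _∣_.equality p∣D

  +D≡ep : + D ≡ + e ℤ.* + p
  +D≡ep = trans (cong +_ D≡ep) (ℤₚ.pos-* e p)

  +D′ : + D′ ≡ + p ℤ.* + D
  +D′ = ℤₚ.pos-* p D

  D*D : + D ℤ.* + D ≡ + e ℤ.* + D′
  D*D = trans (cong (ℤ._* + D) +D≡ep) (trans (ℤₚ.*-assoc (+ e) (+ p) (+ D)) (cong (+ e ℤ.*_) (sym +D′)))

  s-unit : Unit D′ s
  s-unit = mkU (1ℤ ℤ.- + D) (mkC (ℤ.- + e) (trans (l₁ (+ D)) (trans (cong (λ z → 1ℤ ℤ.- z) D*D) (l₂ (+ e) (+ D′)))))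
    where
    l₁ : ∀ d → (1ℤ ℤ.+ d) ℤ.* (1ℤ ℤ.- d) ≡ 1ℤ ℤ.- d ℤ.* d
    l₁ = ℤ-Solver.solve-∀
    l₂ : ∀ e d → 1ℤ ℤ.- e ℤ.* d ≡ 1ℤ ℤ.+ (ℤ.- e) ℤ.* d
    l₂ = ℤ-Solver.solve-∀

  open Quot ℤR (tr T′)
  open CRing A
  open Cyc T′
  open Ideals T′ using (FixesPrime; n∣σx*x̄)
  open Form T′ using (F≡)

  module _ {n : ℕ} .{{nzn : NonZero n}} {x : Poly} (norm : x ⊠ conj x ∼ nat n) (fixes : ∀ q → Prime q → q ∣ n → FixesPrime s q) where
    0<n : 0 < n
    0<n = ℕₚ.n≢0⇒n>0 (≢-nonZero⁻¹ n)

    -- The multiplier is y = σ(x) x̄ / n, integral because n divides the numerator. Then y ȳ = σ(x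
    -- x̄) x x̄ / n² = 1, so the trace form takes its least non-zero value at y.
    σ-multiplier : ∃ λ y → σ s x ∼ y ⊠ x × IsRootOfUnity T′ y
    σ-multiplier = go (n∣σx*x̄ s-unit norm fixes)
      where
      go : nat n ∣ᴿ σ s x ⊠ conj x → ∃ λ y → σ s x ∼ y ⊠ x × IsRootOfUnity T′ y
      go (mk∣ y ey) = y , torsion-free n 0<n multiplier , equality (kronecker T′) y Qy
        where
        open SetoidReasoning setoid
        multiplier : nat n ⊠ σ s x ∼ nat n ⊠ (y ⊠ x)
        multiplier = begin
          nat n ⊠ σ s x              ≈⟨ *-congʳ {σ s x} norm ⟨
          (x ⊠ conj x) ⊠ σ s x       ≈⟨ solve 3 (λ a b c → (a :* b) :* c := (c :* b) :* a) ∼-refl x (conj x) (σ s x) ⟩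
          (σ s x ⊠ conj x) ⊠ x       ≈⟨ *-congʳ {x} ey ⟩
          (nat n ⊠ y) ⊠ x            ≈⟨ *-assoc _ _ _ ⟩
          nat n ⊠ (y ⊠ x)            ∎
        twice : nat n ⊠ (nat n ⊠ (y ⊠ conj y)) ∼ nat n ⊠ (nat n ⊠ X^ 0ℤ)
        twice = begin
          nat n ⊠ (nat n ⊠ (y ⊠ conj y))                              ≈⟨ solve 3 (λ n a b → n :* (n :* (a :* b)) := (n :* a) :* (n :* b)) ∼-refl (nat n) y (conj y) ⟩
          (nat n ⊠ y) ⊠ (nat n ⊠ conj y)                              ≈⟨ *-congˡ {nat n ⊠ y} (*-congʳ {conj y} (σ-nat ℤ.-1ℤ n)) ⟨
          (nat n ⊠ y) ⊠ (conj (nat n) ⊠ conj y)                       ≈⟨ *-congˡ {nat n ⊠ y} (σ-⊠ ℤ.-1ℤ (nat n) y) ⟨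
          (nat n ⊠ y) ⊠ conj (nat n ⊠ y)                              ≈⟨ *-cong ey (conj-cong ey) ⟨
          (σ s x ⊠ conj x) ⊠ conj (σ s x ⊠ conj x)                    ≈⟨ *-congˡ {σ s x ⊠ conj x} (∼-trans (σ-⊠ ℤ.-1ℤ (σ s x) (conj x)) (*-cong (conj-σ s x) (conj-conj x))) ⟩
          (σ s x ⊠ conj x) ⊠ (σ s (conj x) ⊠ x)                       ≈⟨ solve 4 (λ a b c d → (a :* b) :* (c :* d) := (a :* c) :* (d :* b)) ∼-refl (σ s x) (conj x) (σ s (conj x)) x ⟩
          (σ s x ⊠ σ s (conj x)) ⊠ (x ⊠ conj x)                       ≈⟨ *-cong (∼-trans (∼-sym (σ-⊠ s x (conj x))) (∼-trans (σ-cong s-unit norm) (σ-nat s n))) norm ⟩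
          nat n ⊠ nat n                                               ≈⟨ *-congˡ {nat n} (*-identityʳ (nat n)) ⟨
          nat n ⊠ (nat n ⊠ X^ 0ℤ)                                     ∎
        Qy : Q T′ y ≡ + t₀ T′
        Qy = trans (F≡ y y) (trans (eq (torsion-free n {y ⊠ conj y} {X^ 0ℤ} 0<n (torsion-free n 0<n twice)) 0ℤ) (tr-0 T′))

    cancel-x : ∀ {a} → a ⊠ x ∼ x → a ∼ X^ 0ℤ
    cancel-x {a} h = torsion-free n 0<n (begin
      nat n ⊠ a                  ≈⟨ *-congʳ {a} norm ⟨
      (x ⊠ conj x) ⊠ a           ≈⟨ solve 3 (λ a b c → (a :* b) :* c := (c :* a) :* b) ∼-refl x (conj x) a ⟩
      (a ⊠ x) ⊠ conj x           ≈⟨ *-congʳ {conj x} h ⟩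
      x ⊠ conj x                 ≈⟨ norm ⟩
      nat n                      ≈⟨ *-identityʳ (nat n) ⟨
      nat n ⊠ X^ 0ℤ              ∎)
      where open SetoidReasoning setoid

    -- s^a ≡ 1 + aD and 1 + s + … + s^(a-1) ≡ a + D·tri a modulo D′.
    iterate : ∀ ε j → σ s ε ∼ ε → σ s x ∼ (ε ⊠ X^ (+ j)) ⊠ x → ∀ a → σ (1ℤ ℤ.+ + a ℤ.* + D) x ∼ (ε ↑ a ⊠ X^ (+ j ℤ.* (+ a ℤ.+ + D ℤ.* + tri a))) ⊠ x
    iterate ε j σε h zero = begin
      σ (1ℤ ℤ.+ 0ℤ ℤ.* + D) x         ≈⟨ ∼-reflexive (cong (λ z → σ z x) (l₁ (+ D))) ⟩
      σ 1ℤ x                          ≈⟨ σ-id x ⟩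
      x                               ≈⟨ *-identityˡ x ⟨
      X^ 0ℤ ⊠ x                       ≈⟨ *-congʳ {x} (∼-trans (*-identityˡ _) (X^-cong (l₂ (+ j) (+ D)))) ⟨
      (X^ 0ℤ ⊠ X^ (+ j ℤ.* (0ℤ ℤ.+ + D ℤ.* 0ℤ))) ⊠ x  ∎
      where
      open SetoidReasoning setoid
      l₁ : ∀ d → 1ℤ ℤ.+ 0ℤ ℤ.* d ≡ 1ℤ
      l₁ = ℤ-Solver.solve-∀
      l₂ : ∀ j d → j ℤ.* (0ℤ ℤ.+ d ℤ.* 0ℤ) ≡ 0ℤ
      l₂ = ℤ-Solver.solve-∀
    iterate ε j σε h (suc a) = begin
      σ (1ℤ ℤ.+ + suc a ℤ.* + D) x                                ≈⟨ σ-mod (cong-sym (mkC (+ a ℤ.* + e) (trans (l₁ (+ a) (+ D)) (cong (λ v → 1ℤ ℤ.+ + suc a ℤ.* + D ℤ.+ v) (trans (cong (+ a ℤ.*_) D*D) (sym (ℤₚ.*-assoc (+ a) (+ e) (+ D′)))))))) x ⟩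
      σ (s ℤ.* (1ℤ ℤ.+ + a ℤ.* + D)) x                            ≈⟨ σ-σ s (1ℤ ℤ.+ + a ℤ.* + D) x ⟨
      σ s (σ (1ℤ ℤ.+ + a ℤ.* + D) x)                              ≈⟨ σ-cong s-unit (iterate ε j σε h a) ⟩
      σ s ((ε ↑ a ⊠ X^ g) ⊠ x)                                    ≈⟨ ∼-trans (σ-⊠ s (ε ↑ a ⊠ X^ g) x) (*-congʳ {σ s x} (σ-⊠ s (ε ↑ a) (X^ g))) ⟩
      (σ s (ε ↑ a) ⊠ σ s (X^ g)) ⊠ σ s x                          ≈⟨ *-cong (*-cong (∼-trans (σ-↑ s ε a) (↑-cong a σε)) (∼-reflexive (σ-X^ s g))) h ⟩
      (ε ↑ a ⊠ X^ (s ℤ.* g)) ⊠ ((ε ⊠ X^ (+ j)) ⊠ x)               ≈⟨ solve 5 (λ a b c d x → (a :* b) :* ((c :* d) :* x) := ((c :* a) :* (b :* d)) :* x) ∼-refl (ε ↑ a) (X^ (s ℤ.* g)) ε (X^ (+ j)) x ⟩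
      (ε ↑ suc a ⊠ (X^ (s ℤ.* g) ⊠ X^ (+ j))) ⊠ x                 ≈⟨ *-congʳ {x} (*-congˡ {ε ↑ suc a} (∼-trans (X^⊠ (s ℤ.* g) (+ j)) (X^-mod (mkC (+ j ℤ.* + tri a ℤ.* + e) (trans (l₂ (+ j) (+ a) (+ D) (+ tri a)) (cong₂ (λ u v → + j ℤ.* (+ suc a ℤ.+ + D ℤ.* u) ℤ.+ v) (sym (ℤₚ.pos-+ (tri a) a)) (trans (cong (+ j ℤ.* + tri a ℤ.*_) D*D) (sym (ℤₚ.*-assoc (+ j ℤ.* + tri a) (+ e) (+ D′)))))))))) ⟩
      (ε ↑ suc a ⊠ X^ (+ j ℤ.* (+ suc a ℤ.+ + D ℤ.* + tri (suc a)))) ⊠ x  ∎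
      where
      open SetoidReasoning setoid
      g = + j ℤ.* (+ a ℤ.+ + D ℤ.* + tri a)
      l₁ : ∀ a d → (1ℤ ℤ.+ d) ℤ.* (1ℤ ℤ.+ a ℤ.* d) ≡ 1ℤ ℤ.+ (1ℤ ℤ.+ a) ℤ.* d ℤ.+ a ℤ.* (d ℤ.* d)
      l₁ = ℤ-Solver.solve-∀
      l₂ : ∀ j a d t → (1ℤ ℤ.+ d) ℤ.* (j ℤ.* (a ℤ.+ d ℤ.* t)) ℤ.+ j ≡ j ℤ.* ((1ℤ ℤ.+ a) ℤ.+ d ℤ.* (t ℤ.+ a)) ℤ.+ (j ℤ.* t) ℤ.* (d ℤ.* d)
      l₂ = ℤ-Solver.solve-∀

    -- s^p is 1 modulo pD, so p applications of σ return x, and x cancels. The sign ε is kept apart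
    -- from the monomial because -1 need not be a power of x.
    full-turn : ∀ ε j → σ s ε ∼ ε → σ s x ∼ (ε ⊠ X^ (+ j)) ⊠ x → ε ↑ p ⊠ X^ (+ (j * (p + D * tri p))) ∼ X^ 0ℤ
    full-turn ε j σε h = ∼-trans (*-congˡ {ε ↑ p} (X^-cong exponent)) (cancel-x (∼-trans (∼-sym (iterate ε j σε h p)) (∼-trans (σ-mod (mkC 1ℤ (cong (λ z → 1ℤ ℤ.+ z) (trans (sym +D′) (sym (ℤₚ.*-identityˡ (+ D′)))))) x) (σ-id x))))
      where
      exponent : + (j * (p + D * tri p)) ≡ + j ℤ.* (+ p ℤ.+ + D ℤ.* + tri p)
      exponent = trans (ℤₚ.pos-* j (p + D * tri p)) (cong (+ j ℤ.*_) (trans (ℤₚ.pos-+ p (D * tri p)) (cong (λ z → + p ℤ.+ z) (ℤₚ.pos-* D (tri p)))))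

    -- For odd p the second factor is p(1 + Dr), and 1 + Dr is 1 modulo D. For p = 2 and D = 4f it
    -- is 2(1 + 2f), and (1 + 2f)² = 1 + 4f(1 + f) is 1 modulo D.
    D∣exponent : (p ≢ 2 ⊎ 4 ∣ D) → ∀ j → D′ ∣ j * (p + D * tri p) → D ∣ j
    D∣exponent cond j d = go (p ≟ 2)
      where
      odd : p ∣ tri p → D ∣ j
      odd (divides r tri≡) = ∣m+n∣m⇒∣n (subst (D ∣_) (l₂ j D r) (*-cancelˡ-∣ p (subst (p * D ∣_) (trans (cong (λ z → j * (p + D * z)) tri≡) (l₁ j p D r)) d))) (m∣m*n (j * r))
        where
        l₁ : ∀ j p d r → j * (p + d * (r * p)) ≡ p * (j * (1 + d * r))
        l₁ = ℕ-Solver.solve-∀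
        l₂ : ∀ j d r → j * (1 + d * r) ≡ d * (j * r) + j
        l₂ = ℕ-Solver.solve-∀
      even : p ≡ 2 → 4 ∣ D → D ∣ j
      even p≡2 (divides f D≡) = ∣m+n∣m⇒∣n (subst (D ∣_) l₂′ (∣m⇒∣m*n (1 + 2 * f) half)) (m∣m*n (j * (1 + f)))
        where
        l₁ : ∀ j f → j * (2 + f * 4 * 1) ≡ 2 * (j * (1 + 2 * f))
        l₁ = ℕ-Solver.solve-∀
        l₁′ : j * (p + D * tri p) ≡ 2 * (j * (1 + 2 * f))
        l₁′ = trans (cong₂ (λ p d → j * (p + d * tri p)) p≡2 D≡) (l₁ j f)
        half : D ∣ j * (1 + 2 * f)
        half = *-cancelˡ-∣ 2 (subst₂ _∣_ (cong (_* D) p≡2) l₁′ d)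
        l₂ : ∀ j f → j * (1 + 2 * f) * (1 + 2 * f) ≡ f * 4 * (j * (1 + f)) + j
        l₂ = ℕ-Solver.solve-∀
        l₂′ : j * (1 + 2 * f) * (1 + 2 * f) ≡ D * (j * (1 + f)) + j
        l₂′ = trans (l₂ j f) (cong (λ d → d * (j * (1 + f)) + j) (sym D≡))
      go : Dec (p ≡ 2) → D ∣ j
      go (no p≢2)  = odd (p∣tri pr p≢2)
      go (yes p≡2) = [ contradiction p≡2 , even p≡2 ]′ cond

    Multiplier : Set
    Multiplier = ∃ λ j → D ∣ j × σ s x ∼ X^ (+ j) ⊠ x

    multiplier : (p ≢ 2 ⊎ 4 ∣ D) → Multiplier
    multiplier cond = from-root σ-multiplier
      where
      instance nzD′ = tower-nonZero T′

      positive : ∀ j → σ s x ∼ X^ j ⊠ x → Multiplier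
      positive j h = j′ , D∣exponent cond j′ (X^∼1⇒∣ _ (∼-trans (∼-sym (∼-trans (*-congʳ (1↑ p)) (*-identityˡ _))) (full-turn (X^ 0ℤ) j′ (σ-1 s) (∼-trans h′ (*-congʳ {x} (∼-sym (*-identityˡ _))))))) , h′
        where
        j′ = j %ℕ D′
        h′ : σ s x ∼ X^ (+ j′) ⊠ x
        h′ = ∼-trans h (*-congʳ {x} (X^-mod (cong-%ℕ D′ j)))

      negative : ∀ j → σ s x ∼ ⊟ X^ j ⊠ x → Dec (2 ∣ D′) → Multiplier
      negative j h (yes (divides E D′≡)) = positive (+ E ℤ.+ j) (begin
        σ s x                           ≈⟨ h ⟩
        ⊟ X^ j ⊠ x                      ≈⟨ *-congʳ {x} (solve 1 (λ a → :- a := (:- con 1ℤ) :* a) ∼-refl (X^ j)) ⟩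
        (⊟ X^ 0ℤ ⊠ X^ j) ⊠ x            ≈⟨ *-congʳ {x} (∼-trans (*-congʳ {X^ j} (-1∼X^ (trans D′≡ (ℕₚ.*-comm E 2)))) (X^⊠ (+ E) j)) ⟩
        X^ (+ E ℤ.+ j) ⊠ x              ∎)
        where open SetoidReasoning setoid
      -- For odd pD the sign is impossible: (-1)^p x^N = 1 squares to x^(2N) = 1, whence x^N = 1 and
      -- (-1)^p = 1, although p is odd and 2 is not 0.
      negative j h (no odd) = ⊥-elim (absurd (nat∼𝟘⇒ 2 2∼0))
        where
        open SetoidReasoning setoid
        j′ = j %ℕ D′
        N = j′ * (p + D * tri p)
        ε = ⊟ X^ 0ℤ
        σε : σ s ε ∼ ε
        σε = ∼-trans (∼-reflexive (σ-⊟ s (X^ 0ℤ))) (-‿cong (σ-1 s))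
        h′ : σ s x ∼ (ε ⊠ X^ (+ j′)) ⊠ x
        h′ = ∼-trans h (*-congʳ {x} (∼-trans (-‿cong (X^-mod (cong-%ℕ D′ j))) (solve 1 (λ a → :- a := (:- con 1ℤ) :* a) ∼-refl (X^ (+ j′)))))
        turn : ε ↑ p ⊠ X^ (+ N) ∼ X^ 0ℤ
        turn = full-turn ε j′ σε h′
        ε²↑ : ∀ k → ε ↑ k ⊠ ε ↑ k ∼ X^ 0ℤ
        ε²↑ k = ∼-trans (∼-sym (↑-⊙ ε ε k)) (∼-trans (↑-cong k (solve 0 ((:- con 1ℤ) :* (:- con 1ℤ) := con 1ℤ) ∼-refl)) (1↑ k))
        square : X^ (+ (2 * N)) ∼ X^ 0ℤ
        square = begin
          X^ (+ (2 * N))                                   ≈⟨ X^-cong (trans (cong (λ z → + (N + z)) (ℕₚ.+-identityʳ N)) (ℤₚ.pos-+ N N)) ⟩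
          X^ (+ N ℤ.+ + N)                                 ≈⟨ X^⊠ (+ N) (+ N) ⟨
          X^ (+ N) ⊠ X^ (+ N)                              ≈⟨ *-identityˡ _ ⟨
          X^ 0ℤ ⊠ (X^ (+ N) ⊠ X^ (+ N))                    ≈⟨ *-congʳ (ε²↑ p) ⟨
          (ε ↑ p ⊠ ε ↑ p) ⊠ (X^ (+ N) ⊠ X^ (+ N))          ≈⟨ solve 2 (λ a b → (a :* a) :* (b :* b) := (a :* b) :* (a :* b)) ∼-refl (ε ↑ p) (X^ (+ N)) ⟩
          (ε ↑ p ⊠ X^ (+ N)) ⊠ (ε ↑ p ⊠ X^ (+ N))          ≈⟨ *-cong turn turn ⟩
          X^ 0ℤ ⊠ X^ 0ℤ                                    ≈⟨ *-identityˡ _ ⟩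
          X^ 0ℤ                                            ∎
        D′∣N : D′ ∣ N
        D′∣N = Coprimality.coprime-divisor (Coprimality.sym (prime∤⇒coprime prime[2] odd)) (X^∼1⇒∣ (2 * N) square)
        XN : X^ (+ N) ∼ X^ 0ℤ
        XN = X^-mod (go D′∣N)
          where
          go : D′ ∣ N → Cong D′ (+ N) 0ℤ
          go (divides k N≡) = mkC (+ k) (trans (cong +_ N≡) (trans (ℤₚ.pos-* k D′) (sym (ℤₚ.+-identityˡ _))))
        ε^p : ε ↑ p ∼ X^ 0ℤ
        ε^p = ∼-trans (∼-sym (∼-trans (*-congˡ {ε ↑ p} XN) (*-identityʳ _))) turn
        odd-power : ∀ k → ¬ 2 ∣ k → ε ↑ k ∼ ε
        odd-power zero          nd = contradiction (2 ∣0) nd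
        odd-power (suc zero)    nd = *-identityʳ ε
        odd-power (suc (suc k)) nd = ∼-trans (solve 1 (λ a → (:- con 1ℤ) :* ((:- con 1ℤ) :* a) := a) ∼-refl (ε ↑ k)) (odd-power k (λ d → nd (∣m∣n⇒∣m+n (∣-refl {2}) d)))
        2∼0 : nat 2 ∼ 𝟘
        2∼0 = begin
          nat 2                ≈⟨ solve 0 (con (+ 2) := con 1ℤ :- (:- con 1ℤ)) ∼-refl ⟩
          X^ 0ℤ ⊖ ε            ≈⟨ +-congʳ {⊟ ε} ε^p ⟨
          ε ↑ p ⊖ ε            ≈⟨ ≈⇒⊖≈0 (odd-power p (λ d → odd (∣m⇒∣m*n D d))) ⟩
          𝟘                    ∎
        absurd : 2 ≡ 0 → ⊥
        absurd ()

      from-root : (∃ λ y → σ s x ∼ y ⊠ x × IsRootOfUnity T′ y) → Multiplier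
      from-root (y , h , j , inj₁ r) = positive j (∼-trans h (*-congʳ {x} r))
      from-root (y , h , j , inj₂ r) = negative j (∼-trans h (*-congʳ {x} r)) (2 ∣? D′)

module Components {D : ℕ} (p : ℕ) .{{nzp : NonZero p}} (pr : Prime p) (p∣D : p ∣ D) (T : Tower D) where
  open Step p pr p∣D T
  open Ramified p pr p∣D T using (sub-cong; sub-reflects; /ℕ-+)
  private
    module B = Quot ℤR (tr T)
    module C = Quot ℤR (tr T′)
    module BR = CRing B.A
    module CR = CRing C.A
  open B using () renaming (_∼_ to _∼ᵀ_; at to atᵀ)
  open C using (_∼_; eq)

  lin-X^⊠ : ∀ v i a → lin (atᵀ v) (X^ i ⊠ a) ≡ lin (atᵀ (v ℤ.+ i)) a
  lin-X^⊠ v i a = B.at-⊠ v (X^ i) a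

  -- At level D the power x^e is a primitive p-th root of unity. An exponent i of class k becomes i
  -- + p(e i), and e i is e k modulo D, so σ acts on the k-th component as the scalar (x^e)^k.
  sub-σ : ∀ k a → sub p k (σ s a) ∼ᵀ X^ (+ e ℤ.* + k) ⊠ sub p k a
  sub-σ k a = B.mk∼ λ v → begin
    lin (atᵀ v) (sub p k (σ s a))                                               ≡⟨ lin-sub p k (atᵀ v) (σ s a) ⟩
    lin (λ m → sel p k m (atᵀ v (m /ℕ p))) (σ s a)                          ≡⟨ lin-σ _ s a ⟩
    lin (λ i → sel p k (s ℤ.* i) (atᵀ v ((s ℤ.* i) /ℕ p))) a                ≡⟨ lin-cong a (λ i → sel-⇔ p (trans (sym (residue i))) (trans (residue i)) (λ r → value v i (trans (sym (residue i)) r))) ⟩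
    lin (λ i → sel p k i (atᵀ (v ℤ.+ + e ℤ.* + k) (i /ℕ p))) a              ≡⟨ lin-sub p k (atᵀ (v ℤ.+ + e ℤ.* + k)) a ⟨
    lin (atᵀ (v ℤ.+ + e ℤ.* + k)) (sub p k a)                                   ≡⟨ lin-X^⊠ v (+ e ℤ.* + k) (sub p k a) ⟨
    lin (atᵀ v) (X^ (+ e ℤ.* + k) ⊠ sub p k a)                                  ∎
    where
    open ≡-Reasoning
    l₁ : ∀ e p i → (1ℤ ℤ.+ e ℤ.* p) ℤ.* i ≡ (e ℤ.* i) ℤ.* p ℤ.+ i
    l₁ = ℤ-Solver.solve-∀
    si : ∀ i → s ℤ.* i ≡ (+ e ℤ.* i) ℤ.* + p ℤ.+ i
    si i = trans (cong (λ d → (1ℤ ℤ.+ d) ℤ.* i) +D≡ep) (l₁ (+ e) (+ p) i)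
    residue : ∀ i → (s ℤ.* i) %ℕ p ≡ i %ℕ p
    residue i = %ℕ-cong p {j = i} (mkC (+ e ℤ.* i) (trans (si i) (ℤₚ.+-comm ((+ e ℤ.* i) ℤ.* + p) i)))
    quotient : ∀ i → (s ℤ.* i) /ℕ p ≡ + e ℤ.* i ℤ.+ (i /ℕ p)
    quotient i = trans (cong (_/ℕ p) (si i)) (trans (/ℕ-+ ((+ e ℤ.* i) ℤ.* + p) i (proj₁ (*p%ℕp p (+ e ℤ.* i)))) (cong (ℤ._+ (i /ℕ p)) (proj₂ (*p%ℕp p (+ e ℤ.* i)))))
    l₂ : ∀ e r q p → e ℤ.* (r ℤ.+ q ℤ.* p) ≡ e ℤ.* r ℤ.+ q ℤ.* (e ℤ.* p)
    l₂ = ℤ-Solver.solve-∀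
    eik : ∀ i → i %ℕ p ≡ k → Cong D (+ e ℤ.* i) (+ e ℤ.* + k)
    eik i r = mkC (i /ℕ p) (trans (cong (+ e ℤ.*_) (trans (a≡a%ℕn+[a/ℕn]*n i p) (cong (λ z → + z ℤ.+ (i /ℕ p) ℤ.* + p) r)))
      (trans (l₂ (+ e) (+ k) (i /ℕ p) (+ p)) (cong (λ d → + e ℤ.* + k ℤ.+ (i /ℕ p) ℤ.* d) (sym +D≡ep))))
    value : ∀ v i → i %ℕ p ≡ k → atᵀ v ((s ℤ.* i) /ℕ p) ≡ atᵀ (v ℤ.+ + e ℤ.* + k) (i /ℕ p)
    value v i r = tr-cong T (cong-trans (cong-+ (cong-refl {i = v}) (cong-trans (cong-≡ (quotient i)) (cong-+ (eik i r) (cong-refl {i = i /ℕ p}))))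
      (cong-≡ (sym (ℤₚ.+-assoc v (+ e ℤ.* + k) (i /ℕ p)))))

  sub-X^p : ∀ k m a → sub p k (X^ (m ℤ.* + p) ⊠ a) ∼ᵀ X^ m ⊠ sub p k a
  sub-X^p k m a = B.mk∼ λ v → begin
    lin (atᵀ v) (sub p k (X^ (m ℤ.* + p) ⊠ a))                                  ≡⟨ lin-sub p k (atᵀ v) (X^ (m ℤ.* + p) ⊠ a) ⟩
    lin (λ i → sel p k i (atᵀ v (i /ℕ p))) (X^ (m ℤ.* + p) ⊠ a)             ≡⟨ lin-⊠ _ (X^ (m ℤ.* + p)) a ⟩
    lin (λ i → sel p k (m ℤ.* + p ℤ.+ i) (atᵀ v ((m ℤ.* + p ℤ.+ i) /ℕ p))) a ≡⟨ lin-cong a (λ i → sel-⇔ p (trans (sym (residue i))) (trans (residue i)) (λ _ → value v i)) ⟩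
    lin (λ i → sel p k i (atᵀ (v ℤ.+ m) (i /ℕ p))) a                        ≡⟨ lin-sub p k (atᵀ (v ℤ.+ m)) a ⟨
    lin (atᵀ (v ℤ.+ m)) (sub p k a)                                             ≡⟨ lin-X^⊠ v m (sub p k a) ⟨
    lin (atᵀ v) (X^ m ⊠ sub p k a)                                              ∎
    where
    open ≡-Reasoning
    residue : ∀ i → (m ℤ.* + p ℤ.+ i) %ℕ p ≡ i %ℕ p
    residue i = %ℕ-cong p {j = i} (mkC m (ℤₚ.+-comm (m ℤ.* + p) i))
    value : ∀ v i → atᵀ v ((m ℤ.* + p ℤ.+ i) /ℕ p) ≡ atᵀ (v ℤ.+ m) (i /ℕ p)
    value v i = cong (tr T) (trans (cong (λ z → v ℤ.+ z) (trans (/ℕ-+ (m ℤ.* + p) i (proj₁ (*p%ℕp p m))) (cong (ℤ._+ (i /ℕ p)) (proj₂ (*p%ℕp p m))))) (sym (ℤₚ.+-assoc v m (i /ℕ p))))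

  module _ (l k : ℕ) (y : Poly) (l<p : l < p) where
    private
      expand : ∀ v → lin (atᵀ v) (sub p k (X^ (+ l) ⊠ σ (+ p) y)) ≡ lin (λ i → sel p k (+ l ℤ.+ + p ℤ.* i) (atᵀ v ((+ l ℤ.+ + p ℤ.* i) /ℕ p))) y
      expand v = trans (lin-sub p k (atᵀ v) (X^ (+ l) ⊠ σ (+ p) y)) (trans (lin-⊠ _ (X^ (+ l)) (σ (+ p) y)) (lin-σ _ (+ p) y))
      unique : ∀ i → (+ l ℤ.+ + p ℤ.* i) %ℕ p ≡ l × (+ l ℤ.+ + p ℤ.* i) /ℕ p ≡ i
      unique i = %ℕ-unique p (+ l ℤ.+ + p ℤ.* i) l i l<p (cong (λ z → + l ℤ.+ z) (ℤₚ.*-comm (+ p) i))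

    sub-lift-yes : l ≡ k → sub p k (X^ (+ l) ⊠ σ (+ p) y) ∼ᵀ y
    sub-lift-yes l≡k = B.mk∼ λ v → trans (expand v) (lin-cong y (λ i → trans (sel-yes p (trans (proj₁ (unique i)) l≡k)) (cong (atᵀ v) (proj₂ (unique i)))))

    sub-lift-no : l ≢ k → sub p k (X^ (+ l) ⊠ σ (+ p) y) ∼ᵀ 𝟘
    sub-lift-no l≢k = B.mk∼ λ v → trans (expand v) (lin-0 y (λ i → sel-no p (λ r → l≢k (trans (sym (proj₁ (unique i))) r))))

  -- Let z = x^e, of order p. Then z^(k-j) fixes y, and so does every power of z because k - j is
  -- invertible modulo p. Summing over all powers of z gives p y = 0.
  vanish-off : ∀ j k y → k < p → j %ℕ p ≢ k → X^ (+ e ℤ.* + k) ⊠ y ∼ᵀ X^ (+ e ℤ.* j) ⊠ y → y ∼ᵀ 𝟘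
  vanish-off j k y k<p j≢k h = go (unit-d)
    where
    open Cyc T
    d = + k ℤ.- j
    d% : ¬ p ∣ (d %ℕ p)
    d% p∣r = j≢k (trans (proj₂ (i-j%p p (+ k) j) (zero-residue (d %ℕ p) (n%ℕd<d d p) p∣r)) (%ℕ-small p k k<p))
      where
      zero-residue : ∀ r → r < p → p ∣ r → r ≡ 0
      zero-residue zero    _   _   = refl
      zero-residue (suc r) r<p p∣r = contradiction (∣⇒≤ p∣r) (ℕₚ.<⇒≱ r<p)
    unit-d : Unit p (+ (d %ℕ p))
    unit-d = coprime⇒unit (Coprimality.sym (prime∤⇒coprime pr d%))
    open SetoidReasoning BR.setoid
    l₁ : ∀ e k j → (ℤ.- (e ℤ.* j)) ℤ.+ e ℤ.* k ≡ (k ℤ.- j) ℤ.* e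
    l₁ = ℤ-Solver.solve-∀
    base : X^ (d ℤ.* + e) ⊠ y ∼ᵀ y
    base = begin
      X^ (d ℤ.* + e) ⊠ y                                     ≈⟨ BR.*-congʳ {y} (B.∼-trans (X^⊠ (ℤ.- (+ e ℤ.* j)) (+ e ℤ.* + k)) (B.X^-cong (l₁ (+ e) (+ k) j))) ⟨
      (X^ (ℤ.- (+ e ℤ.* j)) ⊠ X^ (+ e ℤ.* + k)) ⊠ y          ≈⟨ BR.*-assoc _ _ y ⟩
      X^ (ℤ.- (+ e ℤ.* j)) ⊠ (X^ (+ e ℤ.* + k) ⊠ y)          ≈⟨ BR.*-congˡ {X^ (ℤ.- (+ e ℤ.* j))} h ⟩
      X^ (ℤ.- (+ e ℤ.* j)) ⊠ (X^ (+ e ℤ.* j) ⊠ y)            ≈⟨ BR.*-assoc _ _ y ⟨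
      (X^ (ℤ.- (+ e ℤ.* j)) ⊠ X^ (+ e ℤ.* j)) ⊠ y            ≈⟨ BR.*-congʳ {y} (X^-inverse (+ e ℤ.* j)) ⟩
      X^ 0ℤ ⊠ y                                              ≈⟨ BR.*-identityˡ y ⟩
      y                                                      ∎
    powers : ∀ a → X^ (+ a ℤ.* (d ℤ.* + e)) ⊠ y ∼ᵀ y
    powers zero    = BR.*-identityˡ y
    powers (suc a) = begin
      X^ (+ suc a ℤ.* (d ℤ.* + e)) ⊠ y                       ≈⟨ BR.*-congʳ {y} (B.∼-trans (X^⊠ (d ℤ.* + e) (+ a ℤ.* (d ℤ.* + e))) (B.X^-cong (sym (ℤₚ.suc-* (+ a) (d ℤ.* + e))))) ⟨
      (X^ (d ℤ.* + e) ⊠ X^ (+ a ℤ.* (d ℤ.* + e))) ⊠ y        ≈⟨ BR.*-assoc _ _ y ⟩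
      X^ (d ℤ.* + e) ⊠ (X^ (+ a ℤ.* (d ℤ.* + e)) ⊠ y)        ≈⟨ BR.*-congˡ {X^ (d ℤ.* + e)} (powers a) ⟩
      X^ (d ℤ.* + e) ⊠ y                                     ≈⟨ base ⟩
      y                                                      ∎
    go : Unit p (+ (d %ℕ p)) → y ∼ᵀ 𝟘
    go (mkU d′ dd′) = torsion-free p (prime>0 pr) (begin
      BR.nat p ⊠ y                                            ≈⟨ Sums.∑-const B.A p y ⟨
      Sums.∑ B.A p (λ _ → y)                                  ≈⟨ Sums.∑-cong B.A p (λ i _ → turn i) ⟨
      Sums.∑ B.A p (λ i → y ⊠ X^ (+ i ℤ.* + e))               ≈⟨ Sums.∑-⊙ˡ B.A p y (λ i → X^ (+ i ℤ.* + e)) ⟩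
      y ⊠ Sums.∑ B.A p (λ i → X^ (+ i ℤ.* + e))               ≈⟨ BR.*-congˡ {y} (vanish pr (trans D≡ep (ℕₚ.*-comm e p))) ⟩
      y ⊠ 𝟘                                                   ≈⟨ BR.zeroʳ y ⟩
      𝟘                                                       ≈⟨ BR.zeroʳ (BR.nat p) ⟨
      BR.nat p ⊠ 𝟘                                            ∎)
      where
      a : ℕ → ℕ
      a i = (d′ ℤ.* + i) %ℕ p
      exponent : ∀ i → Cong D (+ i ℤ.* + e) (+ a i ℤ.* (d ℤ.* + e))
      exponent i = scale (cong-trans (cong-trans (cong-≡ (l₂ (+ i))) (cong-* (cong-sym (cong-trans (cong-* (cong-%ℕ p d) (cong-refl {i = d′})) dd′)) (cong-refl {i = + i})))
          (cong-trans (cong-≡ (l₃ d d′ (+ i))) (cong-* (cong-%ℕ p (d′ ℤ.* + i)) (cong-refl {i = d}))))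
        where
        l₂ : ∀ i → i ≡ 1ℤ ℤ.* i
        l₂ = ℤ-Solver.solve-∀
        l₃ : ∀ d d′ i → (d ℤ.* d′) ℤ.* i ≡ (d′ ℤ.* i) ℤ.* d
        l₃ = ℤ-Solver.solve-∀
        l₄ : ∀ a d k p e → (a ℤ.* d ℤ.+ k ℤ.* p) ℤ.* e ≡ a ℤ.* (d ℤ.* e) ℤ.+ k ℤ.* (e ℤ.* p)
        l₄ = ℤ-Solver.solve-∀
        scale : Cong p (+ i) (+ a i ℤ.* d) → Cong D (+ i ℤ.* + e) (+ a i ℤ.* (d ℤ.* + e))
        scale (mkC k eq) = mkC k (trans (cong (ℤ._* + e) eq) (trans (l₄ (+ a i) d k (+ p) (+ e)) (cong (λ z → + a i ℤ.* (d ℤ.* + e) ℤ.+ k ℤ.* z) (sym +D≡ep))))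
      turn : ∀ i → y ⊠ X^ (+ i ℤ.* + e) ∼ᵀ y
      turn i = B.∼-trans (B.⊠-comm y _) (B.∼-trans (BR.*-congʳ {y} (X^-mod (exponent i))) (powers (a i)))

  -- Write the multiplier as x^(j′D). On components it acts as (x^e)^(j′), whereas σ acts on the
  -- k-th one as (x^e)^k; so only the class l of j′ survives. Then x is x^l times y(x^p), the
  -- monomial drops out of the norm, and the component 0 of the norm equation is the equation at
  -- level D.
  descend : ∀ {n} .{{_ : NonZero n}} {x} → x ⊠ conj x ∼ CR.nat n → (∀ q → Prime q → q ∣ n → Ideals.FixesPrime T′ s q) → (p ≢ 2 ⊎ 4 ∣ D) →
            ∃ λ l → l < p × (∀ k → k < p → k ≢ l → sub p k x ∼ᵀ 𝟘) × sub p l x ⊠ conj (sub p l x) ∼ᵀ BR.nat n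
  descend {n} {x} norm fixes cond = go (multiplier norm fixes cond)
    where
    go : Multiplier norm fixes → _
    go (j , divides j′ j≡ , h) = l , l<p , off , norm-y
      where
      l = (+ j′) %ℕ p
      l<p = n%ℕd<d (+ j′) p
      l₁ : ∀ j e p → j ℤ.* (e ℤ.* p) ≡ (e ℤ.* j) ℤ.* p
      l₁ = ℤ-Solver.solve-∀
      j-exp : + j ≡ (+ e ℤ.* + j′) ℤ.* + p
      j-exp = trans (cong +_ j≡) (trans (ℤₚ.pos-* j′ D) (trans (cong (+ j′ ℤ.*_) +D≡ep) (l₁ (+ j′) (+ e) (+ p))))
      off : ∀ k → k < p → k ≢ l → sub p k x ∼ᵀ 𝟘
      off k k<p k≢l = vanish-off (+ j′) k (sub p k x) k<p (k≢l ∘ sym)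
        (B.∼-trans (B.∼-sym (sub-σ k x)) (B.∼-trans (sub-cong k k<p h) (B.∼-trans (B.∼-reflexive (cong (λ z → sub p k (X^ z ⊠ x)) j-exp)) (sub-X^p k (+ e ℤ.* + j′) x))))
      y = sub p l x
      x∼ : x ∼ X^ (+ l) ⊠ σ (+ p) y
      x∼ = sub-reflects λ k k<p → compare k k<p (l ≟ k)
        where
        compare : ∀ k → k < p → Dec (l ≡ k) → sub p k x ∼ᵀ sub p k (X^ (+ l) ⊠ σ (+ p) y)
        compare k k<p (yes refl) = B.∼-sym (sub-lift-yes l k y l<p refl)
        compare k k<p (no l≢k)   = B.∼-trans (off k k<p (l≢k ∘ sym)) (B.∼-sym (sub-lift-no l k y l<p l≢k))
      open Cyc T′ using (conj-cong; conj-σ; conj-X^; X^⊠)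
      σ-norm : σ (+ p) (y ⊠ conj y) ∼ σ (+ p) (BR.nat n)
      σ-norm = begin
        σ (+ p) (y ⊠ conj y)                                                        ≈⟨ C.σ-⊠ (+ p) y (conj y) ⟩
        σ (+ p) y ⊠ σ (+ p) (conj y)                                                ≈⟨ CR.*-congˡ {σ (+ p) y} (conj-σ (+ p) y) ⟨
        σ (+ p) y ⊠ conj (σ (+ p) y)                                                ≈⟨ CR.*-identityˡ _ ⟨
        X^ 0ℤ ⊠ (σ (+ p) y ⊠ conj (σ (+ p) y))                                      ≈⟨ CR.*-congʳ (C.∼-trans (CR.*-congˡ {X^ (+ l)} (C.∼-reflexive (conj-X^ (+ l)))) (C.∼-trans (X^⊠ (+ l) (ℤ.- + l)) (C.X^-cong (ℤₚ.+-inverseʳ (+ l))))) ⟨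
        (X^ (+ l) ⊠ conj (X^ (+ l))) ⊠ (σ (+ p) y ⊠ conj (σ (+ p) y))               ≈⟨ CR.solve 4 (λ a b c d → (a CR.:* b) CR.:* (c CR.:* d) CR.:= (a CR.:* c) CR.:* (b CR.:* d)) C.∼-refl (X^ (+ l)) (conj (X^ (+ l))) (σ (+ p) y) (conj (σ (+ p) y)) ⟩
        (X^ (+ l) ⊠ σ (+ p) y) ⊠ (conj (X^ (+ l)) ⊠ conj (σ (+ p) y))               ≈⟨ CR.*-congˡ {X^ (+ l) ⊠ σ (+ p) y} (C.σ-⊠ ℤ.-1ℤ (X^ (+ l)) (σ (+ p) y)) ⟨
        (X^ (+ l) ⊠ σ (+ p) y) ⊠ conj (X^ (+ l) ⊠ σ (+ p) y)                        ≈⟨ CR.*-cong x∼ (conj-cong x∼) ⟨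
        x ⊠ conj x                                                                  ≈⟨ norm ⟩
        CR.nat n                                                                    ≈⟨ C.σ-nat (+ p) n ⟨
        σ (+ p) (CR.nat n)                                                          ≡⟨ cong (σ (+ p)) (nat≡ n) ⟩
        σ (+ p) (BR.nat n)                                                          ∎
        where
        open SetoidReasoning CR.setoid
        nat≡ : ∀ n → CR.nat n ≡ BR.nat n
        nat≡ zero    = refl
        nat≡ (suc n) = cong (X^ 0ℤ ⊞_) (nat≡ n)
      unlift : ∀ a → sub p 0 (σ (+ p) a) ∼ᵀ a
      unlift a = B.∼-trans (B.mk∼ (λ v → sym (trans (lin-sub p 0 (atᵀ v) (X^ 0ℤ ⊠ σ (+ p) a)) (trans (lin-⊠ _ (X^ 0ℤ) (σ (+ p) a)) (trans (lin-cong (σ (+ p) a) (λ i → cong (λ z → sel p 0 z (atᵀ v (z /ℕ p))) (ℤₚ.+-identityˡ i))) (sym (lin-sub p 0 (atᵀ v) (σ (+ p) a)))))))) (sub-lift-yes 0 0 a (prime>0 pr) refl)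
      norm-y : y ⊠ conj y ∼ᵀ BR.nat n
      norm-y = B.∼-trans (B.∼-sym (unlift (y ⊠ conj y))) (B.∼-trans (sub-cong 0 (prime>0 pr) σ-norm) (unlift (BR.nat n)))

-- Irreducibility of the cyclotomic polynomials

private
  module ℤsum = SemiringSum (CommutativeRing.semiring ℤR)

-- Gaussian elimination without fractions, one coordinate at a time.
linear-dependence : ∀ h (v : Fin (suc h) → Fin h → ℤ) →
  ∃ λ (k : Fin (suc h) → ℤ) → (∃ λ i → k i ≢ 0ℤ) × (∀ r → ℤsum.sum (λ i → k i ℤ.* v i r) ≡ 0ℤ)
linear-dependence zero v = (λ _ → 1ℤ) , (fzero , λ ()) , λ ()
linear-dependence (suc h) v = go (Finₚ.any? (λ i → ¬? (v i fzero ℤ.≟ 0ℤ)))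
  where
  Goal = ∃ λ (k : Fin (suc (suc h)) → ℤ) → (∃ λ i → k i ≢ 0ℤ) × (∀ r → ℤsum.sum (λ i → k i ℤ.* v i r) ≡ 0ℤ)

  no-pivot : (∀ i → v i fzero ≡ 0ℤ) → Goal
  no-pivot z = from (linear-dependence h (λ i r → v (fsuc i) (fsuc r)))
    where
    from : _ → Goal
    from (k , (i₀ , ne) , rel) = K , (fsuc i₀ , ne) , λ
      { fzero    → trans (ℤsum.sum-cong-≗ (λ i → trans (cong (K i ℤ.*_) (z i)) (ℤₚ.*-zeroʳ (K i)))) (ℤsum.sum-replicate-zero (suc (suc h)))
      ; (fsuc r) → trans (ℤₚ.+-identityˡ _) (rel r) }
      where
      K : Fin (suc (suc h)) → ℤ
      K fzero    = 0ℤ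
      K (fsuc i) = k i

  pivot : (∃ λ i → ¬ v i fzero ≡ 0ℤ) → Goal
  pivot (i₀ , a≢0) = from (linear-dependence h w)
    where
    a = v i₀ fzero
    others : Fin (suc h) → Fin (suc h) → ℤ
    others j = v (Data.Fin.punchIn i₀ j)
    w : Fin (suc h) → Fin h → ℤ
    -- Cross-multiplication with the pivot `a` clears the first coordinate. A dependence `k` of
    -- these vectors lifts to `a` times `k`, and the coefficient at the pivot restores the relation
    -- in the first coordinate.
    w j r = a ℤ.* others j (fsuc r) ℤ.- others j fzero ℤ.* v i₀ (fsuc r)
    from : _ → Goal
    from (k , (j₀ , ne) , rel) = K , (Data.Fin.punchIn i₀ j₀ , nonzero) , relation
      where
      b = ℤ.- ℤsum.sum (λ j → k j ℤ.* others j fzero)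
      K : Fin (suc (suc h)) → ℤ
      K = Data.Vec.Functional.insertAt (λ j → a ℤ.* k j) i₀ b
      K-pivot : K i₀ ≡ b
      K-pivot = VecFₚ.insertAt-lookup (λ j → a ℤ.* k j) i₀ b
      K-other : ∀ j → K (Data.Fin.punchIn i₀ j) ≡ a ℤ.* k j
      K-other j = VecFₚ.insertAt-punchIn (λ j → a ℤ.* k j) i₀ b j
      nonzero : K (Data.Fin.punchIn i₀ j₀) ≢ 0ℤ
      nonzero e = [ a≢0 , ne ]′ (ℤₚ.i*j≡0⇒i≡0∨j≡0 a (trans (sym (K-other j₀)) e))
      expand : ∀ r → ℤsum.sum (λ i → K i ℤ.* v i r) ≡ b ℤ.* v i₀ r ℤ.+ ℤsum.sum (λ j → a ℤ.* k j ℤ.* others j r)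
      expand r = trans (ℤsum.sum-remove {i = i₀} (λ i → K i ℤ.* v i r))
        (cong₂ ℤ._+_ (cong (ℤ._* v i₀ r) K-pivot) (ℤsum.sum-cong-≗ (λ j → cong (ℤ._* others j r) (K-other j))))
      scale : ∀ c (f : Fin (suc h) → ℤ) → ℤsum.sum (λ j → c ℤ.* f j) ≡ c ℤ.* ℤsum.sum f
      scale c f = sym (ℤsum.*-distribˡ-sum c f)
      l₁ : ∀ a k o → a ℤ.* k ℤ.* o ≡ a ℤ.* (k ℤ.* o)
      l₁ = ℤ-Solver.solve-∀
      l₂ : ∀ s a → (ℤ.- s) ℤ.* a ℤ.+ a ℤ.* s ≡ 0ℤ
      l₂ = ℤ-Solver.solve-∀
      l₃ : ∀ a k o p v → a ℤ.* k ℤ.* o ≡ v ℤ.* (k ℤ.* p) ℤ.+ k ℤ.* (a ℤ.* o ℤ.- p ℤ.* v)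
      l₃ = ℤ-Solver.solve-∀
      l₄ : ∀ s v x → (ℤ.- s) ℤ.* v ℤ.+ (v ℤ.* s ℤ.+ x) ≡ x
      l₄ = ℤ-Solver.solve-∀
      relation : ∀ r → ℤsum.sum (λ i → K i ℤ.* v i r) ≡ 0ℤ
      relation fzero = trans (expand fzero) (trans
        (cong (λ z → b ℤ.* a ℤ.+ z) (trans (ℤsum.sum-cong-≗ (λ j → l₁ a (k j) (others j fzero))) (scale a (λ j → k j ℤ.* others j fzero))))
        (l₂ (ℤsum.sum (λ j → k j ℤ.* others j fzero)) a))
      relation (fsuc r) = trans (expand (fsuc r)) (trans
        (cong (λ z → b ℤ.* v i₀ (fsuc r) ℤ.+ z) (trans (ℤsum.sum-cong-≗ (λ j → l₃ a (k j) (others j (fsuc r)) (others j fzero) (v i₀ (fsuc r))))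
          (trans (ℤsum.∑-distrib-+ (λ j → v i₀ (fsuc r) ℤ.* (k j ℤ.* others j fzero)) (λ j → k j ℤ.* w j r))
            (cong (ℤ._+ ℤsum.sum (λ j → k j ℤ.* w j r)) (scale (v i₀ (fsuc r)) (λ j → k j ℤ.* others j fzero))))))
        (trans (l₄ (ℤsum.sum (λ j → k j ℤ.* others j fzero)) (v i₀ (fsuc r)) (ℤsum.sum (λ j → k j ℤ.* w j r))) (rel r)))

  go : Dec (∃ λ i → ¬ v i fzero ≡ 0ℤ) → Goal
  go (yes pv) = pivot pv
  go (no ¬pv) = no-pivot (λ i → decidable-stable (v i fzero ℤ.≟ 0ℤ) (λ ne → ¬pv (i , ne)))

-- One expression for all quotients; the zero functional only selects a ring structure on `Poly`
-- whose operations are the constructors.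
const : ℤ → Poly
const = CRing.int (Quot.A ℤR (λ _ → 0ℤ))

module Constants (R : CommutativeRing 0ℓ 0ℓ) (t : ℤ → CommutativeRing.Carrier R) where
  open Quot R t
  open CRing A
  private module RR = CRing R

  nat-const : ∀ n → nat n ≡ CRing.nat (Quot.A ℤR (λ _ → 0ℤ)) n
  nat-const zero    = refl
  nat-const (suc n) = cong (X^ 0ℤ ⊞_) (nat-const n)

  lin-const : ∀ f k → Lin.lin R f (const k) RR.≈ RR.int k RR.⊙ f 0ℤ
  lin-const f (+ n)    = RR.≈-trans (RR.≈-reflexive (cong (Lin.lin R f) (sym (nat-const n)))) (lin-nat f n)
  lin-const f -[1+ n ] = RR.≈-trans (RR.-‿cong (RR.≈-trans (RR.≈-reflexive (cong (Lin.lin R f) (sym (nat-const (suc n))))) (lin-nat f (suc n))))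
    (RR.solve 2 (λ a b → RR.:- (a RR.:* b) RR.:= (RR.:- a) RR.:* b) RR.≈-refl (RR.nat (suc n)) (f 0ℤ))

  lin-const⊠ : ∀ j k a → Lin.lin R (at j) (const k ⊠ a) RR.≈ RR.int k RR.⊙ Lin.lin R (at j) a
  lin-const⊠ j k a = RR.≈-trans (at-⊠ j (const k) a) (RR.≈-trans (lin-const _ k)
    (RR.*-congˡ (RR.≈-reflexive (cong (λ z → Lin.lin R (at z) a) (ℤₚ.+-identityʳ j)))))

horner : List ℤ → Poly → Poly
horner []       z = 𝟘
horner (k ∷ ks) z = const k ⊞ z ⊠ horner ks z

module Horner (R : CommutativeRing 0ℓ 0ℓ) (t : ℤ → CommutativeRing.Carrier R) where
  open Quot R t
  open CRing A
  open Constants R t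

  -- As z is no zero divisor, factors z are cancelled until the constant coefficient k is non-zero.
  -- Then z divides the non-zero integer k.
  horner-root : ∀ z → (∀ a → z ⊠ a ∼ 𝟘 → a ∼ 𝟘) → ∀ ks → Any (_≢ 0ℤ) ks → horner ks z ∼ 𝟘 →
                ∃₂ λ k w → k ≢ 0ℤ × const k ⊞ z ⊠ w ∼ 𝟘
  horner-root z nzd (k ∷ ks) nz e = go (k ℤ.≟ 0ℤ) nz
    where
    go : Dec (k ≡ 0ℤ) → Any (_≢ 0ℤ) (k ∷ ks) → ∃₂ λ k w → k ≢ 0ℤ × const k ⊞ z ⊠ w ∼ 𝟘
    go (no k≢0)   _            = k , horner ks z , k≢0 , e
    go (yes refl) (here k≢0)   = contradiction refl k≢0
    go (yes refl) (there rest) = horner-root z nzd ks rest (nzd _ (∼-trans (∼-sym (+-identityˡ _)) e))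

  horner-tabulate : ∀ {n} (k : Fin n → ℤ) z → horner (Data.List.tabulate k) z ∼ sumFin A (λ i → const (k i) ⊠ z ↑ toℕ i)
  horner-tabulate {zero}  k z = ∼-refl
  horner-tabulate {suc n} k z = +-cong (∼-sym (*-identityʳ (const (k fzero)))) (∼-trans (*-congˡ {z} (horner-tabulate (k ∘ fsuc) z)) (shift (k ∘ fsuc)))
    where
    shift : ∀ {m} (k : Fin m → ℤ) → z ⊠ sumFin A (λ i → const (k i) ⊠ z ↑ toℕ i) ∼ sumFin A (λ i → const (k i) ⊠ z ↑ suc (toℕ i))
    shift = shift′ toℕ
      where
      shift′ : ∀ {m} (d : Fin m → ℕ) (k : Fin m → ℤ) → z ⊠ sumFin A (λ i → const (k i) ⊠ z ↑ d i) ∼ sumFin A (λ i → const (k i) ⊠ z ↑ suc (d i))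
      shift′ {zero}  d k = zeroʳ z
      shift′ {suc m} d k = ∼-trans (distribˡ z _ _) (+-cong
        (solve 3 (λ z c w → z :* (c :* w) := c :* (z :* w)) ∼-refl z (const (k fzero)) (z ↑ d fzero))
        (shift′ (d ∘ fsuc) (k ∘ fsuc)))

-- ℤ[x]/(xʰ - 1).
module GroupRing (h : ℕ) .{{nzh : NonZero h}} where
  -- The coefficient of 1. Pairing with x^j reads the coefficient of x^(-j), so the radical is
  -- generated by x^h - 1.
  u : ℤ → ℤ
  u i = sel h 0 i 1ℤ

  coefficient : ℕ → Poly → ℤ
  coefficient k = lin (λ i → sel h k i 1ℤ)

  open Quot ℤR u
  open CRing A
  open Constants ℤR u
  open Horner ℤR u

  at≡coefficient : ∀ j a → lin (at j) a ≡ coefficient ((ℤ.- j) %ℕ h) a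
  at≡coefficient j a = lin-cong a (λ i → sel-⇔ h {0} {(ℤ.- j) %ℕ h} {j ℤ.+ i} {i}
      (λ e → proj₂ (i-j%p h (ℤ.- j) i) (trans (cong (_%ℕ h) (l₁ j i)) (neg {j ℤ.+ i} e)))
      (λ e → neg′ {j ℤ.+ i} (trans (cong (_%ℕ h) (sym (l₁ j i))) (proj₁ (i-j%p h (ℤ.- j) i) e))) (λ _ → refl))
    where
    l₁ : ∀ j i → (ℤ.- j) ℤ.- i ≡ ℤ.-1ℤ ℤ.* (j ℤ.+ i)
    l₁ = ℤ-Solver.solve-∀
    neg : ∀ {m} → m %ℕ h ≡ 0 → (ℤ.-1ℤ ℤ.* m) %ℕ h ≡ 0
    neg {m} = proj₁ (%ℕ-unit h {ℤ.-1ℤ} {m} -1-unit)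
    neg′ : ∀ {m} → (ℤ.-1ℤ ℤ.* m) %ℕ h ≡ 0 → m %ℕ h ≡ 0
    neg′ {m} = proj₂ (%ℕ-unit h {ℤ.-1ℤ} {m} -1-unit)

  ∼𝟘⇒coefficients : ∀ a → a ∼ 𝟘 → ∀ k → k < h → coefficient k a ≡ 0ℤ
  ∼𝟘⇒coefficients a e k k<h = trans (cong (λ z → coefficient z a) (sym (trans (cong (_%ℕ h) (ℤₚ.neg-involutive (+ k))) (%ℕ-small h k k<h)))) (trans (sym (at≡coefficient (ℤ.- + k) a)) (eq e (ℤ.- + k)))

  -- The h + 1 powers z^0, ..., z^h lie in a module of rank h.
  algebraic : ∀ z → ∃ λ ks → Any (_≢ 0ℤ) ks × horner ks z ∼ 𝟘
  algebraic z = go (linear-dependence h (λ i r → coefficient (toℕ r) (z ↑ toℕ i)))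
    where
    go : _ → ∃ λ ks → Any (_≢ 0ℤ) ks × horner ks z ∼ 𝟘
    go (k , (i , ne) , rel) = Data.List.tabulate k , Anyₚ.tabulate⁺ {f = k} i ne ,
      ∼-trans (horner-tabulate k z) (mk∼ λ j → trans (expand j k toℕ) (trans (ℤsum.sum-cong-≗ (λ i → cong (k i ℤ.*_) (residue j i))) (rel (fromℕ< (n%ℕd<d (ℤ.- j) h)))))
      where
      expand : ∀ j {m} (k : Fin m → ℤ) (d : Fin m → ℕ) → lin (at j) (sumFin A (λ i → const (k i) ⊠ z ↑ d i)) ≡ ℤsum.sum (λ i → k i ℤ.* lin (at j) (z ↑ d i))
      expand j {zero}  k d = refl
      expand j {suc m} k d = cong₂ ℤ._+_ (trans (lin-const⊠ j (k fzero) (z ↑ d fzero)) (cong (ℤ._* lin (at j) (z ↑ d fzero)) (int≡ (k fzero)))) (expand j (k ∘ fsuc) (d ∘ fsuc))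
        where
        int≡ : ∀ k → CRing.int ℤR k ≡ k
        int≡ (+ n)    = nat≡+ n
        int≡ -[1+ n ] = cong ℤ.-_ (nat≡+ (suc n))
      residue : ∀ j i → lin (at j) (z ↑ toℕ i) ≡ coefficient (toℕ (fromℕ< (n%ℕd<d (ℤ.- j) h))) (z ↑ toℕ i)
      residue j i = trans (at≡coefficient j (z ↑ toℕ i)) (cong (λ k → coefficient k (z ↑ toℕ i)) (sym (Finₚ.toℕ-fromℕ< (n%ℕd<d (ℤ.- j) h))))

-- Landau's argument: relations pass to the conjugates of ζ

k<p^k : ∀ {p} → 1 < p → ∀ k → k < p ^ k
k<p^k {p} 1<p zero    = s≤s z≤n
k<p^k {p} 1<p (suc k) = begin-strict
  suc k              ≤⟨ k<p^k 1<p k ⟩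
  p ^ k              <⟨ ℕₚ.m<m*n (p ^ k) p {{>-nonZero (ℕₚ.≤-<-trans z≤n (k<p^k 1<p k))}} 1<p ⟩
  p ^ k * p          ≡⟨ ℕₚ.*-comm (p ^ k) p ⟩
  p ^ suc k          ∎
  where open ℕₚ.≤-Reasoning

module Landau (h : ℕ) .{{nzh : NonZero h}} (s : ℕ) (coprime : Coprime s h) where
  coprimeProduct : ℕ → ℕ
  coprimeProduct zero    = 1
  coprimeProduct (suc M) with gcd (suc M) s ≟ 1
  ... | yes _ = suc M * coprimeProduct M
  ... | no _  = coprimeProduct M

  coprimeProduct>0 : ∀ M → 0 < coprimeProduct M
  coprimeProduct>0 zero = s≤s z≤n
  coprimeProduct>0 (suc M) with gcd (suc M) s ≟ 1
  ... | yes _ = ℕₚ.*-mono-≤ (s≤s (z≤n {M})) (coprimeProduct>0 M)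
  ... | no _  = coprimeProduct>0 M

  ∣coprimeProduct : ∀ M k → 0 < k → k ≤ M → gcd k s ≡ 1 → k ∣ coprimeProduct M
  ∣coprimeProduct zero    k 0<k k≤0 _ = contradiction 0<k (ℕₚ.≤⇒≯ k≤0)
  ∣coprimeProduct (suc M) k 0<k k≤M g with gcd (suc M) s ≟ 1 | ℕₚ.m≤n⇒m<n∨m≡n k≤M
  ... | yes _ | inj₁ (s≤s k≤) = ∣n⇒∣m*n (suc M) (∣coprimeProduct M k 0<k k≤ g)
  ... | yes _ | inj₂ refl     = m∣m*n _
  ... | no _  | inj₁ (s≤s k≤) = ∣coprimeProduct M k 0<k k≤ g
  ... | no ne | inj₂ refl     = contradiction g ne

  prime∣coprimeProduct : ∀ M {ℓ} → Prime ℓ → ℓ ∣ coprimeProduct M → ¬ ℓ ∣ s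
  prime∣coprimeProduct zero    pr d _ = contradiction (∣1⇒≡1 d) (ℕₚ.<⇒≢ (prime>1 pr) ∘ sym)
  prime∣coprimeProduct (suc M) {ℓ} pr d ℓ∣s with gcd (suc M) s ≟ 1
  ... | no _  = prime∣coprimeProduct M pr d ℓ∣s
  ... | yes g with euclidsLemma (suc M) (coprimeProduct M) pr d
  ...   | inj₁ ℓ∣M = contradiction (∣1⇒≡1 (subst (ℓ ∣_) g (gcd-greatest ℓ∣M ℓ∣s))) (ℕₚ.<⇒≢ (prime>1 pr) ∘ sym)
  ...   | inj₂ ℓ∣c = prime∣coprimeProduct M pr ℓ∣c ℓ∣s

  lifted : ℕ → ℕ
  lifted M = s + coprimeProduct M * h

  lifted>0 : ∀ M → 0 < lifted M
  lifted>0 M = ℕₚ.<-≤-trans (ℕₚ.*-mono-≤ (coprimeProduct>0 M) (ℕₚ.n≢0⇒n>0 (≢-nonZero⁻¹ h))) (ℕₚ.m≤n+m _ s)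

  -- This replaces Dirichlet's theorem: the class of s modulo h contains a number without prime
  -- factors up to M. A prime ℓ <= M that divides s divides neither the product nor h; one that does
  -- not divide s divides the product.
  lifted-rough : ∀ M {ℓ} → Prime ℓ → ℓ ∣ lifted M → M < ℓ
  lifted-rough M {ℓ} pr d = ℕₚ.≰⇒> λ ℓ≤M → go ℓ≤M (ℓ ∣? s)
    where
    not-h : ℓ ∣ s → ¬ ℓ ∣ h
    not-h ℓ∣s ℓ∣h = contradiction (coprime (ℓ∣s , ℓ∣h)) (ℕₚ.<⇒≢ (prime>1 pr) ∘ sym)
    go : ℓ ≤ M → Dec (ℓ ∣ s) → ⊥
    go ℓ≤M (yes ℓ∣s) = [ (λ x → prime∣coprimeProduct M pr x ℓ∣s) , not-h ℓ∣s ]′ (euclidsLemma (coprimeProduct M) h pr (∣m+n∣m⇒∣n d ℓ∣s))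
    go ℓ≤M (no ℓ∤s)  = ℓ∤s (∣m+n∣m⇒∣n (subst (ℓ ∣_) (ℕₚ.+-comm s _) d) (∣m⇒∣m*n h (∣coprimeProduct M ℓ (prime>0 pr) ℓ≤M (Coprimality.coprime⇒gcd≡1 (prime∤⇒coprime pr ℓ∤s)))))

module Transfer (R : CommutativeRing 0ℓ 0ℓ) (domain : IsIntegralDomain R) (char0 : HasCharZero R)
                (h : ℕ) .{{nzh : NonZero h}} (ζ : CommutativeRing.Carrier R) (prim : IsPrimitiveRoot R h ζ) where
  open CRing R
  open Sums R renaming (∑ to ∑ᴿ; ∑-cong to ∑ᴿ-cong)
  open Lin R using () renaming (lin to linᴿ; lin-cong to linᴿ-cong; lin-⊠ to linᴿ-⊠; lin-σ to linᴿ-σ; lin-⊙ˡ to linᴿ-⊙ˡ)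

  χ : ℤ → Carrier
  χ i = ζ ↑ (i %ℕ h)

  χ-cong : ∀ {i j} → Cong h i j → χ i ≡ χ j
  χ-cong cg = cong (ζ ↑_) (%ℕ-cong h cg)

  χ-nat : ∀ n → χ (+ n) ≈ ζ ↑ n
  χ-nat n = ≈-sym (begin
    ζ ↑ n                             ≈⟨ ≈-reflexive (cong (ζ ↑_) (m≡m%n+[m/n]*n n h)) ⟩
    ζ ↑ (n % h + n / h * h)           ≈⟨ ↑-+ ζ (n % h) (n / h * h) ⟩
    ζ ↑ (n % h) ⊙ ζ ↑ (n / h * h)     ≈⟨ *-congˡ (≈-trans (↑-* ζ (n / h) h) (≈-trans (↑-cong (n / h) (proj₁ prim)) (1↑ (n / h)))) ⟩
    ζ ↑ (n % h) ⊙ 1#                  ≈⟨ *-identityʳ _ ⟩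
    ζ ↑ (n % h)                       ≈⟨ ≈-reflexive (cong (ζ ↑_) (sym (proj₁ (%ℕ-unique h (+ n) (n % h) (+ (n / h)) (m%n<n n h) (trans (cong +_ (m≡m%n+[m/n]*n n h)) (cong (λ z → + (n % h) ℤ.+ z) (ℤₚ.pos-* (n / h) h))))))) ⟩
    χ (+ n)                           ∎)
    where open SetoidReasoning setoid

  χ-+ : ∀ i j → χ (i ℤ.+ j) ≈ χ i ⊙ χ j
  χ-+ i j = begin
    χ (i ℤ.+ j)                                    ≈⟨ ≈-reflexive (χ-cong (cong-+ (cong-%ℕ h i) (cong-%ℕ h j))) ⟩
    χ (+ (i %ℕ h) ℤ.+ + (j %ℕ h))          ≈⟨ ≈-reflexive (cong χ (sym (ℤₚ.pos-+ (i %ℕ h) (j %ℕ h)))) ⟩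
    χ (+ (i %ℕ h + j %ℕ h))                ≈⟨ χ-nat _ ⟩
    ζ ↑ (i %ℕ h + j %ℕ h)                  ≈⟨ ↑-+ ζ (i %ℕ h) (j %ℕ h) ⟩
    χ i ⊙ χ j                                      ∎
    where open SetoidReasoning setoid

  χ-0 : χ 0ℤ ≈ 1#
  χ-0 = χ-nat 0

  ev : Poly → Carrier
  ev = linᴿ χ

  ev-⊠ : ∀ a b → ev (a ⊠ b) ≈ ev a ⊙ ev b
  ev-⊠ a b = begin
    ev (a ⊠ b)                              ≈⟨ linᴿ-⊠ χ a b ⟩
    linᴿ (λ i → linᴿ (λ j → χ (i ℤ.+ j)) b) a ≈⟨ linᴿ-cong a (λ i → ≈-trans (linᴿ-cong b (λ j → χ-+ i j)) (≈-trans (linᴿ-⊙ˡ b (χ i) χ) (*-comm _ _))) ⟩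
    linᴿ (λ i → ev b ⊙ χ i) a               ≈⟨ linᴿ-⊙ˡ a (ev b) χ ⟩
    ev b ⊙ ev a                             ≈⟨ *-comm _ _ ⟩
    ev a ⊙ ev b                             ∎
    where open SetoidReasoning setoid

  private
    module Z = Quot R χ
    module ZR = CRing Z.A
    module G = GroupRing h
    module GQ = Quot ℤR G.u
    module GR = CRing GQ.A

  linᴿ-at : ∀ j a → linᴿ (Z.at j) a ≈ χ j ⊙ ev a
  linᴿ-at j a = ≈-trans (linᴿ-cong a (λ i → χ-+ j i)) (linᴿ-⊙ˡ a (χ j) χ)

  -- χ is multiplicative, so testing against x^j only multiplies by ζ^j. This quotient is therefore
  -- the image ℤ[ζ] in `R`.
  ev⇒∼ : ∀ {a b} → ev a ≈ ev b → a Z.∼ b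
  ev⇒∼ {a} {b} e = Z.mk∼ λ j → ≈-trans (linᴿ-at j a) (≈-trans (*-congˡ e) (≈-sym (linᴿ-at j b)))

  ∼⇒ev : ∀ {a b} → a Z.∼ b → ev a ≈ ev b
  ∼⇒ev {a} {b} e = ≈-trans (expand a) (≈-trans (Z.eq e 0ℤ) (≈-sym (expand b)))
    where
    expand : ∀ a → ev a ≈ linᴿ (Z.at 0ℤ) a
    expand a = ≈-sym (≈-trans (linᴿ-at 0ℤ a) (≈-trans (*-congʳ χ-0) (*-identityˡ _)))

  int-0⇒ : ∀ k → int k ≈ 0# → k ≡ 0ℤ
  int-0⇒ (+ n)    e = cong +_ (char0 n e)
  int-0⇒ -[1+ n ] e = contradiction (char0 (suc n) (≈-trans (solve 1 (λ a → a := :- (:- a)) ≈-refl (nat (suc n))) (≈-trans (-‿cong e) (solve 0 (:- con 0ℤ := con 0ℤ) ≈-refl)))) λ ()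

  ev-expansion : ∀ a → ev a ≈ ∑ᴿ h (λ k → int (G.coefficient k a) ⊙ χ (+ k))
  ev-expansion 𝟘 = ≈-sym (∑-zero h (λ k _ → zeroˡ _))
  ev-expansion (X^ i) = ≈-sym (≈-trans
    (∑-single h (λ k → int (sel h k i 1ℤ) ⊙ χ (+ k)) (i %ℕ h) (n%ℕd<d i h) (λ k _ k≢ → ≈-trans (*-congʳ (≈-reflexive (cong int (sel-no h (k≢ ∘ sym))))) (zeroˡ _)))
    (≈-trans (*-cong (≈-trans (≈-reflexive (cong int (sel-yes h refl))) nat-1) (≈-reflexive (χ-cong (cong-sym (cong-%ℕ h i))))) (*-identityˡ _)))
  ev-expansion (a ⊞ b) = ≈-trans (+-cong (ev-expansion a) (ev-expansion b)) (≈-trans (≈-sym (∑-⊕ h _ _))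
    (∑ᴿ-cong h (λ k _ → ≈-trans (≈-sym (distribʳ _ _ _)) (*-congʳ (≈-sym (int-+ (G.coefficient k a) (G.coefficient k b)))))))
  ev-expansion (⊟ a) = ≈-trans (-‿cong (ev-expansion a)) (≈-trans (≈-sym (∑-⊝ h _))
    (∑ᴿ-cong h (λ k _ → ≈-trans (solve 2 (λ a b → :- (a :* b) := (:- a) :* b) ≈-refl _ _) (*-congʳ (≈-sym (int-neg (G.coefficient k a)))))))

  group⇒∼ : ∀ {a} → a GQ.∼ 𝟘 → a Z.∼ 𝟘
  group⇒∼ {a} e = ev⇒∼ (≈-trans (ev-expansion a) (∑-zero h (λ k k<h → ≈-trans (*-congʳ (≈-reflexive (cong int (G.∼𝟘⇒coefficients a e k k<h)))) (zeroˡ _))))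

  ev-const : ∀ k → ev (const k) ≈ int k
  ev-const k = ≈-trans (Constants.lin-const R χ χ k) (≈-trans (*-congˡ χ-0) (*-identityʳ _))

  -- z is algebraic by counting ranks in ℤ[x]/(x^h - 1), and it is no zero divisor in ℤ[ζ]. The
  -- integer k so obtained bounds the primes that can divide z.
  integer-multiple : ∀ z → ¬ ev z ≈ 0# → ∃₂ λ k w → k ≢ 0ℤ × const k ⊞ z ⊠ w Z.∼ 𝟘
  integer-multiple z z≉0 = go (G.algebraic z)
    where
    nzd : ∀ a → z ⊠ a Z.∼ 𝟘 → a Z.∼ 𝟘
    nzd a e = ev⇒∼ ([ (λ z≈0 → contradiction z≈0 z≉0) , id ]′ (proj₂ domain (ev z) (ev a) (≈-trans (≈-sym (ev-⊠ z a)) (∼⇒ev e))))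
    go : (∃ λ ks → Any (_≢ 0ℤ) ks × horner ks z GQ.∼ 𝟘) → ∃₂ λ k w → k ≢ 0ℤ × const k ⊞ z ⊠ w Z.∼ 𝟘
    go (ks , nz , e) = Horner.horner-root R χ z nzd ks nz (group⇒∼ e)

  -- 1 - pb is a non-zero-divisor of ℤ[x]/(xʰ - 1), so one of its multiples is a nonzero integer.
  p-not-unit : ∀ {p} → Prime p → ∀ b → ¬ ev (GR.nat p ⊠ b) ≈ 1#
  p-not-unit {p} pr b e = go (G.algebraic z)
    where
    z : Poly
    z = X^ 0ℤ GR.⊖ GR.nat p ⊠ b
    ev-z : ev z ≈ 0#
    ev-z = ≈⇒⊖≈0 (≈-trans χ-0 (≈-sym e))
    nzd : ∀ a → z ⊠ a GQ.∼ 𝟘 → a GQ.∼ 𝟘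
    -- z a = 0 says a = p b a; iterating this makes every coefficient of a divisible by all powers
    -- of p.
    nzd a za = GQ.mk∼ λ j → small (lin (GQ.at j) a) λ N → divisible j N
      where
      absorb : a GQ.∼ GR.nat p ⊠ (b ⊠ a)
      absorb = GR.⊖≈0⇒≈ (GQ.∼-trans (GR.solve 3 (λ a p b → a GR.:- p GR.:* (b GR.:* a) GR.:= (GR.con 1ℤ GR.:- p GR.:* b) GR.:* a) GQ.∼-refl a (GR.nat p) b) za)
      iterate : ∀ N → ∃ λ w → a GQ.∼ GR.nat (p ^ N) ⊠ (w ⊠ a)
      iterate zero    = X^ 0ℤ , GR.≈-sym (GR.≈-trans (GR.*-cong GR.nat-1 (GR.*-identityˡ a)) (GR.*-identityˡ a))
      iterate (suc N) = step (iterate N)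
        where
        open SetoidReasoning GR.setoid
        step : (∃ λ w → a GQ.∼ GR.nat (p ^ N) ⊠ (w ⊠ a)) → ∃ λ w → a GQ.∼ GR.nat (p ^ suc N) ⊠ (w ⊠ a)
        step (w , ew) = b ⊠ w , (begin
          a                                                      ≈⟨ absorb ⟩
          GR.nat p ⊠ (b ⊠ a)                                     ≈⟨ GR.*-congˡ {GR.nat p} (GR.*-congˡ {b} ew) ⟩
          GR.nat p ⊠ (b ⊠ (GR.nat (p ^ N) ⊠ (w ⊠ a)))            ≈⟨ GR.solve 5 (λ p b q w a → p GR.:* (b GR.:* (q GR.:* (w GR.:* a))) GR.:= (p GR.:* q) GR.:* ((b GR.:* w) GR.:* a)) GQ.∼-refl (GR.nat p) b (GR.nat (p ^ N)) w a ⟩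
          (GR.nat p ⊠ GR.nat (p ^ N)) ⊠ ((b ⊠ w) ⊠ a)            ≈⟨ GR.*-congʳ (GR.nat-* p (p ^ N)) ⟨
          GR.nat (p ^ suc N) ⊠ ((b ⊠ w) ⊠ a)                     ∎)
      divisible : ∀ j N → p ^ N ∣ ℤ.∣ lin (GQ.at j) a ∣
      divisible j N = from (iterate N)
        where
        from : (∃ λ w → a GQ.∼ GR.nat (p ^ N) ⊠ (w ⊠ a)) → p ^ N ∣ ℤ.∣ lin (GQ.at j) a ∣
        from (w , ew) = divides ℤ.∣ lin (GQ.at j) (w ⊠ a) ∣ (trans (cong ℤ.∣_∣ (trans (GQ.eq ew j) (trans (GQ.lin-nat⊠ j (p ^ N) (w ⊠ a)) (cong (ℤ._* lin (GQ.at j) (w ⊠ a)) (nat≡+ (p ^ N))))))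
          (trans (ℤₚ.abs-* (+ (p ^ N)) (lin (GQ.at j) (w ⊠ a))) (ℕₚ.*-comm (p ^ N) _)))
      small : ∀ i → (∀ N → p ^ N ∣ ℤ.∣ i ∣) → i ≡ 0ℤ
      small i d = ℤₚ.∣i∣≡0⇒i≡0 (tiny ℤ.∣ i ∣ (d ℤ.∣ i ∣))
        where
        tiny : ∀ k → p ^ k ∣ k → k ≡ 0
        tiny zero    _ = refl
        tiny (suc k) d = contradiction (∣⇒≤ d) (ℕₚ.<⇒≱ (k<p^k (prime>1 pr) (suc k)))
    go : (∃ λ ks → Any (_≢ 0ℤ) ks × horner ks z GQ.∼ 𝟘) → ⊥
    go (ks , nz , ez) = from (Horner.horner-root ℤR G.u z nzd ks nz ez)
      where
      from : (∃₂ λ k w → k ≢ 0ℤ × const k ⊞ z ⊠ w GQ.∼ 𝟘) → ⊥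
      from (k , w , k≢0 , e′) = k≢0 (int-0⇒ k (begin
        int k                        ≈⟨ ev-const k ⟨
        ev (const k)                 ≈⟨ +-identityʳ _ ⟨
        ev (const k) ⊕ 0#            ≈⟨ +-congˡ (≈-trans (ev-⊠ z w) (≈-trans (*-congʳ ev-z) (zeroˡ _))) ⟨
        ev (const k ⊞ z ⊠ w)         ≈⟨ ∼⇒ev (group⇒∼ e′) ⟩
        0#                           ∎))
        where open SetoidReasoning setoid

  ev-nat : ∀ n → ev (GR.nat n) ≈ nat n
  ev-nat n = ≈-trans (≈-reflexive (cong ev (trans (Constants.nat-const ℤR G.u n) (sym (Constants.nat-const R χ n))))) (≈-trans (Z.lin-nat χ n) (≈-trans (*-congˡ χ-0) (*-identityʳ _)))

  -- Otherwise Bézout's identity for p and k would make p a unit of ℤ[ζ].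
  integer-divisibility : ∀ {p} → Prime p → ∀ k b → k ≢ 0ℤ → int k ≈ nat p ⊙ ev b → p ∣ ℤ.∣ k ∣
  integer-divisibility {p} pr k b k≢0 e = decidable-stable (p ∣? ℤ.∣ k ∣) λ p∤k → go (Coprimality.coprime-Bézout (prime∤⇒coprime pr p∤k))
    where
    open SetoidReasoning setoid
    sign-abs : ∃ λ b′ → nat ℤ.∣ k ∣ ≈ nat p ⊙ ev b′
    sign-abs = sgn k e
      where
      sgn : ∀ k → int k ≈ nat p ⊙ ev b → ∃ λ b′ → nat ℤ.∣ k ∣ ≈ nat p ⊙ ev b′
      sgn (+ n)    e = b , e
      sgn -[1+ n ] e = ⊟ b , ≈-trans (solve 1 (λ a → a := :- (:- a)) ≈-refl (nat (suc n))) (≈-trans (-‿cong e) (solve 2 (λ a b → :- (a :* b) := a :* (:- b)) ≈-refl (nat p) (ev b)))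
    b′ = proj₁ sign-abs
    go : Bézout.Identity 1 p ℤ.∣ k ∣ → ⊥
    go (Bézout.+- x y eq) = p-not-unit pr (GR.nat x GR.⊖ GR.nat y ⊠ b′) (begin
      ev (GR.nat p ⊠ (GR.nat x GR.⊖ GR.nat y ⊠ b′))   ≈⟨ ≈-trans (ev-⊠ _ _) (*-cong (ev-nat p) (+-cong (ev-nat x) (-‿cong (≈-trans (ev-⊠ (GR.nat y) b′) (*-congʳ (ev-nat y)))))) ⟩
      nat p ⊙ (nat x ⊖ nat y ⊙ ev b′)                 ≈⟨ solve 4 (λ p x y b → p :* (x :- y :* b) := x :* p :- y :* (p :* b)) ≈-refl (nat p) (nat x) (nat y) (ev b′) ⟩
      nat x ⊙ nat p ⊖ nat y ⊙ (nat p ⊙ ev b′)         ≈⟨ +-cong (≈-sym (nat-* x p)) (-‿cong (≈-trans (*-congˡ (≈-sym (proj₂ sign-abs))) (≈-sym (nat-* y ℤ.∣ k ∣)))) ⟩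
      nat (x * p) ⊖ nat (y * ℤ.∣ k ∣)                 ≈⟨ +-congʳ (≈-reflexive (cong nat (sym eq))) ⟩
      (1# ⊕ nat (y * ℤ.∣ k ∣)) ⊖ nat (y * ℤ.∣ k ∣)    ≈⟨ solve 1 (λ a → (con 1ℤ :+ a) :- a := con 1ℤ) ≈-refl (nat (y * ℤ.∣ k ∣)) ⟩
      1#                                              ∎)
    go (Bézout.-+ x y eq) = p-not-unit pr (GR.nat y ⊠ b′ GR.⊖ GR.nat x) (begin
      ev (GR.nat p ⊠ (GR.nat y ⊠ b′ GR.⊖ GR.nat x))   ≈⟨ ≈-trans (ev-⊠ _ _) (*-cong (ev-nat p) (+-cong (≈-trans (ev-⊠ (GR.nat y) b′) (*-congʳ (ev-nat y))) (-‿cong (ev-nat x)))) ⟩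
      nat p ⊙ (nat y ⊙ ev b′ ⊖ nat x)                 ≈⟨ solve 4 (λ p x y b → p :* (y :* b :- x) := y :* (p :* b) :- x :* p) ≈-refl (nat p) (nat x) (nat y) (ev b′) ⟩
      nat y ⊙ (nat p ⊙ ev b′) ⊖ nat x ⊙ nat p         ≈⟨ +-cong (≈-trans (*-congˡ (≈-sym (proj₂ sign-abs))) (≈-sym (nat-* y ℤ.∣ k ∣))) (-‿cong (≈-sym (nat-* x p))) ⟩
      nat (y * ℤ.∣ k ∣) ⊖ nat (x * p)                 ≈⟨ +-congʳ (≈-reflexive (cong nat (sym eq))) ⟩
      (1# ⊕ nat (x * p)) ⊖ nat (x * p)                ≈⟨ solve 1 (λ a → (con 1ℤ :+ a) :- a := con 1ℤ) ≈-refl (nat (x * p)) ⟩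
      1#                                              ∎)

  module _ (a : Poly) (ev-a : ev a ≈ 0#) where
    Zero : ℤ → Set
    Zero s = ev (σ s a) ≈ 0#

    Bounded : ℕ → ℤ → Set
    Bounded M s = ∀ p → Prime p → ZR.nat p ZR.∣ᴿ σ s a → p ≤ M

    bounded : ∀ s → ¬ Zero s → ∃ λ M → Bounded M s
    bounded s nz = go (integer-multiple (σ s a) nz)
      where
      go : (∃₂ λ k w → k ≢ 0ℤ × const k ⊞ σ s a ⊠ w Z.∼ 𝟘) → ∃ λ M → Bounded M s
      go (k , w , k≢0 , e) = ℤ.∣ k ∣ , λ p pr d → ∣⇒≤ {{≢-nonZero (k≢0 ∘ ℤₚ.∣i∣≡0⇒i≡0)}} (from p pr d)
        where
        open SetoidReasoning setoid
        from : ∀ p → Prime p → ZR.nat p ZR.∣ᴿ σ s a → p ∣ ℤ.∣ k ∣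
        from p pr (ZR.mk∣ b eb) = integer-divisibility pr k (⊟ (b ⊠ w)) k≢0 (begin
          int k                                            ≈⟨ ev-const k ⟨
          ev (const k)                                     ≈⟨ solve 2 (λ x y → x := (x :+ y) :- y) ≈-refl (ev (const k)) (ev (σ s a ⊠ w)) ⟩
          ev (const k ⊞ σ s a ⊠ w) ⊖ ev (σ s a ⊠ w)        ≈⟨ +-cong (∼⇒ev e) (-‿cong (≈-trans (ev-⊠ (σ s a) w) (*-congʳ (≈-trans (∼⇒ev eb) (ev-⊠ (ZR.nat p) b))))) ⟩
          0# ⊖ (ev (ZR.nat p) ⊙ ev b) ⊙ ev w               ≈⟨ +-congˡ (-‿cong (*-congʳ (*-congʳ (≈-trans (Z.lin-nat χ p) (≈-trans (*-congˡ χ-0) (*-identityʳ _)))))) ⟩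
          0# ⊖ (nat p ⊙ ev b) ⊙ ev w                       ≈⟨ solve 3 (λ p b w → con 0ℤ :- (p :* b) :* w := p :* (:- (b :* w))) ≈-refl (nat p) (ev b) (ev w) ⟩
          nat p ⊙ (⊝ (ev b ⊙ ev w))                        ≈⟨ *-congˡ (-‿cong (ev-⊠ b w)) ⟨
          nat p ⊙ ev (⊟ (b ⊠ w))                           ∎)

    -- Equality in R need not be decidable, but a stable conclusion may be proved by finitely many case distinctions.
    decide-all : ∀ m {G : Set} → ((∃ λ M → ∀ k → k < m → Zero (+ k) ⊎ Bounded M (+ k)) → ¬ G) → ¬ G
    decide-all zero    f = f (0 , λ k ())
    decide-all (suc m) {G} f = decide-all m λ (M , all) g → lem (λ { (inj₁ z) → f (M , widen M all (inj₁ z)) g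
                                                               ; (inj₂ nz) → f (raise M all (bounded (+ m) nz)) g })
      where
      lem : ¬ ¬ (Zero (+ m) ⊎ ¬ Zero (+ m))
      lem g = g (inj₂ (λ z → g (inj₁ z)))
      widen : ∀ M → (∀ k → k < m → Zero (+ k) ⊎ Bounded M (+ k)) → Zero (+ m) ⊎ Bounded M (+ m) → ∀ k → k < suc m → Zero (+ k) ⊎ Bounded M (+ k)
      widen M all l k (s≤s k≤m) = [ all k , (λ { refl → l }) ]′ (ℕₚ.m≤n⇒m<n∨m≡n k≤m)
      raise : ∀ M → (∀ k → k < m → Zero (+ k) ⊎ Bounded M (+ k)) → (∃ λ M′ → Bounded M′ (+ m)) → ∃ λ M → ∀ k → k < suc m → Zero (+ k) ⊎ Bounded M (+ k)
      raise M all (M′ , b) = M + M′ , widen (M + M′)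
        (λ k k<m → [ inj₁ , (λ bd → inj₂ (λ p pr d → ℕₚ.≤-trans (bd p pr d) (ℕₚ.m≤m+n M M′))) ]′ (all k k<m))
        (inj₂ (λ p pr d → ℕₚ.≤-trans (b p pr d) (ℕₚ.m≤n+m M′ M)))

    σ-χ : ∀ {r s} → Cong h r s → ev (σ r a) ≈ ev (σ s a)
    σ-χ {r} {s} cg = ≈-trans (≈-reflexive (linᴿ-σ χ r a)) (≈-trans (linᴿ-cong a (λ i → ≈-reflexive (χ-cong (cong-* cg (cong-refl {i = i}))))) (≈-reflexive (sym (linᴿ-σ χ s a))))

    module _ (M : ℕ) (cases : ∀ k → k < h → Zero (+ k) ⊎ Bounded M (+ k)) where
      -- Modulo p the conjugate at p u is the p-th power of the one at u, hence 0. So p divides the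
      -- conjugate at p u, and if that one were bounded, p would be at most M.
      prime-step : ∀ p → Prime p → M < p → ∀ u → Zero u → Zero (+ p ℤ.* u)
      prime-step p pr M<p u zu = ≈-trans (σ-χ (cong-%ℕ h (+ p ℤ.* u))) ([ id , (λ bd → ⊥-elim (ℕₚ.<⇒≱ M<p (bd p pr divisible))) ]′ (cases k (n%ℕd<d (+ p ℤ.* u) h)))
        where
        k = (+ p ℤ.* u) %ℕ h
        divisible : ZR.nat p ZR.∣ᴿ σ (+ k) a
        divisible = ZR.∣-resp (ZR.≈-trans (ZR.solve 2 (λ x y → ZR.:- (x ZR.:- y) ZR.:+ x ZR.:= y) ZR.≈-refl (σ u a ZR.↑ p) (σ (+ p) (σ u a))) (ev⇒∼ (≈-trans (∼⇒ev (Z.σ-σ (+ p) u a)) (σ-χ (cong-%ℕ h (+ p ℤ.* u))))))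
          (ZR.∣-⊕ (ZR.∣-⊝ (QuotFrobenius.σ-frobenius R χ pr (σ u a))) (ZR.∣-resp (ZR.≈-sym (ZR.≈-trans (ZR.↑-cong p (ev⇒∼ zu)) (ZR.0↑ p (prime>0 pr)))) ZR.∣-0))

      primes-step : ∀ ps → All Prime ps → All (M <_) ps → Zero (+ product ps)
      primes-step []       []         []         = ≈-trans (≈-reflexive (linᴿ-σ χ 1ℤ a)) (≈-trans (linᴿ-cong a (λ i → ≈-reflexive (cong χ (ℤₚ.*-identityˡ i)))) ev-a)
      primes-step (p ∷ ps) (pr ∷ prs) (M<p ∷ Ms) = ≈-trans (≈-reflexive (cong (λ s → ev (σ s a)) (ℤₚ.pos-* p (product ps)))) (prime-step p pr M<p (+ product ps) (primes-step ps prs Ms))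

      -- s is replaced by a member of its class modulo h whose prime factors all exceed M, and these
      -- primes are applied one at a time.
      conjugates : ∀ s → Coprime s h → Zero (+ s)
      conjugates s cop = go (factorise N {{>-nonZero (L.lifted>0 M)}})
        where
        module L = Landau h s cop
        N = L.lifted M
        go : PrimeFactorisation N → Zero (+ s)
        go f = ≈-trans (σ-χ (cong-sym (mkC (+ L.coprimeProduct M) (trans (ℤₚ.pos-+ s (L.coprimeProduct M * h)) (cong (λ z → + s ℤ.+ z) (ℤₚ.pos-* (L.coprimeProduct M) h))))))
          (subst (λ n → Zero (+ n)) (sym isFactorisation) (primes-step factors factorsPrime (big factors factorsPrime (λ {q} d → subst (q ∣_) (sym isFactorisation) d))))
          where
          open PrimeFactorisation f
          big : ∀ ps → All Prime ps → (∀ {q} → q ∣ product ps → q ∣ N) → All (M <_) ps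
          big []       []         _  = []
          big (p ∷ ps) (pr ∷ prs) up = L.lifted-rough M pr (up (m∣m*n _)) ∷ big ps prs (λ d → up (∣n⇒∣m*n p d))

-- Fourier expansion of the trace

module Fourier (R : CommutativeRing 0ℓ 0ℓ) (domain : IsIntegralDomain R) (char0 : HasCharZero R)
               (h : ℕ) .{{nzh : NonZero h}} (ζ : CommutativeRing.Carrier R) (prim : IsPrimitiveRoot R h ζ) (T : Tower h) where
  open Transfer R domain char0 h ζ prim
  open CRing R
  open Sums R renaming (∑ to ∑ᴿ; ∑-cong to ∑ᴿ-cong)
  open Lin R using () renaming (lin to linᴿ; lin-cong to linᴿ-cong; lin-σ to linᴿ-σ; lin-⊙ˡ to linᴿ-⊙ˡ; lin-∑ to linᴿ-∑)
  open SetoidReasoning setoid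

  cancel : ∀ n {x} → n ≢ 0 → nat n ⊙ x ≈ 0# → x ≈ 0#
  cancel n {x} n≢0 e = [ (λ n≈0 → contradiction (char0 n n≈0) n≢0) , id ]′ (proj₂ domain (nat n) x e)

  h≢0 : h ≢ 0
  h≢0 = ≢-nonZero⁻¹ h

  χ-power : ∀ d s → χ (+ s ℤ.* d) ≈ χ d ↑ s
  χ-power d zero    = χ-0
  χ-power d (suc s) = ≈-trans (≈-reflexive (cong χ (ℤₚ.suc-* (+ s) d))) (≈-trans (χ-+ d (+ s ℤ.* d)) (*-congˡ (χ-power d s)))

  orthogonality-0 : ∀ d → Cong h d 0ℤ → ∑ᴿ h (λ s → χ (+ s ℤ.* d)) ≈ nat h
  orthogonality-0 d cg = ≈-trans (∑ᴿ-cong h (λ s _ → ≈-trans (≈-reflexive (χ-cong (cong-trans (cong-*ˡ (+ s) cg) (cong-≡ (ℤₚ.*-zeroʳ (+ s)))))) χ-0)) (≈-trans (∑-const h 1#) (*-identityʳ _))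

  orthogonality : ∀ d → d %ℕ h ≢ 0 → ∑ᴿ h (λ s → χ (+ s ℤ.* d)) ≈ 0#
  orthogonality d d≢0 = [ (λ w≈1 → contradiction (⊖≈0⇒≈ w≈1) (proj₂ prim (d %ℕ h) (ℕₚ.n≢0⇒n>0 d≢0) (n%ℕd<d d h))) , id ]′
    (proj₂ domain (w ⊖ 1#) S (≈-trans (solve 2 (λ w s → (w :- con 1ℤ) :* s := w :* s :- s) ≈-refl w S) (≈⇒⊖≈0 turn)))
    where
    w = χ d
    S = ∑ᴿ h (λ s → χ (+ s ℤ.* d))
    periodic : χ (+ h ℤ.* d) ≈ χ (0ℤ ℤ.* d)
    periodic = ≈-reflexive (χ-cong {j = 0ℤ ℤ.* d} (mkC d (trans (ℤₚ.*-comm (+ h) d) (sym (trans (cong (ℤ._+ d ℤ.* + h) (ℤₚ.*-zeroˡ d)) (ℤₚ.+-identityˡ _))))))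
    turn : w ⊙ S ≈ S
    turn = begin
      w ⊙ S                                      ≈⟨ ∑-⊙ˡ h w (λ s → χ (+ s ℤ.* d)) ⟨
      ∑ᴿ h (λ s → w ⊙ χ (+ s ℤ.* d))             ≈⟨ ∑ᴿ-cong h (λ s _ → ≈-trans (≈-sym (χ-+ d (+ s ℤ.* d))) (≈-reflexive (cong χ (sym (ℤₚ.suc-* (+ s) d))))) ⟩
      ∑ᴿ h (λ s → χ (+ suc s ℤ.* d))             ≈⟨ ∑-shift₁ h (λ s → χ (+ s ℤ.* d)) periodic ⟩
      S                                          ∎

  -- The discrete Fourier transform of the trace on ℤ/h, without the factor 1/h.
  t̂ : ℕ → Carrier
  t̂ s = ∑ᴿ h (λ k → int (tr T (+ k)) ⊙ χ (ℤ.- (+ s ℤ.* + k)))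

  inversion : ∀ m → ∑ᴿ h (λ s → t̂ s ⊙ χ (+ s ℤ.* m)) ≈ nat h ⊙ int (tr T m)
  inversion m = begin
    ∑ᴿ h (λ s → t̂ s ⊙ χ (+ s ℤ.* m))                                                     ≈⟨ ∑ᴿ-cong h (λ s _ → expand s) ⟩
    ∑ᴿ h (λ s → ∑ᴿ h (λ k → int (tr T (+ k)) ⊙ χ (+ s ℤ.* (m ℤ.- + k))))                 ≈⟨ ∑-swap h h (λ s k → int (tr T (+ k)) ⊙ χ (+ s ℤ.* (m ℤ.- + k))) ⟩
    ∑ᴿ h (λ k → ∑ᴿ h (λ s → int (tr T (+ k)) ⊙ χ (+ s ℤ.* (m ℤ.- + k))))                 ≈⟨ ∑ᴿ-cong h (λ k _ → ∑-⊙ˡ h (int (tr T (+ k))) (λ s → χ (+ s ℤ.* (m ℤ.- + k)))) ⟩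
    ∑ᴿ h (λ k → int (tr T (+ k)) ⊙ ∑ᴿ h (λ s → χ (+ s ℤ.* (m ℤ.- + k))))                 ≈⟨ ∑-single h _ r (n%ℕd<d m h) others ⟩
    int (tr T (+ r)) ⊙ ∑ᴿ h (λ s → χ (+ s ℤ.* (m ℤ.- + r)))                              ≈⟨ *-cong (≈-reflexive (cong int (tr-cong T (cong-sym (cong-%ℕ h m))))) (orthogonality-0 (m ℤ.- + r) (cong-trans (cong-+ (cong-%ℕ h m) (cong-refl {i = ℤ.- + r})) (cong-≡ (ℤₚ.+-inverseʳ (+ r))))) ⟩
    int (tr T m) ⊙ nat h                                                                 ≈⟨ *-comm _ _ ⟩
    nat h ⊙ int (tr T m)                                                                 ∎
    where
    r = m %ℕ h
    l₁ : ∀ s m k → ℤ.- (s ℤ.* k) ℤ.+ s ℤ.* m ≡ s ℤ.* (m ℤ.- k)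
    l₁ = ℤ-Solver.solve-∀
    expand : ∀ s → t̂ s ⊙ χ (+ s ℤ.* m) ≈ ∑ᴿ h (λ k → int (tr T (+ k)) ⊙ χ (+ s ℤ.* (m ℤ.- + k)))
    expand s = ≈-trans (*-comm _ _) (≈-trans (≈-sym (∑-⊙ˡ h (χ (+ s ℤ.* m)) _)) (∑ᴿ-cong h (λ k _ → begin
      χ (+ s ℤ.* m) ⊙ (int (tr T (+ k)) ⊙ χ (ℤ.- (+ s ℤ.* + k)))      ≈⟨ solve 3 (λ a b c → a :* (b :* c) := b :* (c :* a)) ≈-refl _ _ _ ⟩
      int (tr T (+ k)) ⊙ (χ (ℤ.- (+ s ℤ.* + k)) ⊙ χ (+ s ℤ.* m))      ≈⟨ *-congˡ (≈-sym (χ-+ (ℤ.- (+ s ℤ.* + k)) (+ s ℤ.* m))) ⟩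
      int (tr T (+ k)) ⊙ χ (ℤ.- (+ s ℤ.* + k) ℤ.+ + s ℤ.* m)          ≈⟨ *-congˡ (≈-reflexive (cong χ (l₁ (+ s) m (+ k)))) ⟩
      int (tr T (+ k)) ⊙ χ (+ s ℤ.* (m ℤ.- + k))                      ∎)))
    others : ∀ k → k < h → k ≢ r → int (tr T (+ k)) ⊙ ∑ᴿ h (λ s → χ (+ s ℤ.* (m ℤ.- + k))) ≈ 0#
    others k k<h k≢r = ≈-trans (*-congˡ (orthogonality (m ℤ.- + k) (λ e → k≢r (trans (sym (%ℕ-small h k k<h)) (proj₂ (i-j%p h m (+ k)) e))))) (zeroʳ _)

  -- Translating k by multiples of E = h/ℓ does not change the character at s, because ℓ divides s,
  -- whereas the trace sums to zero over such translates. Hence only frequencies prime to h, which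
  -- belong to conjugates of ζ, contribute to the trace.
  t̂-vanish : ∀ s {ℓ} → Prime ℓ → ℓ ∣ s → ℓ ∣ h → t̂ s ≈ 0#
  t̂-vanish s {ℓ} pr (divides s′ s≡) (divides E h≡) = cancel ℓ (ℕₚ.<⇒≢ (prime>0 pr) ∘ sym) (begin
    nat ℓ ⊙ t̂ s                                            ≈⟨ ∑-const ℓ (t̂ s) ⟨
    ∑ᴿ ℓ (λ _ → t̂ s)                                       ≈⟨ ∑ᴿ-cong ℓ (λ i _ → ≈-sym (∑-shift h g periodic (i * E))) ⟩
    ∑ᴿ ℓ (λ i → ∑ᴿ h (λ k → g (k + i * E)))                ≈⟨ ∑-swap ℓ h (λ i k → g (k + i * E)) ⟩
    ∑ᴿ h (λ k → ∑ᴿ ℓ (λ i → g (k + i * E)))                ≈⟨ ∑-zero h (λ k _ → inner k) ⟩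
    0#                                                     ∎)
    where
    g : ℕ → Carrier
    g k = int (tr T (+ k)) ⊙ χ (ℤ.- (+ s ℤ.* + k))
    periodic : ∀ k → g (k + h) ≈ g k
    periodic k = ≈-reflexive (cong₂ (λ x y → int x ⊙ y)
      (tr-cong T (mkC 1ℤ (trans (ℤₚ.pos-+ k h) (cong (λ z → + k ℤ.+ z) (sym (ℤₚ.*-identityˡ (+ h)))))))
      (χ-cong {j = ℤ.- (+ s ℤ.* + k)} (mkC (ℤ.- + s) (trans (cong (λ z → ℤ.- (+ s ℤ.* z)) (ℤₚ.pos-+ k h)) (l₁ (+ s) (+ k) (+ h))))))
      where
      l₁ : ∀ s k h → ℤ.- (s ℤ.* (k ℤ.+ h)) ≡ ℤ.- (s ℤ.* k) ℤ.+ (ℤ.- s) ℤ.* h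
      l₁ = ℤ-Solver.solve-∀
    int-∑ : ∀ n f → int (∑ n f) ≈ ∑ᴿ n (int ∘ f)
    int-∑ zero    f = ≈-refl
    int-∑ (suc n) f = ≈-trans (int-+ (f 0) (∑ n (f ∘ suc))) (+-congˡ (int-∑ n (f ∘ suc)))
    shifted : ∀ k i → g (k + i * E) ≈ χ (ℤ.- (+ s ℤ.* + k)) ⊙ int (tr T (+ k ℤ.+ + i ℤ.* + E))
    shifted k i = ≈-trans (*-comm _ _) (*-cong (≈-reflexive (χ-cong {j = ℤ.- (+ s ℤ.* + k)} (mkC (ℤ.- (+ s′ ℤ.* + i)) (trans (cong (λ z → ℤ.- (+ s ℤ.* z)) kiE) (trans (cong (λ z → ℤ.- (z ℤ.* (+ k ℤ.+ + i ℤ.* + E))) +s) (trans (l₁ (+ s′) (+ ℓ) (+ k) (+ i) (+ E)) (cong₂ (λ x y → ℤ.- (x ℤ.* + k) ℤ.+ (ℤ.- (+ s′ ℤ.* + i)) ℤ.* y) (sym +s) (sym +h))))))))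
      (≈-reflexive (cong (λ z → int (tr T z)) kiE)))
      where
      kiE : + (k + i * E) ≡ + k ℤ.+ + i ℤ.* + E
      kiE = trans (ℤₚ.pos-+ k (i * E)) (cong (λ z → + k ℤ.+ z) (ℤₚ.pos-* i E))
      +s : + s ≡ + s′ ℤ.* + ℓ
      +s = trans (cong +_ s≡) (ℤₚ.pos-* s′ ℓ)
      +h : + h ≡ + E ℤ.* + ℓ
      +h = trans (cong +_ h≡) (ℤₚ.pos-* E ℓ)
      l₁ : ∀ s l k i e → ℤ.- ((s ℤ.* l) ℤ.* (k ℤ.+ i ℤ.* e)) ≡ ℤ.- ((s ℤ.* l) ℤ.* k) ℤ.+ (ℤ.- (s ℤ.* i)) ℤ.* (e ℤ.* l)
      l₁ = ℤ-Solver.solve-∀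
    inner : ∀ k → ∑ᴿ ℓ (λ i → g (k + i * E)) ≈ 0#
    inner k = begin
      ∑ᴿ ℓ (λ i → g (k + i * E))                                                        ≈⟨ ∑ᴿ-cong ℓ (λ i _ → shifted k i) ⟩
      ∑ᴿ ℓ (λ i → χ (ℤ.- (+ s ℤ.* + k)) ⊙ int (tr T (+ k ℤ.+ + i ℤ.* + E)))             ≈⟨ ∑-⊙ˡ ℓ (χ (ℤ.- (+ s ℤ.* + k))) _ ⟩
      χ (ℤ.- (+ s ℤ.* + k)) ⊙ ∑ᴿ ℓ (λ i → int (tr T (+ k ℤ.+ + i ℤ.* + E)))             ≈⟨ *-congˡ (int-∑ ℓ (λ i → tr T (+ k ℤ.+ + i ℤ.* + E))) ⟨
      χ (ℤ.- (+ s ℤ.* + k)) ⊙ int (∑ ℓ (λ i → tr T (+ k ℤ.+ + i ℤ.* + E)))              ≈⟨ *-congˡ (≈-reflexive (cong int (tr-vanish T pr (trans h≡ (ℕₚ.*-comm E ℓ)) (+ k)))) ⟩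
      χ (ℤ.- (+ s ℤ.* + k)) ⊙ 0#                                                        ≈⟨ zeroʳ _ ⟩
      0#                                                                                ∎

  int-lin : ∀ f a → int (lin f a) ≈ linᴿ (int ∘ f) a
  int-lin f 𝟘       = ≈-refl
  int-lin f (X^ i)  = ≈-refl
  int-lin f (a ⊞ b) = ≈-trans (int-+ (lin f a) (lin f b)) (+-cong (int-lin f a) (int-lin f b))
  int-lin f (⊟ a)   = ≈-trans (int-neg (lin f a)) (-‿cong (int-lin f a))

  open Quot ℤR (tr T) using (_∼_; mk∼; at)

  -- Irreducibility of the cyclotomic polynomial: a relation holding at ζ holds in the abstract cyclotomic ring.
  transfer : ∀ a → ev a ≈ 0# → a ∼ 𝟘
  transfer a ev-a = mk∼ λ j → decidable-stable (lin (at j) a ℤ.≟ 0ℤ) (decide-all a ev-a h λ (M , cases) ne → ne (vanishing j (conjugates a ev-a M cases)))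
    where
    vanishing : ∀ j → (∀ s → Coprime s h → ev (σ (+ s) a) ≈ 0#) → lin (at j) a ≡ 0ℤ
    vanishing j conj0 = int-0⇒ (lin (at j) a) (cancel h h≢0 (begin
      nat h ⊙ int (lin (at j) a)                                             ≈⟨ *-congˡ (int-lin (at j) a) ⟩
      nat h ⊙ linᴿ (λ i → int (at j i)) a                                    ≈⟨ linᴿ-⊙ˡ a (nat h) (λ i → int (at j i)) ⟨
      linᴿ (λ i → nat h ⊙ int (tr T (j ℤ.+ i))) a                            ≈⟨ linᴿ-cong a (λ i → inversion (j ℤ.+ i)) ⟨
      linᴿ (λ i → ∑ᴿ h (λ s → t̂ s ⊙ χ (+ s ℤ.* (j ℤ.+ i)))) a                ≈⟨ linᴿ-∑ a h (λ s i → t̂ s ⊙ χ (+ s ℤ.* (j ℤ.+ i))) ⟩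
      ∑ᴿ h (λ s → linᴿ (λ i → t̂ s ⊙ χ (+ s ℤ.* (j ℤ.+ i))) a)                ≈⟨ ∑-zero h (λ s _ → term s) ⟩
      0#                                                                     ∎))
      where
      value : ∀ s → linᴿ (λ i → t̂ s ⊙ χ (+ s ℤ.* (j ℤ.+ i))) a ≈ t̂ s ⊙ (χ (+ s ℤ.* j) ⊙ ev (σ (+ s) a))
      value s = ≈-trans (linᴿ-⊙ˡ a (t̂ s) _) (*-congˡ (≈-trans
        (linᴿ-cong a (λ i → ≈-trans (≈-reflexive (cong χ (ℤₚ.*-distribˡ-+ (+ s) j i))) (χ-+ (+ s ℤ.* j) (+ s ℤ.* i))))
        (≈-trans (linᴿ-⊙ˡ a (χ (+ s ℤ.* j)) (λ i → χ (+ s ℤ.* i))) (*-congˡ (≈-reflexive (sym (linᴿ-σ χ (+ s) a)))))))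
      term : ∀ s → linᴿ (λ i → t̂ s ⊙ χ (+ s ℤ.* (j ℤ.+ i))) a ≈ 0#
      term s = ≈-trans (value s) (by-cases (Coprimality.coprime? s h))
        where
        common-prime : ¬ Coprime s h → ∃ λ ℓ → Prime ℓ × ℓ ∣ s × ℓ ∣ h
        common-prime nc = big (gcd s h) refl
          where
          from : ∀ g → gcd s h ≡ g → (∃ λ ℓ → Prime ℓ × ℓ ∣ g) → ∃ λ ℓ → Prime ℓ × ℓ ∣ s × ℓ ∣ h
          from g eq (ℓ , pr , d) = ℓ , pr , ∣-trans (subst (ℓ ∣_) (sym eq) d) (gcd[m,n]∣m s h) , ∣-trans (subst (ℓ ∣_) (sym eq) d) (gcd[m,n]∣n s h)
          big : ∀ g → gcd s h ≡ g → ∃ λ ℓ → Prime ℓ × ℓ ∣ s × ℓ ∣ h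
          big zero          eq = contradiction (gcd[m,n]≡0⇒n≡0 s eq) h≢0
          big (suc zero)    eq = ⊥-elim (nc (Coprimality.gcd≡1⇒coprime eq))
          big (suc (suc g)) eq = from (suc (suc g)) eq (primeDivisor (suc (suc g)) (s≤s (s≤s z≤n)))
        frequency : (∃ λ ℓ → Prime ℓ × ℓ ∣ s × ℓ ∣ h) → t̂ s ≈ 0#
        frequency (ℓ , pr , ℓ∣s , ℓ∣h) = t̂-vanish s pr ℓ∣s ℓ∣h
        by-cases : Dec (Coprime s h) → t̂ s ⊙ (χ (+ s ℤ.* j) ⊙ ev (σ (+ s) a)) ≈ 0#
        by-cases (yes cop) = ≈-trans (*-congˡ (≈-trans (*-congˡ (conj0 s cop)) (zeroʳ _))) (zeroʳ _)
        by-cases (no nc)   = ≈-trans (*-congʳ (frequency (common-prime nc))) (zeroˡ _)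

-- Lifting the exponent

module ZZ = CRing ℤR
open ZZ using () renaming (_∣ᴿ_ to _∣ᶻ_) public

+^ : ∀ q k → + (q ^ k) ≡ (+ q) ZZ.↑ k
+^ q zero    = refl
+^ q (suc k) = trans (ℤₚ.pos-* q (q ^ k)) (cong (+ q ℤ.*_) (+^ q k))

∣ᶻ⇒∣ : ∀ {n x} → + n ∣ᶻ x → n ∣ ℤ.∣ x ∣
∣ᶻ⇒∣ {n} {x} (ZZ.mk∣ w e) = divides ℤ.∣ w ∣ (trans (cong ℤ.∣_∣ e) (trans (ℤₚ.abs-* (+ n) w) (ℕₚ.*-comm n ℤ.∣ w ∣)))

∣⇒∣ᶻ : ∀ {n x} → n ∣ ℤ.∣ x ∣ → + n ∣ᶻ x
∣⇒∣ᶻ {n} {x} d = from (ℤsgn.∣ᵤ⇒∣ {+ n} {x} d)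
  where
  from : ℤsgn._∣_ (+ n) x → + n ∣ᶻ x
  from (ℤsgn.divides q e) = ZZ.mk∣ q (trans e (ℤₚ.*-comm q (+ n)))

cong⇒∣ᶻ : ∀ {n i j} → Cong n i j → + n ∣ᶻ i ℤ.- j
cong⇒∣ᶻ {n} {i} {j} (mkC k refl) = ZZ.mk∣ k (lem j k (+ n))
  where
  lem : ∀ j k n → (j ℤ.+ k ℤ.* n) ℤ.- j ≡ n ℤ.* k
  lem = ℤ-Solver.solve-∀

∣ᶻ⇒cong : ∀ {n i j} → + n ∣ᶻ i ℤ.- j → Cong n i j
∣ᶻ⇒cong {n} {i} {j} (ZZ.mk∣ k e) = mkC k (trans (l₁ i j) (cong (λ z → j ℤ.+ z) (trans e (ℤₚ.*-comm (+ n) k))))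
  where
  l₁ : ∀ i j → i ≡ j ℤ.+ (i ℤ.- j)
  l₁ = ℤ-Solver.solve-∀

∣ᶻ-coprime : ∀ {n a b} → Coprime n ℤ.∣ a ∣ → + n ∣ᶻ a ℤ.* b → + n ∣ᶻ b
∣ᶻ-coprime {n} {a} {b} c d = ∣⇒∣ᶻ (Coprimality.coprime-divisor c (subst (n ∣_) (ℤₚ.abs-* a b) (∣ᶻ⇒∣ d)))

1↑ᶻ : ∀ n → 1ℤ ZZ.↑ n ≡ 1ℤ
1↑ᶻ = ZZ.1↑

geo : ℤ → ℕ → ℤ
geo x n = ZZ.geometric x 1ℤ n

geo-eq : ∀ x n → x ZZ.↑ n ℤ.- 1ℤ ≡ (x ℤ.- 1ℤ) ℤ.* geo x n
geo-eq x n = trans (cong (λ z → x ZZ.↑ n ℤ.- z) (sym (1↑ᶻ n))) (ZZ.geometric-eq x 1ℤ n)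

geo-mod : ∀ {d} x n → d ∣ᶻ x ℤ.- 1ℤ → d ∣ᶻ geo x n ℤ.- + n
geo-mod x n p = ZZ.∣-resp (cong₂ ℤ._-_ (ℤₚ.*-identityˡ (geo x n)) (trans (cong₂ ℤ._*_ (nat≡+ n) (1↑ᶻ n)) (ℤₚ.*-identityʳ (+ n)))) (ZZ.geometric-mod {a = x} {1ℤ} n p)

∣-pred-power : ∀ {d} x n → d ∣ᶻ x ℤ.- 1ℤ → d ∣ᶻ x ZZ.↑ n ℤ.- 1ℤ
∣-pred-power x n p = ZZ.∣-resp (sym (geo-eq x n)) (ZZ.∣-⊙ʳ (geo x n) p)

∣-geo : ∀ {d} x n → + d ∣ᶻ x ℤ.- 1ℤ → d ∣ n → + d ∣ᶻ geo x n
∣-geo {d} x n p d∣n = ZZ.∣-resp (lem (geo x n) (+ n)) (ZZ.∣-⊕ (geo-mod x n p) (∣⇒∣ᶻ d∣n))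
  where
  lem : ∀ g n → g ℤ.- n ℤ.+ n ≡ g
  lem = ℤ-Solver.solve-∀

raise-∣ : ∀ {N d} x → + N ∣ᶻ x ℤ.- 1ℤ → + d ∣ᶻ x ℤ.- 1ℤ → + (d * N) ∣ᶻ x ZZ.↑ d ℤ.- 1ℤ
raise-∣ {N} {d} x pN pd = ZZ.∣-respˡ (trans (sym (ℤₚ.pos-* N d)) (cong +_ (ℕₚ.*-comm N d))) (ZZ.∣-resp (sym (geo-eq x d)) (ZZ.∣-⊙⊙ pN (∣-geo x d pd ∣-refl)))

-- One prime at a time: if y = x^N′ is 1 modulo N′ and modulo ℓ, then y^ℓ - 1 is y - 1 times a sum
-- of ℓ terms that are 1 modulo ℓ.
modulus-∣ : ∀ x N → .{{NonZero N}} → (∀ ℓ → Prime ℓ → ℓ ∣ N → + ℓ ∣ᶻ x ℤ.- 1ℤ) → + N ∣ᶻ x ZZ.↑ N ℤ.- 1ℤ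
modulus-∣ x N hyp = subst (λ N → + N ∣ᶻ x ZZ.↑ N ℤ.- 1ℤ) (sym isFactorisation) (go factors factorsPrime (λ ℓ pr d → hyp ℓ pr (subst (ℓ ∣_) (sym isFactorisation) d)))
  where
  open PrimeFactorisation (factorise N)
  go : ∀ ps → All Prime ps → (∀ ℓ → Prime ℓ → ℓ ∣ product ps → + ℓ ∣ᶻ x ℤ.- 1ℤ) → + product ps ∣ᶻ x ZZ.↑ product ps ℤ.- 1ℤ
  go []       []         _ = ZZ.mk∣ (x ZZ.↑ 1 ℤ.- 1ℤ) (sym (ℤₚ.*-identityˡ _))
  go (ℓ ∷ ps) (pr ∷ prs) h = ZZ.∣-resp (cong (ℤ._- 1ℤ) (sym (ZZ.↑-* x ℓ N′)))
    (raise-∣ (x ZZ.↑ N′) (go ps prs (λ ℓ′ pr′ d → h ℓ′ pr′ (∣n⇒∣m*n ℓ d))) (∣-pred-power x N′ (h ℓ pr (m∣m*n N′))))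
    where N′ = product ps

-- x^N - 1 is x - 1 times a sum congruent to N modulo p, and this sum is prime to p.
∤-pred-power : ∀ {p} → Prime p → ∀ x N k → ¬ p ∣ N → + p ∣ᶻ x ℤ.- 1ℤ → ¬ + (p ^ k) ∣ᶻ x ℤ.- 1ℤ → ¬ + (p ^ k) ∣ᶻ x ZZ.↑ N ℤ.- 1ℤ
∤-pred-power {p} pr x N k p∤N p∣ nd d = nd (∣ᶻ-coprime {a = geo x N} (coprime-^ k pr p∤geo) (ZZ.∣-resp (trans (geo-eq x N) (ℤₚ.*-comm (x ℤ.- 1ℤ) (geo x N))) d))
  where
  lem : ∀ g n → g ℤ.- (g ℤ.- n) ≡ n
  lem = ℤ-Solver.solve-∀
  p∤geo : ¬ p ∣ ℤ.∣ geo x N ∣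
  p∤geo p∣g = p∤N (∣ᶻ⇒∣ {x = + N} (ZZ.∣-resp (lem (geo x N) (+ N)) (ZZ.∣-⊖ (∣⇒∣ᶻ {p} {geo x N} p∣g) (geo-mod x N p∣))))

-- x ≡ 1 (mod p), and x ≡ 1 (mod 4) if p = 2; this is what lifting the exponent needs.
Principal : ℕ → ℤ → Set
Principal p x = ∃ λ u → x ≡ 1ℤ ℤ.+ + p ℤ.* u × + p ∣ᶻ u ℤ.* + tri p

principal : ∀ {p} → Prime p → ∀ x → + p ∣ᶻ x ℤ.- 1ℤ → (p ≡ 2 → + 4 ∣ᶻ x ℤ.- 1ℤ) → Principal p x
principal {p} pr x (ZZ.mk∣ u e) four = u , trans (l₁ x) (cong (λ z → 1ℤ ℤ.+ z) e) , by-cases (p ≟ 2)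
  where
  l₁ : ∀ x → x ≡ 1ℤ ℤ.+ (x ℤ.- 1ℤ)
  l₁ = ℤ-Solver.solve-∀
  by-cases : Dec (p ≡ 2) → + p ∣ᶻ u ℤ.* + tri p
  by-cases (no p≢2)   = ZZ.∣-⊙ˡ u (∣⇒∣ᶻ (p∣tri pr p≢2))
  by-cases (yes refl) = ZZ.∣-⊙ʳ 1ℤ (half (four refl))
    where
    half : + 4 ∣ᶻ x ℤ.- 1ℤ → + 2 ∣ᶻ u
    half (ZZ.mk∣ v e′) = ZZ.mk∣ v (ℤₚ.*-cancelˡ-≡ (+ 2) u (+ 2 ℤ.* v) (trans (sym e) (trans e′ (ℤₚ.*-assoc (+ 2) (+ 2) v))))

-- (1 + pu)^i is 1 + i p u modulo p², and the i < n add up to `tri n`.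
geo-mod-p² : ∀ p u n → + p ℤ.* + p ∣ᶻ geo (1ℤ ℤ.+ + p ℤ.* u) n ℤ.- (+ n ℤ.+ + p ℤ.* u ℤ.* + tri n)
geo-mod-p² p u zero = ZZ.mk∣ 0ℤ (lem (+ p) u)
  where
  lem : ∀ p u → 0ℤ ℤ.- (0ℤ ℤ.+ p ℤ.* u ℤ.* 0ℤ) ≡ p ℤ.* p ℤ.* 0ℤ
  lem = ℤ-Solver.solve-∀
geo-mod-p² p u (suc n) = ZZ.∣-resp eq′ (ZZ.∣-⊕ (geo-mod-p² p u n) (ZZ.∣-⊙ˡ u (ZZ.∣-⊙⊙ (ZZ.∣-self {+ p}) (geo-mod x n (ZZ.mk∣ u (l₂ (+ p) u))))))
  where
  x = 1ℤ ℤ.+ + p ℤ.* u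
  l₂ : ∀ p u → (1ℤ ℤ.+ p ℤ.* u) ℤ.- 1ℤ ≡ p ℤ.* u
  l₂ = ℤ-Solver.solve-∀
  l₁ : ∀ p u n t g → (g ℤ.- (n ℤ.+ p ℤ.* u ℤ.* t)) ℤ.+ u ℤ.* (p ℤ.* (g ℤ.- n)) ≡ ((1ℤ ℤ.+ p ℤ.* u) ℤ.* g ℤ.+ 1ℤ) ℤ.- ((1ℤ ℤ.+ n) ℤ.+ p ℤ.* u ℤ.* (t ℤ.+ n))
  l₁ = ℤ-Solver.solve-∀
  eq′ : (geo x n ℤ.- (+ n ℤ.+ + p ℤ.* u ℤ.* + tri n)) ℤ.+ u ℤ.* (+ p ℤ.* (geo x n ℤ.- + n)) ≡ geo x (suc n) ℤ.- (+ suc n ℤ.+ + p ℤ.* u ℤ.* + tri (suc n))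
  eq′ = trans (l₁ (+ p) u (+ n) (+ tri n) (geo x n)) (cong₂ (λ a b → (x ℤ.* geo x n ℤ.+ a) ℤ.- (+ suc n ℤ.+ + p ℤ.* u ℤ.* b)) (sym (1↑ᶻ n)) (sym (ℤₚ.pos-+ (tri n) n)))

-- Modulo p² the sum is p + p u `tri p`, and p divides u `tri p`; so p divides the sum exactly once.
geo-p : ∀ {p} → Prime p → ∀ x → Principal p x → ∃ λ w → geo x p ≡ + p ℤ.* (1ℤ ℤ.+ + p ℤ.* w)
geo-p {p} pr x (u , refl , ZZ.mk∣ r e) = from (geo-mod-p² p u p)
  where
  l₁ : ∀ p u t r w → u ℤ.* t ≡ p ℤ.* r → p ℤ.* p ℤ.* w ℤ.+ (p ℤ.+ p ℤ.* u ℤ.* t) ≡ p ℤ.* (1ℤ ℤ.+ p ℤ.* (w ℤ.+ r))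
  l₁ p u t r w e = trans (l₂ p u t w) (trans (cong (λ z → p ℤ.* p ℤ.* w ℤ.+ (p ℤ.+ p ℤ.* z)) e) (l₃ p r w))
    where
    l₂ : ∀ p u t w → p ℤ.* p ℤ.* w ℤ.+ (p ℤ.+ p ℤ.* u ℤ.* t) ≡ p ℤ.* p ℤ.* w ℤ.+ (p ℤ.+ p ℤ.* (u ℤ.* t))
    l₂ = ℤ-Solver.solve-∀
    l₃ : ∀ p r w → p ℤ.* p ℤ.* w ℤ.+ (p ℤ.+ p ℤ.* (p ℤ.* r)) ≡ p ℤ.* (1ℤ ℤ.+ p ℤ.* (w ℤ.+ r))
    l₃ = ℤ-Solver.solve-∀
  l₄ : ∀ g a → g ≡ (g ℤ.- a) ℤ.+ a
  l₄ = ℤ-Solver.solve-∀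
  from : + p ℤ.* + p ∣ᶻ geo (1ℤ ℤ.+ + p ℤ.* u) p ℤ.- (+ p ℤ.+ + p ℤ.* u ℤ.* + tri p) → ∃ λ w → geo (1ℤ ℤ.+ + p ℤ.* u) p ≡ + p ℤ.* (1ℤ ℤ.+ + p ℤ.* w)
  from (ZZ.mk∣ w ew) = w ℤ.+ r , trans (l₄ _ (+ p ℤ.+ + p ℤ.* u ℤ.* + tri p)) (trans (cong (ℤ._+ (+ p ℤ.+ + p ℤ.* u ℤ.* + tri p)) ew) (l₁ (+ p) u (+ tri p) r w e))

∤-pth-power : ∀ {p} → Prime p → ∀ x → Principal p x → ∀ k → ¬ + (p ^ k) ∣ᶻ x ℤ.- 1ℤ → ¬ + (p ^ suc k) ∣ᶻ x ZZ.↑ p ℤ.- 1ℤ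
∤-pth-power {p} pr x px k nd d = nd (from (geo-p pr x px))
  where
  instance _ = ℤ.≢-nonZero {+ p} (ℕₚ.<⇒≢ (prime>0 pr) ∘ sym ∘ ℤₚ.+-injective)
  l₁ : ∀ a p s → a ℤ.* (p ℤ.* s) ≡ p ℤ.* (s ℤ.* a)
  l₁ = ℤ-Solver.solve-∀
  l₂ : ∀ p w → (1ℤ ℤ.+ p ℤ.* w) ℤ.- p ℤ.* w ≡ 1ℤ
  l₂ = ℤ-Solver.solve-∀
  from : (∃ λ w → geo x p ≡ + p ℤ.* (1ℤ ℤ.+ + p ℤ.* w)) → + (p ^ k) ∣ᶻ x ℤ.- 1ℤ
  from (w , e) = ∣ᶻ-coprime {a = s} (coprime-^ k pr p∤s) (cancel d)
    where
    s = 1ℤ ℤ.+ + p ℤ.* w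
    p∤s : ¬ p ∣ ℤ.∣ s ∣
    p∤s p∣s = ℕₚ.<⇒≢ (prime>1 pr) (sym (∣1⇒≡1 (∣ᶻ⇒∣ {p} {1ℤ} (ZZ.∣-resp (l₂ (+ p) w) (ZZ.∣-⊖ (∣⇒∣ᶻ {p} {s} p∣s) (ZZ.mk∣ w refl))))))
    cancel : + (p ^ suc k) ∣ᶻ x ZZ.↑ p ℤ.- 1ℤ → + (p ^ k) ∣ᶻ s ℤ.* (x ℤ.- 1ℤ)
    cancel (ZZ.mk∣ v ev) = ZZ.mk∣ v (ℤₚ.*-cancelˡ-≡ (+ p) _ _ (trans (sym (trans (geo-eq x p) (trans (cong ((x ℤ.- 1ℤ) ℤ.*_) e) (l₁ (x ℤ.- 1ℤ) (+ p) s)))) (trans ev (trans (cong (ℤ._* v) (ℤₚ.pos-* p (p ^ k))) (ℤₚ.*-assoc (+ p) (+ (p ^ k)) v)))))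

-- Each p-th power raises the valuation of x - 1 at p by exactly one, so the target k is reached
-- from any smaller valuation.
exact-power : ∀ {p} → Prime p → ∀ x → + p ∣ᶻ x ℤ.- 1ℤ → (p ≡ 2 → + 4 ∣ᶻ x ℤ.- 1ℤ) → ∀ k → ¬ + (p ^ suc k) ∣ᶻ x ℤ.- 1ℤ →
              ∃ λ T → + (p ^ k) ∣ᶻ x ZZ.↑ T ℤ.- 1ℤ × ¬ + (p ^ suc k) ∣ᶻ x ZZ.↑ T ℤ.- 1ℤ
exact-power {p} pr x p∣ four k nd = by-cases k nd (p ^ k ∣? ℤ.∣ x ℤ.- 1ℤ ∣)
  where
  x↑1 : x ZZ.↑ 1 ≡ x
  x↑1 = ℤₚ.*-identityʳ x
  by-cases : ∀ k → ¬ + (p ^ suc k) ∣ᶻ x ℤ.- 1ℤ → Dec (p ^ k ∣ ℤ.∣ x ℤ.- 1ℤ ∣) → ∃ λ T → + (p ^ k) ∣ᶻ x ZZ.↑ T ℤ.- 1ℤ × ¬ + (p ^ suc k) ∣ᶻ x ZZ.↑ T ℤ.- 1ℤ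
  by-cases k nd (yes d) = 1 , subst (λ z → + (p ^ k) ∣ᶻ z ℤ.- 1ℤ) (sym x↑1) (∣⇒∣ᶻ d) , λ d′ → nd (subst (λ z → + (p ^ suc k) ∣ᶻ z ℤ.- 1ℤ) x↑1 d′)
  by-cases zero    nd (no nd′) = contradiction (1∣ _) nd′
  by-cases (suc k) nd (no nd′) = up (by-cases k (nd′ ∘ ∣ᶻ⇒∣) (p ^ k ∣? ℤ.∣ x ℤ.- 1ℤ ∣))
    where
    up : (∃ λ T → + (p ^ k) ∣ᶻ x ZZ.↑ T ℤ.- 1ℤ × ¬ + (p ^ suc k) ∣ᶻ x ZZ.↑ T ℤ.- 1ℤ) → ∃ λ T → + (p ^ suc k) ∣ᶻ x ZZ.↑ T ℤ.- 1ℤ × ¬ + (p ^ suc (suc k)) ∣ᶻ x ZZ.↑ T ℤ.- 1ℤ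
    up (T , d , nd″) = p * T , ZZ.∣-resp (cong (ℤ._- 1ℤ) (sym (ZZ.↑-* x p T))) (raise-∣ y d p∣y) ,
        λ d′ → ∤-pth-power pr y (principal pr y p∣y (λ p≡2 → ∣-pred-power x T (four p≡2))) (suc k) nd″ (ZZ.∣-resp (cong (ℤ._- 1ℤ) (ZZ.↑-* x p T)) d′)
      where
      y = x ZZ.↑ T
      p∣y = ∣-pred-power x T p∣

module _ {p : ℕ} (pr : Prime p) (N k : ℕ) (p∣M : p ∣ p ^ k * N) (c : ℤ) where
  private
    instance nzp = prime⇒nonZero pr
    M = p ^ k * N

  -- Write y = 1 + Mv, where p does not divide v. Modulo pM the power y^w is 1 + w v M, so w is c
  -- times the inverse of v modulo p.
  hit-residue : ∀ y → + M ∣ᶻ y ℤ.- 1ℤ → ¬ + (p ^ suc k) ∣ᶻ y ℤ.- 1ℤ → ∃ λ w → + (p * M) ∣ᶻ y ZZ.↑ w ℤ.- (1ℤ ℤ.+ c ℤ.* + M)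
  hit-residue y (ZZ.mk∣ v e) nd = from (coprime⇒unit (Coprimality.sym (prime∤⇒coprime pr p∤v)))
    where
    r = v %ℕ p
    l₀ : ∀ q n p z → (q ℤ.* n) ℤ.* (p ℤ.* z) ≡ (p ℤ.* q) ℤ.* (n ℤ.* z)
    l₀ = ℤ-Solver.solve-∀
    p∤v : ¬ p ∣ r
    p∤v p∣r = nd (from-v (ZZ.∣-resp (sym (l₁ v (+ r))) (ZZ.∣-⊕ (cong⇒∣ᶻ (cong-%ℕ p v)) (∣⇒∣ᶻ {p} {+ r} p∣r))))
      where
      l₁ : ∀ v r → v ≡ (v ℤ.- r) ℤ.+ r
      l₁ = ℤ-Solver.solve-∀
      from-v : + p ∣ᶻ v → + (p ^ suc k) ∣ᶻ y ℤ.- 1ℤ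
      from-v (ZZ.mk∣ z ez) = ZZ.mk∣ (+ N ℤ.* z) (trans e (trans (cong₂ ℤ._*_ (ℤₚ.pos-* (p ^ k) N) ez) (trans (l₀ (+ (p ^ k)) (+ N) (+ p) z) (cong (ℤ._* (+ N ℤ.* z)) (sym (ℤₚ.pos-* p (p ^ k)))))))
    from : Unit p (+ r) → ∃ λ w → + (p * M) ∣ᶻ y ZZ.↑ w ℤ.- (1ℤ ℤ.+ c ℤ.* + M)
    from (mkU r′ rr′) = w , ZZ.∣-resp (sym total) (ZZ.∣-respˡ (trans (sym (ℤₚ.pos-* M p)) (cong +_ (ℕₚ.*-comm M p))) (ZZ.∣-⊙⊙ (ZZ.∣-self {+ M}) residual))
      where
      w = (c ℤ.* r′) %ℕ p
      p∣y-1 : + p ∣ᶻ y ℤ.- 1ℤ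
      p∣y-1 = ZZ.∣-trans′ (∣⇒∣ᶻ {p} {+ M} p∣M) (ZZ.mk∣ v e)
      l₂ : ∀ m v g c → (m ℤ.* v) ℤ.* g ℤ.- c ℤ.* m ≡ m ℤ.* (v ℤ.* g ℤ.- c)
      l₂ = ℤ-Solver.solve-∀
      l₃ : ∀ a b → a ℤ.- (1ℤ ℤ.+ b) ≡ (a ℤ.- 1ℤ) ℤ.- b
      l₃ = ℤ-Solver.solve-∀
      total : y ZZ.↑ w ℤ.- (1ℤ ℤ.+ c ℤ.* + M) ≡ + M ℤ.* (v ℤ.* geo y w ℤ.- c)
      total = trans (l₃ (y ZZ.↑ w) (c ℤ.* + M)) (trans (cong (ℤ._- c ℤ.* + M) (trans (geo-eq y w) (cong (ℤ._* geo y w) e))) (l₂ (+ M) v (geo y w) c))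
      l₄ : ∀ r c r′ → r ℤ.* (c ℤ.* r′) ≡ c ℤ.* (r ℤ.* r′)
      l₄ = ℤ-Solver.solve-∀
      residual : + p ∣ᶻ v ℤ.* geo y w ℤ.- c
      residual = cong⇒∣ᶻ (cong-trans (cong-* (cong-%ℕ p v) (∣ᶻ⇒cong (geo-mod y w p∣y-1)))
        (cong-trans (cong-*ˡ (+ r) (cong-sym (cong-%ℕ p (c ℤ.* r′)))) (cong-trans (cong-≡ (l₄ (+ r) c r′)) (cong-trans (cong-*ˡ c rr′) (cong-≡ (ℤₚ.*-identityʳ c))))))

-- Three exponents are multiplied: N makes the power 1 modulo N, T brings the valuation at p of the
-- difference from 1 to exactly k, and w selects the required multiple of p^k N modulo p.
frobenius-power : ∀ {p} → Prime p → ∀ Q N k c → .{{NonZero N}} → ¬ p ∣ N → 0 < k →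
  (∀ ℓ → Prime ℓ → ℓ ∣ p * N → + ℓ ∣ᶻ Q ℤ.- 1ℤ) → (p ≡ 2 → + 4 ∣ᶻ Q ℤ.- 1ℤ) → ¬ + (p ^ suc k) ∣ᶻ Q ℤ.- 1ℤ →
  ∃ λ w → + (p * (p ^ k * N)) ∣ᶻ Q ZZ.↑ w ℤ.- (1ℤ ℤ.+ c ℤ.* + (p ^ k * N))
frobenius-power {p} pr Q N k c p∤N 0<k small four nd = from (exact-power pr Q₁ (∣-pred-power Q N p∣Q) (λ e → ∣-pred-power Q N (four e)) k (∤-pred-power pr Q N (suc k) p∤N p∣Q nd))
  where
  p∣Q : + p ∣ᶻ Q ℤ.- 1ℤ
  p∣Q = small p pr (m∣m*n N)
  Q₁ = Q ZZ.↑ N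
  N∣Q₁ : + N ∣ᶻ Q₁ ℤ.- 1ℤ
  N∣Q₁ = modulus-∣ Q N (λ ℓ prℓ d → small ℓ prℓ (∣n⇒∣m*n p d))
  p∣p^k : ∀ k → 0 < k → p ∣ p ^ k * N
  p∣p^k (suc k) _ = ∣m⇒∣m*n N (m∣m*n (p ^ k))
  from : (∃ λ T → + (p ^ k) ∣ᶻ Q₁ ZZ.↑ T ℤ.- 1ℤ × ¬ + (p ^ suc k) ∣ᶻ Q₁ ZZ.↑ T ℤ.- 1ℤ) → _
  from (T , d , nd′) = up (hit-residue pr N k (p∣p^k k 0<k) c (Q₁ ZZ.↑ T) both nd′)
    where
    both : + (p ^ k * N) ∣ᶻ Q₁ ZZ.↑ T ℤ.- 1ℤ
    both = ∣⇒∣ᶻ (coprime-* (coprime-^ k pr p∤N) (∣ᶻ⇒∣ d) (∣ᶻ⇒∣ (∣-pred-power Q₁ T N∣Q₁)))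
      where
      coprime-* : ∀ {a b z} → Coprime a b → a ∣ z → b ∣ z → a * b ∣ z
      coprime-* {a} {b} {z} cop (divides x refl) b∣z = subst (_∣ x * a) (ℕₚ.*-comm b a) (*-monoˡ-∣ a (Coprimality.coprime-divisor (Coprimality.sym cop) (subst (b ∣_) (ℕₚ.*-comm x a) b∣z)))
    up : (∃ λ w → + (p * (p ^ k * N)) ∣ᶻ (Q₁ ZZ.↑ T) ZZ.↑ w ℤ.- (1ℤ ℤ.+ c ℤ.* + (p ^ k * N))) → _
    up (w , e) = w * (T * N) , ZZ.∣-resp (cong (ℤ._- (1ℤ ℤ.+ c ℤ.* + (p ^ k * N))) (sym (trans (ZZ.↑-* Q w (T * N)) (ZZ.↑-cong w (ZZ.↑-* Q T N))))) e

-- Multiplicative orders and the modulus `mTilde`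

coprime-power : ∀ {N q} i → .{{NonZero N}} → Coprime q N → Coprime N (q ^ i)
coprime-power {N} {q} i cop = no-common-prime⇒coprime λ pr ℓ∣N ℓ∣q^i → ℕₚ.<⇒≢ (prime>1 pr) (sym (cop (prime∣^⇒∣ pr i ℓ∣q^i , ℓ∣N)))

power≡1 : ∀ {N q} → .{{NonZero N}} → Coprime q N → ∃ λ f → 0 < f × + N ∣ᶻ + (q ^ f) ℤ.- 1ℤ
power≡1 {N} {q} cop = from (Finₚ.pigeonhole (ℕₚ.n<1+n N) (λ i → (q ^ toℕ i) mod N))
  where
  from : (∃₂ λ i j → i Data.Fin.< j × (q ^ toℕ i) mod N ≡ (q ^ toℕ j) mod N) → ∃ λ f → 0 < f × + N ∣ᶻ + (q ^ f) ℤ.- 1ℤ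
  from (i , j , i<j , e) = f , ℕₚ.m<n⇒0<n∸m i<j , ∣ᶻ-coprime {a = + (q ^ a)} (coprime-power a cop) (ZZ.∣-resp eq′ diff)
    where
    a = toℕ i
    b = toℕ j
    f = b ∸ a
    %-eq : q ^ a % N ≡ q ^ b % N
    %-eq = trans (sym (Finₚ.toℕ-fromℕ< (m%n<n (q ^ a) N))) (trans (cong toℕ e) (Finₚ.toℕ-fromℕ< (m%n<n (q ^ b) N)))
    as-residue : ∀ x → Cong N (+ x) (+ (x % N))
    as-residue x = mkC (+ (x / N)) (trans (cong +_ (m≡m%n+[m/n]*n x N)) (trans (ℤₚ.pos-+ (x % N) (x / N * N)) (cong (λ z → + (x % N) ℤ.+ z) (ℤₚ.pos-* (x / N) N))))
    diff : + N ∣ᶻ + (q ^ b) ℤ.- + (q ^ a)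
    diff = cong⇒∣ᶻ (cong-trans (as-residue (q ^ b)) (cong-trans (cong-≡ (cong +_ (sym %-eq))) (cong-sym (as-residue (q ^ a)))))
    l₁ : ∀ x y → x ℤ.* y ℤ.- x ≡ x ℤ.* (y ℤ.- 1ℤ)
    l₁ = ℤ-Solver.solve-∀
    eq′ : + (q ^ b) ℤ.- + (q ^ a) ≡ + (q ^ a) ℤ.* (+ (q ^ f) ℤ.- 1ℤ)
    eq′ = trans (cong (ℤ._- + (q ^ a)) (trans (cong (λ z → + (q ^ z)) (sym (ℕₚ.m+[n∸m]≡n (ℕₚ.<⇒≤ i<j)))) (trans (cong +_ (ℕₚ.^-distribˡ-+-* q a f)) (ℤₚ.pos-* (q ^ a) (q ^ f))))) (l₁ (+ (q ^ a)) (+ (q ^ f)))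

≋⇒∣ᶻ : ∀ {a N} → a ≋ 1 [mod N ] → + N ∣ᶻ + a ℤ.- 1ℤ
≋⇒∣ᶻ d = ∣⇒∣ᶻ d

∣ᶻ⇒≋ : ∀ {a N} → + N ∣ᶻ + a ℤ.- 1ℤ → a ≋ 1 [mod N ]
∣ᶻ⇒≋ d = ∣ᶻ⇒∣ d

least : ∀ {P : ℕ → Set} → (∀ n → Dec (P n)) → ∀ n → P n → ∃ λ m → P m × (∀ i → i < m → ¬ P i)
least {P} P? n = <-rec (λ n → P n → ∃ λ m → P m × (∀ i → i < m → ¬ P i)) step n
  where
  step : ∀ n → (∀ {m} → m < n → P m → ∃ λ m → P m × (∀ i → i < m → ¬ P i)) → P n → ∃ λ m → P m × (∀ i → i < m → ¬ P i)
  step n rec pn = by-cases (ℕₚ.anyUpTo? P? n)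
    where
    by-cases : Dec (∃ λ i → i < n × P i) → ∃ λ m → P m × (∀ i → i < m → ¬ P i)
    by-cases (yes (i , i<n , pi)) = rec i<n pi
    by-cases (no none)            = n , pn , λ i i<n pi → none (i , i<n , pi)

order : ∀ {N q} → .{{NonZero N}} → Coprime q N → ∃ λ j → IsOrder N q j
order {N} {q} cop = from (power≡1 cop)
  where
  P : ℕ → Set
  P j = 0 < j × q ^ j ≋ 1 [mod N ]
  P? : ∀ j → Dec (P j)
  P? j = (0 <? j) ×-dec (N ∣? ℤ.∣ + (q ^ j) ℤ.- 1ℤ ∣)
  from : (∃ λ f → 0 < f × + N ∣ᶻ + (q ^ f) ℤ.- 1ℤ) → ∃ λ j → IsOrder N q j
  from (f , 0<f , d) = go (least P? f (0<f , ∣ᶻ⇒≋ {q ^ f} d))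
    where
    go : (∃ λ j → P j × (∀ i → i < j → ¬ P i)) → ∃ λ j → IsOrder N q j
    go (j , (0<j , e) , min) = j , 0<j , e , λ i 0<i i<j e′ → min i i<j (0<i , e′)

module _ (m r s : ℕ) .{{nzm : NonZero m}} where
  private
    Ok : ℕ → Set
    Ok p = (Prime p × p ∣ m) × (p ≢ r × p ≢ s)
    ok? : ∀ p → Dec (Ok p)
    ok? p = (prime? p ×-dec (p ∣? m)) ×-dec (¬? (p ≟ r) ×-dec ¬? (p ≟ s))

  ∣radExcept : ∀ {ℓ} → Prime ℓ → ℓ ∣ m → ℓ ≢ r → ℓ ≢ s → ℓ ∣ radExcept m r s
  ∣radExcept {ℓ} pr ℓ∣m ℓ≢r ℓ≢s = ListActionₚ.∈⇒∣product (Memₚ.∈-filter⁺ ok? (Memₚ.∈-upTo⁺ (s≤s (∣⇒≤ ℓ∣m))) ((pr , ℓ∣m) , (ℓ≢r , ℓ≢s)))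

  radExcept-primes : All Ok (filter ok? (upTo (suc m)))
  radExcept-primes = Allₚ.all-filter ok? (upTo (suc m))

  prime∣radExcept : ∀ {ℓ} → Prime ℓ → ℓ ∣ radExcept m r s → ℓ ≢ r × ℓ ≢ s
  prime∣radExcept {ℓ} pr d = go _ radExcept-primes d
    where
    go : ∀ ps → All Ok ps → ℓ ∣ product ps → ℓ ≢ r × ℓ ≢ s
    go []       []         d = contradiction (∣1⇒≡1 d) (ℕₚ.<⇒≢ (prime>1 pr) ∘ sym)
    go (p ∷ ps) (ok ∷ oks) d = [ (λ ℓ∣p → subst (λ z → z ≢ r × z ≢ s) (sym (prime∣prime pr (proj₁ (proj₁ ok)) ℓ∣p)) (proj₂ ok)) , go ps oks ]′ (euclidsLemma p _ pr d)

  radExcept>0 : 0 < radExcept m r s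
  radExcept>0 = go _ radExcept-primes
    where
    go : ∀ ps → All Ok ps → 0 < product ps
    go []       []         = s≤s z≤n
    go (p ∷ ps) (ok ∷ oks) = ℕₚ.*-mono-≤ (prime>0 (proj₁ (proj₁ ok))) (go ps oks)

module _ (m : ℕ) .{{nzm : NonZero m}} {q : ℕ} (prq : Prime q) where
  mTilde>0 : 0 < mTilde m q
  mTilde>0 with 2 ∣? m | q ≟ 2
  ... | no _  | _     = radExcept>0 m q q
  ... | yes _ | yes _ = radExcept>0 m q q
  ... | yes _ | no _  = ℕₚ.*-mono-≤ (s≤s (z≤n {3})) (radExcept>0 m 2 q)

  q∤mTilde : ¬ q ∣ mTilde m q
  q∤mTilde d with 2 ∣? m | q ≟ 2
  ... | no _  | _     = proj₁ (prime∣radExcept m q q prq d) refl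
  ... | yes _ | yes _ = proj₁ (prime∣radExcept m q q prq d) refl
  ... | yes _ | no ne with euclidsLemma 4 _ prq d
  ...   | inj₁ q∣4 = ne (prime∣prime prq prime[2] (prime∣^⇒∣ prq 2 q∣4))
  ...   | inj₂ q∣r = proj₂ (prime∣radExcept m 2 q prq q∣r) refl

  ∣mTilde : ∀ {ℓ} → Prime ℓ → ℓ ∣ m → ℓ ≢ q → ℓ ∣ mTilde m q
  ∣mTilde {ℓ} pr ℓ∣m ℓ≢q with 2 ∣? m | q ≟ 2
  ... | no _  | _     = ∣radExcept m q q pr ℓ∣m ℓ≢q ℓ≢q
  ... | yes _ | yes _ = ∣radExcept m q q pr ℓ∣m ℓ≢q ℓ≢q
  ... | yes _ | no _ with ℓ ≟ 2
  ...   | yes refl = ∣m⇒∣m*n (radExcept m 2 q) (divides 2 refl)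
  ...   | no ℓ≢2   = ∣n⇒∣m*n 4 (∣radExcept m 2 q pr ℓ∣m ℓ≢2 ℓ≢q)

  -- The factor 4 lets the lifting of exponents at p = 2 start from a residue 1 modulo 4.
  4∣mTilde : 2 ∣ m → q ≢ 2 → 4 ∣ mTilde m q
  4∣mTilde 2∣m q≢2 with 2 ∣? m | q ≟ 2
  ... | no 2∤m | _     = contradiction 2∣m 2∤m
  ... | yes _  | yes e = contradiction e q≢2
  ... | yes _  | no _  = m∣m*n (radExcept m 2 q)

OrderCondition : ℕ → ℕ → Set
OrderCondition n h = ∀ p → Prime p → p ∣ n → ∀ q → Prime q → q ∣ n → q ≢ p →
  ∀ e j → IsValuation p h e → IsOrder (mTilde (lcm n h) q) q j → ¬ (q ^ j ≋ 1 [mod p ^ suc e ])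

valuation : ∀ {p} → Prime p → ∀ h → .{{NonZero h}} → ∃ λ e → IsValuation p h e
valuation {p} pr h = from (split pr h)
  where
  from : Split p h → ∃ λ e → IsValuation p h e
  from (mkSplit e r h≡ p∤r) = e , subst (p ^ e ∣_) (sym h≡) (m∣m*n r) ,
    λ d → p∤r (*-cancelˡ-∣ (p ^ e) {{ℕₚ.m^n≢0 p e {{prime⇒nonZero pr}}}} (subst₂ _∣_ (ℕₚ.*-comm p (p ^ e)) h≡ d))

^-∣ : ∀ p {a b} → a ≤ b → p ^ a ∣ p ^ b
^-∣ p {a} {b} a≤b = divides (p ^ (b ∸ a)) (trans (cong (p ^_) (sym (ℕₚ.m∸n+n≡m a≤b))) (ℕₚ.^-distribˡ-+-* p (b ∸ a) a))

exponent-≤ : ∀ {p} → Prime p → ∀ b k N → ¬ p ∣ N → p ^ b ∣ p ^ k * N → b ≤ k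
exponent-≤ {p} pr b k N p∤N d = ℕₚ.≮⇒≥ λ k<b → p∤N (*-cancelˡ-∣ (p ^ k) {{ℕₚ.m^n≢0 p k {{prime⇒nonZero pr}}}}
  (∣-trans (subst (_∣ p ^ b) (ℕₚ.*-comm p (p ^ k)) (^-∣ p k<b)) d))

module FixedPrimes (n h : ℕ) .{{nzn : NonZero n}} .{{nzh : NonZero h}} (m : ℕ) (m≡ : m ≡ lcm n h) .{{nzm : NonZero m}}
                   (order-condition : OrderCondition n h) (q∣h : ∀ q → Prime q → q ∣ n → q ∣ h)
                   {D : ℕ} (p : ℕ) .{{nzp : NonZero p}} (pr : Prime p) (p∣n : p ∣ n) (p∣D : p ∣ D) (h∣D : h ∣ D) (D′∣m : p * D ∣ m) (T : Tower D) where
  private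
    T′ = ram p pr p∣D T
    instance nzD′ = tower-nonZero T′

  open Ideals T′ using (FixesPrime)

  -- For q ≠ p write E = p^(k+1) N and D = q^(κ+1) p^k N. The power Q = q^j, with j the order, is 1
  -- modulo every prime of E, and modulo 4 if p = 2. As h divides D, the valuation of h at p is at
  -- most k, so the order condition keeps p^(k+1) from dividing Q - 1. Lifting the exponent then
  -- makes some power of Q equal to 1 + D modulo E.
  fixes-prime : ∀ q → Prime q → q ∣ n → FixesPrime (1ℤ ℤ.+ + D) q
  fixes-prime q prq q∣n = from (split prq (p * D))
    where
    q∣D′ : q ∣ p * D
    q∣D′ = ∣n⇒∣m*n p (∣-trans (q∣h q prq q∣n) h∣D)
    from : Split q (p * D) → FixesPrime (1ℤ ℤ.+ + D) q
    from (mkSplit zero E D′≡ q∤E)    = contradiction (subst (q ∣_) (trans D′≡ (ℕₚ.*-identityˡ E)) q∣D′) q∤E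
    from (mkSplit (suc κ) E D′≡ q∤E) = with-power (power≡1 coprime-qE) (exponent (q ≟ p))
      where
      nzE : NonZero E
      nzE = ≢-nonZero λ E≡0 → ≢-nonZero⁻¹ (p * D) (trans D′≡ (trans (cong (q ^ suc κ *_) E≡0) (ℕₚ.*-zeroʳ (q ^ suc κ))))
      instance _ = nzE
      coprime-qE : Coprime q E
      coprime-qE = prime∤⇒coprime prq q∤E
      E∣m : E ∣ m
      E∣m = ∣-trans (subst (E ∣_) (sym D′≡) (n∣m*n (q ^ suc κ))) D′∣m

      with-power : (∃ λ f → 0 < f × + E ∣ᶻ + (q ^ f) ℤ.- 1ℤ) → (∃ λ τ → Cong E (+ (q ^ τ)) (1ℤ ℤ.+ + D)) → FixesPrime (1ℤ ℤ.+ + D) q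
      with-power (f , 0<f , d) (τ , sτ) = record { prime = prq ; κ = κ ; E = E ; D≡ = D′≡ ; τ = τ ; sτ = sτ ; f = f ; 0<f = 0<f ; qf = ∣ᶻ⇒cong d }

      exponent : Dec (q ≡ p) → ∃ λ τ → Cong E (+ (q ^ τ)) (1ℤ ℤ.+ + D)
      -- For q = p the q-free part E divides D, so 1 + D is q^0 modulo E.
      exponent (yes refl) = 0 , cong-sym (mkC (+ (q ^ κ)) (cong (λ z → 1ℤ ℤ.+ z) (trans (cong +_ D≡) (ℤₚ.pos-* (q ^ κ) E))))
        where
        D≡ : D ≡ q ^ κ * E
        D≡ = ℕₚ.*-cancelˡ-≡ D (q ^ κ * E) q (trans D′≡ (ℕₚ.*-assoc q (q ^ κ) E))
      exponent (no q≢p) = at-p (split pr E)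
        where
        p∤q^ : ¬ p ∣ q ^ suc κ
        p∤q^ d = q≢p (sym (prime∣prime pr prq (prime∣^⇒∣ pr (suc κ) d)))
        coprime-q^ : ∀ b → Coprime (p ^ b) (q ^ suc κ)
        coprime-q^ b = coprime-^ b pr p∤q^
        at-p : Split p E → ∃ λ τ → Cong E (+ (q ^ τ)) (1ℤ ℤ.+ + D)
        at-p (mkSplit zero N E≡ p∤N) = ⊥-elim ([ p∤q^ , (λ d → p∤N (subst (p ∣_) (trans E≡ (ℕₚ.*-identityˡ N)) d)) ]′ (euclidsLemma (q ^ suc κ) E pr (subst (p ∣_) D′≡ (m∣m*n D))))
        at-p (mkSplit (suc k) N E≡ p∤N) = use (valuation pr h) (order {{nzmT}} coprime-qm̃)
          where
          l₁ : ∀ q p x n → q * (p * x * n) ≡ p * (q * (x * n))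
          l₁ = ℕ-Solver.solve-∀
          D≡ : D ≡ q ^ suc κ * (p ^ k * N)
          D≡ = ℕₚ.*-cancelˡ-≡ D _ p (trans D′≡ (trans (cong (q ^ suc κ *_) E≡) (l₁ (q ^ suc κ) p (p ^ k) N)))
          E≡′ : E ≡ p * (p ^ k * N)
          E≡′ = trans E≡ (ℕₚ.*-assoc p (p ^ k) N)
          nzN : NonZero N
          nzN = ≢-nonZero λ N≡0 → ≢-nonZero⁻¹ E (trans E≡ (trans (cong (p ^ suc k *_) N≡0) (ℕₚ.*-zeroʳ (p ^ suc k))))
          nzmT : NonZero (mTilde (lcm n h) q)
          nzmT = >-nonZero (subst (λ m → 0 < mTilde m q) m≡ (mTilde>0 m prq))
          coprime-qm̃ : Coprime q (mTilde (lcm n h) q)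
          coprime-qm̃ = prime∤⇒coprime prq (subst (λ m → ¬ q ∣ mTilde m q) m≡ (q∤mTilde m prq))
          divides-D : ∀ b → p ^ b ∣ D → p ^ b ∣ p ^ k * N
          divides-D b d = Coprimality.coprime-divisor (coprime-q^ b) (subst (p ^ b ∣_) D≡ d)
          0<k : 0 < k
          0<k = exponent-≤ pr 1 k N p∤N (divides-D 1 (subst (_∣ D) (sym (ℕₚ.*-identityʳ p)) p∣D))
          use : (∃ λ e → IsValuation p h e) → (∃ λ j → IsOrder (mTilde (lcm n h) q) q j) → ∃ λ τ → Cong E (+ (q ^ τ)) (1ℤ ℤ.+ + D)
          use (b , val) (j , ord) = final (frobenius-power pr qʲ N k (+ (q ^ suc κ)) {{nzN}} p∤N 0<k small four nd)
            where
            qʲ = + (q ^ j)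
            m̃∣qʲ : + mTilde m q ∣ᶻ qʲ ℤ.- 1ℤ
            m̃∣qʲ = subst (λ m → + mTilde m q ∣ᶻ qʲ ℤ.- 1ℤ) (sym m≡) (≋⇒∣ᶻ {q ^ j} (proj₁ (proj₂ ord)))
            small : ∀ ℓ → Prime ℓ → ℓ ∣ p * N → + ℓ ∣ᶻ qʲ ℤ.- 1ℤ
            small ℓ prℓ d = ZZ.∣-trans′ (∣⇒∣ᶻ (∣mTilde m prq prℓ (∣-trans ℓ∣E E∣m) (λ { refl → q∤E ℓ∣E }))) m̃∣qʲ
              where
              ℓ∣E : ℓ ∣ E
              ℓ∣E = ∣-trans d (subst (p * N ∣_) (sym E≡′) (*-monoʳ-∣ p (n∣m*n (p ^ k))))
            four : p ≡ 2 → + 4 ∣ᶻ qʲ ℤ.- 1ℤ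
            four refl = ZZ.∣-trans′ (∣⇒∣ᶻ (4∣mTilde m prq (∣-trans (m∣m*n D) D′∣m) q≢p)) m̃∣qʲ
            b≤k : b ≤ k
            b≤k = exponent-≤ pr b k N p∤N (divides-D b (∣-trans (proj₁ val) h∣D))
            nd : ¬ + (p ^ suc k) ∣ᶻ qʲ ℤ.- 1ℤ
            nd d = order-condition p pr p∣n q prq q∣n q≢p b j val ord (∣ᶻ⇒≋ {q ^ j} (ZZ.∣-trans′ (∣⇒∣ᶻ (^-∣ p (s≤s b≤k))) d))
            final : (∃ λ w → + (p * (p ^ k * N)) ∣ᶻ qʲ ZZ.↑ w ℤ.- (1ℤ ℤ.+ + (q ^ suc κ) ℤ.* + (p ^ k * N))) → ∃ λ τ → Cong E (+ (q ^ τ)) (1ℤ ℤ.+ + D)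
            final (w , d) = w * j , ∣ᶻ⇒cong (ZZ.∣-respˡ (cong +_ (sym E≡′)) (ZZ.∣-resp (cong₂ (λ x y → x ℤ.- (1ℤ ℤ.+ y)) power (trans (sym (ℤₚ.pos-* (q ^ suc κ) (p ^ k * N))) (cong +_ (sym D≡)))) d))
              where
              power : qʲ ZZ.↑ w ≡ + (q ^ (w * j))
              power = trans (ZZ.↑-cong w (+^ q j)) (trans (sym (ZZ.↑-* (+ q) w j)) (sym (+^ q (w * j))))

-- Iterated descent

polyOf : (ℕ → ℤ) → List ℕ → Poly
polyOf e []       = 𝟘
polyOf e (k ∷ ks) = X^ (e k) ⊞ polyOf e ks

Norm : ∀ {D} → Tower D → ℕ → Poly → Set
Norm T n a = Quot._∼_ ℤR (tr T) (a ⊠ conj a) (CRing.nat (Quot.A ℤR (tr T)) n)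

norm-cong : ∀ {D} (T : Tower D) {n a b} → (∀ f → lin f a ≡ lin f b) → Norm T n a → Norm T n b
norm-cong T {n} {a} {b} e na = ∼-trans (⊠-cong (∼-sym a∼b) (Cyc.conj-cong T (∼-sym a∼b))) na
  where
  open Quot ℤR (tr T)
  a∼b : a ∼ b
  a∼b = mk∼ (λ j → e (at j))

module _ (p : ℕ) .{{_ : NonZero p}} (l : ℕ) (e : ℕ → ℤ) where
  inClass? : ∀ k → Dec (e k %ℕ p ≡ l)
  inClass? k = e k %ℕ p ≟ l

  -- Taking a component preserves the shape of a sum of monomials over a list of indices, so
  -- distinctness of the indices survives every descent.
  sub-polyOf : ∀ ks f → lin f (sub p l (polyOf e ks)) ≡ lin f (polyOf (λ k → e k /ℕ p) (filter inClass? ks))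
  sub-polyOf []       f = lin-sub p l f 𝟘
  sub-polyOf (k ∷ ks) f = trans (lin-sub p l f (polyOf e (k ∷ ks))) (trans (cong (λ z → sel p l (e k) (f (e k /ℕ p)) ℤ.+ z) (trans (sym (lin-sub p l f (polyOf e ks))) (sub-polyOf ks f))) (head (inClass? k)))
    where
    rest = filter inClass? ks
    e/ : ℕ → ℤ
    e/ k = e k /ℕ p
    head : Dec (e k %ℕ p ≡ l) → sel p l (e k) (f (e/ k)) ℤ.+ lin f (polyOf e/ rest) ≡ lin f (polyOf e/ (filter inClass? (k ∷ ks)))
    head (yes h) = trans (cong (ℤ._+ lin f (polyOf e/ rest)) (sel-yes p h)) (cong (lin f ∘ polyOf e/) (sym (Listₚ.filter-accept inClass? h)))
    head (no h)  = trans (cong (ℤ._+ lin f (polyOf e/ rest)) (sel-no p h)) (trans (ℤₚ.+-identityˡ _) (cong (lin f ∘ polyOf e/) (sym (Listₚ.filter-reject inClass? h))))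

-- T arises from T₀ by w-fold ramified extension, one prime at a time, and σ (1 + D) fixes the primes above n at each step.
data Chain (n : ℕ) {h : ℕ} (T₀ : Tower h) : ∀ {D} → Tower D → ℕ → Set where
  done : Chain n T₀ T₀ 1
  step : ∀ {D} {T : Tower D} {w} p .{{_ : NonZero p}} (pr : Prime p) (p∣D : p ∣ D) →
         (∀ q → Prime q → q ∣ n → Ideals.FixesPrime (ram p pr p∣D T) (1ℤ ℤ.+ + D) q) → (p ≢ 2 ⊎ 4 ∣ D) →
         Chain n T₀ T w → Chain n T₀ (ram p pr p∣D T) (p * w)

-- Each step fixes one digit of the exponents, so the surviving e k agree modulo w; `e≡` keeps this
-- for the final count.
record Descended (n : ℕ) {h : ℕ} (T₀ : Tower h) (w : ℕ) (e : ℕ → ℤ) (ks : List ℕ) : Set where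
  field
    e₀     : ℕ → ℤ
    ks₀    : List ℕ
    offset : ℤ
    unique : Unique ks₀
    ks₀⊆ks : ∀ {k} → k ∈ ks₀ → k ∈ ks
    norm   : Norm T₀ n (polyOf e₀ ks₀)
    e≡     : ∀ {k} → k ∈ ks₀ → e k ≡ offset ℤ.+ e₀ k ℤ.* + w

descent : ∀ {n} .{{_ : NonZero n}} {h} {T₀ : Tower h} {D} {T : Tower D} {w} → Chain n T₀ T w → ∀ e ks → Unique ks → Norm T n (polyOf e ks) → Descended n T₀ w e ks
descent done e ks uniq norm = record { e₀ = e ; ks₀ = ks ; offset = 0ℤ ; unique = uniq ; ks₀⊆ks = id ; norm = norm ; e≡ = λ {k} _ → lem (e k) }
  where
  lem : ∀ x → x ≡ 0ℤ ℤ.+ x ℤ.* 1ℤ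
  lem = ℤ-Solver.solve-∀
descent {n} {T₀ = T₀} (step {T = T} {w} p pr p∣D fixes cond chain) e ks uniq norm = from (Components.descend p pr p∣D T norm fixes cond)
  where
  from : _ → Descended n T₀ (p * w) e ks
  from (l , l<p , _ , norm-y) = up (descent chain e/ ks′ (Uniqueₚ.filter⁺ (inClass? p l e) uniq) (norm-cong T {n} {sub p l (polyOf e ks)} (sub-polyOf p l e ks) norm-y))
    where
    e/ : ℕ → ℤ
    e/ k = e k /ℕ p
    ks′ = filter (inClass? p l e) ks
    l₁ : ∀ l p o x w → l ℤ.+ (o ℤ.+ x ℤ.* w) ℤ.* p ≡ (l ℤ.+ o ℤ.* p) ℤ.+ x ℤ.* (p ℤ.* w)
    l₁ = ℤ-Solver.solve-∀
    up : Descended n T₀ w e/ ks′ → Descended n T₀ (p * w) e ks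
    up d = record { e₀ = e₀ ; ks₀ = ks₀ ; offset = + l ℤ.+ offset ℤ.* + p ; unique = unique ; ks₀⊆ks = λ m → proj₁ (Memₚ.∈-filter⁻ (inClass? p l e) (ks₀⊆ks m))
                  ; norm = Descended.norm d
                  ; e≡ = λ {k} m → trans (a≡a%ℕn+[a/ℕn]*n (e k) p) (trans (cong₂ (λ r q → + r ℤ.+ q ℤ.* + p) (proj₂ (Memₚ.∈-filter⁻ (inClass? p l e) {xs = ks} (ks₀⊆ks m))) (e≡ m))
                      (trans (l₁ (+ l) (+ p) offset (e₀ k) (+ w)) (cong (λ z → (+ l ℤ.+ offset ℤ.* + p) ℤ.+ e₀ k ℤ.* z) (sym (ℤₚ.pos-* p w))))) }
      where open Descended d using (e₀; ks₀; offset; unique; ks₀⊆ks; e≡)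

module _ {D} (T : Tower D) where
  lin-polyOf-≤ : ∀ f M → (∀ i → f i ℤ.≤ M) → ∀ e ks → lin f (polyOf e ks) ℤ.≤ + length ks ℤ.* M
  lin-polyOf-≤ f M h e []       = ℤₚ.≤-refl
  lin-polyOf-≤ f M h e (k ∷ ks) = ℤₚ.≤-trans (ℤₚ.+-mono-≤ (h (e k)) (lin-polyOf-≤ f M h e ks)) (ℤₚ.≤-reflexive (sym (ℤₚ.suc-* (+ length ks) M)))

  Q-polyOf-≤ : ∀ e ks → Q T (polyOf e ks) ℤ.≤ + length ks ℤ.* (+ length ks ℤ.* + t₀ T)
  Q-polyOf-≤ e ks = subst (ℤ._≤ + length ks ℤ.* (+ length ks ℤ.* + t₀ T)) (sym (F-def T (polyOf e ks) (polyOf e ks)))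
    (lin-polyOf-≤ _ (+ length ks ℤ.* + t₀ T) (λ i → lin-polyOf-≤ _ (+ t₀ T) (λ j → tr≤ T (i ℤ.- j)) e ks) e ks)

  Q-norm : ∀ {n a} → Norm T n a → Q T a ≡ + n ℤ.* + t₀ T
  Q-norm {n} {a} na = trans (Form.F≡ T a a) (trans (Quot.eq na 0ℤ) (trans (Quot.lin-nat ℤR (tr T) (Quot.at ℤR (tr T) 0ℤ) n) (cong₂ ℤ._*_ (nat≡+ n) (tr-0 T))))

  -- Norm n gives the form the value n `t₀`, while each ordered pair of terms contributes at most
  -- `t₀`.
  norm-bound : ∀ {n} e ks → Norm T n (polyOf e ks) → n ≤ length ks * length ks
  norm-bound {n} e ks na = ℕₚ.*-cancelʳ-≤ n (length ks * length ks) (t₀ T) {{>-nonZero (t₀>0 T)}}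
    (ℤₚ.drop‿+≤+ (subst₂ ℤ._≤_ (trans (Q-norm {n} {polyOf e ks} na) (sym (ℤₚ.pos-* n (t₀ T)))) (trans (cong (+ length ks ℤ.*_) (sym (ℤₚ.pos-* (length ks) (t₀ T)))) (trans (sym (ℤₚ.pos-* (length ks) (length ks * t₀ T))) (cong +_ (sym (ℕₚ.*-assoc (length ks) (length ks) (t₀ T)))))) (Q-polyOf-≤ e ks)))

lookup-injective : ∀ {ks : List ℕ} → Unique ks → ∀ i j → Data.List.lookup ks i ≡ Data.List.lookup ks j → i ≡ j
lookup-injective (_ ∷ _)    fzero    fzero    _ = refl
lookup-injective (k∉ ∷ _)   fzero    (fsuc j) e = contradiction e (Data.List.Relation.Unary.All.lookup k∉ (Memₚ.∈-lookup j))
lookup-injective (k∉ ∷ _)   (fsuc i) fzero    e = contradiction (sym e) (Data.List.Relation.Unary.All.lookup k∉ (Memₚ.∈-lookup i))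
lookup-injective (_ ∷ uniq) (fsuc i) (fsuc j) e = cong fsuc (lookup-injective uniq i j e)

count-class : ∀ ks w g → .{{_ : NonZero w}} → Unique ks → (∀ {k} → k ∈ ks → k < w * g) → (∀ {k k′} → k ∈ ks → k′ ∈ ks → Cong w (+ k) (+ k′)) → length ks ≤ g
count-class ks w g uniq bound same = Finₚ.injective⇒≤ {f = f} inj
  where
  elem : Fin (length ks) → ℕ
  elem = Data.List.lookup ks
  elem∈ : ∀ i → elem i ∈ ks
  elem∈ i = Memₚ.∈-lookup {xs = ks} i
  quotient< : ∀ i → elem i / w < g
  quotient< i = Data.Nat.DivMod.m<n*o⇒m/o<n (subst (elem i <_) (ℕₚ.*-comm w g) (bound (elem∈ i)))
  f : Fin (length ks) → Fin g
  f i = fromℕ< (quotient< i)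
  as-residue : ∀ x → Cong w (+ x) (+ (x % w))
  as-residue x = mkC (+ (x / w)) (trans (cong +_ (m≡m%n+[m/n]*n x w)) (trans (ℤₚ.pos-+ (x % w) (x / w * w)) (cong (λ z → + (x % w) ℤ.+ z) (ℤₚ.pos-* (x / w) w))))
  inj : ∀ {i j} → f i ≡ f j → i ≡ j
  inj {i} {j} e = lookup-injective uniq i j (trans (m≡m%n+[m/n]*n (elem i) w) (trans (cong₂ (λ r q → r + q * w) residues quotients) (sym (m≡m%n+[m/n]*n (elem j) w))))
    where
    quotients : elem i / w ≡ elem j / w
    quotients = trans (sym (Finₚ.toℕ-fromℕ< (quotient< i))) (trans (cong toℕ e) (Finₚ.toℕ-fromℕ< (quotient< j)))
    residues : elem i % w ≡ elem j % w
    residues = cong⇒≡ w (m%n<n (elem i) w) (m%n<n (elem j) w) (cong-trans (cong-sym (as-residue (elem i))) (cong-trans (same (elem∈ i) (elem∈ j)) (as-residue (elem j))))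

module Embedding {D : ℕ} (p : ℕ) .{{nzp : NonZero p}} (pr : Prime p) (p∣D : p ∣ D) (T : Tower D) where
  open Components p pr p∣D T using (sub-lift-yes; sub-lift-no)
  private
    module B = Quot ℤR (tr T)
    module C = Quot ℤR (tr (ram p pr p∣D T))

  -- The image of a has a as its component 0 and zero in the other classes, and components determine
  -- an element.
  σ-embed : ∀ {a b} → a B.∼ b → σ (+ p) a C.∼ σ (+ p) b
  σ-embed {a} {b} e = C.∼-trans (C.∼-sym (C.⊠-identityˡ (σ (+ p) a))) (C.∼-trans (Ramified.sub-reflects p pr p∣D T (λ k _ → go k (0 ≟ k))) (C.⊠-identityˡ (σ (+ p) b)))
    where
    go : ∀ k → Dec (0 ≡ k) → sub p k (X^ 0ℤ ⊠ σ (+ p) a) B.∼ sub p k (X^ 0ℤ ⊠ σ (+ p) b)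
    go k (yes z) = B.∼-trans (sub-lift-yes 0 k a (prime>0 pr) z) (B.∼-trans e (B.∼-sym (sub-lift-yes 0 k b (prime>0 pr) z)))
    go k (no nz) = B.∼-trans (sub-lift-no 0 k a (prime>0 pr) nz) (B.∼-sym (sub-lift-no 0 k b (prime>0 pr) nz))

chain-embed : ∀ {n h} {T₀ : Tower h} {D} {T : Tower D} {w} → Chain n T₀ T w → ∀ {a b} → Quot._∼_ ℤR (tr T₀) a b → Quot._∼_ ℤR (tr T) (σ (+ w) a) (σ (+ w) b)
chain-embed {T₀ = T₀} done {a} {b} e = Quot.∼-trans ℤR (tr T₀) (Cyc.σ-id T₀ a) (Quot.∼-trans ℤR (tr T₀) e (Quot.∼-sym ℤR (tr T₀) (Cyc.σ-id T₀ b)))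
chain-embed (step {T = T} {w} p pr p∣D _ _ chain) {a} {b} e = C.∼-trans (expand a) (C.∼-trans (Embedding.σ-embed p pr p∣D T (chain-embed chain e)) (C.∼-sym (expand b)))
  where
  module C = Quot ℤR (tr (ram p pr p∣D T))
  expand : ∀ a → σ (+ (p * w)) a C.∼ σ (+ p) (σ (+ w) a)
  expand a = C.∼-trans (C.∼-reflexive (cong (λ s → σ s a) (ℤₚ.pos-* p w))) (C.∼-sym (C.σ-σ (+ p) (+ w) a))

climb : List ℕ → ℕ → ℕ
climb []       h = h
climb (p ∷ ps) h = p * climb ps h

climb≡ : ∀ ps h → climb ps h ≡ product ps * h
climb≡ []       h = sym (ℕₚ.*-identityˡ h)
climb≡ (p ∷ ps) h = trans (cong (p *_) (climb≡ ps h)) (sym (ℕₚ.*-assoc p _ h))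

∣climb : ∀ ps h → h ∣ climb ps h
∣climb ps h = subst (h ∣_) (sym (climb≡ ps h)) (n∣m*n (product ps))

module Build (n h : ℕ) .{{nzn : NonZero n}} .{{nzh : NonZero h}} (m : ℕ) (m≡ : m ≡ lcm n h) .{{nzm : NonZero m}}
             (order-condition : OrderCondition n h) (q∣h : ∀ q → Prime q → q ∣ n → q ∣ h)
             {h₀ : ℕ} (T₀ : Tower h₀) (h∣h₀ : h ∣ h₀) where
  build : ∀ ps → All Prime ps → All (_∣ n) ps → climb ps h₀ ∣ m → (2 ∈ ps → 4 ∣ h₀) → ∃ λ (T : Tower (climb ps h₀)) → Chain n T₀ T (product ps)
  build []       []         []         _  _    = T₀ , done
  build (p ∷ ps) (pr ∷ prs) (d ∷ ds) ∣m four = up (build ps prs ds (∣-trans (n∣m*n p) ∣m) (four ∘ there))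
    where
    instance nzp = prime⇒nonZero pr
    D = climb ps h₀
    h∣D : h ∣ D
    h∣D = ∣-trans h∣h₀ (∣climb ps h₀)
    p∣D : p ∣ D
    p∣D = ∣-trans (q∣h p pr d) h∣D
    cond : Dec (p ≡ 2) → p ≢ 2 ⊎ 4 ∣ D
    cond (yes p≡2) = inj₂ (∣-trans (four (here (sym p≡2))) (∣climb ps h₀))
    cond (no p≢2)  = inj₁ p≢2
    up : (∃ λ (T : Tower D) → Chain n T₀ T (product ps)) → ∃ λ (T : Tower (p * D)) → Chain n T₀ T (p * product ps)
    up (T , chain) = ram p pr p∣D T , step p pr p∣D (FixedPrimes.fixes-prime n h m m≡ order-condition q∣h p pr d p∣D h∣D ∣m T) (cond (p ≟ 2)) chain

-- Butson matrices

Σᴾ : ℕ → (ℕ → Poly) → Poly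
Σᴾ zero    f = 𝟘
Σᴾ (suc n) f = f 0 ⊞ Σᴾ n (f ∘ suc)

Σᴾ≡∑ : ∀ t n f → Σᴾ n f ≡ Sums.∑ (Quot.A ℤR t) n f
Σᴾ≡∑ t zero    f = refl
Σᴾ≡∑ t (suc n) f = cong (f 0 ⊞_) (Σᴾ≡∑ t n (f ∘ suc))

σ-Σᴾ : ∀ s n f → σ s (Σᴾ n f) ≡ Σᴾ n (σ s ∘ f)
σ-Σᴾ s zero    f = σ-𝟘 s
σ-Σᴾ s (suc n) f = trans (σ-⊞ s (f 0) (Σᴾ n (f ∘ suc))) (cong (σ s (f 0) ⊞_) (σ-Σᴾ s n (f ∘ suc)))

lin-Σᴾ : ∀ R f n g → CommutativeRing._≈_ R (Lin.lin R f (Σᴾ n g)) (Sums.∑ R n (Lin.lin R f ∘ g))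
lin-Σᴾ R f zero    g = CommutativeRing.refl R
lin-Σᴾ R f (suc n) g = CommutativeRing.+-congˡ R (lin-Σᴾ R f n (g ∘ suc))

polyOf-upTo : ∀ e n → polyOf e (upTo n) ≡ Σᴾ n (λ k → X^ (e k))
polyOf-upTo e n = go n id
  where
  go : ∀ n f → polyOf e (Data.List.applyUpTo f n) ≡ Σᴾ n (λ k → X^ (e (f k)))
  go zero    f = refl
  go (suc n) f = cong (X^ (e (f 0)) ⊞_) (go n (f ∘ suc))

module BH (n h : ℕ) .{{nzn : NonZero n}} .{{nzh : NonZero h}} (R : CommutativeRing 0ℓ 0ℓ) (domain : IsIntegralDomain R) (char0 : HasCharZero R)
          (ζ : CommutativeRing.Carrier R) (prim : IsPrimitiveRoot R h ζ) (a : Fin n → Fin n → Fin h) (bh : IsBH R n h ζ a) where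
  Tₕ : Tower h
  Tₕ = tower h

  b : ℕ → ℕ → ℕ
  b g k = toℕ (a (g mod n) (k mod n))

  b<h : ∀ g k → b g k < h
  b<h g k = Finₚ.toℕ<n (a (g mod n) (k mod n))

  mod-≡ : ∀ {x y} → x % n ≡ y % n → x mod n ≡ y mod n
  mod-≡ {x} {y} e = Finₚ.toℕ-injective (trans (Finₚ.toℕ-fromℕ< (m%n<n x n)) (trans e (sym (Finₚ.toℕ-fromℕ< (m%n<n y n)))))

  addZ-mod : ∀ g l → (g + l) mod n ≡ addZ n (g mod n) (l mod n)
  addZ-mod g l = mod-≡ (trans (%-distribˡ-+ g l n) (cong₂ (λ x y → (x + y) % n) (sym (Finₚ.toℕ-fromℕ< (m%n<n g n))) (sym (Finₚ.toℕ-fromℕ< (m%n<n l n)))))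

  b-shift : ∀ g k l → b (g + l) (k + l) ≡ b g k
  b-shift g k l = cong toℕ (trans (cong₂ a (addZ-mod g l) (addZ-mod k l)) (proj₁ bh (g mod n) (k mod n) (l mod n)))

  b-periodic : ∀ g k → b (g + n) k ≡ b g k
  b-periodic g k = cong (λ z → toℕ (a z (k mod n))) (mod-≡ (Data.Nat.DivMod.[m+n]%n≡m%n g n))

  private
    module RR = CRing R
    module TR = Transfer R domain char0 h ζ prim

  orthogonal : ∀ g g′ → g ≢ g′ → RR._≈_ (sumFin R (λ k → pow R ζ (toℕ (a g k)) RR.⊙ pow R ζ (h ∸ toℕ (a g′ k)))) RR.0#
  orthogonal g g′ ne with g Data.Fin.≟ g′ | proj₂ bh g g′
  ... | yes e | _ = contradiction e ne
  ... | no _  | r = r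

  -- The inner product of the rows g and g′, written with x in place of ζ.
  ρ : ℕ → ℕ → Poly
  ρ g g′ = Σᴾ n (λ k → X^ (+ b g k ℤ.- + b g′ k))

  ρ∼𝟘 : ∀ g g′ → g < n → g′ < n → g ≢ g′ → Quot._∼_ ℤR (tr Tₕ) (ρ g g′) 𝟘
  ρ∼𝟘 g g′ g<n g′<n g≢g′ = Fourier.transfer R domain char0 h ζ prim Tₕ (ρ g g′) (begin
    TR.ev (ρ g g′)                                                                      ≈⟨ lin-Σᴾ R TR.χ n _ ⟩
    ∑ᴿ n (λ k → TR.χ (+ b g k ℤ.- + b g′ k))                                            ≈⟨ ∑ᴿ-cong n (λ k _ → term k) ⟩
    ∑ᴿ n (λ k → pow R ζ (b g k) RR.⊙ pow R ζ (h ∸ b g′ k))                              ≈⟨ Sums.∑-sumFin R n _ ⟨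
    sumFin R {n} (λ k → pow R ζ (b g (toℕ k)) RR.⊙ pow R ζ (h ∸ b g′ (toℕ k)))          ≈⟨ sumFin-cong (λ k → RR.≈-reflexive (cong (λ k → pow R ζ (toℕ (a (g mod n) k)) RR.⊙ pow R ζ (h ∸ toℕ (a (g′ mod n) k))) (toℕ-mod k))) ⟩
    sumFin R {n} (λ k → pow R ζ (toℕ (a (g mod n) k)) RR.⊙ pow R ζ (h ∸ toℕ (a (g′ mod n) k))) ≈⟨ orthogonal (g mod n) (g′ mod n) distinct ⟩
    RR.0#                                                                               ∎)
    where
    open SetoidReasoning RR.setoid
    open Sums R using () renaming (∑ to ∑ᴿ; ∑-cong to ∑ᴿ-cong)
    sumFin-cong : ∀ {m} {f f′ : Fin m → RR.Carrier} → (∀ k → f k RR.≈ f′ k) → sumFin R f RR.≈ sumFin R f′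
    sumFin-cong {zero}  e = RR.≈-refl
    sumFin-cong {suc m} e = RR.+-cong (e fzero) (sumFin-cong (e ∘ fsuc))
    toℕ-mod : ∀ (k : Fin n) → toℕ k mod n ≡ k
    toℕ-mod k = Finₚ.toℕ-injective (trans (Finₚ.toℕ-fromℕ< (m%n<n (toℕ k) n)) (m<n⇒m%n≡m (Finₚ.toℕ<n k)))
    distinct : g mod n ≢ g′ mod n
    distinct e = g≢g′ (trans (sym (m<n⇒m%n≡m g<n)) (trans (trans (sym (Finₚ.toℕ-fromℕ< (m%n<n g n))) (trans (cong toℕ e) (Finₚ.toℕ-fromℕ< (m%n<n g′ n)))) (m<n⇒m%n≡m g′<n)))
    l₁ : ∀ x y h → x ℤ.+ (h ℤ.- y) ≡ (x ℤ.- y) ℤ.+ 1ℤ ℤ.* h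
    l₁ = ℤ-Solver.solve-∀
    term : ∀ k → TR.χ (+ b g k ℤ.- + b g′ k) RR.≈ pow R ζ (b g k) RR.⊙ pow R ζ (h ∸ b g′ k)
    term k = begin
      TR.χ (+ b g k ℤ.- + b g′ k)                        ≡⟨ TR.χ-cong {+ b g k ℤ.- + b g′ k} (cong-sym (mkC 1ℤ (trans (ℤₚ.pos-+ (b g k) (h ∸ b g′ k)) (trans (cong (λ z → + b g k ℤ.+ z) (sym (trans (ℤₚ.[+m]-[+n]≡m⊖n h (b g′ k)) (ℤₚ.⊖-≥ (ℕₚ.<⇒≤ (b<h g′ k)))))) (l₁ (+ b g k) (+ b g′ k) (+ h)))))) ⟩
      TR.χ (+ (b g k + (h ∸ b g′ k)))                    ≈⟨ TR.χ-nat (b g k + (h ∸ b g′ k)) ⟩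
      pow R ζ (b g k + (h ∸ b g′ k))                     ≈⟨ RR.↑-+ ζ (b g k) (h ∸ b g′ k) ⟩
      pow R ζ (b g k) RR.⊙ pow R ζ (h ∸ b g′ k)          ∎

  -- The value of the primitive character of ℤ_n at the first column of the matrix.
  exponent : ℕ → ℕ → ℕ → ℤ
  exponent w v g = + w ℤ.* + b g 0 ℤ.+ + v ℤ.* + g

  module _ {m : ℕ} (T : Tower m) (w v : ℕ) (wh≡m : w * h ≡ m) (vn≡m : v * n ≡ m)
           (embed : ∀ {x y} → Quot._∼_ ℤR (tr Tₕ) x y → Quot._∼_ ℤR (tr T) (σ (+ w) x) (σ (+ w) y)) where
    open Quot ℤR (tr T)
    open CRing A
    open Sums A renaming (∑ to ∑ᴬ; ∑-cong to ∑ᴬ-cong)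
    open Cyc T
    open SetoidReasoning setoid

    E : ℕ → ℕ → ℤ
    E k g = + w ℤ.* + b g k ℤ.+ + v ℤ.* + g

    -- The character g ↦ x^(vg) of ℤ_n applied to column k; x^v has order n, and x^w stands for ζ.
    Z : ℕ → Poly
    Z k = ∑ᴬ n (λ g → X^ (E k g))

    conj-∑ : ∀ n f → conj (∑ᴬ n f) ∼ ∑ᴬ n (conj ∘ f)
    conj-∑ zero    f = ∼-reflexive (σ-𝟘 ℤ.-1ℤ)
    conj-∑ (suc n) f = ∼-trans (∼-reflexive (σ-⊞ ℤ.-1ℤ (f 0) (∑ᴬ n (f ∘ suc)))) (+-congˡ {conj (f 0)} (conj-∑ n (f ∘ suc)))

    ∑⊠∑ : ∀ n f g → ∑ᴬ n f ⊠ ∑ᴬ n g ∼ ∑ᴬ n (λ i → ∑ᴬ n (λ j → f i ⊠ g j))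
    ∑⊠∑ n f g = begin
      ∑ᴬ n f ⊠ ∑ᴬ n g                        ≈⟨ *-comm (∑ᴬ n f) (∑ᴬ n g) ⟩
      ∑ᴬ n g ⊠ ∑ᴬ n f                        ≈⟨ ∑-⊙ˡ n (∑ᴬ n g) f ⟨
      ∑ᴬ n (λ i → ∑ᴬ n g ⊠ f i)              ≈⟨ ∑ᴬ-cong n (λ i _ → ∼-trans (*-comm (∑ᴬ n g) (f i)) (∼-sym (∑-⊙ˡ n (f i) g))) ⟩
      ∑ᴬ n (λ i → ∑ᴬ n (λ j → f i ⊠ g j))    ∎

    Z-norm : ∀ k → Z k ⊠ conj (Z k) ∼ ∑ᴬ n (λ g → ∑ᴬ n (λ g′ → X^ (E k g ℤ.- E k g′)))
    Z-norm k = begin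
      Z k ⊠ conj (Z k)                                              ≈⟨ *-congˡ {Z k} (conj-∑ n (λ g → X^ (E k g))) ⟩
      Z k ⊠ ∑ᴬ n (λ g → conj (X^ (E k g)))                          ≈⟨ ∑⊠∑ n _ _ ⟩
      ∑ᴬ n (λ g → ∑ᴬ n (λ g′ → X^ (E k g) ⊠ conj (X^ (E k g′))))    ≈⟨ ∑ᴬ-cong n (λ g _ → ∑ᴬ-cong n (λ g′ _ → ∼-trans (*-congˡ {X^ (E k g)} (∼-reflexive (conj-X^ (E k g′)))) (X^⊠ (E k g) (ℤ.- E k g′)))) ⟩
      ∑ᴬ n (λ g → ∑ᴬ n (λ g′ → X^ (E k g ℤ.- E k g′)))              ∎

    σρ : ∀ g g′ → σ (+ w) (ρ g g′) ∼ ∑ᴬ n (λ k → X^ (+ w ℤ.* (+ b g k ℤ.- + b g′ k)))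
    σρ g g′ = ∼-reflexive (trans (σ-Σᴾ (+ w) n _) (trans (Σᴾ≡∑ (tr T) n _) (∑-≡ n (λ k → σ-X^ (+ w) (+ b g k ℤ.- + b g′ k)))))
      where
      ∑-≡ : ∀ n {f f′ : ℕ → Poly} → (∀ k → f k ≡ f′ k) → ∑ᴬ n f ≡ ∑ᴬ n f′
      ∑-≡ zero    e = refl
      ∑-≡ (suc n) e = cong₂ _⊞_ (e 0) (∑-≡ n (e ∘ suc))

    column-sum : ∀ g g′ → ∑ᴬ n (λ k → X^ (E k g ℤ.- E k g′)) ∼ X^ (+ v ℤ.* (+ g ℤ.- + g′)) ⊠ σ (+ w) (ρ g g′)
    column-sum g g′ = begin
      ∑ᴬ n (λ k → X^ (E k g ℤ.- E k g′))                                                    ≈⟨ ∑ᴬ-cong n (λ k _ → ∼-trans (X^-cong (l₁ (+ w) (+ b g k) (+ b g′ k) (+ v) (+ g) (+ g′))) (∼-sym (X^⊠ (+ v ℤ.* (+ g ℤ.- + g′)) (+ w ℤ.* (+ b g k ℤ.- + b g′ k))))) ⟩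
      ∑ᴬ n (λ k → X^ (+ v ℤ.* (+ g ℤ.- + g′)) ⊠ X^ (+ w ℤ.* (+ b g k ℤ.- + b g′ k)))        ≈⟨ ∑-⊙ˡ n (X^ (+ v ℤ.* (+ g ℤ.- + g′))) _ ⟩
      X^ (+ v ℤ.* (+ g ℤ.- + g′)) ⊠ ∑ᴬ n (λ k → X^ (+ w ℤ.* (+ b g k ℤ.- + b g′ k)))        ≈⟨ *-congˡ {X^ (+ v ℤ.* (+ g ℤ.- + g′))} (σρ g g′) ⟨
      X^ (+ v ℤ.* (+ g ℤ.- + g′)) ⊠ σ (+ w) (ρ g g′)                                        ∎
      where
      l₁ : ∀ w x y v g g′ → (w ℤ.* x ℤ.+ v ℤ.* g) ℤ.- (w ℤ.* y ℤ.+ v ℤ.* g′) ≡ v ℤ.* (g ℤ.- g′) ℤ.+ w ℤ.* (x ℤ.- y)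
      l₁ = ℤ-Solver.solve-∀

    off-diagonal : ∀ g g′ → g < n → g′ < n → g ≢ g′ → ∑ᴬ n (λ k → X^ (E k g ℤ.- E k g′)) ∼ 𝟘
    off-diagonal g g′ g<n g′<n ne = ∼-trans (column-sum g g′) (∼-trans (*-congˡ {X^ (+ v ℤ.* (+ g ℤ.- + g′))} (∼-trans (embed (ρ∼𝟘 g g′ g<n g′<n ne)) (∼-reflexive (σ-𝟘 (+ w))))) (zeroʳ _))

    diagonal : ∀ g → ∑ᴬ n (λ k → X^ (E k g ℤ.- E k g)) ∼ nat n
    diagonal g = ∼-trans (∑ᴬ-cong n (λ k _ → X^-cong (ℤₚ.+-inverseʳ (E k g)))) (∼-trans (∑-const n (X^ 0ℤ)) (*-identityʳ _))

    -- Parseval: summing over the columns first produces the inner products of the rows with weights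
    -- x^(v(g-g′)), and only the n diagonal ones survive.
    total : ∑ᴬ n (λ k → Z k ⊠ conj (Z k)) ∼ nat n ⊠ nat n
    total = begin
      ∑ᴬ n (λ k → Z k ⊠ conj (Z k))                                               ≈⟨ ∑ᴬ-cong n (λ k _ → Z-norm k) ⟩
      ∑ᴬ n (λ k → ∑ᴬ n (λ g → ∑ᴬ n (λ g′ → X^ (E k g ℤ.- E k g′))))               ≈⟨ ∑-swap n n _ ⟩
      ∑ᴬ n (λ g → ∑ᴬ n (λ k → ∑ᴬ n (λ g′ → X^ (E k g ℤ.- E k g′))))               ≈⟨ ∑ᴬ-cong n (λ g _ → ∑-swap n n _) ⟩
      ∑ᴬ n (λ g → ∑ᴬ n (λ g′ → ∑ᴬ n (λ k → X^ (E k g ℤ.- E k g′))))               ≈⟨ ∑ᴬ-cong n (λ g g<n → ∼-trans (∑-single n _ g g<n (λ g′ g′<n ne → off-diagonal g g′ g<n g′<n (ne ∘ sym))) (diagonal g)) ⟩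
      ∑ᴬ n (λ _ → nat n)                                                          ≈⟨ ∑-const n (nat n) ⟩
      nat n ⊠ nat n                                                               ∎

    -- Invariance makes column k a cyclic translate of column 0 by k, which the character turns into
    -- the factor x^(vk).
    Z-shift : ∀ k → Z k ∼ X^ (+ v ℤ.* + k) ⊠ Z 0
    Z-shift k = begin
      ∑ᴬ n (λ g → X^ (E k g))                                ≈⟨ ∑-shift n (λ g → X^ (E k g)) periodic k ⟨
      ∑ᴬ n (λ g → X^ (E k (g + k)))                          ≈⟨ ∑ᴬ-cong n (λ g _ → ∼-trans (X^-cong (rearrange g)) (∼-sym (X^⊠ (+ v ℤ.* + k) (E 0 g)))) ⟩
      ∑ᴬ n (λ g → X^ (+ v ℤ.* + k) ⊠ X^ (E 0 g))             ≈⟨ ∑-⊙ˡ n (X^ (+ v ℤ.* + k)) _ ⟩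
      X^ (+ v ℤ.* + k) ⊠ Z 0                                 ∎
      where
      l₁ : ∀ x v g n → x ℤ.+ v ℤ.* (g ℤ.+ n) ≡ (x ℤ.+ v ℤ.* g) ℤ.+ 1ℤ ℤ.* (v ℤ.* n)
      l₁ = ℤ-Solver.solve-∀
      l₂ : ∀ x v g k → x ℤ.+ v ℤ.* (g ℤ.+ k) ≡ v ℤ.* k ℤ.+ (x ℤ.+ v ℤ.* g)
      l₂ = ℤ-Solver.solve-∀
      periodic : ∀ g → X^ (E k (g + n)) ∼ X^ (E k g)
      periodic g = X^-mod (mkC 1ℤ (trans (cong₂ (λ x y → + w ℤ.* + x ℤ.+ + v ℤ.* y) (b-periodic g k) (ℤₚ.pos-+ g n)) (trans (l₁ (+ w ℤ.* + b g k) (+ v) (+ g) (+ n)) (cong (λ z → E k g ℤ.+ 1ℤ ℤ.* z) (trans (sym (ℤₚ.pos-* v n)) (cong +_ vn≡m))))))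
      rearrange : ∀ g → E k (g + k) ≡ + v ℤ.* + k ℤ.+ E 0 g
      rearrange g = trans (cong₂ (λ x y → + w ℤ.* + x ℤ.+ + v ℤ.* y) (b-shift g 0 k) (ℤₚ.pos-+ g k)) (l₂ (+ w ℤ.* + b g 0) (+ v) (+ g) (+ k))

    same-norm : ∀ k → Z k ⊠ conj (Z k) ∼ Z 0 ⊠ conj (Z 0)
    same-norm k = begin
      Z k ⊠ conj (Z k)                                            ≈⟨ *-cong (Z-shift k) (conj-cong (Z-shift k)) ⟩
      (x ⊠ Z 0) ⊠ conj (x ⊠ Z 0)                                  ≈⟨ *-congˡ {x ⊠ Z 0} (σ-⊠ ℤ.-1ℤ x (Z 0)) ⟩
      (x ⊠ Z 0) ⊠ (conj x ⊠ conj (Z 0))                           ≈⟨ solve 4 (λ x z y w → (x :* z) :* (y :* w) := (y :* x) :* (z :* w)) ∼-refl x (Z 0) (conj x) (conj (Z 0)) ⟩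
      (conj x ⊠ x) ⊠ (Z 0 ⊠ conj (Z 0))                           ≈⟨ *-congʳ (∼-trans (*-congʳ {x} (∼-reflexive (conj-X^ (+ v ℤ.* + k)))) (X^-inverse (+ v ℤ.* + k))) ⟩
      X^ 0ℤ ⊠ (Z 0 ⊠ conj (Z 0))                                  ≈⟨ *-identityˡ _ ⟩
      Z 0 ⊠ conj (Z 0)                                            ∎
      where x = X^ (+ v ℤ.* + k)

    -- The Z k differ by roots of unity, so n equal norms add up to n².
    norm-Z : Z 0 ⊠ conj (Z 0) ∼ nat n
    norm-Z = torsion-free n (ℕₚ.n≢0⇒n>0 (≢-nonZero⁻¹ n)) (begin
      nat n ⊠ (Z 0 ⊠ conj (Z 0))              ≈⟨ ∑-const n (Z 0 ⊠ conj (Z 0)) ⟨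
      ∑ᴬ n (λ _ → Z 0 ⊠ conj (Z 0))           ≈⟨ ∑ᴬ-cong n (λ k _ → same-norm k) ⟨
      ∑ᴬ n (λ k → Z k ⊠ conj (Z k))           ≈⟨ total ⟩
      nat n ⊠ nat n                           ∎)

    norm-character : Norm T n (polyOf (exponent w v) (upTo n))
    norm-character = subst (Norm T n) (sym (trans (polyOf-upTo (exponent w v) n) (Σᴾ≡∑ (tr T) n _))) norm-Z

-- Order n = 8 with h = 2v, v odd, is not reached by the descent bound; it is excluded by the autocorrelations at shifts 2, 4 and 6.
module OrderEight {h : ℕ} (T : Tower h) (v : ℕ) (h≡2v : h ≡ 2 * v) (4∤h : ¬ 4 ∣ h) where
  open Quot ℤR (tr T)
  open CRing A using (_⊖_; ⊖≈0⇒≈)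
  open Cyc T
  open Form T

  private
    t : ℤ → ℤ
    t = tr T
    t₀ᶻ = + t₀ T

  t-even : ∀ x → t (ℤ.- x) ≡ t x
  t-even x = trans (cong t (sym (ℤₚ.-1*i≡-i x))) (tr-unit T -1-unit x)

  -1∼X^v : ⊟ X^ 0ℤ ∼ X^ (+ v)
  -1∼X^v = -1∼X^ h≡2v

  t-shift : ∀ x → t (x ℤ.+ + v) ≡ ℤ.- t x
  t-shift x = sym (trans (cong (λ z → ℤ.- t z) (sym (ℤₚ.+-identityʳ x))) (eq -1∼X^v x))

  Q-X^⊖X^ : ∀ x y → Q T (X^ x ⊖ X^ y) ≡ + 2 ℤ.* (t₀ᶻ ℤ.- t (x ℤ.- y))
  Q-X^⊖X^ x y = trans (Q-⊖ (X^ x) (X^ y)) (trans (cong₂ (λ a b → a ℤ.- + 2 ℤ.* b) (cong₂ ℤ._+_ (self x) (self y)) (F-def T (X^ x) (X^ y))) (lem t₀ᶻ (t (x ℤ.- y))))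
    where
    self : ∀ x → Q T (X^ x) ≡ t₀ᶻ
    self x = trans (F-def T (X^ x) (X^ x)) (trans (cong t (ℤₚ.+-inverseʳ x)) (tr-0 T))
    lem : ∀ a b → a ℤ.+ a ℤ.- + 2 ℤ.* b ≡ + 2 ℤ.* (a ℤ.- b)
    lem = ℤ-Solver.solve-∀

  -- For a root of unity of maximal trace the form vanishes at its difference from 1. Non-zero
  -- elements have form at least `t₀`, so the difference is zero.
  t-max : ∀ x → t x ≡ t₀ᶻ → Cong h x 0ℤ
  t-max x e = from (dichotomy (kronecker T) (X^ x ⊖ X^ 0ℤ))
    where
    instance _ = tower-nonZero T
    Q≡0 : Q T (X^ x ⊖ X^ 0ℤ) ≡ 0ℤ
    Q≡0 = trans (Q-X^⊖X^ x 0ℤ) (trans (cong (λ z → + 2 ℤ.* (t₀ᶻ ℤ.- z)) (trans (cong t (ℤₚ.+-identityʳ x)) e)) (cong (+ 2 ℤ.*_) (ℤₚ.+-inverseʳ t₀ᶻ)))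
    from : X^ x ⊖ X^ 0ℤ ∼ 𝟘 ⊎ t₀ᶻ ℤ.≤ Q T (X^ x ⊖ X^ 0ℤ) → Cong h x 0ℤ
    from (inj₂ le) = ⊥-elim (ℤₚ.<⇒≱ (0<t₀ T) (subst (t₀ᶻ ℤ.≤_) Q≡0 le))
    from (inj₁ z)  = cong-trans (cong-%ℕ h x) (divisible (X^∼1⇒∣ (x %ℕ h) (∼-trans (∼-sym (X^-mod (cong-%ℕ h x))) (⊖≈0⇒≈ z))))
      where
      divisible : h ∣ (x %ℕ h) → Cong h (+ (x %ℕ h)) 0ℤ
      divisible (divides k e) = mkC (+ k) (trans (cong +_ e) (trans (ℤₚ.pos-* k h) (sym (ℤₚ.+-identityˡ _))))

  +h : + h ≡ + 2 ℤ.* + v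
  +h = trans (cong +_ h≡2v) (ℤₚ.pos-* 2 v)

  t-min : ∀ x → t x ≡ ℤ.- t₀ᶻ → Cong h x (+ v)
  t-min x e = cong-trans (mkC ℤ.-1ℤ (trans (l₁ x (+ v)) (cong (λ z → (x ℤ.+ + v) ℤ.+ + v ℤ.+ ℤ.-1ℤ ℤ.* z) (sym +h))))
    (cong-trans (cong-+ (t-max (x ℤ.+ + v) (trans (t-shift x) (trans (cong ℤ.-_ e) (ℤₚ.neg-involutive t₀ᶻ)))) (cong-refl {i = + v})) (cong-≡ (ℤₚ.+-identityˡ (+ v))))
    where
    l₁ : ∀ x v → x ≡ (x ℤ.+ v) ℤ.+ v ℤ.+ ℤ.-1ℤ ℤ.* (+ 2 ℤ.* v)
    l₁ = ℤ-Solver.solve-∀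

  t≥-t₀ : ∀ x → ℤ.- t₀ᶻ ℤ.≤ t x
  t≥-t₀ x = subst (ℤ.- t₀ᶻ ℤ.≤_) (trans (cong ℤ.-_ (t-shift x)) (ℤₚ.neg-involutive (t x))) (ℤₚ.neg-mono-≤ (tr≤ T (x ℤ.+ + v)))

  -- Exponents of an 8-periodic sequence of h-th roots of unity whose periodic autocorrelations at
  -- the shifts 1 to 7 are zero; j is the monomial tested against.
  record Sequence : Set where
    field
      B        : ℕ → ℤ
      periodic : ∀ i → B (i + 8) ≡ B i
      P        : ∀ d → 0 < d → d < 8 → ∀ j → ∑ 8 (λ i → t (j ℤ.+ (B i ℤ.- B (i + d)))) ≡ 0ℤ

  shift : Sequence → Sequence
  shift S = record
    { B        = λ i → B (suc i)
    ; periodic = λ i → periodic (suc i)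
    ; P        = λ d 0<d d<8 j → trans (ℤ∑.∑-shift₁ 8 (λ i → t (j ℤ.+ (B i ℤ.- B (i + d))))
                   (cong₂ (λ x y → t (j ℤ.+ (x ℤ.- y))) (periodic 0) (trans (cong B (ℕₚ.+-comm 8 d)) (periodic d)))) (P d 0<d d<8 j)
    }
    where open Sequence S

  -- Both traces are at least -`t₀`, and the relation forces both to attain this bound.
  double-min : ∀ x y → + 4 ℤ.* t₀ᶻ ℤ.+ (t x ℤ.+ t x ℤ.+ (t y ℤ.+ t y)) ≡ 0ℤ → t x ≡ ℤ.- t₀ᶻ
  double-min x y e = ℤₚ.≤-antisym (ℤₚ.≮⇒≥ λ lt → ℤₚ.<-irrefl (sym (trans e (sym (l₁ t₀ᶻ)))) (ℤₚ.+-monoʳ-< (+ 4 ℤ.* t₀ᶻ) (ℤₚ.+-mono-<-≤ (ℤₚ.+-mono-< lt lt) (ℤₚ.+-mono-≤ (t≥-t₀ y) (t≥-t₀ y))))) (t≥-t₀ x)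
    where
    l₁ : ∀ a → + 4 ℤ.* a ℤ.+ ((ℤ.- a) ℤ.+ (ℤ.- a) ℤ.+ ((ℤ.- a) ℤ.+ (ℤ.- a))) ≡ 0ℤ
    l₁ = ℤ-Solver.solve-∀

  -- Write s i for x^(B i); the hypotheses are s 4 = s 0 and s 6 = s 2. At shift 4 the even terms
  -- contribute 4, which forces s 5 = -s 1 and s 7 = -s 3. Tested at δ, the shifts 2 and 6 together
  -- then give x^(2δ) = -1. So 2δ is v modulo 2v and v is even, whereas 4 does not divide h = 2v.
  contradiction-even : (S : Sequence) → Cong h (Sequence.B S 4) (Sequence.B S 0) → Cong h (Sequence.B S 6) (Sequence.B S 2) → ⊥
  contradiction-even S c₄ c₆ = parity δ-half
    where
    open Sequence S
    b₈ : B 8 ≡ B 0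
    b₈ = periodic 0
    t≡ : ∀ {x y} → Cong h x y → t x ≡ t y
    t≡ = tr-cong T
    diff : ∀ {x y x′ y′} → Cong h x x′ → Cong h y y′ → Cong h (x ℤ.- y) (x′ ℤ.- y′)
    diff c c′ = cong-+ c (cong-trans (cong-≡ (sym (ℤₚ.-1*i≡-i _))) (cong-trans (cong-*ˡ ℤ.-1ℤ c′) (cong-≡ (ℤₚ.-1*i≡-i _))))
    zero-diff : ∀ {x y} → Cong h x y → t (0ℤ ℤ.+ (x ℤ.- y)) ≡ t₀ᶻ
    zero-diff {x} {y} c = trans (t≡ (cong-trans (cong-≡ (ℤₚ.+-identityˡ (x ℤ.- y))) (cong-trans (diff c (cong-refl {i = y})) (cong-≡ (ℤₚ.+-inverseʳ y))))) (tr-0 T)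
    neg-diff : ∀ x y → t (0ℤ ℤ.+ (x ℤ.- y)) ≡ t (y ℤ.- x)
    neg-diff x y = trans (cong t (l x y)) (t-even (y ℤ.- x))
      where
      l : ∀ x y → 0ℤ ℤ.+ (x ℤ.- y) ≡ ℤ.- (y ℤ.- x)
      l = ℤ-Solver.solve-∀
    eight-terms : ∀ {a b c d e f g k a′ b′ c′ d′ e′ f′ g′ k′ : ℤ} → a ≡ a′ → b ≡ b′ → c ≡ c′ → d ≡ d′ → e ≡ e′ → f ≡ f′ → g ≡ g′ → k ≡ k′ →
             a ℤ.+ (b ℤ.+ (c ℤ.+ (d ℤ.+ (e ℤ.+ (f ℤ.+ (g ℤ.+ (k ℤ.+ 0ℤ))))))) ≡ a′ ℤ.+ (b′ ℤ.+ (c′ ℤ.+ (d′ ℤ.+ (e′ ℤ.+ (f′ ℤ.+ (g′ ℤ.+ (k′ ℤ.+ 0ℤ)))))))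
    eight-terms refl refl refl refl refl refl refl refl = refl
    half-turn : + 4 ℤ.* t₀ᶻ ℤ.+ (t (B 5 ℤ.- B 1) ℤ.+ t (B 5 ℤ.- B 1) ℤ.+ (t (B 7 ℤ.- B 3) ℤ.+ t (B 7 ℤ.- B 3))) ≡ 0ℤ
    half-turn = trans (sym (trans (eight-terms (zero-diff (cong-sym c₄)) (neg-diff (B 1) (B 5)) (zero-diff (cong-sym c₆)) (neg-diff (B 3) (B 7))
        (zero-diff (cong-trans c₄ (cong-≡ (sym b₈)))) (trans (cong (λ z → t (0ℤ ℤ.+ (B 5 ℤ.- z))) (periodic 1)) (cong t (ℤₚ.+-identityˡ _)))
        (zero-diff (cong-trans c₆ (cong-≡ (sym (periodic 2))))) (trans (cong (λ z → t (0ℤ ℤ.+ (B 7 ℤ.- z))) (periodic 3)) (cong t (ℤₚ.+-identityˡ _))))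
        (l₁ t₀ᶻ (t (B 5 ℤ.- B 1)) (t (B 7 ℤ.- B 3))))) (P 4 (s≤s z≤n) (s≤s (s≤s (s≤s (s≤s (s≤s z≤n))))) 0ℤ)
      where
      l₁ : ∀ a x y → a ℤ.+ (x ℤ.+ (a ℤ.+ (y ℤ.+ (a ℤ.+ (x ℤ.+ (a ℤ.+ (y ℤ.+ 0ℤ))))))) ≡ + 4 ℤ.* a ℤ.+ (x ℤ.+ x ℤ.+ (y ℤ.+ y))
      l₁ = ℤ-Solver.solve-∀
    swap : ∀ x y → + 4 ℤ.* t₀ᶻ ℤ.+ (x ℤ.+ x ℤ.+ (y ℤ.+ y)) ≡ + 4 ℤ.* t₀ᶻ ℤ.+ (y ℤ.+ y ℤ.+ (x ℤ.+ x))
    swap x y = cong (λ z → + 4 ℤ.* t₀ᶻ ℤ.+ z) (ℤₚ.+-comm (x ℤ.+ x) (y ℤ.+ y))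
    plus-v : ∀ {x y} → t (x ℤ.- y) ≡ ℤ.- t₀ᶻ → Cong h x (y ℤ.+ + v)
    plus-v {x} {y} e = cong-trans (cong-≡ (l x y)) (cong-+ (cong-refl {i = y}) (t-min (x ℤ.- y) e))
      where
      l : ∀ x y → x ≡ y ℤ.+ (x ℤ.- y)
      l = ℤ-Solver.solve-∀
    c₅ : Cong h (B 5) (B 1 ℤ.+ + v)
    c₅ = plus-v (double-min (B 5 ℤ.- B 1) (B 7 ℤ.- B 3) half-turn)
    c₇ : Cong h (B 7) (B 3 ℤ.+ + v)
    c₇ = plus-v (double-min (B 7 ℤ.- B 3) (B 5 ℤ.- B 1) (trans (swap (t (B 7 ℤ.- B 3)) (t (B 5 ℤ.- B 1))) half-turn))
    δ = B 0 ℤ.- B 2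
    -- At the shifts 2 and 6 the odd terms cancel in pairs and only the even ones survive.
    at2 : ∑ 8 (λ i → t (δ ℤ.+ (B i ℤ.- B (i + 2)))) ≡ 0ℤ
    at2 = P 2 (s≤s z≤n) (s≤s (s≤s (s≤s z≤n))) δ
    at6 : ∑ 8 (λ i → t (δ ℤ.+ (B i ℤ.- B (i + 6)))) ≡ 0ℤ
    at6 = P 6 (s≤s z≤n) (s≤s (s≤s (s≤s (s≤s (s≤s (s≤s (s≤s z≤n))))))) δ
    u = t (+ 2 ℤ.* δ)
    term : ∀ {x x′ y y′} → Cong h x x′ → Cong h y y′ → t (δ ℤ.+ (x ℤ.- y)) ≡ t (δ ℤ.+ (x′ ℤ.- y′))
    term c c′ = t≡ (cong-+ (cong-refl {i = δ}) (diff c c′))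
    forward : t (δ ℤ.+ (B 0 ℤ.- B 2)) ≡ u
    forward = cong t (l (B 0 ℤ.- B 2))
      where
      l : ∀ d → d ℤ.+ d ≡ + 2 ℤ.* d
      l = ℤ-Solver.solve-∀
    backward : t (δ ℤ.+ (B 2 ℤ.- B 0)) ≡ t₀ᶻ
    backward = trans (cong t (l (B 0) (B 2))) (tr-0 T)
      where
      l : ∀ x y → (x ℤ.- y) ℤ.+ (y ℤ.- x) ≡ 0ℤ
      l = ℤ-Solver.solve-∀
    r : ∀ i → Cong h (B i) (B i)
    r i = cong-refl
    m₁ = t (δ ℤ.+ (B 1 ℤ.- B 3))
    m₃ = t (δ ℤ.+ (B 3 ℤ.- B 1))
    neg-v : ∀ x y → t (δ ℤ.+ ((x ℤ.+ + v) ℤ.- y)) ≡ ℤ.- t (δ ℤ.+ (x ℤ.- y))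
    neg-v x y = trans (cong t (l δ x (+ v) y)) (t-shift (δ ℤ.+ (x ℤ.- y)))
      where
      l : ∀ d x v y → d ℤ.+ ((x ℤ.+ v) ℤ.- y) ≡ (d ℤ.+ (x ℤ.- y)) ℤ.+ v
      l = ℤ-Solver.solve-∀
    sub-v : ∀ x y → t (δ ℤ.+ (x ℤ.- (y ℤ.+ + v))) ≡ ℤ.- t (δ ℤ.+ (x ℤ.- y))
    sub-v x y = trans (sym (ℤₚ.neg-involutive _)) (cong ℤ.-_ (trans (sym (t-shift (δ ℤ.+ (x ℤ.- (y ℤ.+ + v))))) (cong t (l δ x (+ v) y))))
      where
      l : ∀ d x v y → d ℤ.+ (x ℤ.- (y ℤ.+ v)) ℤ.+ v ≡ d ℤ.+ (x ℤ.- y)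
      l = ℤ-Solver.solve-∀
    both-v : ∀ x y → t (δ ℤ.+ ((x ℤ.+ + v) ℤ.- (y ℤ.+ + v))) ≡ t (δ ℤ.+ (x ℤ.- y))
    both-v x y = cong t (cong (λ z → δ ℤ.+ z) (l x (+ v) y))
      where
      l : ∀ x v y → (x ℤ.+ v) ℤ.- (y ℤ.+ v) ≡ x ℤ.- y
      l = ℤ-Solver.solve-∀
    p₈ : Cong h (B 8) (B 0)
    p₈ = cong-≡ b₈
    p₁₀ : Cong h (B 10) (B 2)
    p₁₀ = cong-≡ (periodic 2)
    p₁₂ : Cong h (B 12) (B 0)
    p₁₂ = cong-trans (cong-≡ (periodic 4)) c₄
    p₉ : Cong h (B 9) (B 1)
    p₉ = cong-≡ (periodic 1)
    p₁₁ : Cong h (B 11) (B 3)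
    p₁₁ = cong-≡ (periodic 3)
    p₁₃ : Cong h (B 13) (B 1 ℤ.+ + v)
    p₁₃ = cong-trans (cong-≡ (periodic 5)) c₅
    sum2 : ∑ 8 (λ i → t (δ ℤ.+ (B i ℤ.- B (i + 2)))) ≡ u ℤ.+ (m₁ ℤ.+ (t₀ᶻ ℤ.+ ((ℤ.- m₃) ℤ.+ (u ℤ.+ (m₁ ℤ.+ (t₀ᶻ ℤ.+ ((ℤ.- m₃) ℤ.+ 0ℤ)))))))
    sum2 = eight-terms forward (refl {x = m₁}) (trans (term (r 2) c₄) backward) (trans (term (r 3) c₅) (sub-v (B 3) (B 1)))
      (trans (term c₄ c₆) forward) (trans (term c₅ c₇) (both-v (B 1) (B 3))) (trans (term c₆ p₈) backward) (trans (term c₇ p₉) (neg-v (B 3) (B 1)))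
    sum6 : ∑ 8 (λ i → t (δ ℤ.+ (B i ℤ.- B (i + 6)))) ≡ u ℤ.+ ((ℤ.- m₁) ℤ.+ (t₀ᶻ ℤ.+ (m₃ ℤ.+ (u ℤ.+ ((ℤ.- m₁) ℤ.+ (t₀ᶻ ℤ.+ (m₃ ℤ.+ 0ℤ)))))))
    sum6 = eight-terms (trans (term (r 0) c₆) forward) (trans (term (r 1) c₇) (sub-v (B 1) (B 3))) (trans (term (r 2) p₈) backward) (term (r 3) p₉)
      (trans (term c₄ p₁₀) forward) (trans (term c₅ p₁₁) (neg-v (B 1) (B 3))) (trans (term c₆ p₁₂) backward) (trans (term c₇ p₁₃) (both-v (B 3) (B 1)))
    u≡ : u ≡ ℤ.- t₀ᶻ
    u≡ = ℤₚ.*-cancelˡ-≡ (+ 4) u (ℤ.- t₀ᶻ) (trans (l u t₀ᶻ m₁ m₃) (trans (cong (ℤ._+ + 4 ℤ.* (ℤ.- t₀ᶻ)) (cong₂ ℤ._+_ (trans (sym sum2) at2) (trans (sym sum6) at6))) (ℤₚ.+-identityˡ _)))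
      where
      l : ∀ u a x y → + 4 ℤ.* u ≡ ((u ℤ.+ (x ℤ.+ (a ℤ.+ ((ℤ.- y) ℤ.+ (u ℤ.+ (x ℤ.+ (a ℤ.+ ((ℤ.- y) ℤ.+ 0ℤ)))))))) ℤ.+ (u ℤ.+ ((ℤ.- x) ℤ.+ (a ℤ.+ (y ℤ.+ (u ℤ.+ ((ℤ.- x) ℤ.+ (a ℤ.+ (y ℤ.+ 0ℤ))))))))) ℤ.+ + 4 ℤ.* (ℤ.- a)
      l = ℤ-Solver.solve-∀
    δ-half : Cong h (+ 2 ℤ.* δ) (+ v)
    δ-half = t-min (+ 2 ℤ.* δ) u≡
    parity : Cong h (+ 2 ℤ.* δ) (+ v) → ⊥
    parity (mkC k e) = 4∤h (subst (4 ∣_) (sym h≡2v) (*-monoʳ-∣ 2 (∣ᶻ⇒∣ {2} {+ v} (ZZ.mk∣ (δ ℤ.- k ℤ.* + v) (trans (l₁ (+ v) (k ℤ.* + h)) (trans (cong (ℤ._- k ℤ.* + h) (sym e)) (trans (cong (λ z → + 2 ℤ.* δ ℤ.- k ℤ.* z) +h) (l₂ δ k (+ v)))))))))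
      where
      l₁ : ∀ v x → v ≡ (v ℤ.+ x) ℤ.- x
      l₁ = ℤ-Solver.solve-∀
      l₂ : ∀ d k v → + 2 ℤ.* d ℤ.- k ℤ.* (+ 2 ℤ.* v) ≡ + 2 ℤ.* (d ℤ.- k ℤ.* v)
      l₂ = ℤ-Solver.solve-∀

  contradiction-odd : (S : Sequence) → Cong h (Sequence.B S 5) (Sequence.B S 1) → Cong h (Sequence.B S 7) (Sequence.B S 3) → ⊥
  contradiction-odd S = contradiction-even (shift S)

-- The bound and its exceptional case

module Theorem (n h : ℕ) .{{nzn : NonZero n}} .{{nzh : NonZero h}} (R : CommutativeRing 0ℓ 0ℓ) (domain : IsIntegralDomain R) (char0 : HasCharZero R)
               (ζ : CommutativeRing.Carrier R) (prim : IsPrimitiveRoot R h ζ) (a : Fin n → Fin n → Fin h) (bh : IsBH R n h ζ a)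
               (q∣h : ∀ q → Prime q → q ∣ n → q ∣ h) (order-condition : OrderCondition n h) where
  open BH n h R domain char0 ζ prim a bh using (Tₕ; b; b-shift; b-periodic; mod-≡; ρ∼𝟘; exponent; norm-character)

  g = gcd h n

  instance
    nzg : NonZero g
    nzg = ≢-nonZero (gcd[m,n]≢0 h n (inj₁ (≢-nonZero⁻¹ h)))

  v w : ℕ
  v = _∣_.quotient (gcd[m,n]∣m h n)
  w = _∣_.quotient (gcd[m,n]∣n h n)

  h≡ : h ≡ v * g
  h≡ = _∣_.equality (gcd[m,n]∣m h n)

  n≡ : n ≡ w * g
  n≡ = _∣_.equality (gcd[m,n]∣n h n)

  instance
    nzw : NonZero w
    nzw = ≢-nonZero λ w≡0 → ≢-nonZero⁻¹ n (trans n≡ (cong (_* g) w≡0))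

  coprime-vw : Coprime v w
  coprime-vw {d} (d∣v , d∣w) = ∣1⇒≡1 (*-cancelʳ-∣ g (subst (d * g ∣_) (sym (ℕₚ.*-identityˡ g))
    (gcd-greatest (subst (d * g ∣_) (sym h≡) (*-monoˡ-∣ g d∣v)) (subst (d * g ∣_) (sym n≡) (*-monoˡ-∣ g d∣w)))))

  m : ℕ
  m = w * h

  instance
    nzm : NonZero m
    nzm = ℕₚ.m*n≢0 w h

  m≡ : m ≡ lcm n h
  m≡ = ℕₚ.*-cancelˡ-≡ m (lcm n h) g (trans (lem g w h) (trans (cong (_* h) (sym n≡)) (trans (sym (gcd*lcm n h)) (cong (_* lcm n h) (gcd-comm n h)))))
    where
    lem : ∀ g w h → g * (w * h) ≡ w * g * h
    lem = ℕ-Solver.solve-∀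

  vn≡m : v * n ≡ m
  vn≡m = trans (cong (v *_) n≡) (trans (lem v w g) (cong (w *_) (sym h≡)))
    where
    lem : ∀ v w g → v * (w * g) ≡ w * (v * g)
    lem = ℕ-Solver.solve-∀

  w∣n : w ∣ n
  w∣n = subst (w ∣_) (sym n≡) (m∣m*n g)

  e : ℕ → ℤ
  e = exponent w v

  factors-∣ : ∀ {x} ps → product ps ∣ x → All (_∣ x) ps
  factors-∣ []       d = []
  factors-∣ (p ∷ ps) d = ∣-trans (m∣m*n _) d ∷ factors-∣ ps (∣-trans (n∣m*n p) d)

  Reached : ∀ {h₀} → Tower h₀ → ℕ → ℕ → Set
  Reached {h₀} T₀ w₀ D = ∃ λ (T : Tower D) → Chain n T₀ T w₀

  reach : ∀ {h₀} (T₀ : Tower h₀) w₀ → .{{NonZero w₀}} → h ∣ h₀ → w₀ * h₀ ≡ m → w₀ ∣ n → (2 ∣ w₀ → 4 ∣ h₀) → Reached T₀ w₀ m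
  reach {h₀} T₀ w₀ h∣h₀ eq w₀∣n four = subst₂ (Reached T₀) (sym isFactorisation) D≡ (Build.build n h m m≡ order-condition q∣h T₀ h∣h₀ factors factorsPrime
      (factors-∣ factors (subst (_∣ n) isFactorisation w₀∣n)) (∣-reflexive D≡) (λ 2∈ → four (subst (2 ∣_) (sym isFactorisation) (ListActionₚ.∈⇒∣product 2∈))))
    where
    open PrimeFactorisation (factorise w₀)
    D≡ : climb factors h₀ ≡ m
    D≡ = trans (climb≡ factors h₀) (trans (cong (_* h₀) (sym isFactorisation)) eq)

  upTo-bound : ∀ {k} → k ∈ upTo n → k < n
  upTo-bound = Memₚ.∈-upTo⁻

  -- Modulo a divisor of w the exponent is v k, and v is prime to w.
  index-class : ∀ {u} → u ∣ w → ∀ k k′ → Cong u (e k) (e k′) → Cong u (+ k) (+ k′)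
  index-class {u} u∣w k k′ c = unit-cancel (unit-∣ u∣w (coprime⇒unit coprime-vw))
      (cong-trans (cong-≡ (l₁ (+ w) (+ b k 0) (+ v ℤ.* + k))) (cong-trans (cong-+ c (cong-trans (from-w (b k 0)) (cong-sym (from-w (b k′ 0))))) (cong-≡ (sym (l₁ (+ w) (+ b k′ 0) (+ v ℤ.* + k′))))))
    where
    l₁ : ∀ w x y → y ≡ (w ℤ.* x ℤ.+ y) ℤ.+ (ℤ.- x) ℤ.* w
    l₁ = ℤ-Solver.solve-∀
    from-w : ∀ x → Cong u ((ℤ.- + x) ℤ.* + w) 0ℤ
    from-w x = cong-∣ u∣w (mkC (ℤ.- + x) (sym (ℤₚ.+-identityˡ _)))

  main : (2 ∣ w → 4 ∣ h) → n ≤ gcd h n ^ 2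
  main four = from (reach Tₕ w ∣-refl refl w∣n four)
    where
    from : Reached Tₕ w m → n ≤ gcd h n ^ 2
    from (T , chain) = bound (descent chain e (upTo n) (Uniqueₚ.upTo⁺ n) (norm-character T w v refl vn≡m (chain-embed chain)))
      where
      bound : Descended n Tₕ w e (upTo n) → n ≤ gcd h n ^ 2
      bound d = ℕₚ.≤-trans (norm-bound Tₕ e₀ ks₀ norm) (subst (length ks₀ * length ks₀ ≤_) (cong (g *_) (sym (ℕₚ.*-identityʳ g))) (ℕₚ.*-mono-≤ few few))
        where
        open Descended d
        same : ∀ {k k′} → k ∈ ks₀ → k′ ∈ ks₀ → Cong w (+ k) (+ k′)
        same {k} {k′} k∈ k′∈ = index-class ∣-refl k k′ (cong-trans {j = offset} (mkC (e₀ k) (e≡ k∈)) (cong-sym (mkC (e₀ k′) (e≡ k′∈))))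
        few : length ks₀ ≤ g
        few = count-class ks₀ w g unique (λ k∈ → subst (_ <_) n≡ (upTo-bound (ks₀⊆ks k∈))) same

  module Exceptional (2∣w : 2 ∣ w) (4∤h : ¬ 4 ∣ h) where
    2∣n : 2 ∣ n
    2∣n = ∣-trans 2∣w w∣n

    2∣h : 2 ∣ h
    2∣h = q∣h 2 prime[2] 2∣n

    -- For odd q the modulus `mTilde` is a multiple of 4, so q^j is 1 modulo 4. As 2 divides h
    -- exactly once, 4 is the modulus in the order condition for the pair 2 and q.
    only-2 : ∀ q → Prime q → q ∣ n → q ≡ 2
    only-2 q pr q∣n = decidable-stable (q ≟ 2) λ q≢2 → go q≢2 (order {{>-nonZero (mTilde>0 (lcm n h) {{nzl}} pr)}} (prime∤⇒coprime pr (q∤mTilde (lcm n h) {{nzl}} pr)))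
      where
      nzl : NonZero (lcm n h)
      nzl = subst NonZero m≡ nzm
      go : q ≢ 2 → (∃ λ j → IsOrder (mTilde (lcm n h) q) q j) → ⊥
      go q≢2 (j , ord) = order-condition 2 prime[2] 2∣n q pr q∣n q≢2 1 j (2∣h , 4∤h) ord
        (∣-trans (4∣mTilde (lcm n h) {{nzl}} pr (∣-trans 2∣n (m∣lcm[m,n] n h)) q≢2) (proj₁ (proj₂ ord)))

    even-or-1 : ∀ x → x ∣ n → x ≢ 1 → 2 ∣ x
    even-or-1 zero          d ne = 2 ∣0
    even-or-1 (suc zero)    d ne = contradiction refl ne
    even-or-1 x@(suc (suc _)) d ne = go (primeDivisor x (s≤s (s≤s z≤n)))
      where
      go : (∃ λ ℓ → Prime ℓ × ℓ ∣ x) → 2 ∣ x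
      go (ℓ , pr , ℓ∣x) = subst (_∣ x) (only-2 ℓ pr (∣-trans ℓ∣x d)) ℓ∣x

    -- n has no odd prime factor, and 4 does not divide h.
    g≡2 : g ≡ 2
    g≡2 = go (gcd-greatest 2∣h 2∣n)
      where
      go : 2 ∣ g → g ≡ 2
      go (divides g′ g≡) = trans g≡ (cong (_* 2) g′≡1)
        where
        g′≡1 : g′ ≡ 1
        g′≡1 = decidable-stable (g′ ≟ 1) λ ne → 4∤h (∣-trans (subst (4 ∣_) (sym g≡) (*-monoˡ-∣ 2 (even-or-1 g′ (∣-trans (subst (g′ ∣_) (sym g≡) (m∣m*n 2)) (gcd[m,n]∣n h n)) ne))) (gcd[m,n]∣m h n))

    T₀ : Tower (2 * h)
    T₀ = ram 2 prime[2] 2∣h Tₕ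

    4∣2h : 4 ∣ 2 * h
    4∣2h = *-monoʳ-∣ 2 2∣h

    w′ : ℕ
    w′ = _∣_.quotient 2∣w

    w≡ : w ≡ w′ * 2
    w≡ = _∣_.equality 2∣w

    instance
      nzw′ : NonZero w′
      nzw′ = ≢-nonZero λ w′≡0 → ≢-nonZero⁻¹ w (trans w≡ (cong (_* 2) w′≡0))

    w′∣w : w′ ∣ w
    w′∣w = subst (w′ ∣_) (sym w≡) (m∣m*n 2)

    embed : ∀ {D} {T : Tower D} → Chain n T₀ T w′ → ∀ {x y} → Quot._∼_ ℤR (tr Tₕ) x y → Quot._∼_ ℤR (tr T) (σ (+ w) x) (σ (+ w) y)
    embed {T = T} chain {x} {y} p = ∼-trans (expand x) (∼-trans (chain-embed chain (Embedding.σ-embed 2 prime[2] 2∣h Tₕ p)) (∼-sym (expand y)))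
      where
      open Quot ℤR (tr T)
      expand : ∀ x → σ (+ w) x ∼ σ (+ w′) (σ (+ 2) x)
      expand x = ∼-trans (∼-reflexive (cong (λ s → σ s x) (trans (cong +_ w≡) (ℤₚ.pos-* w′ 2)))) (∼-sym (σ-σ (+ w′) (+ 2) x))

    w′*2h : w′ * (2 * h) ≡ m
    w′*2h = trans (sym (ℕₚ.*-assoc w′ 2 h)) (cong (_* h) (sym w≡))

    -- Descent stops at level 2h with up to four terms, which by counting alone would give 16. Split
    -- by the parity of the exponent, each half consists of indices in one class modulo w below n =
    -- 2w, hence of at most two terms. The form is the sum over the two halves, at most 4 + 4 times
    -- `t₀`.
    n≤8 : n ≤ 8
    n≤8 = from (reach T₀ w′ (n∣m*n 2) w′*2h (∣-trans w′∣w w∣n) (λ _ → 4∣2h))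
      where
      from : Reached T₀ w′ m → n ≤ 8
      from (T , chain) = bound (descent chain e (upTo n) (Uniqueₚ.upTo⁺ n) (norm-character T w v refl vn≡m (embed chain)))
        where
        bound : Descended n T₀ w′ e (upTo n) → n ≤ 8
        bound d = ℕₚ.*-cancelʳ-≤ n 8 (t₀ Tₕ) {{>-nonZero (t₀>0 Tₕ)}} (ℤₚ.drop‿+≤+ (begin
            + (n * t₀ Tₕ)                                   ≡⟨ ℤₚ.pos-* n (t₀ Tₕ) ⟩
            + n ℤ.* + t₀ Tₕ                                 ≡⟨ Q-norm T₀ {n} {y} norm ⟨
            Q T₀ y                                          ≡⟨ Ramified.Q-sub 2 prime[2] 2∣h Tₕ y ⟩
            Q Tₕ (sub 2 0 y) ℤ.+ (Q Tₕ (sub 2 1 y) ℤ.+ 0ℤ)  ≤⟨ ℤₚ.+-mono-≤ (part 0) (ℤₚ.+-mono-≤ (part 1) ℤₚ.≤-refl) ⟩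
            + 4 ℤ.* + t₀ Tₕ ℤ.+ (+ 4 ℤ.* + t₀ Tₕ ℤ.+ 0ℤ)    ≡⟨ l₁ (+ t₀ Tₕ) ⟩
            + 8 ℤ.* + t₀ Tₕ                                 ≡⟨ ℤₚ.pos-* 8 (t₀ Tₕ) ⟨
            + (8 * t₀ Tₕ)                                   ∎))
          where
          open Descended d
          open ℤₚ.≤-Reasoning
          l₁ : ∀ t → + 4 ℤ.* t ℤ.+ (+ 4 ℤ.* t ℤ.+ 0ℤ) ≡ + 8 ℤ.* t
          l₁ = ℤ-Solver.solve-∀
          y : Poly
          y = polyOf e₀ ks₀
          part : ∀ r → Q Tₕ (sub 2 r y) ℤ.≤ + 4 ℤ.* + t₀ Tₕ
          part r = begin
            Q Tₕ (sub 2 r y)                                           ≡⟨ Form.F-cong Tₕ same-poly same-poly ⟩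
            Q Tₕ (polyOf (λ k → e₀ k /ℕ 2) L)                       ≤⟨ Q-polyOf-≤ Tₕ (λ k → e₀ k /ℕ 2) L ⟩
            + length L ℤ.* (+ length L ℤ.* + t₀ Tₕ)                    ≡⟨ trans (sym (ℤₚ.*-assoc (+ length L) (+ length L) (+ t₀ Tₕ))) (cong (ℤ._* + t₀ Tₕ) (sym (ℤₚ.pos-* (length L) (length L)))) ⟩
            + (length L * length L) ℤ.* + t₀ Tₕ                        ≤⟨ ℤₚ.*-monoʳ-≤-nonNeg (+ t₀ Tₕ) (ℤ.+≤+ (ℕₚ.*-mono-≤ few few)) ⟩
            + 4 ℤ.* + t₀ Tₕ                                            ∎
            where
            L : List ℕ
            L = filter (inClass? 2 r e₀) ks₀
            same-poly : Quot._∼_ ℤR (tr Tₕ) (sub 2 r y) (polyOf (λ k → e₀ k /ℕ 2) L)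
            same-poly = Quot.mk∼ (λ j → sub-polyOf 2 r e₀ ks₀ (Quot.at ℤR (tr Tₕ) j))
            l₂ : ∀ o r q w → o ℤ.+ (r ℤ.+ q ℤ.* + 2) ℤ.* w ≡ (o ℤ.+ r ℤ.* w) ℤ.+ q ℤ.* (w ℤ.* + 2)
            l₂ = ℤ-Solver.solve-∀
            residue : ∀ {k} → k ∈ L → Cong w (e k) (offset ℤ.+ + r ℤ.* + w′)
            residue {k} k∈ = mkC (e₀ k /ℕ 2) (trans (e≡ (proj₁ mem)) (trans (cong (λ z → offset ℤ.+ z ℤ.* + w′) (trans (a≡a%ℕn+[a/ℕn]*n (e₀ k) 2) (cong (λ s → + s ℤ.+ (e₀ k /ℕ 2) ℤ.* + 2) (proj₂ mem))))
                (trans (l₂ offset (+ r) (e₀ k /ℕ 2) (+ w′)) (cong (λ z → (offset ℤ.+ + r ℤ.* + w′) ℤ.+ (e₀ k /ℕ 2) ℤ.* z) (trans (sym (ℤₚ.pos-* w′ 2)) (cong +_ (sym w≡)))))))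
              where mem = Memₚ.∈-filter⁻ (inClass? 2 r e₀) {xs = ks₀} k∈
            few : length L ≤ 2
            few = count-class L w 2 (Uniqueₚ.filter⁺ (inClass? 2 r e₀) unique)
              (λ {k} k∈ → subst (k <_) (trans n≡ (cong (w *_) g≡2)) (upTo-bound (ks₀⊆ks (proj₁ (Memₚ.∈-filter⁻ (inClass? 2 r e₀) {xs = ks₀} k∈)))))
              (λ {k} {k′} k∈ k′∈ → index-class ∣-refl k k′ (cong-trans (residue k∈) (cong-sym (residue k′∈))))

    h≡2v : h ≡ 2 * v
    h≡2v = trans h≡ (trans (cong (v *_) g≡2) (ℕₚ.*-comm v 2))

    module Order8 (w≡4 : w ≡ 4) where
      n≡8 : n ≡ 8
      n≡8 = trans n≡ (cong₂ _*_ w≡4 g≡2)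

      2∣2h : 2 ∣ 2 * h
      2∣2h = m∣m*n h

      T₈ : Tower (2 * (2 * h))
      T₈ = ram 2 prime[2] 2∣2h T₀

      m≡4h : m ≡ 2 * (2 * h)
      m≡4h = trans (cong (_* h) w≡4) (ℕₚ.*-assoc 2 2 h)

      fixes : ∀ q → Prime q → q ∣ n → Ideals.FixesPrime T₈ (1ℤ ℤ.+ + (2 * h)) q
      fixes = FixedPrimes.fixes-prime n h m m≡ order-condition q∣h 2 prime[2] 2∣n 2∣2h (n∣m*n 2) (∣-reflexive (sym m≡4h)) T₀

      chain : Chain n T₀ T₈ w′
      chain = subst (Chain n T₀ T₈) (sym (ℕₚ.*-cancelʳ-≡ w′ 2 2 (trans (sym w≡) w≡4))) (step 2 prime[2] 2∣2h fixes (inj₂ 4∣2h) done)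

      x : Poly
      x = polyOf e (upTo n)

      norm : Norm T₈ n x
      norm = norm-character T₈ w v m≡4h (trans vn≡m m≡4h) (embed chain)

      private
        t : ℤ → ℤ
        t = tr Tₕ

      open OrderEight Tₕ v h≡2v 4∤h using (Sequence; t-min; contradiction-even; contradiction-odd)

      lin-x : ∀ f → lin f x ≡ ∑ 8 (f ∘ e)
      lin-x f = trans (cong (lin f) (polyOf-upTo e n)) (trans (lin-Σᴾ ℤR f n (λ k → X^ (e k))) (cong (λ n → ∑ n (f ∘ e)) n≡8))

      two-terms : ∀ F c → c < 4 → (∀ i → i < 4 → i ≢ c → F i ≡ 0ℤ × F (i + 4) ≡ 0ℤ) → ∑ 8 F ≡ F c ℤ.+ F (c + 4)
      two-terms F c c<4 zeros = trans (fold (F 0) (F 1) (F 2) (F 3) (F 4) (F 5) (F 6) (F 7))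
          (ℤ∑.∑-single 4 (λ i → F i ℤ.+ F (i + 4)) c c<4 (λ i i<4 i≢c → cong₂ ℤ._+_ (proj₁ (zeros i i<4 i≢c)) (proj₂ (zeros i i<4 i≢c))))
        where
        fold : ∀ a b c d e f g k → a ℤ.+ (b ℤ.+ (c ℤ.+ (d ℤ.+ (e ℤ.+ (f ℤ.+ (g ℤ.+ (k ℤ.+ 0ℤ))))))) ≡ (a ℤ.+ e) ℤ.+ ((b ℤ.+ f) ℤ.+ ((c ℤ.+ g) ℤ.+ ((d ℤ.+ k) ℤ.+ 0ℤ)))
        fold = ℤ-Solver.solve-∀

      quarter : ℤ → ℤ
      quarter i = (i /ℕ 2) /ℕ 2

      recompose : ∀ i → i ≡ (+ (i %ℕ 2) ℤ.+ + 2 ℤ.* + ((i /ℕ 2) %ℕ 2)) ℤ.+ quarter i ℤ.* + 4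
      recompose i = trans (a≡a%ℕn+[a/ℕn]*n i 2) (trans (cong (λ z → + (i %ℕ 2) ℤ.+ z ℤ.* + 2) (a≡a%ℕn+[a/ℕn]*n (i /ℕ 2) 2)) (lem (+ (i %ℕ 2)) (+ ((i /ℕ 2) %ℕ 2)) (quarter i)))
        where
        lem : ∀ a b q → a ℤ.+ (b ℤ.+ q ℤ.* + 2) ℤ.* + 2 ≡ (a ℤ.+ + 2 ℤ.* b) ℤ.+ q ℤ.* + 4
        lem = ℤ-Solver.solve-∀

      half-+ : ∀ i Δ → (i ℤ.+ Δ ℤ.* + 4) %ℕ 2 ≡ i %ℕ 2 × (i ℤ.+ Δ ℤ.* + 4) /ℕ 2 ≡ (i /ℕ 2) ℤ.+ Δ ℤ.* + 2
      half-+ i Δ = %ℕ-unique 2 (i ℤ.+ Δ ℤ.* + 4) (i %ℕ 2) _ (n%ℕd<d i 2) (trans (cong (ℤ._+ Δ ℤ.* + 4) (a≡a%ℕn+[a/ℕn]*n i 2)) (lem (+ (i %ℕ 2)) (i /ℕ 2) Δ))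
        where
        lem : ∀ r q d → (r ℤ.+ q ℤ.* + 2) ℤ.+ d ℤ.* + 4 ≡ r ℤ.+ (q ℤ.+ d ℤ.* + 2) ℤ.* + 2
        lem = ℤ-Solver.solve-∀

      half-+₁ : ∀ i Δ → (i ℤ.+ Δ ℤ.* + 2) %ℕ 2 ≡ i %ℕ 2 × (i ℤ.+ Δ ℤ.* + 2) /ℕ 2 ≡ (i /ℕ 2) ℤ.+ Δ
      half-+₁ i Δ = %ℕ-unique 2 (i ℤ.+ Δ ℤ.* + 2) (i %ℕ 2) _ (n%ℕd<d i 2) (trans (cong (ℤ._+ Δ ℤ.* + 2) (a≡a%ℕn+[a/ℕn]*n i 2)) (lem (+ (i %ℕ 2)) (i /ℕ 2) Δ))
        where
        lem : ∀ r q d → (r ℤ.+ q ℤ.* + 2) ℤ.+ d ℤ.* + 2 ≡ r ℤ.+ (q ℤ.+ d) ℤ.* + 2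
        lem = ℤ-Solver.solve-∀

      -- A quarter of e (c + 4) - e c, since w = 4. The terms c and c + 4 of `x` add up to x^(e c)
      -- (1 + y^Δ) with y = x^4, which has order h.
      Δ : ℕ → ℤ
      Δ c = + b (c + 4) 0 ℤ.- + b c 0 ℤ.+ + v

      e-shift : ∀ c → e (c + 4) ≡ e c ℤ.+ Δ c ℤ.* + 4
      e-shift c = trans (cong₂ (λ W C → + W ℤ.* + b (c + 4) 0 ℤ.+ + v ℤ.* C) w≡4 (ℤₚ.pos-+ c 4)) (trans (lem (+ b (c + 4) 0) (+ b c 0) (+ v) (+ c)) (cong (λ W → (+ W ℤ.* + b c 0 ℤ.+ + v ℤ.* + c) ℤ.+ Δ c ℤ.* + 4) (sym w≡4)))
        where
        lem : ∀ y x v c → + 4 ℤ.* y ℤ.+ v ℤ.* (c ℤ.+ + 4) ≡ (+ 4 ℤ.* x ℤ.+ v ℤ.* c) ℤ.+ (y ℤ.- x ℤ.+ v) ℤ.* + 4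
        lem = ℤ-Solver.solve-∀

      -- w is even, and v is odd because 4 does not divide h = 2v.
      e-parity : ∀ c → (e c) %ℕ 2 ≡ (+ c) %ℕ 2
      e-parity c = %ℕ-cong 2 (from (2 ∣? v))
        where
        lem : ∀ w′ x v c → (w′ ℤ.* + 2) ℤ.* x ℤ.+ (1ℤ ℤ.+ v ℤ.* + 2) ℤ.* c ≡ c ℤ.+ (w′ ℤ.* x ℤ.+ v ℤ.* c) ℤ.* + 2
        lem = ℤ-Solver.solve-∀
        from : Dec (2 ∣ v) → Cong 2 (e c) (+ c)
        from (yes 2∣v) = ⊥-elim (4∤h (subst (4 ∣_) (sym h≡2v) (*-monoʳ-∣ 2 2∣v)))
        from (no 2∤v)  = odd (v % 2) (m≡m%n+[m/n]*n v 2) (m%n<n v 2)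
          where
          odd : ∀ r → v ≡ r + v / 2 * 2 → r < 2 → Cong 2 (e c) (+ c)
          odd zero          v≡ _ = contradiction (divides (v / 2) v≡) 2∤v
          odd (suc zero)    v≡ _ = mkC (+ w′ ℤ.* + b c 0 ℤ.+ + (v / 2) ℤ.* + c) (trans (cong₂ (λ W V → W ℤ.* + b c 0 ℤ.+ V ℤ.* + c) (trans (cong +_ w≡) (ℤₚ.pos-* w′ 2)) (trans (cong +_ v≡) (cong (λ z → 1ℤ ℤ.+ z) (ℤₚ.pos-* (v / 2) 2)))) (lem (+ w′) (+ b c 0) (+ (v / 2)) (+ c)))
          odd (suc (suc _)) v≡ (s≤s (s≤s ()))

      -- Only the terms c and c + 4 share their class of exponents modulo 4. If the component
      -- vanishes, they cancel, so y^Δ = -1 for y = x^4; then `Δ c` is v modulo h and the two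
      -- entries agree.
      vanishing-pair : ∀ k → k < 2 → Quot._∼_ ℤR (tr T₀) (sub 2 k x) 𝟘 → ∀ c → c < 4 → (+ c) %ℕ 2 ≡ k → Cong h (+ b (c + 4) 0) (+ b c 0)
      vanishing-pair k k<2 off c c<4 ck = cong-trans (cong-≡ (l₁ (+ b (c + 4) 0) (+ b c 0) (+ v)))
          (cong-trans (cong-+ (cong-refl {i = + b c 0}) (cong-+ (t-min (Δ c) (minus pair)) (cong-refl {i = ℤ.- + v}))) (cong-≡ (l₂ (+ b c 0) (+ v))))
        where
        l₁ : ∀ y x v → y ≡ x ℤ.+ ((y ℤ.- x ℤ.+ v) ℤ.+ ℤ.- v)
        l₁ = ℤ-Solver.solve-∀
        l₂ : ∀ x v → x ℤ.+ (v ℤ.+ ℤ.- v) ≡ x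
        l₂ = ℤ-Solver.solve-∀
        -- k and r are the binary digits of the class of e c modulo 4; shifting by -α normalises the
        -- contribution of the term c to `t₀`.
        r = (e c /ℕ 2) %ℕ 2
        α = quarter (e c)
        φ : ℤ → ℤ
        φ i = sel 2 k i (sel 2 r (i /ℕ 2) (t (ℤ.- α ℤ.+ quarter i)))
        vanish : ∑ 8 (φ ∘ e) ≡ 0ℤ
        vanish = trans (sym (lin-x φ)) (trans (sym (trans (lin-sub 2 r (Quot.at ℤR t (ℤ.- α)) (sub 2 k x)) (lin-sub 2 k _ x)))
          (trans (Quot.eq (Ramified.sub-cong 2 prime[2] 2∣h Tₕ r (n%ℕd<d (e c /ℕ 2) 2) off) (ℤ.- α)) (lin-sub 2 r (Quot.at ℤR t (ℤ.- α)) 𝟘)))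
        same-class : ∀ i → (e i) %ℕ 2 ≡ k → ((e i) /ℕ 2) %ℕ 2 ≡ r → Cong 4 (+ i) (+ c)
        same-class i ik ir = index-class {4} (∣-reflexive (sym w≡4)) i c (cong-trans {j = + (e c %ℕ 2) ℤ.+ + 2 ℤ.* + r} (mkC (quarter (e i)) (trans (recompose (e i)) (cong₂ (λ x y → (+ x ℤ.+ + 2 ℤ.* + y) ℤ.+ quarter (e i) ℤ.* + 4) (trans ik (sym (trans (e-parity c) ck))) ir)))
          (cong-sym (mkC α (recompose (e c)))))
        φ-zero : ∀ i → ¬ Cong 4 (+ i) (+ c) → φ (e i) ≡ 0ℤ
        φ-zero i nc = go ((e i) %ℕ 2 ≟ k) (((e i) /ℕ 2) %ℕ 2 ≟ r)
          where
          go : Dec ((e i) %ℕ 2 ≡ k) → Dec (((e i) /ℕ 2) %ℕ 2 ≡ r) → φ (e i) ≡ 0ℤ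
          go (no ne)  _        = sel-no 2 ne
          go (yes ik) (no ne)  = trans (sel-yes 2 ik) (sel-no 2 ne)
          go (yes ik) (yes ir) = ⊥-elim (nc (same-class i ik ir))
        φ-value : ∀ i → (e i) %ℕ 2 ≡ k → ((e i) /ℕ 2) %ℕ 2 ≡ r → φ (e i) ≡ t (ℤ.- α ℤ.+ quarter (e i))
        φ-value i ik ir = trans (sel-yes 2 ik) (sel-yes 2 ir)
        at-c : φ (e c) ≡ + t₀ Tₕ
        at-c = trans (φ-value c (trans (e-parity c) ck) refl) (trans (cong t (ℤₚ.+-inverseˡ α)) (tr-0 Tₕ))
        half : (e (c + 4)) /ℕ 2 ≡ (e c /ℕ 2) ℤ.+ Δ c ℤ.* + 2
        half = trans (cong (_/ℕ 2) (e-shift c)) (proj₂ (half-+ (e c) (Δ c)))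
        at-c+4 : φ (e (c + 4)) ≡ t (Δ c)
        at-c+4 = trans (φ-value (c + 4) (trans (cong (_%ℕ 2) (e-shift c)) (trans (proj₁ (half-+ (e c) (Δ c))) (trans (e-parity c) ck))) (trans (cong (_%ℕ 2) half) (proj₁ (half-+₁ (e c /ℕ 2) (Δ c)))))
          (cong t (trans (cong (λ z → ℤ.- α ℤ.+ z) (trans (cong (_/ℕ 2) half) (proj₂ (half-+₁ (e c /ℕ 2) (Δ c))))) (l₃ α (Δ c))))
          where
          l₃ : ∀ a d → ℤ.- a ℤ.+ (a ℤ.+ d) ≡ d
          l₃ = ℤ-Solver.solve-∀
        zeros : ∀ i → i < 4 → i ≢ c → φ (e i) ≡ 0ℤ × φ (e (i + 4)) ≡ 0ℤ
        zeros i i<4 i≢c = φ-zero i (λ cg → i≢c (cong⇒≡ 4 i<4 c<4 cg)) ,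
          φ-zero (i + 4) (λ cg → i≢c (cong⇒≡ 4 i<4 c<4 (cong-trans (cong-sym (mkC 1ℤ (ℤₚ.pos-+ i 4))) cg)))
        pair : + t₀ Tₕ ℤ.+ t (Δ c) ≡ 0ℤ
        pair = trans (sym (cong₂ ℤ._+_ at-c at-c+4)) (trans (sym (two-terms (φ ∘ e) c c<4 zeros)) vanish)
        minus : + t₀ Tₕ ℤ.+ t (Δ c) ≡ 0ℤ → t (Δ c) ≡ ℤ.- + t₀ Tₕ
        minus p = trans (l₄ (+ t₀ Tₕ) (t (Δ c))) (trans (cong (ℤ._- + t₀ Tₕ) p) (ℤₚ.+-identityˡ _))
          where
          l₄ : ∀ a b → b ≡ (a ℤ.+ b) ℤ.- a
          l₄ = ℤ-Solver.solve-∀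

      -- By invariance the entry (g , k) is the entry (g + 8 - k , 0). The inner product of the rows
      -- 0 and d is thus the autocorrelation of column 0 at shift d, summed backwards.
      sequence : Sequence
      sequence = record { B = B ; periodic = λ i → cong +_ (trans (cong (λ n → b (i + n) 0) (sym n≡8)) (b-periodic i 0)) ; P = P }
        where
        B : ℕ → ℤ
        B i = + b i 0
        column : ∀ g k → k ≤ 8 → b g k ≡ b (g + (8 ∸ k)) 0
        column g k k≤8 = trans (sym (b-shift g k (8 ∸ k))) (cong (λ z → toℕ (a ((g + (8 ∸ k)) mod n) z)) (mod-≡ (trans (cong (_% n) (trans (ℕₚ.m+[n∸m]≡n k≤8) (sym n≡8))) (trans (n%n≡0 n) (sym (m<n⇒m%n≡m (ℕₚ.n≢0⇒n>0 (≢-nonZero⁻¹ n))))))))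
        P : ∀ d → 0 < d → d < 8 → ∀ j → ∑ 8 (λ i → t (j ℤ.+ (B i ℤ.- B (i + d)))) ≡ 0ℤ
        P d 0<d d<8 j = trans (sym (trans reverse-sum (rev (ψ 0) (ψ 1) (ψ 2) (ψ 3) (ψ 4) (ψ 5) (ψ 6) (ψ 7)))) relation
          where
          ψ : ℕ → ℤ
          ψ i = t (j ℤ.+ (B i ℤ.- B (i + d)))
          per : ∀ i → B (i + 8) ≡ B i
          per i = cong +_ (trans (cong (λ n → b (i + n) 0) (sym n≡8)) (b-periodic i 0))
          rev : ∀ a b c d e f g k → a ℤ.+ (k ℤ.+ (g ℤ.+ (f ℤ.+ (e ℤ.+ (d ℤ.+ (c ℤ.+ (b ℤ.+ 0ℤ))))))) ≡ a ℤ.+ (b ℤ.+ (c ℤ.+ (d ℤ.+ (e ℤ.+ (f ℤ.+ (g ℤ.+ (k ℤ.+ 0ℤ)))))))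
          rev = ℤ-Solver.solve-∀
          term : ∀ k → k ≤ 8 → t (j ℤ.+ (+ b 0 k ℤ.- + b d k)) ≡ ψ (8 ∸ k)
          term k k≤8 = cong₂ (λ x y → t (j ℤ.+ (+ x ℤ.- + y))) (column 0 k k≤8) (trans (column d k k≤8) (cong (λ i → b i 0) (ℕₚ.+-comm d (8 ∸ k))))
          ψ8 : ψ 8 ≡ ψ 0
          ψ8 = cong₂ (λ x y → t (j ℤ.+ (x ℤ.- y))) (per 0) (trans (cong B (ℕₚ.+-comm 8 d)) (per d))
          reverse-sum : ∑ 8 (λ k → t (j ℤ.+ (+ b 0 k ℤ.- + b d k))) ≡ ψ 0 ℤ.+ (ψ 7 ℤ.+ (ψ 6 ℤ.+ (ψ 5 ℤ.+ (ψ 4 ℤ.+ (ψ 3 ℤ.+ (ψ 2 ℤ.+ (ψ 1 ℤ.+ 0ℤ)))))))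
          reverse-sum = trans (ℤ∑.∑-cong 8 (λ k k<8 → term k (ℕₚ.<⇒≤ k<8))) (cong (ℤ._+ (ψ 7 ℤ.+ (ψ 6 ℤ.+ (ψ 5 ℤ.+ (ψ 4 ℤ.+ (ψ 3 ℤ.+ (ψ 2 ℤ.+ (ψ 1 ℤ.+ 0ℤ)))))))) ψ8)
          relation : ∑ 8 (λ k → t (j ℤ.+ (+ b 0 k ℤ.- + b d k))) ≡ 0ℤ
          relation = trans (cong (λ n → ∑ n (λ k → t (j ℤ.+ (+ b 0 k ℤ.- + b d k)))) (sym n≡8)) (trans (sym (lin-Σᴾ ℤR (Quot.at ℤR t j) n _))
            (Quot.eq (ρ∼𝟘 0 d (ℕₚ.n≢0⇒n>0 (≢-nonZero⁻¹ n)) (subst (d <_) (sym n≡8) d<8) (ℕₚ.<⇒≢ 0<d)) j))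

      -- One more descent, from level 4h to level 2h, empties one parity class of exponents, and
      -- exponents have the parity of their index. So the entries i and i + 4 of column 0 agree for
      -- all i of that parity.
      impossible : ⊥
      impossible = from (Components.descend 2 prime[2] 2∣2h T₀ norm fixes (inj₂ 4∣2h))
        where
        from : (∃ λ l → l < 2 × (∀ k → k < 2 → k ≢ l → Quot._∼_ ℤR (tr T₀) (sub 2 k x) 𝟘) × Norm T₀ n (sub 2 l x)) → ⊥
        from (0 , _ , off , _) = contradiction-odd sequence (pair 1 (s≤s (s≤s z≤n)) refl) (pair 3 (s≤s (s≤s (s≤s (s≤s z≤n)))) refl)
          where pair = vanishing-pair 1 (s≤s (s≤s z≤n)) (off 1 (s≤s (s≤s z≤n)) (λ ()))
        from (1 , _ , off , _) = contradiction-even sequence (pair 0 (s≤s z≤n) refl) (pair 2 (s≤s (s≤s (s≤s z≤n))) refl)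
          where pair = vanishing-pair 0 (s≤s z≤n) (off 0 (s≤s z≤n) (λ ()))
        from (suc (suc _) , s≤s (s≤s ()) , _)

    exceptional : n ≤ gcd h n ^ 2
    exceptional = by-cases (w′ ≟ 1)
      where
      by-cases : Dec (w′ ≡ 1) → n ≤ gcd h n ^ 2
      -- Here w = 2 and n = 4 = 2², so the bound is an equality.
      by-cases (yes w′≡1) = ℕₚ.≤-reflexive (trans n≡ (trans (cong (_* g) (trans w≡ (cong (_* 2) w′≡1))) (trans (cong (2 *_) g≡2) (cong (_^ 2) (sym g≡2)))))
      by-cases (no w′≢1) = go (even-or-1 w′ (∣-trans w′∣w w∣n) w′≢1)
        where
        go : 2 ∣ w′ → n ≤ gcd h n ^ 2
        go (divides u w′≡) = ⊥-elim (Order8.impossible (trans w≡4u (cong (_* 4) u≡1)))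
          where
          w≡4u : w ≡ u * 4
          w≡4u = trans w≡ (trans (cong (_* 2) w′≡) (ℕₚ.*-assoc u 2 2))
          n≡8u : n ≡ u * 8
          n≡8u = trans n≡ (trans (cong₂ _*_ w≡4u g≡2) (ℕₚ.*-assoc u 4 2))
          u≤1 : u ≤ 1
          u≤1 = ℕₚ.*-cancelʳ-≤ u 1 8 (subst (_≤ 8) n≡8u n≤8)
          u≡1 : u ≡ 1
          u≡1 = ℕₚ.≤-antisym u≤1 (ℕₚ.n≢0⇒n>0 (λ u≡0 → ≢-nonZero⁻¹ n (trans n≡8u (cong (_* 8) u≡0))))

  theorem : n ≤ gcd h n ^ 2
  theorem = by-cases (2 ∣? w) (4 ∣? h)
    where
    by-cases : Dec (2 ∣ w) → Dec (4 ∣ h) → n ≤ gcd h n ^ 2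
    by-cases _         (yes 4∣h) = main (λ _ → 4∣h)
    by-cases (no 2∤w)  (no _)    = main (λ 2∣w → contradiction 2∣w 2∤w)
    by-cases (yes 2∣w) (no 4∤h)  = Exceptional.exceptional 2∣w 4∤h

theorem3p2 : (n h : ℕ) .{{_ : NonZero n}} .{{_ : NonZero h}} →
    (R : CommutativeRing 0ℓ 0ℓ) → IsIntegralDomain R → HasCharZero R →
    (ζ : CommutativeRing.Carrier R) → IsPrimitiveRoot R h ζ →
    ∃ (λ (a : Fin n → Fin n → Fin h) → IsBH R n h ζ a) →
    (∀ p → Prime p → p ∣ n → p ∣ h) →
    (∀ p → Prime p → p ∣ n → ∀ q → Prime q → q ∣ n → q ≢ p →
    ∀ e j → IsValuation p h e → IsOrder (mTilde (lcm n h) q) q j →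
    ¬ (q ^ j ≋ 1 [mod p ^ suc e ])) →
    n ≤ gcd h n ^ 2
theorem3p2 n h R domain char0 ζ prim (a , bh) q∣h order-condition = Theorem.theorem n h R domain char0 ζ prim a bh q∣h order-condition
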